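{- Let $q$ be an odd prime power, let $n\geq 1$ and $t\geq 1$ be integers, and let $\ell\in\mathbb{F}_{q^n}[x]$ be an exceptional $t$-normalized $t$-scattered $q$-linearized polynomial of linearized degree $r$. Let $d\coloneqq\max\{r,t\}$ and suppose that $d$ is an odd prime. Then $\ell=x$.
   Context: A $q$-linearized polynomial is one of the form $\sum_{i=0}^r a_i x^{q^i}$; if $a_r\neq 0$ its linearized degree is $r$. For a prime power $q$, positive integers $n,m$ and a non-negative integer $t$, a $q$-linearized $\ell\in\mathbb{F}_{q^n}[x]$ is called $(q,n,m,t)$-scattered if for every $s_0\in\mathbb{F}_{q^{nm}}$ the polynomial $\ell-s_0x^{q^t}$ has at most $q$ roots in $\mathbb{F}_{q^{nm}}$. It is called exceptional $t$-scattered if (for the fixed $q,n,t$) it is $(q,n,m,t)$-scattered for infinitely many positive integers $m$. It is called $t$-normalized if it is monic, its coefficient of $x^{q^t}$ is zero, and, when $t>0$, its coefficient of $x$ is non-zero. -}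

module Defs where

open import Level using (0ℓ)
open import Algebra.Bundles using (CommutativeRing)
open import Algebra.Morphism.Structures using (module RingMorphisms)
open import Data.Nat using (ℕ; zero; suc; _^_; _<?_; _≤_; _%_)
import Data.Nat as N
import Data.Fin
import Data.Fin as Fin
open import Data.Nat.Primality using (Prime)
open import Data.Fin using (Fin; fromℕ<)
open import Data.Product using (Σ; ∃; _×_; _,_)
open import Relation.Nullary using (¬_; yes; no)
open import Relation.Binary.PropositionalEquality using (_≡_)

IsPrimePower : ℕ → Set
IsPrimePower q = Σ ℕ λ p → Σ ℕ λ k → Prime p × (q ≡ p ^ suc k)

IsOdd : ℕ → Set
IsOdd q = q % 2 ≡ 1

module _ (R : CommutativeRing 0ℓ 0ℓ) where
  open CommutativeRing R using (Carrier; _≈_; _+_; _*_; 0#; 1#)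

  IsField : Set
  IsField = (¬ (1# ≈ 0#)) × (∀ x → ¬ (x ≈ 0#) → ∃ λ y → x * y ≈ 1#)

  HasCard : ℕ → Set
  HasCard N = Σ (Fin N → Carrier) λ f →
                (∀ i j → f i ≈ f j → i ≡ j) × (∀ x → ∃ λ i → f i ≈ x)

  pow : Carrier → ℕ → Carrier
  pow x zero = 1#
  pow x (suc k) = x * pow x k

  sumFin : ∀ n → (Fin n → Carrier) → Carrier
  sumFin zero f = 0#
  sumFin (suc n) f = f Fin.zero + sumFin n (λ i → f (Fin.suc i))

record FiniteField (N : ℕ) : Set₁ where
  field
    ring    : CommutativeRing 0ℓ 0ℓ
    isField : IsField ring
    card    : HasCard ring N

-- A q-linearized polynomial  Σ_{i=0}^{r} a_i x^{q^i}  over F, stored as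
-- the bound r and the coefficients a_0 … a_r.
record LinPoly (F : CommutativeRing 0ℓ 0ℓ) : Set where
  field
    r     : ℕ
    coeff : Fin (suc r) → CommutativeRing.Carrier F

module _ {F : CommutativeRing 0ℓ 0ℓ} where
  open CommutativeRing F using (Carrier; _≈_; 0#; 1#)

  coeffAt : LinPoly F → ℕ → Carrier
  coeffAt ℓ i with i <? suc (LinPoly.r ℓ)
  ... | yes p = LinPoly.coeff ℓ (fromℕ< p)
  ... | no _  = 0#

  HasLinDegree : LinPoly F → ℕ → Set
  HasLinDegree ℓ d = (LinPoly.r ℓ ≡ d) × ¬ (coeffAt ℓ (LinPoly.r ℓ) ≈ 0#)

  TNormalized : ℕ → LinPoly F → Set
  TNormalized t ℓ =
    (coeffAt ℓ (LinPoly.r ℓ) ≈ 1#) ×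
    (coeffAt ℓ t ≈ 0#) ×
    (1 ≤ t → ¬ (coeffAt ℓ 0 ≈ 0#))

-- (q,n,m,t)-scattered, relative to a concrete field K with q^{nm} elements
-- together with an embedding φ : F → K (a ring homomorphism):
-- for every s₀ ∈ K, ℓ(x) - s₀ x^{q^t} has at most q roots in K,
-- i.e. there are no q+1 pairwise distinct roots.
module _ {F K : CommutativeRing 0ℓ 0ℓ} where
  private module K = CommutativeRing K

  IsEmbedding : (CommutativeRing.Carrier F → K.Carrier) → Set
  IsEmbedding φ = RingMorphisms.IsRingHomomorphism
                    (CommutativeRing.rawRing F) (CommutativeRing.rawRing K) φ

  evalIn : (q : ℕ) → (φ : CommutativeRing.Carrier F → K.Carrier) →
           LinPoly F → K.Carrier → K.Carrier
  evalIn q φ ℓ x = sumFin K (suc (LinPoly.r ℓ))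
                     (λ i → φ (LinPoly.coeff ℓ i) K.* pow K x (q ^ Data.Fin.toℕ i))

  ScatteredIn : (q t : ℕ) → (φ : CommutativeRing.Carrier F → K.Carrier) →
                LinPoly F → Set
  ScatteredIn q t φ ℓ =
    ∀ (s₀ : K.Carrier) →
      ¬ (Σ (Fin (suc q) → K.Carrier) λ g →
           (∀ i j → g i K.≈ g j → i ≡ j) ×
           (∀ i → (evalIn q φ ℓ (g i) K.- s₀ K.* pow K (g i) (q ^ t)) K.≈ K.0#))

-- (q,n,m,t)-scattered: scattered in every field with q^{nm} elements
-- containing F (any such field; they are all isomorphic)
QNMTScattered : {F : CommutativeRing 0ℓ 0ℓ} → (q n m t : ℕ) → LinPoly F → Set₁
QNMTScattered {F} q n m t ℓ =
  (K : FiniteField (q ^ (n N.* m))) →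
  (φ : CommutativeRing.Carrier F → CommutativeRing.Carrier (FiniteField.ring K)) →
  IsEmbedding {F} {FiniteField.ring K} φ →
  ScatteredIn {F} {FiniteField.ring K} q t φ ℓ

ExceptionalScattered : {F : CommutativeRing 0ℓ 0ℓ} → (q n t : ℕ) → LinPoly F → Set₁
ExceptionalScattered {F} q n t ℓ =
  ∀ (M : ℕ) → Σ ℕ λ m → (M ≤ m) × (1 ≤ m) × QNMTScattered {F} q n m t ℓ

{-# OPTIONS --safe #-}
module Submission where

-- Suppose r ≥ 1. Then ℓ is not scattered in K as soon as there are x ≠ 0 and z with z^q ≠ z in K such that
-- ℓ(z x) = z^(q^t) ℓ(x): the elements z x and c x, c ∈ F_q, are q + 1 roots of ℓ - s₀ x^(q^t) for s₀ = ℓ(x) / x^(q^t).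
-- So it suffices to find points on the curve b(x, z) = Σ a_i (z^(q^t) - z^(q^i)) x^(q^i - 1) = 0 over all large K.
--
-- This is done by the method of Stepanov and Bombieri. If there were no points, then for z ∈ K the roots Y of the
-- monic form of b(·, z) and their conjugates Y^|K| would be different points of the same fibre. Linear algebra yields
-- a relation between z, Y and Y′ of low degree that holds on all pairs Y ≠ Y′; put Y′ = Y^|K| and take a root of order B,
-- a power of q. The result is a function H on the curve that vanishes at more points than its degree allows.
-- That H ≠ 0 is seen on the formal branch of the curve at (0, z₀), z₀ ∈ F_{q^t} ∖ F_q, for which one needs
-- that no nonzero polynomial of degree < q^r - 1 in x vanishes on the branch, that is, a form of irreducibility of b.
--
-- Let b = f₁ f₂ with f₁ containing the branch. From θ b = -a₀ z, θ = z d/dz, the components do not meet over z₀, and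
-- x b(x, z₀) is a polynomial in x^q, so q divides the degree e of f₂ in x. If r > t, all branches at z = ∞ have the same
-- slope, hence (q^r - 1) | (q^r - q^t) e, and e = 0 because r is prime. If r < t, f₁ vanishes at all (0, z₁),
-- z₁ ∈ F_{q^t} ∖ F_q, which leaves for f₂ at most a multiple of z^q - z, and again e = 0.
-- For t = 1 the same is applied to the adjoint polynomial with respect to the trace form, for which t becomes r - 1.
--
-- Fields are only assumed to be discrete, so splitting fields and minimal choices exist under a double negation;
-- this is harmless since the goal is a contradiction.

open import Defs
open import Level using (0ℓ)
open import Algebra.Bundles using (CommutativeRing)
import Algebra.Properties.CommutativeMonoid.Mult
import Algebra.Properties.CommutativeMonoid.Sum
import Algebra.Properties.CommutativeSemigroup
import Algebra.Properties.CommutativeSemiring.Binomial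
import Algebra.Properties.CommutativeSemiring.Exp
import Algebra.Properties.Ring
import Algebra.Properties.Semiring.Exp
import Algebra.Properties.Semiring.Mult
import Algebra.Solver.Ring.NaturalCoefficients.Default
open import Data.Empty using (⊥; ⊥-elim)
open import Data.Fin as Fin using (Fin; toℕ; fromℕ<)
import Data.Fin.Permutation as Perm
import Data.Fin.Properties as Finₚ
open import Data.Nat as ℕ using (ℕ; zero; suc; _≤_; _<_; z≤n; s≤s; _⊔_)
open import Data.Nat.Combinatorics using (_C_; nCn≡1; nCk≡n!/k![n-k]!; k![n∸k]!∣n!)
open import Data.Nat.Coprimality using (Coprime; coprime-Bézout; coprime-divisor; prime⇒coprime) renaming (sym to coprime-sym)
open import Data.Nat.DivMod using (_/_; _%_; m%n<n; m<n*o⇒m/o<n; m≡m%n+[m/n]*n; m*n/n≡m; [m+kn]%n≡m%n; m<n⇒m%n≡m; m<n⇒m/n≡0; +-distrib-/-∣ˡ; m/n*n≡m)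
open import Data.Nat.Divisibility using (_∣_; divides; _∣?_; 1∣_; *-monoʳ-∣; *-cancelˡ-∣; m∣m*n; n∣m*n; ∣-trans; ∣⇒≤; ∣m+n∣m⇒∣n; ∣m∣n⇒∣m+n; ∣n⇒∣m*n; ∣m⇒∣m*n; _∣0; ∣1⇒≡1)
open import Data.Nat.GCD using (module Bézout)
open import Data.Nat.Induction using (<-rec)
open import Data.Nat.Primality using (Prime; euclidsLemma; prime⇒nonZero; prime⇒nonTrivial; prime⇒irreducible)
import Data.Nat.Properties as ℕₚ
open import Data.Nat.Solver using (module +-*-Solver)
open import Data.Product using (Σ; ∃; _×_; _,_; proj₁; proj₂)
open import Data.Sum as Sum using (_⊎_; inj₁; inj₂)
open import Data.Unit using (⊤; tt)
open import Function using (_∘_; mk↔ₛ′)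
open import Relation.Binary.Definitions using (tri<; tri≈; tri>)
import Relation.Binary.Reasoning.Setoid
open import Relation.Binary.Structures using (IsEquivalence)
open import Relation.Nullary using (¬_; Dec; yes; no)
open import Relation.Nullary.Decidable.Core using (¬¬-excluded-middle)
open import Relation.Binary.PropositionalEquality as ≡ using (_≡_)

-- Only the existence of a point is wanted, so the method starts from the assumption that there is
-- none, and no count of points in the manner of Hasse and Weil appears. That assumption makes Y^|K|
-- - Y cancellable: it lowers the degree of the relation for Y′ from n = q^r - 1 to n - 1, and the
-- whole dimension count lives on this gain of one part in n. One choice of coefficients has to
-- serve at all points, so the points are gathered in a product ring and the linear algebra is done
-- there once; the formal branch is later adjoined as one more factor, so that the reduction of H
-- modulo the curve is the same on the points and on the branch. The hypothesis on q gives n ≥ 2.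
-- For t = 1 there is no z₀ in F_{q^t} outside F_q at which a branch could start, which is why the
-- adjoint is needed. For r = 2 and t = 1 the adjoint has t = 1 again; this case is excluded by d
-- being odd.

Ring : Set₁
Ring = CommutativeRing 0ℓ 0ℓ

-- Commutative rings, finite sums and homomorphisms

module Kit (R : Ring) where
  open CommutativeRing R public
    using (Carrier; _≈_; _+_; _*_; -_; 0#; 1#; refl; sym; trans; +-cong; +-congˡ; +-congʳ; *-cong; *-congˡ; *-congʳ; -‿cong;
           +-assoc; +-comm; +-identityˡ; +-identityʳ; -‿inverseˡ; *-assoc; *-comm; *-identityˡ; *-identityʳ; distribˡ; distribʳ;
           zeroˡ; zeroʳ; +-commutativeMonoid; *-commutativeMonoid; commutativeSemiring)
  open Algebra.Properties.Ring (CommutativeRing.ring R) public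
    using (-‿distribˡ-*; -‿distribʳ-*; -‿involutive; -0#≈0#; -‿+-comm; +-cancelˡ; +-cancelʳ)
  open Algebra.Properties.Semiring.Exp (CommutativeRing.semiring R) public
    using (_^_; ^-congˡ; ^-congʳ; ^-homo-*; ^-assocʳ)
  open Algebra.Properties.CommutativeSemiring.Exp commutativeSemiring public
    using (^-distrib-*)
  open Algebra.Properties.Semiring.Mult (CommutativeRing.semiring R) public
    using (×-congʳ; ×-assocˡ; ×-comm-*; ×-assoc-*; ×1-homo-*) renaming (_×_ to _×ₙ_)
  open Algebra.Properties.CommutativeMonoid.Mult +-commutativeMonoid public using (×-distrib-+)
  module +S = Algebra.Properties.CommutativeSemigroup (CommutativeRing.+-commutativeSemigroup R)
    using (interchange; xy∙z≈xz∙y; xy∙z≈x∙zy; x∙yz≈yx∙z; x∙yz≈y∙xz)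
  module *S = Algebra.Properties.CommutativeSemigroup (CommutativeRing.*-commutativeSemigroup R)
    using (interchange; xy∙z≈x∙zy; xy∙z≈y∙xz; x∙yz≈xz∙y; x∙yz≈yx∙z; x∙yz≈y∙xz; x∙yz≈y∙zx; x∙yz≈z∙xy)
  module ≈R = Relation.Binary.Reasoning.Setoid (CommutativeRing.setoid R)
    using (begin_; step-≈-⟩; step-≈-⟨; _∎)

  infixl 6 _-_
  _-_ : Carrier → Carrier → Carrier
  x - y = x + - y

  ≡⇒≈ : ∀ {x y} → x ≡ y → x ≈ y
  ≡⇒≈ ≡.refl = refl

  -‿congr : ∀ {x y z w} → x ≈ y → z ≈ w → x - z ≈ y - w
  -‿congr p q = +-cong p (-‿cong q)

  x-x : ∀ x → x - x ≈ 0#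
  x-x = CommutativeRing.-‿inverseʳ R

  x-0 : ∀ x → x - 0# ≈ x
  x-0 x = trans (+-congˡ -0#≈0#) (+-identityʳ x)

  x-y≈0⇒x≈y : ∀ {x y} → x - y ≈ 0# → x ≈ y
  x-y≈0⇒x≈y {x} {y} p = +-cancelʳ (- y) x y (trans p (sym (x-x y)))

  x≈y⇒x-y≈0 : ∀ {x y} → x ≈ y → x - y ≈ 0#
  x≈y⇒x-y≈0 p = trans (+-congʳ p) (x-x _)

  x+y≈z⇒x≈z-y : ∀ {x y z} → x + y ≈ z → x ≈ z - y
  x+y≈z⇒x≈z-y {x} {y} {z} p =
    trans (sym (trans (+-assoc x y (- y)) (trans (+-congˡ (x-x y)) (+-identityʳ x)))) (+-congʳ p)

  x-y+y : ∀ x y → (x - y) + y ≈ x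
  x-y+y x y = trans (+-assoc x (- y) y) (trans (+-congˡ (-‿inverseˡ y)) (+-identityʳ x))

  distribˡ-- : ∀ x y z → x * (y - z) ≈ x * y - x * z
  distribˡ-- x y z = trans (distribˡ x y (- z)) (+-congˡ (sym (-‿distribʳ-* x z)))

  distribʳ-- : ∀ x y z → (y - z) * x ≈ y * x - z * x
  distribʳ-- x y z = trans (distribʳ x y (- z)) (+-congˡ (sym (-‿distribˡ-* z x)))

  -‿+ : ∀ x y z w → (x + y) - (z + w) ≈ (x - z) + (y - w)
  -‿+ x y z w = trans (+-congˡ (sym (-‿+-comm z w))) (+S.interchange x y (- z) (- w))

  x-y≈-[y-x] : ∀ x y → x - y ≈ - (y - x)
  x-y≈-[y-x] x y = sym (trans (sym (-‿+-comm y (- x)))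
    (trans (+-congˡ (-‿involutive x)) (+-comm (- y) x)))

  telescope : ∀ x y z → (x - y) + (y - z) ≈ x - z
  telescope x y z = trans (sym (+-assoc (x - y) y (- z))) (+-congʳ (x-y+y x y))

  x*0≈0 : ∀ {x y} → y ≈ 0# → x * y ≈ 0#
  x*0≈0 p = trans (*-congˡ p) (zeroʳ _)

  0*x≈0 : ∀ {x y} → x ≈ 0# → x * y ≈ 0#
  0*x≈0 p = trans (*-congʳ p) (zeroˡ _)

  0+0≈0 : ∀ {x y} → x ≈ 0# → y ≈ 0# → x + y ≈ 0#
  0+0≈0 p q = trans (+-cong p q) (+-identityˡ 0#)

  0+x≈x : ∀ {x y} → x ≈ 0# → x + y ≈ y
  0+x≈x p = trans (+-congʳ p) (+-identityˡ _)

  x+0≈x : ∀ {x y} → y ≈ 0# → x + y ≈ x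
  x+0≈x p = trans (+-congˡ p) (+-identityʳ _)

  1^n≈1 : ∀ n → 1# ^ n ≈ 1#
  1^n≈1 zero = refl
  1^n≈1 (suc n) = trans (*-identityˡ _) (1^n≈1 n)

  0^n≈0 : ∀ {x} n → 0 < n → x ≈ 0# → x ^ n ≈ 0#
  0^n≈0 (suc n) _ p = 0*x≈0 p

  ×ₙ-zero : ∀ n {x} → x ≈ 0# → n ×ₙ x ≈ 0#
  ×ₙ-zero zero p = refl
  ×ₙ-zero (suc n) p = 0+0≈0 p (×ₙ-zero n p)

  ×ₙ≈× : ∀ n x → n ×ₙ x ≈ (n ×ₙ 1#) * x
  ×ₙ≈× n x = sym (trans (×-assoc-* n 1# x) (×-congʳ n (*-identityˡ x)))

  opaque
    sumN : ℕ → (ℕ → Carrier) → Carrier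
    sumN zero f = 0#
    sumN (suc n) f = f 0 + sumN n (f ∘ suc)

    sum-nil : ∀ f → sumN 0 f ≈ 0#
    sum-nil f = refl

    sum-suc : ∀ n f → sumN (suc n) f ≈ f 0 + sumN n (f ∘ suc)
    sum-suc n f = refl

    sum-cong : ∀ n {f g} → (∀ i → i < n → f i ≈ g i) → sumN n f ≈ sumN n g
    sum-cong zero h = refl
    sum-cong (suc n) h = +-cong (h 0 (s≤s z≤n)) (sum-cong n (λ i i<n → h (suc i) (s≤s i<n)))

    sum-zero : ∀ n {f} → (∀ i → i < n → f i ≈ 0#) → sumN n f ≈ 0#
    sum-zero zero h = refl
    sum-zero (suc n) h = 0+0≈0 (h 0 (s≤s z≤n)) (sum-zero n (λ i i<n → h (suc i) (s≤s i<n)))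

    sum-+ : ∀ n f g → sumN n (λ i → f i + g i) ≈ sumN n f + sumN n g
    sum-+ zero f g = sym (+-identityˡ 0#)
    sum-+ (suc n) f g = trans (+-congˡ (sum-+ n (f ∘ suc) (g ∘ suc))) (+S.interchange _ _ _ _)

    sum-*ˡ : ∀ n c f → c * sumN n f ≈ sumN n (λ i → c * f i)
    sum-*ˡ zero c f = zeroʳ c
    sum-*ˡ (suc n) c f = trans (distribˡ _ _ _) (+-congˡ (sum-*ˡ n c (f ∘ suc)))

    sum-*ʳ : ∀ n c f → sumN n f * c ≈ sumN n (λ i → f i * c)
    sum-*ʳ zero c f = zeroˡ c
    sum-*ʳ (suc n) c f = trans (distribʳ _ _ _) (+-congˡ (sum-*ʳ n c (f ∘ suc)))

    sum-neg : ∀ n f → - sumN n f ≈ sumN n (λ i → - f i)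
    sum-neg zero f = -0#≈0#
    sum-neg (suc n) f = trans (sym (-‿+-comm _ _)) (+-congˡ (sum-neg n (f ∘ suc)))

    sum-split : ∀ m n f → sumN (m ℕ.+ n) f ≈ sumN m f + sumN n (λ i → f (m ℕ.+ i))
    sum-split zero n f = sym (+-identityˡ _)
    sum-split (suc m) n f = trans (+-congˡ (sum-split m n (f ∘ suc))) (sym (+-assoc _ _ _))

    sum-last : ∀ n f → sumN (suc n) f ≈ sumN n f + f n
    sum-last zero f = +-comm _ _
    sum-last (suc n) f = trans (+-congˡ (sum-last n (f ∘ suc))) (sym (+-assoc _ _ _))

    sum-comm : ∀ m n (f : ℕ → ℕ → Carrier) → sumN m (λ i → sumN n (f i)) ≈ sumN n (λ j → sumN m (λ i → f i j))
    sum-comm zero n f = sym (sum-zero n (λ _ _ → refl))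
    sum-comm (suc m) n f =
      trans (+-congˡ (sum-comm m n (f ∘ suc))) (sym (sum-+ n (f 0) (λ j → sumN m (λ i → f (suc i) j))))

    sum-single : ∀ n f i → i < n → (∀ j → j < n → ¬ (j ≡ i) → f j ≈ 0#) → sumN n f ≈ f i
    sum-single (suc n) f zero i<n h =
      x+0≈x (sum-zero n (λ j j<n → h (suc j) (s≤s j<n) (λ ())))
    sum-single (suc n) f (suc i) (s≤s i<n) h =
      trans (0+x≈x (h 0 (s≤s z≤n) (λ ())))
            (sum-single n (f ∘ suc) i i<n (λ j j<n j≢i → h (suc j) (s≤s j<n) (j≢i ∘ ℕₚ.suc-injective)))

    sum-nest : ∀ m n f → sumN (m ℕ.* n) f ≈ sumN m (λ i → sumN n (λ j → f (i ℕ.* n ℕ.+ j)))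
    sum-nest zero n f = refl
    sum-nest (suc m) n f = trans (sum-split n (m ℕ.* n) f) (+-congˡ
      (trans (sum-nest m n (λ i → f (n ℕ.+ i)))
        (sum-cong m (λ i _ → sum-cong n (λ j _ → ≡⇒≈ (≡.cong f (≡.sym (ℕₚ.+-assoc n (i ℕ.* n) j))))))))

    sum-reverse : ∀ n f → sumN (suc n) f ≈ sumN (suc n) (λ i → f (n ℕ.∸ i))
    sum-reverse zero f = refl
    sum-reverse (suc n) f = trans (sum-last (suc n) f)
      (trans (+-comm _ _) (+-congˡ (sum-reverse n f)))

  Distinct : ℕ → (ℕ → Carrier) → Set
  Distinct j ρ = ∀ a b → a < j → b < j → ρ a ≈ ρ b → a ≡ b

record Hom (R S : Ring) : Set where
  private module R = Kit R using (Carrier; _≈_; _+_; _*_; -_; 0#; 1#; +-identityˡ; _^_; _×ₙ_; _-_; x-x; sumN; sum-nil; sum-suc)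
  private module S = Kit S using (Carrier; _≈_; _+_; _*_; -_; 0#; 1#; sym; trans; +-congˡ; *-congˡ; +-identityʳ; +-cancelˡ; _^_; _×ₙ_; _-_; x-x; sumN; sum-nil; sum-suc)
  field
    ⟦_⟧     : R.Carrier → S.Carrier
    ⟦⟧-cong : ∀ {x y} → x R.≈ y → ⟦ x ⟧ S.≈ ⟦ y ⟧
    ⟦⟧-+    : ∀ x y → ⟦ x R.+ y ⟧ S.≈ ⟦ x ⟧ S.+ ⟦ y ⟧
    ⟦⟧-*    : ∀ x y → ⟦ x R.* y ⟧ S.≈ ⟦ x ⟧ S.* ⟦ y ⟧
    ⟦⟧-1    : ⟦ R.1# ⟧ S.≈ S.1#

  ⟦⟧-0 : ⟦ R.0# ⟧ S.≈ S.0#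
  ⟦⟧-0 = S.+-cancelˡ ⟦ R.0# ⟧ ⟦ R.0# ⟧ S.0#
    (S.trans (S.sym (⟦⟧-+ R.0# R.0#)) (S.trans (⟦⟧-cong (R.+-identityˡ R.0#)) (S.sym (S.+-identityʳ _))))

  ⟦⟧≈0 : ∀ {x} → x R.≈ R.0# → ⟦ x ⟧ S.≈ S.0#
  ⟦⟧≈0 p = S.trans (⟦⟧-cong p) ⟦⟧-0

  ⟦⟧-neg : ∀ x → ⟦ R.- x ⟧ S.≈ S.- ⟦ x ⟧
  ⟦⟧-neg x = S.+-cancelˡ ⟦ x ⟧ ⟦ R.- x ⟧ (S.- ⟦ x ⟧)
    (S.trans (S.sym (⟦⟧-+ x (R.- x))) (S.trans (⟦⟧≈0 (R.x-x x)) (S.sym (S.x-x _))))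

  ⟦⟧-- : ∀ x y → ⟦ x R.- y ⟧ S.≈ ⟦ x ⟧ S.- ⟦ y ⟧
  ⟦⟧-- x y = S.trans (⟦⟧-+ x (R.- y)) (S.+-congˡ (⟦⟧-neg y))

  ⟦⟧-^ : ∀ x n → ⟦ x R.^ n ⟧ S.≈ ⟦ x ⟧ S.^ n
  ⟦⟧-^ x zero = ⟦⟧-1
  ⟦⟧-^ x (suc n) = S.trans (⟦⟧-* _ _) (S.*-congˡ (⟦⟧-^ x n))

  ⟦⟧-× : ∀ n x → ⟦ n R.×ₙ x ⟧ S.≈ n S.×ₙ ⟦ x ⟧
  ⟦⟧-× zero x = ⟦⟧-0
  ⟦⟧-× (suc n) x = S.trans (⟦⟧-+ _ _) (S.+-congˡ (⟦⟧-× n x))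

  ⟦⟧-sum : ∀ n f → ⟦ R.sumN n f ⟧ S.≈ S.sumN n (λ i → ⟦ f i ⟧)
  ⟦⟧-sum zero f = S.trans (⟦⟧-cong (R.sum-nil f)) (S.trans ⟦⟧-0 (S.sym (S.sum-nil _)))
  ⟦⟧-sum (suc n) f = S.trans (⟦⟧-cong (R.sum-suc n f)) (S.trans (⟦⟧-+ _ _)
    (S.trans (S.+-congˡ (⟦⟧-sum n (f ∘ suc))) (S.sym (S.sum-suc n _))))

open Hom public using (⟦_⟧; ⟦⟧-cong; ⟦⟧-+; ⟦⟧-*; ⟦⟧-1; ⟦⟧-0; ⟦⟧≈0; ⟦⟧-neg; ⟦⟧--; ⟦⟧-^; ⟦⟧-×; ⟦⟧-sum)

idHom : (R : Ring) → Hom R R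
idHom R = record { ⟦_⟧ = λ x → x ; ⟦⟧-cong = λ p → p ; ⟦⟧-+ = λ _ _ → refl ; ⟦⟧-* = λ _ _ → refl ; ⟦⟧-1 = refl }
  where open Kit R using (refl; trans)

infixr 9 _∘H_
_∘H_ : {R S T : Ring} → Hom S T → Hom R S → Hom R T
_∘H_ {R} {S} {T} g f = record
  { ⟦_⟧ = λ x → ⟦ g ⟧ (⟦ f ⟧ x)
  ; ⟦⟧-cong = λ p → ⟦⟧-cong g (⟦⟧-cong f p)
  ; ⟦⟧-+ = λ x y → trans (⟦⟧-cong g (⟦⟧-+ f x y)) (⟦⟧-+ g _ _)
  ; ⟦⟧-* = λ x y → trans (⟦⟧-cong g (⟦⟧-* f x y)) (⟦⟧-* g _ _)
  ; ⟦⟧-1 = trans (⟦⟧-cong g (⟦⟧-1 f)) (⟦⟧-1 g) }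
  where open Kit T using (Carrier; _≈_; _+_; _*_; -_; 0#; 1#; trans; +-cong; *-cong; -‿cong; +-assoc; +-comm; +-identityˡ; -‿inverseˡ; *-assoc; *-comm; *-identityˡ; distribʳ; _-_)

record RingData : Set₁ where
  infixl 6 _+_
  infixl 7 _*_
  infix 4 _≈_
  field
    Carrier : Set
    _≈_ : Carrier → Carrier → Set
    _+_ _*_ : Carrier → Carrier → Carrier
    -_ : Carrier → Carrier
    0# 1# : Carrier
    ≈-equiv : IsEquivalence _≈_
    +-cong : ∀ {x y u v} → x ≈ y → u ≈ v → (x + u) ≈ (y + v)
    *-cong : ∀ {x y u v} → x ≈ y → u ≈ v → (x * u) ≈ (y * v)
    -‿cong : ∀ {x y} → x ≈ y → (- x) ≈ (- y)
    +-assoc : ∀ x y z → ((x + y) + z) ≈ (x + (y + z))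
    +-comm : ∀ x y → (x + y) ≈ (y + x)
    +-identityˡ : ∀ x → (0# + x) ≈ x
    -‿inverseˡ : ∀ x → ((- x) + x) ≈ 0#
    *-assoc : ∀ x y z → ((x * y) * z) ≈ (x * (y * z))
    *-comm : ∀ x y → (x * y) ≈ (y * x)
    *-identityˡ : ∀ x → (1# * x) ≈ x
    distribʳ : ∀ x y z → ((y + z) * x) ≈ ((y * x) + (z * x))

-- Wrapping the equality keeps both sides of an equation inferable from its type.
record Wrap {A : Set} (_~_ : A → A → Set) (x y : A) : Set where
  constructor wrap
  field unwrap : x ~ y
open Wrap public

mkRing : RingData → Ring
mkRing D = record
  { Carrier = Carrier ; _≈_ = Wrap _≈_ ; _+_ = _+_ ; _*_ = _*_ ; -_ = -_ ; 0# = 0# ; 1# = 1#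
  ; isCommutativeRing = record
    { isRing = record
      { +-isAbelianGroup = record
        { isGroup = record
          { isMonoid = record
            { isSemigroup = record
              { isMagma = record
                { isEquivalence = record
                  { refl = wrap refl ; sym = λ (wrap p) → wrap (sym p) ; trans = λ (wrap p) (wrap q) → wrap (trans p q) }
                ; ∙-cong = λ (wrap p) (wrap q) → wrap (+-cong p q) }
              ; assoc = λ x y z → wrap (+-assoc x y z) }
            ; identity = (λ x → wrap (+-identityˡ x)) , λ x → wrap (trans (+-comm x 0#) (+-identityˡ x)) }
          ; inverse = (λ x → wrap (-‿inverseˡ x)) , λ x → wrap (trans (+-comm x (- x)) (-‿inverseˡ x))
          ; ⁻¹-cong = λ (wrap p) → wrap (-‿cong p) }
        ; comm = λ x y → wrap (+-comm x y) }
      ; *-cong = λ (wrap p) (wrap q) → wrap (*-cong p q)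
      ; *-assoc = λ x y z → wrap (*-assoc x y z)
      ; *-identity = (λ x → wrap (*-identityˡ x)) , λ x → wrap (trans (*-comm x 1#) (*-identityˡ x))
      ; distrib = (λ x y z → wrap (trans (*-comm x (y + z))
                    (trans (distribʳ x y z) (+-cong (*-comm y x) (*-comm z x)))))
                , λ x y z → wrap (distribʳ x y z) }
    ; *-comm = λ x y → wrap (*-comm x y) } }
  where
  open RingData D
  open IsEquivalence ≈-equiv using (refl; sym; trans)

-- Subrings, quotients by principal ideals, and products.

SubRing : (R : Ring) → let open Kit R using (Carrier; _≈_; _+_; _*_; -_; 0#; 1#; refl; sym; trans; +-cong; *-cong; -‿cong; +-assoc; +-comm; +-identityˡ; -‿inverseˡ; *-assoc; *-comm; *-identityˡ; distribʳ; _-_) in (P : Carrier → Set) →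
  (∀ {x y} → P x → P y → P (x + y)) → (∀ {x y} → P x → P y → P (x * y)) →
  (∀ {x} → P x → P (- x)) → P 0# → P 1# → Ring
SubRing R P P+ P* P- P0 P1 = mkRing record
  { Carrier = Σ Carrier P
  ; _≈_ = λ x y → proj₁ x ≈ proj₁ y
  ; _+_ = λ x y → proj₁ x + proj₁ y , P+ (proj₂ x) (proj₂ y)
  ; _*_ = λ x y → proj₁ x * proj₁ y , P* (proj₂ x) (proj₂ y)
  ; -_ = λ x → - proj₁ x , P- (proj₂ x)
  ; 0# = 0# , P0
  ; 1# = 1# , P1
  ; ≈-equiv = record { refl = refl ; sym = sym ; trans = trans }
  ; +-cong = +-cong ; *-cong = *-cong ; -‿cong = -‿cong
  ; +-assoc = λ _ _ _ → +-assoc _ _ _ ; +-comm = λ _ _ → +-comm _ _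
  ; +-identityˡ = λ _ → +-identityˡ _ ; -‿inverseˡ = λ _ → -‿inverseˡ _
  ; *-assoc = λ _ _ _ → *-assoc _ _ _ ; *-comm = λ _ _ → *-comm _ _
  ; *-identityˡ = λ _ → *-identityˡ _ ; distribʳ = λ _ _ _ → distribʳ _ _ _ }
  where open Kit R using (Carrier; _≈_; _+_; _*_; -_; 0#; 1#; refl; sym; trans; +-cong; *-cong; *-congˡ; *-congʳ; -‿cong; +-assoc; +-comm; +-identityˡ; -‿inverseˡ; *-assoc; *-comm; *-identityˡ; distribˡ; distribʳ; zeroʳ; -‿distribʳ-*; -‿+-comm; _-_; x≈y⇒x-y≈0; distribˡ--; distribʳ--; -‿+; x-y≈-[y-x]; telescope; module *S; module ≈R)

QuotRing : (R : Ring) → CommutativeRing.Carrier R → Ring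
QuotRing R π = mkRing record
  { Carrier = Carrier
  ; _≈_ = λ x y → ∃ λ u → x - y ≈ π * u
  ; _+_ = _+_ ; _*_ = _*_ ; -_ = -_ ; 0# = 0# ; 1# = 1#
  ; ≈-equiv = record
    { refl = fromEq refl
    ; sym = λ { {x} {y} (u , p) → - u , trans (x-y≈-[y-x] y x) (trans (-‿cong p) (-‿distribʳ-* π u)) }
    ; trans = λ { {x} {y} {z} (u , p) (v , q) → u + v ,
        trans (sym (telescope x y z)) (trans (+-cong p q) (sym (distribˡ π u v))) } }
  ; +-cong = λ { {x} {y} {a} {b} (u , p) (v , q) → u + v ,
      trans (-‿+ x a y b) (trans (+-cong p q) (sym (distribˡ π u v))) }
  ; *-cong = λ { {x} {y} {a} {b} (u , p) (v , q) → u * a + v * y ,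
      (begin
        x * a - y * b                       ≈⟨ telescope (x * a) (y * a) (y * b) ⟨
        (x * a - y * a) + (y * a - y * b)   ≈⟨ +-cong (distribʳ-- a x y) (distribˡ-- y a b) ⟨
        (x - y) * a + y * (a - b)           ≈⟨ +-cong (*-congʳ p) (*-congˡ q) ⟩
        (π * u) * a + y * (π * v)           ≈⟨ +-cong (*-assoc π u a) (*S.x∙yz≈y∙zx y π v) ⟩
        π * (u * a) + π * (v * y)           ≈⟨ distribˡ π _ _ ⟨
        π * (u * a + v * y)                 ∎) }
  ; -‿cong = λ { {x} {y} (u , p) → - u ,
      trans (-‿+-comm x (- y)) (trans (-‿cong p) (-‿distribʳ-* π u)) }
  ; +-assoc = λ x y z → fromEq (+-assoc x y z) ; +-comm = λ x y → fromEq (+-comm x y)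
  ; +-identityˡ = λ x → fromEq (+-identityˡ x) ; -‿inverseˡ = λ x → fromEq (-‿inverseˡ x)
  ; *-assoc = λ x y z → fromEq (*-assoc x y z) ; *-comm = λ x y → fromEq (*-comm x y)
  ; *-identityˡ = λ x → fromEq (*-identityˡ x) ; distribʳ = λ x y z → fromEq (distribʳ x y z) }
  where
  open Kit R using (Carrier; _≈_; _+_; _*_; -_; 0#; 1#; refl; sym; trans; +-cong; *-cong; *-congˡ; *-congʳ; -‿cong; +-assoc; +-comm; +-identityˡ; -‿inverseˡ; *-assoc; *-comm; *-identityˡ; distribˡ; distribʳ; zeroʳ; -‿distribʳ-*; -‿+-comm; _-_; x≈y⇒x-y≈0; distribˡ--; distribʳ--; -‿+; x-y≈-[y-x]; telescope; module *S; module ≈R)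
  open ≈R
  fromEq : ∀ {x y} → x ≈ y → ∃ λ u → x - y ≈ π * u
  fromEq p = 0# , trans (x≈y⇒x-y≈0 p) (sym (zeroʳ π))

opaque
  -- The index set is arbitrary: it will be the set of all points of the curve over a field, so that
  -- one identity in the product is an identity at every point.
  PiRing : (I : Set) → (I → Ring) → Ring
  PiRing I T = mkRing record
    { Carrier = ∀ i → K.Carrier i
    ; _≈_ = λ f g → ∀ i → K._≈_ i (f i) (g i)
    ; _+_ = λ f g i → K._+_ i (f i) (g i)
    ; _*_ = λ f g i → K._*_ i (f i) (g i)
    ; -_ = λ f i → K.-_ i (f i)
    ; 0# = λ i → K.0# i
    ; 1# = λ i → K.1# i
    ; ≈-equiv = record { refl = λ i → K.refl i ; sym = λ p i → K.sym i (p i) ; trans = λ p q i → K.trans i (p i) (q i) }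
    ; +-cong = λ p q i → K.+-cong i (p i) (q i) ; *-cong = λ p q i → K.*-cong i (p i) (q i)
    ; -‿cong = λ p i → K.-‿cong i (p i)
    ; +-assoc = λ f g h i → K.+-assoc i (f i) (g i) (h i) ; +-comm = λ f g i → K.+-comm i (f i) (g i)
    ; +-identityˡ = λ f i → K.+-identityˡ i (f i) ; -‿inverseˡ = λ f i → K.-‿inverseˡ i (f i)
    ; *-assoc = λ f g h i → K.*-assoc i (f i) (g i) (h i) ; *-comm = λ f g i → K.*-comm i (f i) (g i)
    ; *-identityˡ = λ f i → K.*-identityˡ i (f i) ; distribʳ = λ f g h i → K.distribʳ i (f i) (g i) (h i) }
    where module K i = CommutativeRing (T i)

  mkPi : ∀ {I T} → (∀ i → CommutativeRing.Carrier (T i)) → CommutativeRing.Carrier (PiRing I T)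
  mkPi f = f

  projHom : ∀ {I T} (i : I) → Hom (PiRing I T) (T i)
  projHom {I} {T} i = record { ⟦_⟧ = λ f → f i ; ⟦⟧-cong = λ p → unwrap p i ; ⟦⟧-+ = λ _ _ → refl ; ⟦⟧-* = λ _ _ → refl ; ⟦⟧-1 = refl }
    where open Kit (T i) using (Carrier; _≈_; refl)

  proj-mkPi : ∀ {I T} (f : ∀ i → CommutativeRing.Carrier (T i)) (i : I) →
    CommutativeRing._≈_ (T i) (⟦ projHom {T = T} i ⟧ (mkPi f)) (f i)
  proj-mkPi {T = T} f i = Kit.refl (T i)

  Pi-ext : ∀ {I T x y} → (∀ (i : I) → CommutativeRing._≈_ (T i) (⟦ projHom {T = T} i ⟧ x) (⟦ projHom {T = T} i ⟧ y)) →
    CommutativeRing._≈_ (PiRing I T) x y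
  Pi-ext h = wrap h

  tupleHom : ∀ {R I T} → ((i : I) → Hom R (T i)) → Hom R (PiRing I T)
  tupleHom h = record
    { ⟦_⟧ = λ x i → ⟦ h i ⟧ x ; ⟦⟧-cong = λ p → wrap (λ i → ⟦⟧-cong (h i) p) ; ⟦⟧-+ = λ x y → wrap (λ i → ⟦⟧-+ (h i) x y)
    ; ⟦⟧-* = λ x y → wrap (λ i → ⟦⟧-* (h i) x y) ; ⟦⟧-1 = wrap (λ i → ⟦⟧-1 (h i)) }

  proj-tuple : ∀ {R I T} (h : (i : I) → Hom R (T i)) i x →
    CommutativeRing._≈_ (T i) (⟦ projHom {T = T} i ⟧ (⟦ tupleHom {T = T} h ⟧ x)) (⟦ h i ⟧ x)
  proj-tuple {T = T} h i x = Kit.refl (T i)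

-- Power series and polynomials

module PSRaw (R : Ring) where
  open Kit R using (Carrier; _≈_; _+_; _*_; -_; 0#; 1#; refl; sym; trans; +-cong; +-congˡ; +-congʳ; *-cong; -‿cong; +-assoc; +-comm; +-identityˡ; -‿inverseˡ; *-assoc; *-comm; *-identityˡ; distribˡ; distribʳ; zeroˡ; _-_; x*0≈0; 0*x≈0; 0+0≈0; 0+x≈x; x+0≈x; module +S; module ≈R)

  C : Set
  C = ℕ → Carrier

  infix 4 _≋_
  _≋_ : C → C → Set
  f ≋ g = ∀ n → f n ≈ g n

  tail : C → C
  tail f n = f (suc n)

  infixl 7 _⊛_
  infixl 6 _⊕_
  _⊕_ : C → C → C
  (f ⊕ g) n = f n + g n

  -- The Cauchy product through f g = f(0) g + X (tail f) g. Peeling off the first factor turns the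
  -- ring laws into inductions on the index.
  _⊛_ : C → C → C
  (f ⊛ g) zero = f 0 * g 0
  (f ⊛ g) (suc n) = f 0 * g (suc n) + (tail f ⊛ g) n

  ⊝_ : C → C
  (⊝ f) n = - f n

  const : Carrier → C
  const c zero = c
  const c (suc n) = 0#

  const-vanish : ∀ c i → 1 ≤ i → const c i ≈ 0#
  const-vanish c (suc i) _ = refl

  zeros : C
  zeros n = 0#

  scale : Carrier → C → C
  scale c f n = c * f n

  ⊛-cong : ∀ {f g h k} → f ≋ g → h ≋ k → f ⊛ h ≋ g ⊛ k
  ⊛-cong p q zero = *-cong (p 0) (q 0)
  ⊛-cong p q (suc n) = +-cong (*-cong (p 0) (q (suc n))) (⊛-cong (λ i → p (suc i)) q n)

  ⊛-zeroˡ : ∀ {f} g → f ≋ zeros → f ⊛ g ≋ zeros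
  ⊛-zeroˡ g p zero = 0*x≈0 (p 0)
  ⊛-zeroˡ g p (suc n) = 0+0≈0 (0*x≈0 (p 0)) (⊛-zeroˡ g (λ i → p (suc i)) n)

  ⊛-distribʳ : ∀ h f g → (f ⊕ g) ⊛ h ≋ f ⊛ h ⊕ g ⊛ h
  ⊛-distribʳ h f g zero = distribʳ _ _ _
  ⊛-distribʳ h f g (suc n) =
    trans (+-cong (distribʳ _ _ _) (⊛-distribʳ h (tail f) (tail g) n)) (+S.interchange _ _ _ _)

  ⊛-scaleˡ : ∀ c f g → scale c f ⊛ g ≋ scale c (f ⊛ g)
  ⊛-scaleˡ c f g zero = *-assoc _ _ _
  ⊛-scaleˡ c f g (suc n) =
    trans (+-cong (*-assoc _ _ _) (⊛-scaleˡ c (tail f) g n)) (sym (distribˡ _ _ _))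

  ⊛-sucʳ : ∀ f g n → (f ⊛ g) (suc n) ≈ f (suc n) * g 0 + (f ⊛ tail g) n
  ⊛-sucʳ f g zero = +-comm _ _
  ⊛-sucʳ f g (suc n) = trans (+-congˡ (⊛-sucʳ (tail f) g n)) (+S.x∙yz≈y∙xz _ _ _)

  ⊛-comm : ∀ f g → f ⊛ g ≋ g ⊛ f
  ⊛-comm f g zero = *-comm _ _
  ⊛-comm f g (suc n) = trans (+-cong (*-comm _ _) (⊛-comm (tail f) g n)) (sym (⊛-sucʳ g f n))

  ⊛-assoc : ∀ f g h → (f ⊛ g) ⊛ h ≋ f ⊛ (g ⊛ h)
  ⊛-assoc f g h zero = *-assoc _ _ _
  ⊛-assoc f g h (suc n) = begin
    (f 0 * g 0) * h (suc n) + (tail (f ⊛ g) ⊛ h) n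
      ≈⟨ +-cong (*-assoc _ _ _) (⊛-distribʳ h (scale (f 0) (tail g)) (tail f ⊛ g) n) ⟩
    f 0 * (g 0 * h (suc n)) + ((scale (f 0) (tail g) ⊛ h) n + ((tail f ⊛ g) ⊛ h) n)
      ≈⟨ +-congˡ (+-cong (⊛-scaleˡ (f 0) (tail g) h n) (⊛-assoc (tail f) g h n)) ⟩
    f 0 * (g 0 * h (suc n)) + (f 0 * (tail g ⊛ h) n + (tail f ⊛ (g ⊛ h)) n)
      ≈⟨ +-assoc _ _ _ ⟨
    (f 0 * (g 0 * h (suc n)) + f 0 * (tail g ⊛ h) n) + (tail f ⊛ (g ⊛ h)) n
      ≈⟨ +-congʳ (distribˡ _ _ _) ⟨
    f 0 * (g ⊛ h) (suc n) + (tail f ⊛ (g ⊛ h)) n ∎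
    where open ≈R

  const-⊛ : ∀ c f → const c ⊛ f ≋ scale c f
  const-⊛ c f zero = refl
  const-⊛ c f (suc n) = x+0≈x (⊛-zeroˡ f (λ _ → refl) n)

  Vanish : ℕ → C → Set
  Vanish N f = ∀ i → N ≤ i → f i ≈ 0#

  ⊛-vanish : ∀ {N M f g} → Vanish N f → Vanish M g → Vanish (N ℕ.+ M) (f ⊛ g)
  ⊛-vanish {zero} {M} {f} {g} p q i le = ⊛-zeroˡ g (λ j → p j z≤n) i
  ⊛-vanish {suc N} {M} {f} {g} p q (suc i) (s≤s le) =
    0+0≈0 (x*0≈0 (q (suc i) (ℕₚ.≤-trans (ℕₚ.m≤n+m M N) (ℕₚ.≤-trans le (ℕₚ.n≤1+n i)))))
          (⊛-vanish {N} {M} (λ j r → p (suc j) (s≤s r)) q i le)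

  ⊛-top : ∀ d e {f g} → Vanish (suc d) f → Vanish (suc e) g → (f ⊛ g) (d ℕ.+ e) ≈ f d * g e
  ⊛-top zero zero p q = refl
  ⊛-top zero (suc e) {f} {g} p q = x+0≈x (⊛-zeroˡ g (λ i → p (suc i) (s≤s z≤n)) e)
  ⊛-top (suc d) e {f} {g} p q = trans
    (0+x≈x (x*0≈0 (q (suc d ℕ.+ e) (s≤s (ℕₚ.m≤n+m e d)))))
    (⊛-top d e (λ i le → p (suc i) (s≤s le)) q)

  ⊛-vanish-top : ∀ d e {f g} → Vanish (suc d) f → Vanish (suc e) g → Vanish (suc (d ℕ.+ e)) (f ⊛ g)
  ⊛-vanish-top zero e {f} {g} p q (suc i) (s≤s le) =
    0+0≈0 (x*0≈0 (q (suc i) (s≤s le))) (⊛-zeroˡ g (λ j → p (suc j) (s≤s z≤n)) i)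
  ⊛-vanish-top (suc d) e {f} {g} p q (suc i) (s≤s le) =
    0+0≈0 (x*0≈0 (q (suc i) (ℕₚ.m≤n⇒m≤1+n (ℕₚ.≤-trans (s≤s (ℕₚ.m≤n+m e d)) le))))
          (⊛-vanish-top d e (λ j r → p (suc j) (s≤s r)) q i le)

  ⊛-low : ∀ i j {f g} → (∀ k → k < i → f k ≈ 0#) → (∀ k → k < j → g k ≈ 0#) → (f ⊛ g) (i ℕ.+ j) ≈ f i * g j
  ⊛-low (suc i) j {f} {g} p q = trans (0+x≈x (0*x≈0 (p 0 (s≤s z≤n))))
    (⊛-low i j (λ k lt → p (suc k) (s≤s lt)) q)
  ⊛-low zero zero p q = refl
  ⊛-low zero (suc j) {f} {g} p q = x+0≈x (lem j {tail f} (λ k lt → q k lt))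
    where
    lem : ∀ j {f} → (∀ k → k < suc j → g k ≈ 0#) → (f ⊛ g) j ≈ 0#
    lem zero q = x*0≈0 (q 0 (s≤s z≤n))
    lem (suc j) q = 0+0≈0 (x*0≈0 (q (suc j) ℕₚ.≤-refl)) (lem j (λ k lt → q k (ℕₚ.m≤n⇒m≤1+n lt)))

  ⊛-low-zero : ∀ i j {f g} → (∀ k → k < i → f k ≈ 0#) → (∀ k → k < j → g k ≈ 0#) →
               ∀ n → n < i ℕ.+ j → (f ⊛ g) n ≈ 0#
  ⊛-low-zero zero j {f} {g} p q n n<j = go n {f} n<j
    where
    go : ∀ n {f} → n < j → (f ⊛ g) n ≈ 0#
    go zero lt = x*0≈0 (q 0 lt)
    go (suc n) lt = 0+0≈0 (x*0≈0 (q (suc n) lt)) (go n (ℕₚ.<-trans (ℕₚ.n<1+n n) lt))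
  ⊛-low-zero (suc i) j {f} {g} p q zero lt = 0*x≈0 (p 0 (s≤s z≤n))
  ⊛-low-zero (suc i) j {f} {g} p q (suc n) (s≤s lt) =
    0+0≈0 (0*x≈0 (p 0 (s≤s z≤n))) (⊛-low-zero i j (λ k r → p (suc k) (s≤s r)) q n lt)

  -- A congruence for the n-th coefficient that only looks at the antidiagonal,
  -- for any additive relation in place of equality.
  ⊛-antidiagonal : (_~_ : Carrier → Carrier → Set) →
    (∀ {x y u v} → x ~ y → u ~ v → (x + u) ~ (y + v)) →
    ∀ n {f g f′ g′} → (∀ i j → i ℕ.+ j ≡ n → (f i * g j) ~ (f′ i * g′ j)) → (f ⊛ g) n ~ (f′ ⊛ g′) n
  ⊛-antidiagonal _~_ ~+ zero h = h 0 0 ≡.refl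
  ⊛-antidiagonal _~_ ~+ (suc n) h =
    ~+ (h 0 (suc n) ≡.refl) (⊛-antidiagonal _~_ ~+ n (λ i j p → h (suc i) j (≡.cong suc p)))

  shift1 : C → C
  shift1 f zero = 0#
  shift1 f (suc n) = f n

  shift : ℕ → C → C
  shift zero f = f
  shift (suc k) f = shift1 (shift k f)

  shift-at : ∀ k f i → shift k f (k ℕ.+ i) ≡ f i
  shift-at zero f i = ≡.refl
  shift-at (suc k) f i = shift-at k f i

  shift-below : ∀ k f i → i < k → shift k f i ≡ 0#
  shift-below (suc k) f zero lt = ≡.refl
  shift-below (suc k) f (suc i) (s≤s lt) = shift-below k f i lt

  shift1-⊛ : ∀ f g → shift1 f ⊛ g ≋ shift1 (f ⊛ g)
  shift1-⊛ f g zero = zeroˡ _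
  shift1-⊛ f g (suc n) = 0+x≈x (zeroˡ _)

  shift1-cong : ∀ {f g} → f ≋ g → shift1 f ≋ shift1 g
  shift1-cong p zero = refl
  shift1-cong p (suc n) = p n

  shift-cong : ∀ k {f g} → f ≋ g → shift k f ≋ shift k g
  shift-cong zero p = p
  shift-cong (suc k) p = shift1-cong (shift-cong k p)

  shift-⊛ : ∀ k f g → shift k f ⊛ g ≋ shift k (f ⊛ g)
  shift-⊛ zero f g n = refl
  shift-⊛ (suc k) f g n = trans (shift1-⊛ (shift k f) g n) (shift1-cong (shift-⊛ k f g) n)

opaque
  PSRing : Ring → Ring
  PSRing R = mkRing record
    { Carrier = C ; _≈_ = _≋_ ; _+_ = _⊕_ ; _*_ = _⊛_ ; -_ = ⊝_ ; 0# = zeros ; 1# = const 1#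
    ; ≈-equiv = record { refl = λ _ → refl ; sym = λ p n → sym (p n) ; trans = λ p q n → trans (p n) (q n) }
    ; +-cong = λ p q n → +-cong (p n) (q n)
    ; *-cong = ⊛-cong
    ; -‿cong = λ p n → -‿cong (p n)
    ; +-assoc = λ f g h n → +-assoc _ _ _ ; +-comm = λ f g n → +-comm _ _
    ; +-identityˡ = λ f n → +-identityˡ _ ; -‿inverseˡ = λ f n → -‿inverseˡ _
    ; *-assoc = ⊛-assoc ; *-comm = ⊛-comm
    ; *-identityˡ = λ f n → trans (const-⊛ 1# f n) (*-identityˡ _)
    ; distribʳ = ⊛-distribʳ }
    where
    open Kit R using (Carrier; _≈_; _+_; _*_; -_; 0#; 1#; refl; sym; trans; +-cong; *-cong; -‿cong; +-assoc; +-comm; +-identityˡ; -‿inverseˡ; *-assoc; *-comm; *-identityˡ; distribʳ; _-_)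
    open PSRaw R

module PS (R : Ring) where
  open Kit R using (Carrier; _≈_; _+_; _*_; -_; 0#; 1#; refl; sym; +-identityˡ; zeroʳ; _-_; 0+0≈0)
  open PSRaw R public
  module S = Kit (PSRing R)

  opaque
    unfolding PSRing

    coefs : S.Carrier → C
    coefs f = f

    mkS : C → S.Carrier
    mkS f = f

    mkS-at : ∀ f i → coefs (mkS f) i ≈ f i
    mkS-at f i = refl

    mk≈ : ∀ {f g} → coefs f ≋ coefs g → f S.≈ g
    mk≈ = wrap

    at≈ : ∀ {f g} → f S.≈ g → coefs f ≋ coefs g
    at≈ = unwrap

    S+ : ∀ f g → coefs (f S.+ g) ≋ coefs f ⊕ coefs g
    S+ f g n = refl

    S* : ∀ f g → coefs (f S.* g) ≋ coefs f ⊛ coefs g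
    S* f g n = refl

    S-neg : ∀ f → coefs (S.- f) ≋ ⊝ coefs f
    S-neg f n = refl

    S0 : coefs S.0# ≋ zeros
    S0 n = refl

    S1 : coefs S.1# ≋ const 1#
    S1 n = refl

    constHom : Hom R (PSRing R)
    constHom = record
      { ⟦_⟧ = const
      ; ⟦⟧-cong = λ p → wrap λ { zero → p ; (suc n) → refl }
      ; ⟦⟧-+ = λ x y → wrap λ { zero → refl ; (suc n) → sym (+-identityˡ _) }
      ; ⟦⟧-* = λ x y → wrap λ { zero → refl ; (suc n) → sym (0+0≈0 (zeroʳ _) (⊛-zeroˡ (const y) (λ _ → refl) n)) }
      ; ⟦⟧-1 = wrap λ _ → refl }

    constHom-at : ∀ c → coefs (⟦ constHom ⟧ c) ≋ const c
    constHom-at c n = refl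

opaque
  unfolding PSRing

  -- A polynomial is a power series with some bound beyond which it vanishes. The bound need not be
  -- the degree, which cannot be computed over a ring without a zero test, and equality ignores it.
  PolyRing : Ring → Ring
  PolyRing R = SubRing (PSRing R) (λ f → ∃ λ N → Vanish N f)
    (λ { (N , p) (M , q) → N ℕ.⊔ M , λ i le →
         0+0≈0 (p i (ℕₚ.≤-trans (ℕₚ.m≤m⊔n N M) le)) (q i (ℕₚ.≤-trans (ℕₚ.m≤n⊔m N M) le)) })
    (λ { (N , p) (M , q) → N ℕ.+ M , ⊛-vanish {N} {M} p q })
    (λ { (N , p) → N , λ i le → trans (-‿cong (p i le)) -0#≈0# })
    (0 , λ i _ → refl)
    (1 , const-vanish 1#)
    where
    open Kit R using (_+_; 1#; refl; trans; -‿cong; -0#≈0#; 0+0≈0)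
    open PSRaw R

module Poly (R : Ring) where
  open Kit R using (Carrier; _≈_; _+_; _*_; -_; 0#; 1#; refl; sym; trans; +-cong; +-congˡ; *-congˡ; -‿cong; -0#≈0#; _-_; ≡⇒≈; x*0≈0; 0+0≈0; sumN; sum-nil; sum-suc; sum-zero)
  open PSRaw R public
  module P = Kit (PolyRing R) using (Carrier; _≈_; _+_; _*_; -_; 0#; 1#; refl; sym; trans; +-cong; +-congˡ; +-congʳ; *-cong; *-congˡ; *-congʳ; -‿cong; +-assoc; +-comm; +-identityˡ; +-identityʳ; *-assoc; *-comm; *-identityˡ; *-identityʳ; distribˡ; distribʳ; zeroˡ; zeroʳ; -‿distribˡ-*; -‿distribʳ-*; _^_; _-_; -‿congr; x-x; x-0; x≈y⇒x-y≈0; x+y≈z⇒x≈z-y; x-y+y; distribˡ--; distribʳ--; x*0≈0; 0*x≈0; 0+x≈x; x+0≈x; sumN; sum-nil; sum-suc; module +S; module *S; module ≈R)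

  Pol : Set
  Pol = P.Carrier

  opaque
    unfolding PolyRing PSRing

    cf : Pol → C
    cf = proj₁

    mkPol : (f : C) (N : ℕ) → Vanish N f → Pol
    mkPol f N v = f , N , v

    bound : Pol → ℕ
    bound p = proj₁ (proj₂ p)

    vanish : (p : Pol) → Vanish (bound p) (cf p)
    vanish p = proj₂ (proj₂ p)

    cf-mkPol : ∀ {f N v} i → cf (mkPol f N v) i ≈ f i
    cf-mkPol i = refl

    mkP : ∀ {p q} → (∀ i → cf p i ≈ cf q i) → p P.≈ q
    mkP h = wrap (wrap h)

    atP : ∀ {p q} → p P.≈ q → ∀ i → cf p i ≈ cf q i
    atP (wrap (wrap h)) = h

    !+ : ∀ p q i → cf (p P.+ q) i ≈ cf p i + cf q i
    !+ p q i = refl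

    !* : ∀ p q i → cf (p P.* q) i ≈ (cf p ⊛ cf q) i
    !* p q i = refl

    !neg : ∀ p i → cf (P.- p) i ≈ - cf p i
    !neg p i = refl

    !0 : ∀ i → cf P.0# i ≈ 0#
    !0 i = refl

    !1 : ∀ i → cf P.1# i ≈ const 1# i
    !1 i = refl

  infixl 9 _!_
  _!_ : Pol → ℕ → Carrier
  p ! i = cf p i

  !- : ∀ p q i → (p P.- q) ! i ≈ p ! i - q ! i
  !- p q i = trans (!+ p (P.- q) i) (+-congˡ (!neg q i))

  record Deg< (p : Pol) (N : ℕ) : Set where
    constructor deg<
    field van : Vanish N (cf p)
  open Deg< public

  record HasDeg (p : Pol) (d : ℕ) : Set where
    constructor hasDeg
    field
      lead≉0 : ¬ (p ! d ≈ 0#)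
      below : Deg< p (suc d)
  open HasDeg public

  deg<bound : ∀ p → Deg< p (bound p)
  deg<bound p = deg< (vanish p)

  mkPol-Deg< : ∀ f N v → Deg< (mkPol f N v) N
  mkPol-Deg< f N v = deg< λ i le → trans (cf-mkPol i) (v i le)

  con : Carrier → Pol
  con c = mkPol (const c) 1 (const-vanish c)

  con-at : ∀ c i → con c ! i ≈ const c i
  con-at c i = cf-mkPol i

  con-* : ∀ c p i → (con c P.* p) ! i ≈ c * p ! i
  con-* c p i = trans (!* (con c) p i)
    (trans (⊛-cong (con-at c) (λ _ → refl) i) (const-⊛ c (cf p) i))

  shift-vanish : ∀ k {N f} → Vanish N f → Vanish (k ℕ.+ N) (shift k f)
  shift-vanish zero h = h
  shift-vanish (suc k) h (suc i) (s≤s le) = shift-vanish k h i le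

  mono : ℕ → Carrier → Pol
  mono k c = mkPol (shift k (const c)) (k ℕ.+ 1) (shift-vanish k (const-vanish c))

  mono-at : ∀ k c → mono k c ! k ≈ c
  mono-at k c = trans (cf-mkPol k) (go k)
    where
    go : ∀ k → shift k (const c) k ≈ c
    go zero = refl
    go (suc k) = go k

  mono-off : ∀ k c i → ¬ (i ≡ k) → mono k c ! i ≈ 0#
  mono-off k c i ne = trans (cf-mkPol i) (go k i ne)
    where
    go : ∀ k i → ¬ (i ≡ k) → shift k (const c) i ≈ 0#
    go zero zero ne = ⊥-elim (ne ≡.refl)
    go zero (suc i) ne = refl
    go (suc k) zero ne = refl
    go (suc k) (suc i) ne = go k i (ne ∘ ≡.cong suc)

  mono-vanish : ∀ k c → Deg< (mono k c) (suc k)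
  mono-vanish k c = deg< λ i lt → mono-off k c i (λ e → ℕₚ.<-irrefl (≡.sym e) lt)

  mono-*-shift : ∀ k c p i → (mono k c P.* p) ! i ≈ shift k (scale c (cf p)) i
  mono-*-shift k c p i = trans (!* (mono k c) p i)
    (trans (⊛-cong (λ j → cf-mkPol j) (λ _ → refl) i)
      (trans (shift-⊛ k (const c) (cf p) i) (shift-cong k (const-⊛ c (cf p)) i)))

  mono-* : ∀ k c p i → (mono k c P.* p) ! (k ℕ.+ i) ≈ c * p ! i
  mono-* k c p i = trans (mono-*-shift k c p (k ℕ.+ i)) (≡⇒≈ (shift-at k _ i))

  sumP-! : ∀ n (f : ℕ → Pol) i → P.sumN n f ! i ≈ sumN n (λ j → f j ! i)
  sumP-! zero f i = trans (atP (P.sum-nil f) i) (trans (!0 i) (sym (sum-nil _)))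
  sumP-! (suc n) f i = trans (atP (P.sum-suc n f) i) (trans (!+ (f 0) (P.sumN n (f ∘ suc)) i)
    (trans (+-congˡ (sumP-! n (f ∘ suc) i)) (sym (sum-suc n _))))

  sumP-Deg< : ∀ n (f : ℕ → Pol) N → (∀ j → j < n → Deg< (f j) N) → Deg< (P.sumN n f) N
  sumP-Deg< n f N h = deg< λ i le → trans (sumP-! n f i) (sum-zero n (λ j lt → van (h j lt) i le))

  Deg<-resp : ∀ {p q N} → p P.≈ q → Deg< p N → Deg< q N
  Deg<-resp e h = deg< λ i le → trans (sym (atP e i)) (van h i le)

  Deg<-mono : ∀ {p N M} → N ≤ M → Deg< p N → Deg< p M
  Deg<-mono le h = deg< λ i q → van h i (ℕₚ.≤-trans le q)

  Deg<-1 : Deg< P.1# 1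
  Deg<-1 = deg< λ i le → trans (!1 i) (const-vanish 1# i le)

  +-Deg< : ∀ {p q N} → Deg< p N → Deg< q N → Deg< (p P.+ q) N
  +-Deg< {p} {q} h k = deg< λ i le → trans (!+ p q i) (0+0≈0 (van h i le) (van k i le))

  neg-Deg< : ∀ {p N} → Deg< p N → Deg< (P.- p) N
  neg-Deg< {p} h = deg< λ i le → trans (!neg p i) (trans (-‿cong (van h i le)) -0#≈0#)

  truncate : ℕ → C → C
  truncate N f i with i ℕ.<? N
  ... | yes _ = f i
  ... | no _ = 0#

  truncate-at : ∀ N f i → i < N → truncate N f i ≈ f i
  truncate-at N f i lt with i ℕ.<? N
  ... | yes _ = refl
  ... | no ¬lt = ⊥-elim (¬lt lt)

  truncate-vanish : ∀ N f → Vanish N (truncate N f)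
  truncate-vanish N f i le with i ℕ.<? N
  ... | yes lt = ⊥-elim (ℕₚ.<⇒≱ lt le)
  ... | no _ = refl

  ofCoeffs : (N : ℕ) → C → Pol
  ofCoeffs N f = mkPol (truncate N f) N (truncate-vanish N f)

  ofCoeffs-at : ∀ N f i → i < N → ofCoeffs N f ! i ≈ f i
  ofCoeffs-at N f i lt = trans (cf-mkPol i) (truncate-at N f i lt)

  ofCoeffs-Deg< : ∀ N f → Deg< (ofCoeffs N f) N
  ofCoeffs-Deg< N f = mkPol-Deg< (truncate N f) N (truncate-vanish N f)

conHom : (R : Ring) → Hom R (PolyRing R)
conHom R = record
  { ⟦_⟧ = con
  ; ⟦⟧-cong = λ {x} {y} p → mkP λ { zero → trans (con-at x 0) (trans p (sym (con-at y 0)))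
                                    ; (suc i) → trans (con-at x (suc i)) (sym (con-at y (suc i))) }
  ; ⟦⟧-+ = λ x y → mkP λ { zero → trans (con-at (x + y) 0) (sym (trans (!+ (con x) (con y) 0) (+-cong (con-at x 0) (con-at y 0))))
                           ; (suc i) → trans (con-at (x + y) (suc i)) (sym (trans (!+ (con x) (con y) (suc i))
                               (0+0≈0 (con-at x (suc i)) (con-at y (suc i))))) }
  ; ⟦⟧-* = λ x y → mkP λ { zero → trans (con-at (x * y) 0) (sym (trans (con-* x (con y) 0) (*-congˡ (con-at y 0))))
                           ; (suc i) → trans (con-at (x * y) (suc i)) (sym (trans (con-* x (con y) (suc i)) (x*0≈0 (con-at y (suc i))))) }
  ; ⟦⟧-1 = mkP λ i → trans (con-at 1# i) (sym (!1 i)) }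
  where
  open Kit R using (Carrier; _+_; _*_; 1#; sym; trans; +-cong; *-congˡ; x*0≈0; 0+0≈0; module ≈R)
  open Poly R

module Eval {R S : Ring} (φ : Hom R S) (a : CommutativeRing.Carrier S) where
  private
    module R = Kit R using (_+_; _*_; trans)
  open Kit S using (Carrier; _≈_; _+_; _*_; 0#; 1#; refl; sym; trans; +-cong; +-congˡ; +-congʳ; *-congˡ; *-congʳ; +-assoc; +-identityˡ; *-assoc; *-identityʳ; distribˡ; distribʳ; zeroˡ; zeroʳ; _^_; x*0≈0; 0*x≈0; 0+0≈0; x+0≈x; sumN; sum-nil; sum-suc; sum-cong; sum-*ˡ; sum-single; module +S; module *S; module ≈R)
  open Poly R
  open ≈R

  ev : ℕ → C → Carrier
  ev zero f = 0#
  ev (suc N) f = ⟦ φ ⟧ (f 0) + a * ev N (tail f)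

  ev-cong : ∀ N {f g} → f ≋ g → ev N f ≈ ev N g
  ev-cong zero p = refl
  ev-cong (suc N) p = +-cong (⟦⟧-cong φ (p 0)) (*-congˡ (ev-cong N (λ i → p (suc i))))

  ev-zero : ∀ N {f} → f ≋ zeros → ev N f ≈ 0#
  ev-zero zero p = refl
  ev-zero (suc N) p = 0+0≈0 (⟦⟧≈0 φ (p 0)) (x*0≈0 (ev-zero N (λ i → p (suc i))))

  ev-extend : ∀ N k {f} → Vanish N f → ev (N ℕ.+ k) f ≈ ev N f
  ev-extend zero k p = ev-zero k (λ i → p i z≤n)
  ev-extend (suc N) k p = +-congˡ (*-congˡ (ev-extend N k (λ i le → p (suc i) (s≤s le))))

  ev-≤ : ∀ {N M f} → N ≤ M → Vanish N f → ev M f ≈ ev N f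
  ev-≤ {N} {M} {f} le p = ≡.subst (λ m → ev m f ≈ ev N f) (ℕₚ.m+[n∸m]≡n le) (ev-extend N (M ℕ.∸ N) p)

  ev-+ : ∀ N f g → ev N (f ⊕ g) ≈ ev N f + ev N g
  ev-+ zero f g = sym (+-identityˡ _)
  ev-+ (suc N) f g = begin
    ⟦ φ ⟧ (f 0 R.+ g 0) + a * ev N (tail f ⊕ tail g)
      ≈⟨ +-cong (⟦⟧-+ φ _ _) (trans (*-congˡ (ev-+ N (tail f) (tail g))) (distribˡ _ _ _)) ⟩
    (⟦ φ ⟧ (f 0) + ⟦ φ ⟧ (g 0)) + (a * ev N (tail f) + a * ev N (tail g))
      ≈⟨ +S.interchange _ _ _ _ ⟩
    ev (suc N) f + ev (suc N) g ∎

  ev-scale : ∀ N c f → ev N (scale c f) ≈ ⟦ φ ⟧ c * ev N f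
  ev-scale zero c f = sym (zeroʳ _)
  ev-scale (suc N) c f = begin
    ⟦ φ ⟧ (c R.* f 0) + a * ev N (scale c (tail f))
      ≈⟨ +-cong (⟦⟧-* φ _ _) (trans (*-congˡ (ev-scale N c (tail f))) (*S.x∙yz≈y∙xz _ _ _)) ⟩
    ⟦ φ ⟧ c * ⟦ φ ⟧ (f 0) + ⟦ φ ⟧ c * (a * ev N (tail f)) ≈⟨ distribˡ _ _ _ ⟨
    ⟦ φ ⟧ c * ev (suc N) f ∎

  ev-* : ∀ N M f g → Vanish N f → Vanish M g → ev (N ℕ.+ M) (f ⊛ g) ≈ ev N f * ev M g
  ev-* zero M f g p q = trans (ev-zero M (⊛-zeroˡ g (λ i → p i z≤n))) (sym (zeroˡ _))
  ev-* (suc N) M f g p q = begin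
    ⟦ φ ⟧ (f 0 R.* g 0) + a * ev (N ℕ.+ M) (scale (f 0) (tail g) ⊕ (tail f ⊛ g))
      ≈⟨ +-cong (⟦⟧-* φ _ _) (*-congˡ (trans (ev-+ (N ℕ.+ M) _ _)
          (+-cong (ev-scale (N ℕ.+ M) (f 0) (tail g)) (ev-* N M (tail f) g (λ i le → p (suc i) (s≤s le)) q)))) ⟩
    F0 * ⟦ φ ⟧ (g 0) + a * (F0 * E + ev N (tail f) * ev M g)
      ≈⟨ +-congˡ (trans (distribˡ _ _ _) (+-cong (*S.x∙yz≈y∙xz _ _ _) (sym (*-assoc _ _ _)))) ⟩
    F0 * ⟦ φ ⟧ (g 0) + (F0 * (a * E) + a * ev N (tail f) * ev M g)
      ≈⟨ +-assoc _ _ _ ⟨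
    (F0 * ⟦ φ ⟧ (g 0) + F0 * (a * E)) + a * ev N (tail f) * ev M g
      ≈⟨ +-congʳ (distribˡ _ _ _) ⟨
    F0 * ev (suc (N ℕ.+ M)) g + a * ev N (tail f) * ev M g
      ≈⟨ +-congʳ (*-congˡ (ev-≤ {M} {suc (N ℕ.+ M)} (ℕₚ.m≤n+m M (suc N)) q)) ⟩
    F0 * ev M g + a * ev N (tail f) * ev M g
      ≈⟨ distribʳ _ _ _ ⟨
    ev (suc N) f * ev M g ∎
    where
    F0 = ⟦ φ ⟧ (f 0)
    E = ev (N ℕ.+ M) (tail g)

  eval : Pol → Carrier
  eval p = ev (bound p) (cf p)

  eval-bound : ∀ p N → Deg< p N → eval p ≈ ev N (cf p)
  eval-bound p N h with ℕₚ.≤-total (bound p) N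
  ... | inj₁ le = sym (ev-≤ {bound p} {N} le (vanish p))
  ... | inj₂ le = ev-≤ {N} {bound p} le (van h)

  evalHom : Hom (PolyRing R) S
  evalHom = record
    { ⟦_⟧ = eval
    ; ⟦⟧-cong = λ {p} {q} e → trans (ev-cong (bound p) (atP e))
        (sym (eval-bound q (bound p) (Deg<-resp e (deg<bound p))))
    ; ⟦⟧-+ = λ p q → let N = bound p ℕ.⊔ bound q
                         hp = Deg<-mono (ℕₚ.m≤m⊔n (bound p) (bound q)) (deg<bound p)
                         hq = Deg<-mono (ℕₚ.m≤n⊔m (bound p) (bound q)) (deg<bound q) in
        trans (eval-bound (p P.+ q) N (+-Deg< hp hq))
          (trans (ev-cong N (!+ p q)) (trans (ev-+ N (cf p) (cf q))
            (sym (+-cong (eval-bound p N hp) (eval-bound q N hq)))))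
    ; ⟦⟧-* = λ p q → let N = bound p ℕ.+ bound q in
        trans (eval-bound (p P.* q) N (deg< λ i le → R.trans (!* p q i) (⊛-vanish {bound p} {bound q} (vanish p) (vanish q) i le)))
          (trans (ev-cong N (!* p q)) (ev-* (bound p) (bound q) (cf p) (cf q) (vanish p) (vanish q)))
    ; ⟦⟧-1 = trans (eval-bound P.1# 1 Deg<-1) (trans (x+0≈x (zeroʳ a)) (trans (⟦⟧-cong φ (!1 0)) (⟦⟧-1 φ))) }

  ev-sum : ∀ N f → ev N f ≈ sumN N (λ i → ⟦ φ ⟧ (f i) * a ^ i)
  ev-sum zero f = sym (sum-nil _)
  ev-sum (suc N) f = trans (+-cong (sym (*-identityʳ _)) (trans (*-congˡ (ev-sum N (tail f)))
    (trans (sum-*ˡ N a _) (sum-cong N (λ i _ → *S.x∙yz≈y∙xz _ _ _))))) (sym (sum-suc N _))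

  eval-sum : ∀ p N → Deg< p N → eval p ≈ sumN N (λ i → ⟦ φ ⟧ (p ! i) * a ^ i)
  eval-sum p N h = trans (eval-bound p N h) (ev-sum N (cf p))

  eval-mono : ∀ k c → eval (mono k c) ≈ ⟦ φ ⟧ c * a ^ k
  eval-mono k c = trans (eval-sum (mono k c) (suc k) (mono-vanish k c))
    (trans (sum-single (suc k) (λ i → ⟦ φ ⟧ (mono k c ! i) * a ^ i) k ℕₚ.≤-refl (λ j _ ne → 0*x≈0 (⟦⟧≈0 φ (mono-off k c j ne))))
      (*-congʳ (⟦⟧-cong φ (mono-at k c))))

  eval-con : ∀ c → eval (con c) ≈ ⟦ φ ⟧ c
  eval-con c = trans (eval-bound (con c) 1 (mkPol-Deg< (const c) 1 (const-vanish c))) (trans (x+0≈x (zeroʳ a)) (⟦⟧-cong φ (con-at c 0)))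

module _ {R S : Ring} (φ : Hom R S) where
  private
    module A = Poly R
    module B = Poly S
  open Kit S using (_≈_; _+_; _*_; 1#; sym; trans; +-cong)

  mapP : A.Pol → B.Pol
  mapP p = B.mkPol (λ i → ⟦ φ ⟧ (p A.! i)) (A.bound p) (λ i le → ⟦⟧≈0 φ (A.vanish p i le))

  mapP-at : ∀ p i → mapP p B.! i ≈ ⟦ φ ⟧ (p A.! i)
  mapP-at p i = B.cf-mkPol i

  private
    mul : ∀ i f g → ⟦ φ ⟧ ((f A.⊛ g) i) ≈ ((λ j → ⟦ φ ⟧ (f j)) B.⊛ (λ j → ⟦ φ ⟧ (g j))) i
    mul zero f g = ⟦⟧-* φ _ _
    mul (suc i) f g = trans (⟦⟧-+ φ _ _) (+-cong (⟦⟧-* φ _ _) (mul i (A.tail f) g))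

  mapHom : Hom (PolyRing R) (PolyRing S)
  mapHom = record
    { ⟦_⟧ = mapP
    ; ⟦⟧-cong = λ {p} {q} e → B.mkP λ i → trans (mapP-at p i) (trans (⟦⟧-cong φ (A.atP e i)) (sym (mapP-at q i)))
    ; ⟦⟧-+ = λ p q → B.mkP λ i → trans (mapP-at (p A.P.+ q) i) (trans (⟦⟧-cong φ (A.!+ p q i))
        (trans (⟦⟧-+ φ _ _) (sym (trans (B.!+ (mapP p) (mapP q) i) (+-cong (mapP-at p i) (mapP-at q i))))))
    ; ⟦⟧-* = λ p q → B.mkP λ i → trans (mapP-at (p A.P.* q) i) (trans (⟦⟧-cong φ (A.!* p q i))
        (trans (mul i _ _) (sym (trans (B.!* (mapP p) (mapP q) i) (B.⊛-cong (mapP-at p) (mapP-at q) i)))))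
    ; ⟦⟧-1 = B.mkP λ { zero → trans (mapP-at A.P.1# 0) (trans (⟦⟧-cong φ (A.!1 0)) (trans (⟦⟧-1 φ) (sym (B.!1 0))))
                     ; (suc i) → trans (mapP-at A.P.1# (suc i)) (trans (⟦⟧-cong φ (A.!1 (suc i))) (trans (⟦⟧-0 φ) (sym (B.!1 (suc i))))) } }

  mapP-Deg< : ∀ {p N} → A.Deg< p N → B.Deg< (mapP p) N
  mapP-Deg< {p} h = B.deg< λ i le → trans (mapP-at p i) (⟦⟧≈0 φ (A.van h i le))

eval-∘ : {R S T : Ring} (φ : Hom R S) (ψ : Hom S T) (a : CommutativeRing.Carrier S) (p : Poly.Pol R) →
  CommutativeRing._≈_ T (⟦ ψ ⟧ (Eval.eval φ a p)) (Eval.eval (ψ ∘H φ) (⟦ ψ ⟧ a) p)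
eval-∘ {R} {S} {T} φ ψ a p = go (Poly.bound R p) (Poly.cf R p)
  where
  open Kit T using (Carrier; _≈_; refl; trans; +-cong; +-congˡ; *-cong; *-congˡ)
  go : ∀ N f → ⟦ ψ ⟧ (Eval.ev φ a N f) ≈ Eval.ev (ψ ∘H φ) (⟦ ψ ⟧ a) N f
  go zero f = ⟦⟧-0 ψ
  go (suc N) f = trans (⟦⟧-+ ψ _ _) (+-congˡ (trans (⟦⟧-* ψ _ _) (*-congˡ (go N (f ∘ suc)))))

eval-congHom : {R S : Ring} (φ ψ : Hom R S) → let open Kit S using (_≈_; refl; +-cong; *-cong) in (∀ x → ⟦ φ ⟧ x ≈ ⟦ ψ ⟧ x) →
  ∀ {a b} → a ≈ b → (p : Poly.Pol R) → Eval.eval φ a p ≈ Eval.eval ψ b p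
eval-congHom {R} {S} φ ψ h {a} {b} e p = go (Poly.bound R p) (Poly.cf R p)
  where
  open Kit S using (Carrier; _≈_; refl; sym; trans; +-cong; *-cong; *-congʳ; sum-cong)
  go : ∀ N f → Eval.ev φ a N f ≈ Eval.ev ψ b N f
  go zero f = refl
  go (suc N) f = +-cong (h (f 0)) (*-cong e (go N (f ∘ suc)))

eval-map : {R S T : Ring} (φ : Hom R S) (ψ : Hom S T) (a : CommutativeRing.Carrier T) (p : Poly.Pol R) →
  CommutativeRing._≈_ T (Eval.eval ψ a (mapP φ p)) (Eval.eval (ψ ∘H φ) a p)
eval-map {R} {S} {T} φ ψ a p = trans
  (Eval.eval-sum ψ a (mapP φ p) N (mapP-Deg< φ (Poly.deg<bound R p)))
  (trans (sum-cong N (λ i _ → *-congʳ (⟦⟧-cong ψ (mapP-at φ p i))))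
    (sym (Eval.eval-sum (ψ ∘H φ) a p N (Poly.deg<bound R p))))
  where
  open Kit T using (Carrier; _≈_; sym; trans; *-congʳ; sum-cong)
  N = Poly.bound R p

-- Discrete domains and fields, division and roots

¬¬-least : ∀ {a} {P : ℕ → Set a} → (∃ λ n → P n) → ¬ ¬ (∃ λ n → P n × (∀ m → m < n → ¬ P m))
¬¬-least {a} {P} (n , pn) h = <-rec (λ n → ¬ P n) (λ n rec pn → h (n , pn , λ m lt → rec lt)) n pn

record IsDDom (R : Ring) : Set where
  open Kit R using (_≈_; _*_; -_; 0#; 1#; trans; _^_; _-_; x-y≈0⇒x≈y; x≈y⇒x-y≈0; distribˡ--)
  field
    ≟0  : ∀ x → Dec (x ≈ 0#)
    nzd : ∀ {x y} → x * y ≈ 0# → x ≈ 0# ⊎ y ≈ 0#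
    1≉0 : ¬ (1# ≈ 0#)

  nzd-¬ : ∀ {x y} → ¬ (x ≈ 0#) → ¬ (y ≈ 0#) → ¬ (x * y ≈ 0#)
  nzd-¬ nx ny p with nzd p
  ... | inj₁ q = nx q
  ... | inj₂ q = ny q

  cancel : ∀ {x y} → ¬ (x ≈ 0#) → x * y ≈ 0# → y ≈ 0#
  cancel nx p with nzd p
  ... | inj₁ q = ⊥-elim (nx q)
  ... | inj₂ q = q

  cancel-≈ : ∀ {x y z} → ¬ (x ≈ 0#) → x * y ≈ x * z → y ≈ z
  cancel-≈ {x} {y} {z} nx p =
    x-y≈0⇒x≈y (cancel nx (trans (distribˡ-- x y z) (x≈y⇒x-y≈0 p)))

  ^-≉0 : ∀ {x} n → ¬ (x ≈ 0#) → ¬ (x ^ n ≈ 0#)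
  ^-≉0 zero nx = 1≉0
  ^-≉0 (suc n) nx = nzd-¬ nx (^-≉0 n nx)

  ^≈0 : ∀ {x} n → x ^ n ≈ 0# → x ≈ 0#
  ^≈0 {x} n p with ≟0 x
  ... | yes q = q
  ... | no nx = ⊥-elim (^-≉0 n nx p)

  _≟_ : ∀ x y → Dec (x ≈ y)
  x ≟ y with ≟0 (x - y)
  ... | yes p = yes (x-y≈0⇒x≈y p)
  ... | no np = no (np ∘ x≈y⇒x-y≈0)

record IsDField (R : Ring) : Set where
  open Kit R using (_≈_; _*_; 0#; 1#; trans; *-congʳ; *-assoc; *-comm; *-identityˡ; x*0≈0; module ≈R)
  field
    ≟0  : ∀ x → Dec (x ≈ 0#)
    1≉0 : ¬ (1# ≈ 0#)
    inv : ∀ x → ¬ (x ≈ 0#) → ∃ λ y → x * y ≈ 1#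

  ddom : IsDDom R
  ddom = record { ≟0 = ≟0 ; 1≉0 = 1≉0 ; nzd = nzd }
    where
    nzd : ∀ {x y} → x * y ≈ 0# → x ≈ 0# ⊎ y ≈ 0#
    nzd {x} {y} p with ≟0 x
    ... | yes q = inj₁ q
    ... | no nx = let (u , e) = inv x nx in inj₂ (begin
      y            ≈⟨ *-identityˡ y ⟨
      1# * y       ≈⟨ *-congʳ (trans (*-comm u x) e) ⟨
      u * x * y    ≈⟨ *-assoc u x y ⟩
      u * (x * y)  ≈⟨ x*0≈0 p ⟩
      0#           ∎)
      where open ≈R
  open IsDDom ddom public using (nzd; nzd-¬; cancel; cancel-≈; ^-≉0; ^≈0; _≟_)

record DField : Set₁ where
  field
    ring   : Ring
    isDFld : IsDField ring

hom-inj : {R S : Ring} → IsDField R → IsDField S → (φ : Hom R S) → ∀ {x} →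
  CommutativeRing._≈_ S (⟦ φ ⟧ x) (CommutativeRing.0# S) → CommutativeRing._≈_ R x (CommutativeRing.0# R)
hom-inj {R} {S} fR fS φ {x} p with IsDField.≟0 fR x
... | yes q = q
... | no nx = let (y , e) = IsDField.inv fR x nx in ⊥-elim (IsDField.1≉0 fS
  (S.trans (S.sym (⟦⟧-1 φ)) (S.trans (⟦⟧-cong φ (R.sym e)) (S.trans (⟦⟧-* φ x y) (S.0*x≈0 p)))))
  where module S = Kit S using (sym; trans; 0*x≈0)
        module R = Kit R using (sym)

module PolyDom {R : Ring} (dom : IsDDom R) where
  open Kit R using (Carrier; _≈_; _+_; _*_; -_; 0#; 1#; refl; sym; trans; +-cong; +-congʳ; *-congˡ; *-congʳ; +-assoc; +-identityʳ; *-assoc; *-comm; *-identityˡ; *-identityʳ; distribˡ; zeroʳ; _^_; ^-congˡ; _-_; ≡⇒≈; -‿congr; x-x; x-0; x-y≈0⇒x≈y; x≈y⇒x-y≈0; x-y+y; x*0≈0; 0*x≈0; 0+x≈x; x+0≈x; 1^n≈1; Distinct; module +S; module *S; module ≈R)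
  open Poly R using (module P; Pol; cf; bound; mkP; atP; !*; !0; !1; _!_; !-; Deg<; module Deg<; deg<; van; HasDeg; module HasDeg; hasDeg; lead≉0; below; deg<bound; con; con-at; con-*; mono; mono-at; mono-vanish; mono-*; Deg<-resp; Deg<-mono; Deg<-1; const-vanish; ⊛-top; ⊛-vanish-top)
  open IsDDom dom

  deg?-bounded : ∀ N p → Deg< p N → (p P.≈ P.0#) ⊎ (∃ λ d → d < N × HasDeg p d)
  deg?-bounded zero p h = inj₁ (mkP λ i → trans (van h i z≤n) (sym (!0 i)))
  deg?-bounded (suc N) p h with ≟0 (p ! N)
  ... | no np = inj₂ (N , ℕₚ.≤-refl , hasDeg np h)
  ... | yes p0 with deg?-bounded N p (deg< λ i le → case i (ℕₚ.m≤n⇒m<n∨m≡n le))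
    where
    case : ∀ i → N < i ⊎ N ≡ i → p ! i ≈ 0#
    case i (inj₁ lt) = van h i lt
    case i (inj₂ ≡.refl) = p0
  ... | inj₁ z = inj₁ z
  ... | inj₂ (d , lt , hd) = inj₂ (d , ℕₚ.m≤n⇒m≤1+n lt , hd)

  deg? : ∀ p → (p P.≈ P.0#) ⊎ (∃ λ d → HasDeg p d)
  deg? p with deg?-bounded (bound p) p (deg<bound p)
  ... | inj₁ z = inj₁ z
  ... | inj₂ (d , _ , hd) = inj₂ (d , hd)

  HasDeg⇒≉0 : ∀ {p d} → HasDeg p d → ¬ (p P.≈ P.0#)
  HasDeg⇒≉0 h e = lead≉0 h (trans (atP e _) (!0 _))

  HasDeg-< : ∀ {p d N} → HasDeg p d → Deg< p N → d < N
  HasDeg-< {p} {d} {N} hd h = ℕₚ.≰⇒> (λ le → lead≉0 hd (van h d le))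

  HasDeg-unique : ∀ {p d e} → HasDeg p d → HasDeg p e → d ≡ e
  HasDeg-unique hd he = ℕₚ.≤-antisym (ℕₚ.≤-pred (HasDeg-< hd (below he))) (ℕₚ.≤-pred (HasDeg-< he (below hd)))

  HasDeg-resp : ∀ {p q d} → p P.≈ q → HasDeg p d → HasDeg q d
  HasDeg-resp e (hasDeg nz h) = hasDeg (λ z → nz (trans (atP e _) z)) (Deg<-resp e h)

  HasDeg-* : ∀ {p q d e} → HasDeg p d → HasDeg q e → HasDeg (p P.* q) (d ℕ.+ e)
  HasDeg-* {p} {q} {d} {e} (hasDeg np hp) (hasDeg nq hq) = hasDeg
    (λ z → nzd-¬ np nq (trans (sym (trans (!* p q _) (⊛-top d e (van hp) (van hq)))) z))
    (deg< λ i le → trans (!* p q i) (⊛-vanish-top d e (van hp) (van hq) i le))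

  polyDDom : IsDDom (PolyRing R)
  polyDDom = record
    { ≟0 = λ p → dec p
    ; nzd = λ {p} {q} → nz p q
    ; 1≉0 = λ e → 1≉0 (trans (sym (!1 0)) (trans (atP e 0) (!0 0))) }
    where
    dec : ∀ p → Dec (p P.≈ P.0#)
    dec p with deg? p
    ... | inj₁ z = yes z
    ... | inj₂ (d , hd) = no (HasDeg⇒≉0 hd)
    nz : ∀ p q → p P.* q P.≈ P.0# → (p P.≈ P.0#) ⊎ (q P.≈ P.0#)
    nz p q e with deg? p | deg? q
    ... | inj₁ z | _ = inj₁ z
    ... | inj₂ _ | inj₁ z = inj₂ z
    ... | inj₂ (d , hd) | inj₂ (d′ , hd′) = ⊥-elim (HasDeg⇒≉0 (HasDeg-* hd hd′) e)

  module PD = IsDDom polyDDom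

  factor-Deg< : ∀ {p q d N} → HasDeg p d → Deg< (p P.* q) (d ℕ.+ N) → Deg< q N
  factor-Deg< {p} {q} {d} {N} hp h with deg? q
  ... | inj₁ z = deg< λ i _ → trans (atP z i) (!0 i)
  ... | inj₂ (e , he) = Deg<-mono (ℕₚ.+-cancelˡ-< d e N (HasDeg-< (HasDeg-* hp he) h)) (below he)

  -- Pseudo-division: each step multiplies a by the leading coefficient of b instead of dividing by
  -- it. So it is available over L[z], where b is divided by a polynomial in x that is not monic.
  pdiv : ∀ (b : Pol) d → HasDeg b d → ∀ N a → Deg< a N →
    ∃ λ s → ∃ λ q → ∃ λ r → (con ((b ! d) ^ s) P.* a P.≈ b P.* q P.+ r) × Deg< r d
  pdiv b d hb zero a h = 0 , P.0# , a ,
    P.trans (P.trans (P.*-congʳ (⟦⟧-1 (conHom R))) (P.*-identityˡ a)) (P.sym (P.0+x≈x (P.zeroʳ b))) , Deg<-mono z≤n h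
  pdiv b d hb (suc N) a h with suc N ℕ.≤? d
  ... | yes le = 0 , P.0# , a ,
    P.trans (P.trans (P.*-congʳ (⟦⟧-1 (conHom R))) (P.*-identityˡ a)) (P.sym (P.0+x≈x (P.zeroʳ b))) , Deg<-mono le h
  ... | no ¬le = extend (pdiv b d hb N a₁ h₁)
    where
    d≤N : d ≤ N
    d≤N = ℕₚ.≤-pred (ℕₚ.≰⇒> ¬le)
    k = N ℕ.∸ d
    u = b ! d
    c = a ! N
    m = mono k c
    a₁ = con u P.* a P.- m P.* b
    at : ∀ j → (m P.* b) ! (N ℕ.+ j) ≈ c * b ! (d ℕ.+ j)
    at j = ≡.subst (λ t → (m P.* b) ! t ≈ c * b ! (d ℕ.+ j))
      (≡.trans (≡.sym (ℕₚ.+-assoc k d j)) (≡.cong (ℕ._+ j) (ℕₚ.m∸n+n≡m d≤N)))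
      (mono-* k c b (d ℕ.+ j))
    coef : ∀ j → a₁ ! (N ℕ.+ j) ≈ 0#
    coef zero = trans (!- (con u P.* a) (m P.* b) _) (x≈y⇒x-y≈0 (trans (con-* u a _)
      (trans (*-congˡ (≡⇒≈ (≡.cong (a !_) (ℕₚ.+-identityʳ N)))) (trans (*-comm u c)
        (sym (trans (at 0) (*-congˡ (≡⇒≈ (≡.cong (b !_) (ℕₚ.+-identityʳ d))))))))))
    coef (suc j) = trans (!- (con u P.* a) (m P.* b) _) (trans (-‿congr
      (trans (con-* u a _) (x*0≈0 (van h _ (≡.subst (suc N ≤_) (≡.sym (ℕₚ.+-suc N j)) (s≤s (ℕₚ.m≤m+n N j))))))
      (trans (at (suc j)) (x*0≈0 (van (below hb) _ (≡.subst (suc d ≤_) (≡.sym (ℕₚ.+-suc d j)) (s≤s (ℕₚ.m≤m+n d j)))))))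
      (x-x 0#))
    h₁ : Deg< a₁ N
    h₁ = deg< λ i le → ≡.subst (λ t → a₁ ! t ≈ 0#) (ℕₚ.m+[n∸m]≡n le) (coef (i ℕ.∸ N))
    extend : (∃ λ s → ∃ λ q → ∃ λ r → (con (u ^ s) P.* a₁ P.≈ b P.* q P.+ r) × Deg< r d) →
      ∃ λ s → ∃ λ q → ∃ λ r → (con (u ^ s) P.* a P.≈ b P.* q P.+ r) × Deg< r d
    extend (s , q , r , e , hr) = suc s , q P.+ con (u ^ s) P.* m , r , eq , hr
      where
      open P.≈R
      us = con (u ^ s)
      eq : con (u * u ^ s) P.* a P.≈ b P.* (q P.+ us P.* m) P.+ r
      eq = begin
        con (u * u ^ s) P.* a              ≈⟨ P.*-congʳ (⟦⟧-* (conHom R) u (u ^ s)) ⟩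
        con u P.* us P.* a                 ≈⟨ P.*S.xy∙z≈y∙xz (con u) us a ⟩
        us P.* (con u P.* a)               ≈⟨ P.*-congˡ (P.x-y+y (con u P.* a) (m P.* b)) ⟨
        us P.* (a₁ P.+ m P.* b)            ≈⟨ P.distribˡ us a₁ (m P.* b) ⟩
        us P.* a₁ P.+ us P.* (m P.* b)     ≈⟨ P.+-cong e (P.*S.x∙yz≈z∙xy us m b) ⟩
        (b P.* q P.+ r) P.+ b P.* (us P.* m) ≈⟨ P.+S.xy∙z≈xz∙y (b P.* q) r (b P.* (us P.* m)) ⟩
        (b P.* q P.+ b P.* (us P.* m)) P.+ r ≈⟨ P.+-congʳ (P.distribˡ b q (us P.* m)) ⟨
        b P.* (q P.+ us P.* m) P.+ r       ∎

  lin : Carrier → Pol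
  lin ρ = mono 1 1# P.- con ρ

  lin-lead : ∀ ρ → lin ρ ! 1 ≈ 1#
  lin-lead ρ = trans (!- (mono 1 1#) (con ρ) 1) (trans (-‿congr (mono-at 1 1#) (con-at ρ 1)) (x-0 1#))

  lin-HasDeg : ∀ ρ → HasDeg (lin ρ) 1
  lin-HasDeg ρ = hasDeg (λ z → 1≉0 (trans (sym (lin-lead ρ)) z))
    (deg< λ i le → trans (!- (mono 1 1#) (con ρ) i) (trans (-‿congr (van (mono-vanish 1 1#) i le)
      (trans (con-at ρ i) (const-vanish ρ i (ℕₚ.≤-trans (s≤s z≤n) le)))) (x-x 0#)))

  module Ev (a : Carrier) = Eval (idHom R) a
  evalAt : Carrier → Pol → Carrier
  evalAt a p = Ev.eval a p

  eval-lin : ∀ a ρ → evalAt a (lin ρ) ≈ a - ρ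
  eval-lin a ρ = trans (⟦⟧-- (Ev.evalHom a) (mono 1 1#) (con ρ))
    (-‿congr (trans (Ev.eval-mono a 1 1#) (trans (*-identityˡ _) (*-identityʳ _))) (Ev.eval-con a ρ))

  factor-root : ∀ p ρ → evalAt ρ p ≈ 0# → ∃ λ g → p P.≈ lin ρ P.* g
  factor-root p ρ pρ with pdiv (lin ρ) 1 (lin-HasDeg ρ) (bound p) p (deg<bound p)
  ... | s , q , r , e , hr = q , (P.trans lhs (P.trans e (P.x+0≈x r≈0)))
    where
    lead^ : (lin ρ ! 1) ^ s ≈ 1#
    lead^ = trans (^-congˡ s (lin-lead ρ)) (1^n≈1 s)
    lhs : p P.≈ con ((lin ρ ! 1) ^ s) P.* p
    lhs = P.sym (P.trans (P.*-congʳ (P.trans (⟦⟧-cong (conHom R) lead^) (⟦⟧-1 (conHom R)))) (P.*-identityˡ p))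
    module E = Eval (idHom R) ρ
    r0 : r ! 0 ≈ 0#
    r0 = begin
      r ! 0                           ≈⟨ x+0≈x (zeroʳ _) ⟨
      E.ev 1 (cf r)                ≈⟨ E.eval-bound r 1 hr ⟨
      evalAt ρ r                      ≈⟨ 0+x≈x (0*x≈0 (trans (eval-lin ρ ρ) (x-x ρ))) ⟨
      evalAt ρ (lin ρ) * evalAt ρ q + evalAt ρ r ≈⟨ +-congʳ (⟦⟧-* E.evalHom (lin ρ) q) ⟨
      evalAt ρ (lin ρ P.* q) + evalAt ρ r ≈⟨ ⟦⟧-+ E.evalHom (lin ρ P.* q) r ⟨
      evalAt ρ (lin ρ P.* q P.+ r)    ≈⟨ ⟦⟧-cong E.evalHom (P.trans lhs e) ⟨
      evalAt ρ p                      ≈⟨ pρ ⟩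
      0#                              ∎
      where open ≈R
    r≈0 : r P.≈ P.0#
    r≈0 = mkP λ { zero → trans r0 (sym (!0 0)) ; (suc i) → trans (van hr (suc i) (s≤s z≤n)) (sym (!0 (suc i))) }

  distinct-tail : ∀ {j ρ} → Distinct (suc j) ρ → Distinct j (ρ ∘ suc)
  distinct-tail h a b a< b< e = ℕₚ.suc-injective (h (suc a) (suc b) (s≤s a<) (s≤s b<) e)

  root-of-cofactor : ∀ {j} ρ p g → Distinct (suc j) ρ → (∀ i → i < suc j → evalAt (ρ i) p ≈ 0#) →
    p P.≈ lin (ρ 0) P.* g → ∀ i → i < j → evalAt (ρ (suc i)) g ≈ 0#
  root-of-cofactor ρ p g D h e i lt = cancel
    (λ z → absurd (D (suc i) 0 (s≤s lt) (s≤s z≤n) (x-y≈0⇒x≈y z)))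
    (trans (*-congʳ (sym (eval-lin (ρ (suc i)) (ρ 0))))
      (trans (sym (⟦⟧-* (Ev.evalHom (ρ (suc i))) (lin (ρ 0)) g))
        (trans (⟦⟧-cong (Ev.evalHom (ρ (suc i))) (P.sym e)) (h (suc i) (s≤s lt)))))
    where
    absurd : ∀ {i} → suc i ≡ 0 → ⊥
    absurd ()

  root-bound : ∀ N j ρ p → Deg< p N → N ≤ j → Distinct j ρ → (∀ i → i < j → evalAt (ρ i) p ≈ 0#) → p P.≈ P.0#
  root-bound zero j ρ p h _ _ _ = mkP λ i → trans (van h i z≤n) (sym (!0 i))
  root-bound (suc N) (suc j) ρ p h (s≤s le) D z with factor-root p (ρ 0) (z 0 (s≤s z≤n))
  ... | g , e = P.trans e (P.x*0≈0
    (root-bound N j (ρ ∘ suc) g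
      (factor-Deg< (lin-HasDeg (ρ 0)) (Deg<-resp e h)) le (distinct-tail D)
      (root-of-cofactor ρ p g D z e)))

  lins : ℕ → (ℕ → Carrier) → Pol
  lins zero ρ = P.1#
  lins (suc j) ρ = lin (ρ 0) P.* lins j (ρ ∘ suc)

  factor-roots : ∀ j ρ p → Distinct j ρ → (∀ i → i < j → evalAt (ρ i) p ≈ 0#) → ∃ λ g → p P.≈ lins j ρ P.* g
  factor-roots zero ρ p D h = p , P.sym (P.*-identityˡ p)
  factor-roots (suc j) ρ p D h with factor-root p (ρ 0) (h 0 (s≤s z≤n))
  ... | g , e with factor-roots j (ρ ∘ suc) g (distinct-tail D) (root-of-cofactor ρ p g D h e)
  ... | g′ , e′ = g′ , P.trans e (P.trans (P.*-congˡ e′) (P.sym (P.*-assoc (lin (ρ 0)) (lins j (ρ ∘ suc)) g′)))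

  lins-HasDeg : ∀ j ρ → HasDeg (lins j ρ) j
  lins-HasDeg zero ρ = hasDeg (λ z → 1≉0 (trans (sym (!1 0)) z)) Deg<-1
  lins-HasDeg (suc j) ρ = HasDeg-* (lin-HasDeg (ρ 0)) (lins-HasDeg j (ρ ∘ suc))

  eval-lins : ∀ j ρ i → i < j → evalAt (ρ i) (lins j ρ) ≈ 0#
  eval-lins (suc j) ρ zero _ = trans (⟦⟧-* (Ev.evalHom (ρ 0)) (lin (ρ 0)) (lins j (ρ ∘ suc)))
    (0*x≈0 (trans (eval-lin (ρ 0) (ρ 0)) (x-x _)))
  eval-lins (suc j) ρ (suc i) (s≤s lt) = trans (⟦⟧-* (Ev.evalHom (ρ (suc i))) (lin (ρ 0)) (lins j (ρ ∘ suc)))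
    (x*0≈0 (eval-lins j (ρ ∘ suc) i lt))

-- Polynomials over a field and adjunction of a root

module FieldPoly (F : DField) where
  open DField F renaming (ring to L; isDFld to fld)
  open IsDField fld
  open Kit L using (Carrier; _≈_; _+_; _*_; -_; 0#; 1#; refl; sym; trans; +-cong; +-congˡ; +-congʳ; *-congˡ; *-congʳ; -‿cong; +-assoc; +-comm; +-identityʳ; *-assoc; *-identityˡ; *-identityʳ; distribˡ; zeroˡ; zeroʳ; -‿distribˡ-*; -‿distribʳ-*; _^_; _-_; -‿congr; x-x; x-0; x≈y⇒x-y≈0; x+y≈z⇒x≈z-y; distribˡ--; distribʳ--; x*0≈0; 0*x≈0; 0+x≈x; x+0≈x; module +S; module *S; module ≈R)
  open Poly L using (module P; Pol; cf; bound; vanish; mkP; !+; !0; _!_; Deg<; module Deg<; van; HasDeg; module HasDeg; hasDeg; lead≉0; deg<bound; con; con-at; mono; mono-*-shift; mono-*; Deg<-mono; Deg<-1; Vanish)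
  open PolyDom ddom public

  Bez : Pol → Pol → Set
  Bez a b = ∃ λ g → ∃ λ α → ∃ λ β → (g P.≈ α P.* a P.+ β P.* b)
    × (∃ λ a′ → a P.≈ g P.* a′) × (∃ λ b′ → b P.≈ g P.* b′)

  bezout : ∀ N a b → Deg< b N → Bez a b
  bezout-0 : ∀ a b → b P.≈ P.0# → Bez a b
  bezout-0 a b z = a , P.1# , P.0# ,
    P.sym (P.trans (P.+-cong (P.*-identityˡ a) (P.zeroˡ b)) (P.+-identityʳ a)) ,
    (P.1# , P.sym (P.*-identityʳ a)) , (P.0# , P.trans z (P.sym (P.zeroʳ a)))
  bezout zero a b h = bezout-0 a b (mkP λ i → trans (van h i z≤n) (sym (!0 i)))
  bezout (suc N) a b h with deg?-bounded (suc N) b h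
  ... | inj₁ z = bezout-0 a b z
  ... | inj₂ (d , s≤s d≤N , hd) with pdiv b d hd (bound a) a (deg<bound a)
  ... | s , q , r , e , hr with bezout N b r (Deg<-mono d≤N hr)
  ... | g , α , β , ge , (b′ , be) , (r′ , re) =
    g , β P.* us , α P.- β P.* q , ge′ , (w P.* (b′ P.* q P.+ r′) , ae) , (b′ , be)
    where
    open P.≈R
    us = con ((b ! d) ^ s)
    wi = inv ((b ! d) ^ s) (^-≉0 s (lead≉0 hd))
    w = con (proj₁ wi)
    r≈ : r P.≈ us P.* a P.- b P.* q
    r≈ = P.x+y≈z⇒x≈z-y (P.trans (P.+-comm r (b P.* q)) (P.sym e))
    ge′ : g P.≈ β P.* us P.* a P.+ (α P.- β P.* q) P.* b
    ge′ = begin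
      g ≈⟨ ge ⟩
      α P.* b P.+ β P.* r ≈⟨ P.+-congˡ (P.*-congˡ r≈) ⟩
      α P.* b P.+ β P.* (us P.* a P.- b P.* q) ≈⟨ P.+-congˡ (P.distribˡ-- β (us P.* a) (b P.* q)) ⟩
      α P.* b P.+ (β P.* (us P.* a) P.- β P.* (b P.* q)) ≈⟨ P.+S.x∙yz≈y∙xz (α P.* b) (β P.* (us P.* a)) (P.- (β P.* (b P.* q))) ⟩
      β P.* (us P.* a) P.+ (α P.* b P.- β P.* (b P.* q))
        ≈⟨ P.+-cong (P.sym (P.*-assoc β us a)) (P.-‿congr (P.refl) (P.*S.x∙yz≈xz∙y β b q)) ⟩
      β P.* us P.* a P.+ (α P.* b P.- β P.* q P.* b) ≈⟨ P.+-congˡ (P.distribʳ-- b α (β P.* q)) ⟨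
      β P.* us P.* a P.+ (α P.- β P.* q) P.* b ∎
    ae : a P.≈ g P.* (w P.* (b′ P.* q P.+ r′))
    ae = begin
      a ≈⟨ P.*-identityˡ a ⟨
      P.1# P.* a ≈⟨ P.*-congʳ (P.trans (P.sym (⟦⟧-* (conHom L) ((b ! d) ^ s) (proj₁ wi))) (P.trans (⟦⟧-cong (conHom L) (proj₂ wi)) (⟦⟧-1 (conHom L)))) ⟨
      us P.* w P.* a ≈⟨ P.*S.xy∙z≈y∙xz us w a ⟩
      w P.* (us P.* a) ≈⟨ P.*-congˡ e ⟩
      w P.* (b P.* q P.+ r) ≈⟨ P.*-congˡ (P.+-cong (P.*-congʳ be) re) ⟩
      w P.* (g P.* b′ P.* q P.+ g P.* r′) ≈⟨ P.*-congˡ (P.+-congʳ (P.*-assoc g b′ q)) ⟩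
      w P.* (g P.* (b′ P.* q) P.+ g P.* r′) ≈⟨ P.*-congˡ (P.distribˡ g (b′ P.* q) r′) ⟨
      w P.* (g P.* (b′ P.* q P.+ r′)) ≈⟨ P.*S.x∙yz≈y∙xz w g (b′ P.* q P.+ r′) ⟩
      g P.* (w P.* (b′ P.* q P.+ r′)) ∎

  -- Irreducibility as minimality of the degree among the non-constant divisors. This is the form
  -- that a factor of least degree has by its choice, without any algorithm for factorization.
  record Irreducible (π : Pol) : Set where
    field
      deg  : ℕ
      deg>0 : 0 < deg
      πdeg : HasDeg π deg
      minimal : ∀ g h e → π P.≈ g P.* h → HasDeg g e → 0 < e → deg ≤ e

  ¬¬irreducible-factor : ∀ p d → HasDeg p d → 0 < d → ¬ ¬ (∃ λ π → Irreducible π × (∃ λ h → p P.≈ π P.* h))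
  ¬¬irreducible-factor p d hd d>0 k =
    ¬¬-least {P = λ e → ∃ λ g → ∃ λ h → (p P.≈ g P.* h) × HasDeg g e × 0 < e}
      (d , p , P.1# , P.sym (P.*-identityʳ p) , hd , d>0)
      λ { (e , (g , h , eq , he , e>0) , least) → k (g ,
        record { deg = e ; deg>0 = e>0 ; πdeg = he
               ; minimal = λ g′ h′ e′ eq′ he′ e′>0 → ℕₚ.≮⇒≥ λ lt → least e′ lt
                   (g′ , h′ P.* h , P.trans eq (P.trans (P.*-congʳ eq′) (P.*-assoc g′ h′ h)) , he′ , e′>0) }
        , h , eq) }

  module Adjoin (π : Pol) (irr : Irreducible π) where
    open Irreducible irr

    E : Ring
    E = QuotRing (PolyRing L) π

    private module E = Kit E using (Carrier; _≈_; _*_; 0#; 1#; refl; sym; trans)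

    ∣⇒E≈0 : ∀ x u → x P.≈ π P.* u → x E.≈ E.0#
    ∣⇒E≈0 x u e = wrap (u , P.trans (P.x-0 x) e)

    E≈0⇒∣ : ∀ x → x E.≈ E.0# → ∃ λ u → x P.≈ π P.* u
    E≈0⇒∣ x (wrap (u , e)) = u , P.trans (P.sym (P.x-0 x)) e

    quot : Hom (PolyRing L) E
    quot = record
      { ⟦_⟧ = λ x → x
      ; ⟦⟧-cong = λ e → wrap (P.0# , P.trans (P.x≈y⇒x-y≈0 e) (P.sym (P.zeroʳ π)))
      ; ⟦⟧-+ = λ _ _ → E.refl ; ⟦⟧-* = λ _ _ → E.refl ; ⟦⟧-1 = E.refl }

    small-multiple : ∀ r u → Deg< r deg → r P.≈ π P.* u → r P.≈ P.0#
    small-multiple r u hr e with deg? u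
    ... | inj₁ z = P.trans e (P.x*0≈0 z)
    ... | inj₂ (d′ , hd′) = ⊥-elim (ℕₚ.<⇒≱
      (HasDeg-< (HasDeg-resp (P.sym e) (HasDeg-* πdeg hd′)) hr) (ℕₚ.m≤m+n deg d′))

    -- The quotient stays discrete: the remainder modulo π has smaller degree than π, so it is a
    -- multiple of π only if it is zero.
    E≟0 : ∀ x → Dec (x E.≈ E.0#)
    E≟0 x with pdiv π deg πdeg (bound x) x (deg<bound x)
    ... | s , q , r , e , hr with PD.≟0 r
    ...   | yes z = yes (∣⇒E≈0 x (w P.* q) (begin
        x ≈⟨ P.*-identityˡ x ⟨
        P.1# P.* x ≈⟨ P.*-congʳ (P.trans (P.sym (⟦⟧-* (conHom L) us (proj₁ wi))) (P.trans (⟦⟧-cong (conHom L) (proj₂ wi)) (⟦⟧-1 (conHom L)))) ⟨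
        con us P.* w P.* x ≈⟨ P.*S.xy∙z≈y∙xz (con us) w x ⟩
        w P.* (con us P.* x) ≈⟨ P.*-congˡ (P.trans e (P.x+0≈x z)) ⟩
        w P.* (π P.* q) ≈⟨ P.*S.x∙yz≈y∙xz w π q ⟩
        π P.* (w P.* q) ∎))
      where
      open P.≈R
      us = (π ! deg) ^ s
      wi = inv us (^-≉0 s (lead≉0 πdeg))
      w = con (proj₁ wi)
    ...   | no nz = no λ x0 → let (u , xe) = E≈0⇒∣ x x0 in
      nz (small-multiple r (con us P.* u P.- q) hr (begin
        r ≈⟨ P.x+y≈z⇒x≈z-y (P.trans (P.+-comm r (π P.* q)) (P.sym e)) ⟩
        con us P.* x P.- π P.* q ≈⟨ P.+-congʳ (P.*-congˡ xe) ⟩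
        con us P.* (π P.* u) P.- π P.* q ≈⟨ P.+-congʳ (P.*S.x∙yz≈y∙xz (con us) π u) ⟩
        π P.* (con us P.* u) P.- π P.* q ≈⟨ P.distribˡ-- π (con us P.* u) q ⟨
        π P.* (con us P.* u P.- q) ∎))
      where
      open P.≈R
      us = (π ! deg) ^ s

    con-unit : ∀ g → HasDeg g 0 → ∃ λ w → g P.* con w P.≈ P.1#
    con-unit g (hasDeg nz h) = let (w , e) = inv (g ! 0) nz in w ,
      P.trans (P.*-congʳ (mkP λ { zero → sym (con-at _ 0) ; (suc i) → trans (van h (suc i) (s≤s z≤n)) (sym (con-at _ (suc i))) }))
        (P.trans (P.sym (⟦⟧-* (conHom L) (g ! 0) w)) (P.trans (⟦⟧-cong (conHom L) e) (⟦⟧-1 (conHom L))))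

    Einv : ∀ x → ¬ (x E.≈ E.0#) → ∃ λ y → x E.* y E.≈ E.1#
    Einv x nx with bezout (bound π) x π (deg<bound π)
    ... | g , α , β , ge , (x′ , xe) , (π′ , πe) with deg? g
    ...   | inj₁ z = ⊥-elim (HasDeg⇒≉0 πdeg (P.trans πe (P.0*x≈0 z)))
    ...   | inj₂ (zero , hg) = let (w , we) = con-unit g hg in α P.* con w , wrap (P.- (β P.* con w) ,
        (begin
          x P.* (α P.* con w) P.- P.1# ≈⟨ P.-‿congr (P.*S.x∙yz≈yx∙z x α (con w)) (P.sym we) ⟩
          α P.* x P.* con w P.- g P.* con w ≈⟨ P.distribʳ-- (con w) (α P.* x) g ⟨
          (α P.* x P.- g) P.* con w ≈⟨ P.*-congʳ (P.sym (P.x+y≈z⇒x≈z-y (P.trans (P.+-congˡ ge) (P.trans (P.+-comm (P.- (β P.* π)) (α P.* x P.+ β P.* π)) (P.trans (P.+-assoc (α P.* x) (β P.* π) (P.- (β P.* π))) (P.x+0≈x (P.x-x (β P.* π)))))))) ⟩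
          P.- (β P.* π) P.* con w ≈⟨ P.-‿distribˡ-* (β P.* π) (con w) ⟨
          P.- (β P.* π P.* con w) ≈⟨ P.-‿cong (P.*S.xy∙z≈y∙xz β π (con w)) ⟩
          P.- (π P.* (β P.* con w)) ≈⟨ P.-‿distribʳ-* π (β P.* con w) ⟩
          π P.* (P.- (β P.* con w)) ∎))
      where open P.≈R
    -- `g` is a non-constant divisor of π, hence of full degree by minimality. The cofactor is then
    -- a constant, so π divides x, which was excluded.
    ...   | inj₂ (suc e , hg) with deg? π′
    ...     | inj₁ z = ⊥-elim (HasDeg⇒≉0 πdeg (P.trans πe (P.x*0≈0 z)))
    ...     | inj₂ (suc e′ , hπ′) = ⊥-elim (ℕₚ.<⇒≱ (ℕₚ.m<m+n (suc e) {suc e′} (s≤s z≤n))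
        (≡.subst (_≤ suc e) (HasDeg-unique πdeg (HasDeg-resp (P.sym πe) (HasDeg-* hg hπ′)))
          (minimal g π′ (suc e) πe hg (s≤s z≤n))))
    ...     | inj₂ (zero , hπ′) = let (w , we) = con-unit π′ hπ′ in ⊥-elim (nx (∣⇒E≈0 x (con w P.* x′) (begin
        x ≈⟨ xe ⟩
        g P.* x′ ≈⟨ P.*-congʳ (P.*-identityʳ g) ⟨
        g P.* P.1# P.* x′ ≈⟨ P.*-congʳ (P.*-congˡ we) ⟨
        g P.* (π′ P.* con w) P.* x′ ≈⟨ P.*-congʳ (P.*-assoc g π′ (con w)) ⟨
        g P.* π′ P.* con w P.* x′ ≈⟨ P.*-congʳ (P.*-congʳ πe) ⟨
        π P.* con w P.* x′ ≈⟨ P.*-assoc π (con w) x′ ⟩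
        π P.* (con w P.* x′) ∎)))
      where open P.≈R

    E-field : DField
    E-field = record { ring = E ; isDFld = record
      { ≟0 = E≟0
      ; 1≉0 = λ one → let (u , e) = E≈0⇒∣ P.1# one in
          IsDDom.1≉0 polyDDom (small-multiple P.1# u (Deg<-mono deg>0 Deg<-1) e)
      ; inv = Einv } }

    incl : Hom L E
    incl = quot ∘H conHom L

    X̄ : E.Carrier
    X̄ = mono 1 1#

    eval-X̄ : ∀ p → Eval.eval incl X̄ p E.≈ p
    eval-X̄ p = E.trans
      (E.sym (eval-∘ (conHom L) quot (mono 1 1#) p))
      (⟦⟧-cong quot (mkP λ i → go (bound p) (cf p) (vanish p) i))
      where
      go : ∀ N f → Vanish N f → ∀ i → Eval.ev (conHom L) (mono 1 1#) N f ! i ≈ f i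
      go zero f h i = trans (!0 i) (sym (h i z≤n))
      go (suc N) f h i = trans (!+ (con (f 0)) (mono 1 1# P.* e) i) (step i)
        where
        e = Eval.ev (conHom L) (mono 1 1#) N (f ∘ suc)
        step : ∀ i → con (f 0) ! i + (mono 1 1# P.* e) ! i ≈ f i
        step zero = trans (x+0≈x (mono-*-shift 1 1# e 0)) (con-at (f 0) 0)
        step (suc i) = trans (0+x≈x (con-at (f 0) (suc i))) (trans (mono-* 1 1# e i)
          (trans (*-identityˡ _) (go N (f ∘ suc) (λ j le → h (suc j) (s≤s le)) i)))

record Ext (F : DField) : Set₁ where
  constructor ext
  field
    fieldE : DField
    emb    : Hom (DField.ring F) (DField.ring fieldE)

¬¬adjoin-root : (F : DField) → let open Poly (DField.ring F) using (HasDeg; module HasDeg) in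
  ∀ p d → HasDeg p d → 0 < d →
  ¬ ¬ (Σ (Ext F) λ E → let open Ext E in ∃ λ ρ →
    CommutativeRing._≈_ (DField.ring fieldE) (Eval.eval emb ρ p) (CommutativeRing.0# (DField.ring fieldE)))
¬¬adjoin-root F p d hd d>0 k = ¬¬irreducible-factor p d hd d>0 λ { (π , irr , h , e) →
  let open Adjoin π irr in
  k (ext E-field incl , X̄ ,
     Kit.trans E {Eval.eval incl X̄ p} {p} {Kit.0# E} (eval-X̄ p) (∣⇒E≈0 p h e)) }
  where
  open FieldPoly F using (¬¬irreducible-factor; module Adjoin)
  open Poly (DField.ring F) using (HasDeg; module HasDeg)

-- Characteristic p and Frobenius

prime>1 : ∀ {p} → Prime p → 1 < p
prime>1 {p} pr = ℕ.nonTrivial⇒n>1 p {{prime⇒nonTrivial pr}}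

prime>0 : ∀ {p} → Prime p → 0 < p
prime>0 pr = ℕₚ.<-trans (s≤s z≤n) (prime>1 pr)

p∤k! : ∀ {p} → Prime p → ∀ k → k < p → ¬ (p ∣ k ℕ.!)
p∤k! pr zero lt d = ℕₚ.<⇒≱ (prime>1 pr) (∣⇒≤ d)
p∤k! pr (suc k) lt d with euclidsLemma (suc k) (k ℕ.!) pr d
... | inj₁ d′ = ℕₚ.<⇒≱ lt (∣⇒≤ d′)
... | inj₂ d′ = p∤k! pr k (ℕₚ.<-trans (ℕₚ.n<1+n k) lt) d′

p∣p! : ∀ {p} → Prime p → p ∣ p ℕ.!
p∣p! {suc p} pr = m∣m*n (p ℕ.!)
p∣p! {zero} pr = ⊥-elim (ℕₚ.<⇒≱ (prime>1 pr) z≤n)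

p∣pCk : ∀ {p} → Prime p → ∀ k → 0 < k → k < p → p ∣ p C k
p∣pCk {p} pr k k>0 k<p with euclidsLemma (p C k) (k ℕ.! ℕ.* (p ℕ.∸ k) ℕ.!) pr (≡.subst (p ∣_) fac (p∣p! pr))
  where
  fac : p ℕ.! ≡ (p C k) ℕ.* (k ℕ.! ℕ.* (p ℕ.∸ k) ℕ.!)
  fac = ≡.sym (≡.trans (≡.cong (ℕ._* (k ℕ.! ℕ.* (p ℕ.∸ k) ℕ.!)) (nCk≡n!/k![n-k]! (ℕₚ.<⇒≤ k<p)))
    (m/n*n≡m {{k ℕₚ.!* (p ℕ.∸ k) !≢0}} (k![n∸k]!∣n! (ℕₚ.<⇒≤ k<p))))
... | inj₁ d = d
... | inj₂ d with euclidsLemma (k ℕ.!) ((p ℕ.∸ k) ℕ.!) pr d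
...   | inj₁ d′ = ⊥-elim (p∤k! pr k k<p d′)
...   | inj₂ d′ = ⊥-elim (p∤k! pr (p ℕ.∸ k) (ℕₚ.∸-monoʳ-< k>0 (ℕₚ.<⇒≤ k<p)) d′)

record CharP (p : ℕ) (R : Ring) : Set where
  open Kit R using (_≈_; _+_; _*_; 0#; 1#; refl; sym; trans; +-cong; +-congˡ; +-comm; +-identityʳ; *-identityˡ; *-identityʳ; +-commutativeMonoid; commutativeSemiring; _^_; ^-congˡ; ^-assocʳ; ^-distrib-*; ×-congʳ; ×-assocˡ; _×ₙ_; 0*x≈0; 0+x≈x; 1^n≈1; ×ₙ-zero; ×ₙ≈×; module ≈R)
  field
    isPrime : Prime p
    p×1≈0 : p ×ₙ 1# ≈ 0#

  p×x≈0 : ∀ x → p ×ₙ x ≈ 0#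
  p×x≈0 x = trans (×ₙ≈× p x) (0*x≈0 p×1≈0)

  ∣×x≈0 : ∀ {m} → p ∣ m → ∀ x → m ×ₙ x ≈ 0#
  ∣×x≈0 (divides k ≡.refl) x = trans (sym (×-assocˡ x k p)) (×ₙ-zero k (p×x≈0 x))

  frob-p : ∀ x y → (x + y) ^ p ≈ x ^ p + y ^ p
  frob-p x y = go p ≡.refl
    where
    open Algebra.Properties.CommutativeSemiring.Binomial commutativeSemiring using (theorem; binomialTerm)
    open Algebra.Properties.CommutativeMonoid.Sum +-commutativeMonoid using (sum; sum-cong-≋; sum-init-last; sum-replicate-zero)
    open ≈R
    go : ∀ n → n ≡ p → (x + y) ^ n ≈ x ^ n + y ^ n
    go zero e = ⊥-elim (ℕₚ.<⇒≢ (prime>0 isPrime) e)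
    go (suc n) e = begin
      (x + y) ^ suc n ≈⟨ theorem (suc n) x y ⟩
      T Fin.zero + sum (T ∘ Fin.suc) ≈⟨ +-cong first (trans (sum-init-last (T ∘ Fin.suc)) (0+x≈x middle)) ⟩
      y ^ suc n + T (Fin.suc (Fin.fromℕ n)) ≈⟨ +-congˡ last ⟩
      y ^ suc n + x ^ suc n ≈⟨ +-comm _ _ ⟩
      x ^ suc n + y ^ suc n ∎
      where
      T = binomialTerm x y (suc n)
      first : T Fin.zero ≈ y ^ suc n
      first = trans (+-identityʳ _) (*-identityˡ _)
      last : T (Fin.suc (Fin.fromℕ n)) ≈ x ^ suc n
      last rewrite Finₚ.toℕ-fromℕ n | nCn≡1 (suc n) | ℕₚ.n∸n≡0 n = trans (+-identityʳ _) (*-identityʳ _)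
      middle : sum (λ i → T (Fin.suc (Fin.inject₁ i))) ≈ 0#
      middle = trans (sum-cong-≋ (λ i → ∣×x≈0
        (≡.subst (_∣ (suc n C toℕ (Fin.suc (Fin.inject₁ i)))) e
          (p∣pCk (≡.subst Prime (≡.sym e) isPrime) _ (s≤s z≤n)
            (s≤s (≡.subst (_< n) (≡.sym (Finₚ.toℕ-inject₁ i)) (Finₚ.toℕ<n i))))) _))
        (sum-replicate-zero n)

  frob : ∀ h x y → (x + y) ^ (p ℕ.^ h) ≈ x ^ (p ℕ.^ h) + y ^ (p ℕ.^ h)
  frob zero x y = trans (*-identityʳ _) (sym (+-cong (*-identityʳ _) (*-identityʳ _)))
  frob (suc h) x y = begin
    (x + y) ^ (p ℕ.* p ℕ.^ h) ≈⟨ ^-assocʳ (x + y) p (p ℕ.^ h) ⟨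
    ((x + y) ^ p) ^ (p ℕ.^ h) ≈⟨ ^-congˡ (p ℕ.^ h) (frob-p x y) ⟩
    (x ^ p + y ^ p) ^ (p ℕ.^ h) ≈⟨ frob h (x ^ p) (y ^ p) ⟩
    (x ^ p) ^ (p ℕ.^ h) + (y ^ p) ^ (p ℕ.^ h) ≈⟨ +-cong (^-assocʳ x p (p ℕ.^ h)) (^-assocʳ y p (p ℕ.^ h)) ⟩
    x ^ (p ℕ.* p ℕ.^ h) + y ^ (p ℕ.* p ℕ.^ h) ∎
    where open ≈R

  frobHom : ∀ h → Hom R R
  frobHom h = record
    { ⟦_⟧ = _^ (p ℕ.^ h) ; ⟦⟧-cong = ^-congˡ (p ℕ.^ h) ; ⟦⟧-+ = frob h
    ; ⟦⟧-* = λ x y → ^-distrib-* x y (p ℕ.^ h) ; ⟦⟧-1 = 1^n≈1 (p ℕ.^ h) }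

charP-hom : ∀ {p R S} → Hom R S → CharP p R → CharP p S
charP-hom {p} {R} {S} φ c = record
  { isPrime = CharP.isPrime c
  ; p×1≈0 = S.trans (S.×-congʳ p (S.sym (⟦⟧-1 φ))) (S.trans (S.sym (⟦⟧-× φ p _)) (⟦⟧≈0 φ (CharP.p×1≈0 c))) }
  where module S = Kit S using (sym; trans; ×-congʳ)

-- By Bézout n and p generate 1, so n · 1 = 0 would give 1 = 0.
charP-unit : ∀ {p R} → IsDField R → CharP p R → let open Kit R using (_≈_; _+_; _*_; 0#; 1#; refl; sym; trans; ×1-homo-*; _×ₙ_; x*0≈0; x+0≈x; ×ₙ≈×) in ∀ n → ¬ (p ∣ n) → ∀ {x} → n ×ₙ x ≈ 0# → x ≈ 0#
charP-unit {p} {R} fld c n p∤n {x} h with IsDField.nzd fld (trans (sym (×ₙ≈× n x)) h)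
  where open Kit R using (_≈_; _+_; _*_; 0#; 1#; refl; sym; trans; ×1-homo-*; _×ₙ_; x*0≈0; x+0≈x; ×ₙ≈×)
... | inj₂ x0 = x0
... | inj₁ n0 = ⊥-elim (IsDField.1≉0 fld (one coprime))
  where
  open Kit R using (_≈_; _+_; _*_; 0#; 1#; refl; sym; trans; ×1-homo-*; _×ₙ_; x*0≈0; x+0≈x; ×ₙ≈×)
  open CharP c
  coprime : Coprime p n
  coprime {d} (d∣p , d∣n) with prime⇒irreducible isPrime d∣p
  ... | inj₁ d≡1 = d≡1
  ... | inj₂ ≡.refl = ⊥-elim (p∤n d∣n)
  zeroMul : ∀ a m → m ×ₙ 1# ≈ 0# → (a ℕ.* m) ×ₙ 1# ≈ 0#
  zeroMul a m e = trans (×1-homo-* a m) (x*0≈0 e)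
  oneEq : ∀ a b → 1 ℕ.+ a ≡ b → a ×ₙ 1# ≈ 0# → b ×ₙ 1# ≈ 0# → 1# ≈ 0#
  oneEq a .(1 ℕ.+ a) ≡.refl ea eb = trans (sym (x+0≈x ea)) eb
  one : Coprime p n → 1# ≈ 0#
  one cp with coprime-Bézout cp
  ... | Bézout.+- a b e = oneEq (b ℕ.* n) (a ℕ.* p) e (zeroMul b n n0) (zeroMul a p p×1≈0)
  ... | Bézout.-+ a b e = oneEq (a ℕ.* p) (b ℕ.* n) e (zeroMul a p p×1≈0) (zeroMul b n n0)

-- The operator θ = x d/dx, which unlike d/dx preserves the index of a coefficient.

module Theta (R : Ring) where
  open Kit R using (_≈_; _+_; _*_; refl; sym; trans; +-cong; +-congˡ; +-congʳ; +-assoc; zeroˡ; zeroʳ; ×-congʳ; ×-comm-*; _×ₙ_; ×-distrib-+; 0+0≈0; 0+x≈x; ×ₙ-zero; module +S; module ≈R)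
  open Poly R using (module P; Pol; cf; mkPol; bound; vanish; cf-mkPol; mkP; atP; !+; !*; _!_; Deg<; module Deg<; deg<; van; C; tail; _⊛_; ⊛-cong; ⊛-distribʳ)

  θ : C → C
  θ f n = n ×ₙ f n

  θ-⊛ : ∀ f g n → θ (f ⊛ g) n ≈ (θ f ⊛ g) n + (f ⊛ θ g) n
  θ-⊛ f g zero = sym (0+0≈0 (zeroˡ _) (zeroʳ _))
  θ-⊛ f g (suc n) = begin
    suc n ×ₙ (f 0 * g (suc n) + (tail f ⊛ g) n)
      ≈⟨ ×-distrib-+ _ _ (suc n) ⟩
    suc n ×ₙ (f 0 * g (suc n)) + ((tail f ⊛ g) n + n ×ₙ (tail f ⊛ g) n)
      ≈⟨ +-cong (sym (×-comm-* (suc n) (f 0) (g (suc n)))) (+-congˡ (θ-⊛ (tail f) g n)) ⟩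
    A + (B + (D + E)) ≈⟨ +-congˡ (+-assoc B D E) ⟨
    A + ((B + D) + E) ≈⟨ +S.x∙yz≈y∙xz A (B + D) E ⟩
    (B + D) + (A + E) ≈⟨ +-congʳ (trans (sym (⊛-distribʳ g (tail f) (θ (tail f)) n)) (sym (0+x≈x (zeroˡ _)))) ⟩
    (θ f ⊛ g) (suc n) + (f ⊛ θ g) (suc n) ∎
    where
    open ≈R
    A = f 0 * (suc n ×ₙ g (suc n))
    B = (tail f ⊛ g) n
    D = (θ (tail f) ⊛ g) n
    E = (tail f ⊛ θ g) n

  θP : Pol → Pol
  θP p = mkPol (θ (cf p)) (bound p) (λ i le → ×ₙ-zero i (vanish p i le))

  θP-at : ∀ p i → θP p ! i ≈ i ×ₙ (p ! i)
  θP-at p i = cf-mkPol i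

  θP-* : ∀ p q → θP (p P.* q) P.≈ θP p P.* q P.+ p P.* θP q
  θP-* p q = mkP λ i → begin
    θP (p P.* q) ! i ≈⟨ θP-at (p P.* q) i ⟩
    i ×ₙ ((p P.* q) ! i) ≈⟨ ×-congʳ i (!* p q i) ⟩
    θ (cf p ⊛ cf q) i ≈⟨ θ-⊛ (cf p) (cf q) i ⟩
    (θ (cf p) ⊛ cf q) i + (cf p ⊛ θ (cf q)) i
      ≈⟨ +-cong (⊛-cong (λ j → θP-at p j) (λ _ → refl) i) (⊛-cong (λ _ → refl) (λ j → θP-at q j) i) ⟨
    (cf (θP p) ⊛ cf q) i + (cf p ⊛ cf (θP q)) i ≈⟨ +-cong (!* (θP p) q i) (!* p (θP q) i) ⟨
    (θP p P.* q) ! i + (p P.* θP q) ! i ≈⟨ !+ (θP p P.* q) (p P.* θP q) i ⟨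
    (θP p P.* q P.+ p P.* θP q) ! i ∎
    where open ≈R

  θP-cong : ∀ {p q} → p P.≈ q → θP p P.≈ θP q
  θP-cong {p} {q} e = mkP λ i → trans (θP-at p i) (trans (×-congʳ i (atP e i)) (sym (θP-at q i)))

  θP-Deg< : ∀ {p N} → Deg< p N → Deg< (θP p) N
  θP-Deg< {p} h = deg< λ i le → trans (θP-at p i) (×ₙ-zero i (van h i le))

-- Linearized polynomials.

n<q^n : ∀ {q} → 1 < q → ∀ n → n < q ℕ.^ n
n<q^n q>1 zero = s≤s z≤n
n<q^n {q} q>1 (suc n) = ℕₚ.≤-trans
  (ℕₚ.+-mono-≤ (ℕₚ.≤-trans (s≤s z≤n) ih) (ℕₚ.≤-trans ih (ℕₚ.m≤m+n (q ℕ.^ n) 0)))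
  (ℕₚ.*-monoˡ-≤ (q ℕ.^ n) q>1)
  where ih = n<q^n q>1 n

linEval : {R S : Ring} → ℕ → Hom R S → ℕ → (ℕ → CommutativeRing.Carrier R) →
  CommutativeRing.Carrier S → CommutativeRing.Carrier S
linEval {R} {S} q φ r c x = sumN (suc r) (λ i → ⟦ φ ⟧ (c i) * x ^ (q ℕ.^ i))
  where open Kit S using (Carrier; _≈_; _*_; trans; *-congˡ; _^_; sumN; sum-cong)

linEval-∘ : {R S T : Ring} (q : ℕ) (φ : Hom R S) (ψ : Hom S T) (r : ℕ) → ∀ c x →
  CommutativeRing._≈_ T (⟦ ψ ⟧ (linEval q φ r c x)) (linEval q (ψ ∘H φ) r c (⟦ ψ ⟧ x))
linEval-∘ {R} {S} {T} q φ ψ r c x = trans (⟦⟧-sum ψ (suc r) (λ i → ⟦ φ ⟧ (c i) S.* x S.^ (q ℕ.^ i)))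
  (sum-cong (suc r) (λ i _ → trans (⟦⟧-* ψ (⟦ φ ⟧ (c i)) (x S.^ (q ℕ.^ i))) (*-congˡ (⟦⟧-^ ψ x (q ℕ.^ i)))))
  where open Kit T using (Carrier; _≈_; _*_; 0#; trans; *-congˡ; _^_; sum-cong; Distinct)
        module S = Kit S using (_*_; _^_)

record Roots (F : DField) (q r : ℕ) (c : ℕ → CommutativeRing.Carrier (DField.ring F)) (j : ℕ)
             (E : Ext F) : Set where
  constructor roots
  open Ext E
  open Kit (DField.ring fieldE) using (Carrier; _≈_; 0#; _^_; Distinct)
  field
    ρ : ℕ → Carrier
    distinct : Distinct j ρ
    isRoot : ∀ i → i < j → linEval q emb r c (ρ i) ≈ 0#

module LinPol {p : ℕ} (R : Ring) (ch : CharP p R) (h : ℕ) (q>1 : 1 < p ℕ.^ h) (p∣q : p ∣ p ℕ.^ h)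
              (c : ℕ → CommutativeRing.Carrier R) (r : ℕ) where
  open Kit R using (Carrier; _≈_; _+_; _*_; 0#; 1#; refl; sym; trans; +-congˡ; *-cong; *-congˡ; *-congʳ; +-identityʳ; *-identityʳ; _^_; ×-congʳ; _×ₙ_; ×-distrib-+; -‿congr; x-x; x-0; x*0≈0; 0*x≈0; 0+0≈0; ×ₙ-zero; sumN; sum-nil; sum-suc; sum-cong; sum-single; module ≈R)
  open Poly R using (module P; Pol; mkP; atP; _!_; HasDeg; module HasDeg; hasDeg; mono; mono-at; mono-off; mono-vanish; mono-*-shift; mono-*; sumP-!; sumP-Deg<; Deg<-mono)
  open Theta R

  q = p ℕ.^ h

  q^>0 : ∀ i → 0 < q ℕ.^ i
  q^>0 i = ℕₚ.≤-trans (s≤s z≤n) (n<q^n q>1 i)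

  q^-mono : ∀ i → i ≤ r → q ℕ.^ i ≤ q ℕ.^ r
  q^-mono i le = ℕₚ.^-monoʳ-≤ q {{ℕ.>-nonZero (ℕₚ.<-trans (s≤s z≤n) q>1)}} le

  q^-inj : ∀ i j → q ℕ.^ i ≡ q ℕ.^ j → i ≡ j
  q^-inj i j e with ℕₚ.<-cmp i j
  ... | tri< lt _ _ = ⊥-elim (ℕₚ.<⇒≢ (ℕₚ.^-monoʳ-< q q>1 lt) e)
  ... | tri≈ _ eq _ = eq
  ... | tri> _ _ gt = ⊥-elim (ℕₚ.<⇒≢ (ℕₚ.^-monoʳ-< q q>1 gt) (≡.sym e))

  poly : Pol
  poly = P.sumN (suc r) (λ i → mono (q ℕ.^ i) (c i))

  poly-at : ∀ i → i ≤ r → poly ! (q ℕ.^ i) ≈ c i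
  poly-at i le = trans (sumP-! (suc r) (λ j → mono (q ℕ.^ j) (c j)) (q ℕ.^ i))
    (trans (sum-single (suc r) (λ j → mono (q ℕ.^ j) (c j) ! (q ℕ.^ i)) i (s≤s le)
      (λ j _ ne → mono-off (q ℕ.^ j) (c j) (q ℕ.^ i) (λ e → ne (≡.sym (q^-inj i j e)))))
    (mono-at (q ℕ.^ i) (c i)))

  poly-HasDeg : ¬ (c r ≈ 0#) → HasDeg poly (q ℕ.^ r)
  poly-HasDeg nz = hasDeg (λ z → nz (trans (sym (poly-at r ℕₚ.≤-refl)) z))
    (sumP-Deg< (suc r) (λ i → mono (q ℕ.^ i) (c i)) (suc (q ℕ.^ r))
      (λ i lt → Deg<-mono (s≤s (q^-mono i (ℕₚ.≤-pred lt))) (mono-vanish (q ℕ.^ i) (c i))))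

  -- θ multiplies x^(q^i) by q^i, which is zero in characteristic p unless i = 0.
  θ-poly : θP poly P.≈ mono 1 (c 0)
  θ-poly = mkP λ n → trans (θP-at poly n) (trans (×-congʳ n (sumP-! (suc r) (λ i → mono (q ℕ.^ i) (c i)) n))
    (trans (dist n (suc r) (λ i → mono (q ℕ.^ i) (c i) ! n))
      (trans (sum-single (suc r) (λ i → n ×ₙ (mono (q ℕ.^ i) (c i) ! n)) 0 (s≤s z≤n) (λ j _ ne → high n j ne)) (zeroth n))))
    where
    dist : ∀ n k f → n ×ₙ sumN k f ≈ sumN k (λ i → n ×ₙ f i)
    dist n zero f = trans (×ₙ-zero n (sum-nil f)) (sym (sum-nil _))
    dist n (suc k) f = trans (×-congʳ n (sum-suc k f)) (trans (×-distrib-+ _ _ n)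
      (trans (+-congˡ (dist n k (f ∘ suc))) (sym (sum-suc k _))))
    high : ∀ n j → ¬ (j ≡ 0) → n ×ₙ (mono (q ℕ.^ j) (c j) ! n) ≈ 0#
    high n zero ne = ⊥-elim (ne ≡.refl)
    high n (suc j) ne with n ℕ.≟ q ℕ.^ suc j
    ... | yes ≡.refl = CharP.∣×x≈0 ch (∣-trans p∣q (m∣m*n (q ℕ.^ j))) _
    ... | no ne′ = ×ₙ-zero n (mono-off (q ℕ.^ suc j) (c (suc j)) n ne′)
    zeroth : ∀ n → n ×ₙ (mono 1 (c 0) ! n) ≈ mono 1 (c 0) ! n
    zeroth n with n ℕ.≟ 1
    ... | yes ≡.refl = +-identityʳ _
    ... | no ne = trans (×ₙ-zero n (mono-off 1 (c 0) n ne)) (sym (mono-off 1 (c 0) n ne))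

  eval-poly : ∀ {S} (φ : Hom R S) x → CommutativeRing._≈_ S (Eval.eval φ x poly) (linEval q φ r c x)
  eval-poly {S} φ x = S.trans (⟦⟧-sum (Eval.evalHom φ x) (suc r) (λ i → mono (q ℕ.^ i) (c i)))
    (S.sum-cong (suc r) (λ i _ → Eval.eval-mono φ x (q ℕ.^ i) (c i)))
    where module S = Kit S using (trans; sum-cong)

  -- θ of the polynomial is c₀ x and vanishes at a double root ρ, so ρ = 0. But x² does not divide
  -- the polynomial, whose coefficient of x is c₀.
  no-double-root : (dom : IsDDom R) → let open PolyDom dom using (lin; evalAt; eval-lin) in
    ¬ (c 0 ≈ 0#) → ∀ ρ g → ¬ (poly P.≈ lin ρ P.* (lin ρ P.* g))
  no-double-root dom c0 ρ g e = c0 c0≈0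
    where
    open PolyDom dom using (lin; evalAt; eval-lin)
    module Eρ = Eval (idHom R) ρ
    at-lin : evalAt ρ (lin ρ) ≈ 0#
    at-lin = trans (eval-lin ρ ρ) (x-x ρ)
    E = Eρ.evalHom
    vanishing : evalAt ρ (mono 1 (c 0)) ≈ 0#
    vanishing = begin
      evalAt ρ (mono 1 (c 0)) ≈⟨ ⟦⟧-cong E (P.trans (P.sym θ-poly) (P.trans (θP-cong e) (θP-* (lin ρ) (lin ρ P.* g)))) ⟩
      evalAt ρ (θP (lin ρ) P.* (lin ρ P.* g) P.+ lin ρ P.* θP (lin ρ P.* g)) ≈⟨ ⟦⟧-+ E _ _ ⟩
      evalAt ρ (θP (lin ρ) P.* (lin ρ P.* g)) + evalAt ρ (lin ρ P.* θP (lin ρ P.* g))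
        ≈⟨ 0+0≈0 (trans (⟦⟧-* E _ _) (x*0≈0 (trans (⟦⟧-* E _ _) (0*x≈0 at-lin)))) (trans (⟦⟧-* E _ _) (0*x≈0 at-lin)) ⟩
      0# ∎
      where open ≈R
    ρ≈0 : ρ ≈ 0#
    ρ≈0 = IsDDom.cancel dom c0 (trans (*-congˡ (sym (*-identityʳ ρ))) (trans (sym (Eρ.eval-mono 1 (c 0))) vanishing))
    lin≈X : lin ρ P.≈ mono 1 1#
    lin≈X = P.trans (P.-‿congr P.refl (P.trans (⟦⟧-cong (conHom R) ρ≈0) (⟦⟧-0 (conHom R)))) (P.x-0 _)
    c0≈0 : c 0 ≈ 0#
    c0≈0 = begin
      c 0 ≈⟨ poly-at 0 z≤n ⟨
      poly ! 1 ≈⟨ atP (P.trans e (P.*-cong lin≈X (P.*-congʳ lin≈X))) 1 ⟩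
      (mono 1 1# P.* (mono 1 1# P.* g)) ! 1 ≈⟨ mono-* 1 1# (mono 1 1# P.* g) 0 ⟩
      1# * (mono 1 1# P.* g) ! 0 ≈⟨ x*0≈0 (mono-*-shift 1 1# g 0) ⟩
      0# ∎
      where open ≈R

-- Splitting linearized polynomials

module _ {p : ℕ} (F : DField) (ch : CharP p (DField.ring F)) (h : ℕ) (h>0 : 0 < h) where
  private
    L = DField.ring F
    q = p ℕ.^ h
    module L = Kit L using (_≈_; 0#)

    p∣q : p ∣ q
    p∣q = go h h>0
      where
      go : ∀ h → 0 < h → p ∣ p ℕ.^ h
      go (suc h) _ = m∣m*n (p ℕ.^ h)

    q>1 : 1 < q
    q>1 = ℕₚ.<-≤-trans (prime>1 (CharP.isPrime ch)) (∣⇒≤ {{ℕ.>-nonZero q>0}} p∣q)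
      where
      q>0 : 0 < q
      q>0 = ℕₚ.m^n>0 p {{prime⇒nonZero (CharP.isPrime ch)}} h

  -- The roots are adjoined one by one. For j < q^r the cofactor of the linear factors found so far
  -- is not constant, and a root of it is new because there are no double roots.
  ¬¬roots : ∀ r c → ¬ (c 0 L.≈ L.0#) → ¬ (c r L.≈ L.0#) → ∀ j → j ≤ q ℕ.^ r →
    ¬ ¬ (Σ (Ext F) (Roots F q r c j))
  ¬¬roots r c c0 cr zero _ k = k (ext F (idHom L) , roots (λ _ → L.0#) (λ _ _ ()) (λ _ ()))
  ¬¬roots r c c0 cr (suc j) lt k = ¬¬roots r c c0 cr j (ℕₚ.<⇒≤ lt) λ { (ext E emb , roots ρ D z) →
    let module E = Kit (DField.ring E) using (_≈_; 0#; trans; x-y≈0⇒x≈y)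
        module FE = FieldPoly E using (evalAt; lins; factor-roots; lins-HasDeg; eval-lins)
        fE = DField.isDFld E
        c′ = λ i → ⟦ emb ⟧ (c i)
        module LP = LinPol (DField.ring E) (charP-hom emb ch) h q>1 p∣q c′ r using (poly; eval-poly; poly-HasDeg)
        inj = λ {x} → hom-inj (DField.isDFld F) fE emb {x}
        rootE : ∀ i → i < j → FE.evalAt (ρ i) LP.poly E.≈ E.0#
        rootE i lt′ = E.trans (LP.eval-poly (idHom _) (ρ i)) (z i lt′)
        (g , fac) = FE.factor-roots j ρ LP.poly D rootE
        hdeg = LP.poly-HasDeg (λ e → cr (inj e))
        (e , hg) = cofactor-degree E LP.poly (FE.lins j ρ) g (q ℕ.^ r) j fac hdeg (FE.lins-HasDeg j ρ) lt
    in ¬¬adjoin-root E g (suc e) hg (s≤s z≤n) λ { (ext E′ emb′ , σ , gσ) →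
      let module E′ = Kit (DField.ring E′) using (Carrier; _≈_; 0#; refl; sym; trans; x≈y⇒x-y≈0; x*0≈0)
          module FE′ = FieldPoly E′ using (lin; module Ev; evalAt; factor-root)
          module QP = Kit (PolyRing (DField.ring E′)) using (_≈_; _*_; sym; trans; *-cong; *-congˡ; *-assoc; module *S; module ≈R)
          fE′ = DField.isDFld E′
          c″ = λ i → ⟦ emb′ ⟧ (⟦ emb ⟧ (c i))
          module LP′ = LinPol (DField.ring E′) (charP-hom (emb′ ∘H emb) ch) h q>1 p∣q c″ r using (poly; eval-poly; no-double-root)
          A = mapP emb′ (FE.lins j ρ)
          G = mapP emb′ g
          poly′≈ : LP′.poly QP.≈ A QP.* G
          poly′≈ = QP.trans (QP.sym (map-linpoly emb′ h q>1 p∣q (charP-hom emb ch) (charP-hom (emb′ ∘H emb) ch) c′ r))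
            (QP.trans (⟦⟧-cong (mapHom emb′) fac) (⟦⟧-* (mapHom emb′) (FE.lins j ρ) g))
          Gσ : FE′.evalAt σ G E′.≈ E′.0#
          Gσ = E′.trans (eval-map emb′ (idHom _) σ g) (E′.trans (eval-congHom (idHom _ ∘H emb′) emb′ (λ _ → E′.refl) E′.refl g) gσ)
          (g″ , Gfac) = FE′.factor-root G σ Gσ
          new : ∀ i → i < j → ¬ (σ E′.≈ ⟦ emb′ ⟧ (ρ i))
          new i lt′ eq =
            let Aσ : FE′.evalAt σ A E′.≈ E′.0#
                Aσ = E′.trans (eval-map emb′ (idHom _) σ (FE.lins j ρ))
                  (E′.trans (eval-congHom (idHom _ ∘H emb′) (emb′ ∘H idHom _) (λ _ → E′.refl) eq (FE.lins j ρ))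
                    (E′.trans (E′.sym (eval-∘ (idHom _) emb′ (ρ i) (FE.lins j ρ))) (⟦⟧≈0 emb′ (FE.eval-lins j ρ i lt′))))
                (l , Afac) = FE′.factor-root A σ Aσ
                open QP.≈R
            in LP′.no-double-root (IsDField.ddom fE′) (λ e0 → c0 (inj (hom-inj fE fE′ emb′ e0))) σ (l QP.* g″) (begin
              LP′.poly ≈⟨ QP.trans poly′≈ (QP.*-cong Afac Gfac) ⟩
              (FE′.lin σ QP.* l) QP.* (FE′.lin σ QP.* g″) ≈⟨ QP.*-assoc _ _ _ ⟩
              FE′.lin σ QP.* (l QP.* (FE′.lin σ QP.* g″)) ≈⟨ QP.*-congˡ (QP.*S.x∙yz≈y∙xz _ _ _) ⟩
              FE′.lin σ QP.* (FE′.lin σ QP.* (l QP.* g″)) ∎)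
          ρ′ : ℕ → E′.Carrier
          ρ′ = λ { zero → σ ; (suc i) → ⟦ emb′ ⟧ (ρ i) }
      in k (ext E′ (emb′ ∘H emb) , roots ρ′
        (λ { zero zero _ _ _ → ≡.refl
           ; zero (suc b) _ (s≤s b<) eq → ⊥-elim (new b b< eq)
           ; (suc a) zero (s≤s a<) _ eq → ⊥-elim (new a a< (E′.sym eq))
           ; (suc a) (suc b) (s≤s a<) (s≤s b<) eq → ≡.cong suc (D a b a< b<
               (E.x-y≈0⇒x≈y (hom-inj fE fE′ emb′ (E′.trans (⟦⟧-- emb′ _ _) (E′.x≈y⇒x-y≈0 eq))))) })
        (λ { zero _ → E′.trans (E′.sym (LP′.eval-poly (idHom _) σ))
                 (E′.trans (⟦⟧-cong (FE′.Ev.evalHom σ) poly′≈) (E′.trans (⟦⟧-* (FE′.Ev.evalHom σ) A G) (E′.x*0≈0 Gσ)))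
           ; (suc i) (s≤s lt′) → E′.trans (E′.sym (linEval-∘ q emb emb′ r c (ρ i))) (⟦⟧≈0 emb′ (z i lt′)) })) } }
    where
    cofactor-degree : (E : DField) → let open Poly (DField.ring E) using (HasDeg; module P) in ∀ f a g N j → f P.≈ a P.* g →
      HasDeg f N → HasDeg a j → j < N → ∃ λ e → HasDeg g (suc e)
    cofactor-degree E f a g N j e hf ha lt with FieldPoly.deg? E g
    ... | inj₁ g0 = ⊥-elim (HasDeg⇒≉0 hf (trans e (x*0≈0 g0)))
      where open FieldPoly E using (HasDeg⇒≉0)
            open Kit (PolyRing (DField.ring E)) using (trans; x*0≈0)
    ... | inj₂ (zero , hg) = ⊥-elim (ℕₚ.<⇒≢ lt (≡.trans (≡.sym (ℕₚ.+-identityʳ j))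
        (HasDeg-unique (HasDeg-* ha hg) (HasDeg-resp e hf))))
      where open FieldPoly E using (HasDeg-unique; HasDeg-resp; HasDeg-*)
    ... | inj₂ (suc e′ , hg) = e′ , hg
    map-linpoly : {R S : Ring} (φ : Hom R S) (h : ℕ) (q>1 : 1 < p ℕ.^ h) (p∣q : p ∣ p ℕ.^ h)
      (cR : CharP p R) (cS : CharP p S) → ∀ c r →
      CommutativeRing._≈_ (PolyRing S) (mapP φ (LinPol.poly R cR h q>1 p∣q c r))
        (LinPol.poly S cS h q>1 p∣q (λ i → ⟦ φ ⟧ (c i)) r)
    map-linpoly {R} {S} φ h _ _ _ _ c r = SP.trans (⟦⟧-sum (mapHom φ) (suc r) (λ i → Poly.mono R ((p ℕ.^ h) ℕ.^ i) (c i)))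
      (SP.sum-cong (suc r) (λ i _ → map-mono ((p ℕ.^ h) ℕ.^ i) (c i)))
      where
      module SP = Kit (PolyRing S) using (trans; sum-cong)
      module S = Kit S using (_≈_; sym; trans)
      open Poly S using (module P; mkP; _!_; HasDeg; module HasDeg; mono; mono-at; mono-off)
      map-mono : ∀ k a → mapP φ (Poly.mono R k a) P.≈ mono k (⟦ φ ⟧ a)
      map-mono k a = mkP λ i → S.trans (mapP-at φ _ i) (at i)
        where
        at : ∀ i → ⟦ φ ⟧ (Poly._!_ R (Poly.mono R k a) i) S.≈ mono k (⟦ φ ⟧ a) ! i
        at i with i ℕ.≟ k
        ... | yes ≡.refl = S.trans (⟦⟧-cong φ (Poly.mono-at R k a)) (S.sym (mono-at k _))
        ... | no ne = S.trans (⟦⟧≈0 φ (Poly.mono-off R k a i ne)) (S.sym (mono-off k _ i ne))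

search : ∀ {a} {P : ℕ → Set a} → (∀ i → Dec (P i)) → ∀ N → (∃ λ i → i < N × P i) ⊎ (∀ i → i < N → ¬ P i)
search d zero = inj₂ (λ i ())
search {P = P} d (suc N) with d N
... | yes p = inj₁ (N , ℕₚ.≤-refl , p)
... | no np with search d N
...   | inj₁ (i , lt , p) = inj₁ (i , ℕₚ.m≤n⇒m≤1+n lt , p)
...   | inj₂ none = inj₂ λ i lt → below i (ℕₚ.m≤n⇒m<n∨m≡n (ℕₚ.≤-pred lt))
  where
  below : ∀ i → i < N ⊎ i ≡ N → ¬ P i
  below i (inj₁ lt) = none i lt
  below i (inj₂ ≡.refl) = np

roots-mono : ∀ {F q r c j E} → let open Ext E in (E′ : Ext fieldE) →
  Roots F q r c j E → Roots F q r c j (ext (Ext.fieldE E′) (Ext.emb E′ ∘H emb))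
roots-mono {F} {q} {r} {c} {j} {ext E emb} (ext E′ emb′) (roots ρ D z) = roots (⟦ emb′ ⟧ ∘ ρ)
  (λ a b a< b< e → D a b a< b< (E.x-y≈0⇒x≈y
    (hom-inj (DField.isDFld E) (DField.isDFld E′) emb′ (E′.trans (⟦⟧-- emb′ _ _) (E′.x≈y⇒x-y≈0 e)))))
  (λ i lt → E′.trans (E′.sym (linEval-∘ q emb emb′ r c (ρ i))) (⟦⟧≈0 emb′ (z i lt)))
  where
  module E = Kit (DField.ring E) using (x-y≈0⇒x≈y)
  module E′ = Kit (DField.ring E′) using (sym; trans; x≈y⇒x-y≈0)

-- Will be used with one polynomial for each element z of a finite field K, so that all fibres of
-- the curve split in the same extension.
¬¬roots-family : ∀ {p} (F : DField) (ch : CharP p (DField.ring F)) (h : ℕ) → 0 < h → let open Kit (DField.ring F) using (Carrier; _≈_; 0#; refl; _^_) in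
  ∀ r N (c : ℕ → ℕ → Carrier) → (∀ i → i < N → ¬ (c i 0 ≈ 0#)) → (∀ i → i < N → ¬ (c i r ≈ 0#)) →
  ¬ ¬ (Σ (Ext F) λ E → ∀ i → i < N → Roots F (p ℕ.^ h) r (c i) ((p ℕ.^ h) ℕ.^ r) E)
¬¬roots-family F ch h h>0 r zero c c0 cr k = k (ext F (idHom _) , λ i ())
¬¬roots-family {p} F ch h h>0 r (suc N) c c0 cr k =
  ¬¬roots-family F ch h h>0 r N c (λ i lt → c0 i (ℕₚ.m≤n⇒m≤1+n lt)) (λ i lt → cr i (ℕₚ.m≤n⇒m≤1+n lt)) λ { (E , old) →
  let open Ext E
      inj = λ {x} → hom-inj (DField.isDFld F) (DField.isDFld fieldE) emb {x}
  in ¬¬roots fieldE (charP-hom emb ch) h h>0 r (λ i → ⟦ emb ⟧ (c N i))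
    (λ e → c0 N ℕₚ.≤-refl (inj e)) (λ e → cr N ℕₚ.≤-refl (inj e)) _ ℕₚ.≤-refl λ { (E′ , roots ρ D z) →
      k (ext (Ext.fieldE E′) (Ext.emb E′ ∘H emb) , λ i lt →
        pick E E′ old (roots ρ D z) i (ℕₚ.m≤n⇒m<n∨m≡n (ℕₚ.≤-pred lt))) } }
  where
  q = p ℕ.^ h
  pick : (E : Ext F) (E′ : Ext (Ext.fieldE E)) → let E″ = ext (Ext.fieldE E′) (Ext.emb E′ ∘H Ext.emb E) in
    (∀ i → i < N → Roots F q r (c i) (q ℕ.^ r) E) → Roots F q r (c N) (q ℕ.^ r) E″ →
    ∀ i → i < N ⊎ i ≡ N → Roots F q r (c i) (q ℕ.^ r) E″
  pick E E′ old new i (inj₁ lt) = roots-mono E′ (old i lt)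
  pick E E′ old new i (inj₂ ≡.refl) = new

-- Finite fields

record CardField (N : ℕ) (R : Ring) : Set where
  open Kit R using (Carrier; _≈_; _+_; _*_; -_; 0#; 1#; refl; sym; trans; +-congˡ; +-congʳ; *-cong; *-congˡ; *-congʳ; +-assoc; +-identityʳ; *-assoc; *-comm; *-identityˡ; *-identityʳ; +-commutativeMonoid; *-commutativeMonoid; +-cancelˡ; _^_; ^-congˡ; ^-assocʳ; ×1-homo-*; _×ₙ_; _-_; ≡⇒≈; x-x; x-y+y; x*0≈0; x+0≈x; 0^n≈0; Distinct; module ≈R)
  field
    fld  : IsDField R
    card : HasCard R N

  enum = proj₁ card
  enum-inj = proj₁ (proj₂ card)
  index : Carrier → Fin N
  index x = proj₁ (proj₂ (proj₂ card) x)
  enum-index : ∀ x → enum (index x) ≈ x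
  enum-index x = proj₂ (proj₂ (proj₂ card) x)
  index-enum : ∀ i → index (enum i) ≡ i
  index-enum i = enum-inj _ _ (enum-index (enum i))

  index-cong : ∀ {x y} → x ≈ y → index x ≡ index y
  index-cong {x} {y} e = enum-inj _ _ (trans (enum-index x) (trans e (sym (enum-index y))))

  perm : (f g : Carrier → Carrier) → (∀ {x y} → x ≈ y → f x ≈ f y) → (∀ {x y} → x ≈ y → g x ≈ g y) →
    (∀ x → f (g x) ≈ x) → (∀ x → g (f x) ≈ x) → Perm.Permutation N N
  perm f g fc gc fg gf = mk↔ₛ′ (λ i → index (f (enum i))) (λ i → index (g (enum i)))
    (λ i → ≡.trans (index-cong (trans (fc (enum-index _)) (fg (enum i)))) (index-enum i))
    (λ i → ≡.trans (index-cong (trans (gc (enum-index _)) (gf (enum i)))) (index-enum i))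

  elem : ℕ → Carrier
  elem i with i ℕ.<? N
  ... | yes lt = enum (fromℕ< lt)
  ... | no _ = 0#

  elem-distinct : Distinct N elem
  elem-distinct a b a< b< e with a ℕ.<? N | b ℕ.<? N
  ... | yes p | yes q = ≡.trans (≡.sym (Finₚ.toℕ-fromℕ< p)) (≡.trans (≡.cong toℕ (enum-inj _ _ e)) (Finₚ.toℕ-fromℕ< q))
  ... | no np | _ = ⊥-elim (np a<)
  ... | yes _ | no nq = ⊥-elim (nq b<)

  elem-surj : ∀ x → ∃ λ i → i < N × elem i ≈ x
  elem-surj x = toℕ (index x) , Finₚ.toℕ<n (index x) , lem
    where
    lem : elem (toℕ (index x)) ≈ x
    lem with toℕ (index x) ℕ.<? N
    ... | yes lt = trans (≡⇒≈ (≡.cong enum (Finₚ.fromℕ<-toℕ (index x) lt))) (enum-index x)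
    ... | no nlt = ⊥-elim (nlt (Finₚ.toℕ<n (index x)))

  -- Translation by 1 permutes the elements, so their sum S satisfies S = S + N · 1.
  N×1≈0 : N ×ₙ 1# ≈ 0#
  N×1≈0 = +-cancelˡ (sum enum) _ _ (begin
    sum enum + N ×ₙ 1# ≈⟨ +-congˡ (sum-replicate N) ⟨
    sum enum + sum {N} (λ _ → 1#) ≈⟨ ∑-distrib-+ enum (λ _ → 1#) ⟨
    sum (λ i → enum i + 1#) ≈⟨ sum-cong-≋ (λ i → enum-index (enum i + 1#)) ⟨
    sum (λ i → enum (index (enum i + 1#))) ≈⟨ sum-permute enum translate ⟨
    sum enum ≈⟨ +-identityʳ _ ⟨
    sum enum + 0# ∎)
    where
    open Algebra.Properties.CommutativeMonoid.Sum +-commutativeMonoid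
      using (sum; sum-permute; ∑-distrib-+; sum-replicate; sum-cong-≋)
    open ≈R
    translate = perm (_+ 1#) (_+ - 1#) +-congʳ +-congʳ
      (λ x → x-y+y x 1#) (λ x → trans (+-assoc _ _ _) (x+0≈x (x-x 1#)))

  private
    module M = Algebra.Properties.CommutativeMonoid.Sum *-commutativeMonoid
      using (sum; sum-cong-≋; sum-permute; sum-remove; sum-replicate; ∑-distrib-+)
    open IsDField fld

    -- Replaces 0 by 1, so that the product over the whole enumeration is the product of the units.
    -- Multiplication by x permutes the enumeration and contributes x at every index but that of 0.
    unitPart : Carrier → Carrier
    unitPart y with ≟0 y
    ... | yes _ = 1#
    ... | no _ = y

    unitPart≉0 : ∀ y → ¬ (unitPart y ≈ 0#)
    unitPart≉0 y with ≟0 y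
    ... | yes _ = 1≉0
    ... | no n = n

    unitPart-cong : ∀ {x y} → x ≈ y → unitPart x ≈ unitPart y
    unitPart-cong {x} {y} e with ≟0 x | ≟0 y
    ... | yes _ | yes _ = refl
    ... | yes p | no n = ⊥-elim (n (trans (sym e) p))
    ... | no n | yes p = ⊥-elim (n (trans e p))
    ... | no _ | no _ = e

    factor : Carrier → Carrier → Carrier
    factor x y with ≟0 y
    ... | yes _ = 1#
    ... | no _ = x

    unitPart-* : ∀ x y → ¬ (x ≈ 0#) → unitPart (x * y) ≈ factor x y * unitPart y
    unitPart-* x y nx with ≟0 y | ≟0 (x * y)
    ... | yes _ | yes _ = sym (*-identityˡ _)
    ... | yes p | no n = ⊥-elim (n (x*0≈0 p))
    ... | no n | yes p = ⊥-elim (n (cancel nx p))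
    ... | no _ | no _ = refl

    factor-0 : ∀ x y → y ≈ 0# → factor x y ≈ 1#
    factor-0 x y e with ≟0 y
    ... | yes _ = refl
    ... | no n = ⊥-elim (n e)

    factor-≉0 : ∀ x y → ¬ (y ≈ 0#) → factor x y ≈ x
    factor-≉0 x y n with ≟0 y
    ... | yes p = ⊥-elim (n p)
    ... | no _ = refl

  prod≉0 : ∀ {n} (f : Fin n → Carrier) → (∀ i → ¬ (f i ≈ 0#)) → ¬ (M.sum f ≈ 0#)
  prod≉0 {zero} f h = 1≉0
  prod≉0 {suc n} f h = nzd-¬ (h Fin.zero) (prod≉0 (f ∘ Fin.suc) (h ∘ Fin.suc))

  private
    fermat-unit : ∀ x → ¬ (x ≈ 0#) → ∀ N′ → N ≡ suc N′ → x ^ N′ ≈ 1#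
    fermat-unit x nx N′ ≡.refl = cancel-≈ (prod≉0 _ (λ i → unitPart≉0 (enum i))) (begin
      Π * x ^ N′ ≈⟨ *-comm _ _ ⟩
      x ^ N′ * Π ≈⟨ *-congʳ (sym powers) ⟩
      M.sum (λ i → factor x (enum i)) * Π ≈⟨ M.∑-distrib-+ (λ i → factor x (enum i)) (unitPart ∘ enum) ⟨
      M.sum (λ i → factor x (enum i) * unitPart (enum i)) ≈⟨ M.sum-cong-≋ (λ i → unitPart-* x (enum i) nx) ⟨
      M.sum (λ i → unitPart (x * enum i)) ≈⟨ M.sum-cong-≋ (λ i → unitPart-cong (enum-index (x * enum i))) ⟨
      M.sum (λ i → unitPart (enum (index (x * enum i)))) ≈⟨ M.sum-permute (unitPart ∘ enum) scaling ⟨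
      Π ≈⟨ *-identityʳ _ ⟨
      Π * 1# ∎)
      where
      open ≈R
      Π = M.sum (unitPart ∘ enum)
      x⁻¹ = proj₁ (inv x nx)
      xx⁻¹ = proj₂ (inv x nx)
      scaling = perm (x *_) (x⁻¹ *_) *-congˡ *-congˡ
        (λ y → trans (sym (*-assoc _ _ _)) (trans (*-congʳ xx⁻¹) (*-identityˡ y)))
        (λ y → trans (sym (*-assoc _ _ _)) (trans (*-congʳ (trans (*-comm _ _) xx⁻¹)) (*-identityˡ y)))
      i₀ = index 0#
      powers : M.sum (λ i → factor x (enum i)) ≈ x ^ N′
      powers = begin
        M.sum (λ i → factor x (enum i)) ≈⟨ M.sum-remove {i = i₀} (λ i → factor x (enum i)) ⟩
        factor x (enum i₀) * M.sum (λ i → factor x (enum (Fin.punchIn i₀ i)))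
          ≈⟨ *-cong (factor-0 x _ (enum-index 0#)) (M.sum-cong-≋ (λ i → factor-≉0 x _
               (λ e → Finₚ.punchInᵢ≢i i₀ i (enum-inj _ _ (trans e (sym (enum-index 0#))))))) ⟩
        1# * M.sum {N′} (λ _ → x) ≈⟨ *-identityˡ _ ⟩
        M.sum {N′} (λ _ → x) ≈⟨ M.sum-replicate N′ ⟩
        x ^ N′ ∎

  N>0 : 0 < N
  N>0 = ℕₚ.≤-<-trans z≤n (Finₚ.toℕ<n (index 0#))

  fermat : ∀ x → x ^ N ≈ x
  fermat x with ≟0 x
  ... | yes e = trans (0^n≈0 N N>0 e) (sym e)
  ... | no nx = go N ≡.refl N>0
    where
    go : ∀ M → N ≡ M → 0 < M → x ^ M ≈ x
    go (suc N′) e _ = trans (*-congˡ (fermat-unit x nx N′ e)) (*-identityʳ x)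

  fermat-^ : ∀ m x → x ^ (N ℕ.^ m) ≈ x
  fermat-^ zero x = *-identityʳ x
  fermat-^ (suc m) x = trans (sym (^-assocʳ x N (N ℕ.^ m))) (trans (^-congˡ (N ℕ.^ m) (fermat x)) (fermat-^ m x))

  charP : ∀ {p} h → Prime p → N ≡ p ℕ.^ h → CharP p R
  charP {p} h pr ≡.refl = record { isPrime = pr ; p×1≈0 = ^≈0 h (trans (sym (homo h)) N×1≈0) }
    where
    homo : ∀ h → (p ℕ.^ h) ×ₙ 1# ≈ (p ×ₙ 1#) ^ h
    homo zero = +-identityʳ 1#
    homo (suc h) = trans (×1-homo-* p (p ℕ.^ h)) (*-congˡ (homo h))

cardField : ∀ {N} (K : FiniteField N) → CardField N (FiniteField.ring K)
cardField {N} K = record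
  { fld = record
    { ≟0 = dec
    ; 1≉0 = proj₁ (FiniteField.isField K)
    ; inv = proj₂ (FiniteField.isField K) }
  ; card = FiniteField.card K }
  where
  open Kit (FiniteField.ring K) using (Carrier; _≈_; -_; 0#; 1#; sym; trans; _-_; ≡⇒≈)
  enum = proj₁ (FiniteField.card K)
  surj = proj₂ (proj₂ (FiniteField.card K))
  dec : ∀ x → Dec (x ≈ 0#)
  dec x with proj₁ (surj x) Fin.≟ proj₁ (surj 0#)
  ... | yes e = yes (trans (sym (proj₂ (surj x))) (trans (≡⇒≈ (≡.cong enum e)) (proj₂ (surj 0#))))
  ... | no ne = no λ e → ne (proj₁ (proj₂ (FiniteField.card K)) _ _
    (trans (proj₂ (surj x)) (trans e (sym (proj₂ (surj 0#))))))

-- The polynomial x^Q - x in linearized form, with base Q.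
artin : (R : Ring) → ℕ → CommutativeRing.Carrier R
artin R zero = - 1# where open Kit R using (Carrier; _≈_; _+_; _*_; -_; 0#; 1#; refl; sym; trans; +-cong; +-congˡ; +-congʳ; *-cong; *-congˡ; *-congʳ; -‿cong; +-assoc; +-comm; +-identityʳ; *-assoc; *-comm; *-identityˡ; *-identityʳ; +-commutativeMonoid; *-commutativeMonoid; -‿distribˡ-*; -‿involutive; -0#≈0#; +-cancelˡ; _^_; ^-congˡ; ^-congʳ; ^-assocʳ; ^-distrib-*; ×1-homo-*; _×ₙ_; _-_; ≡⇒≈; -‿congr; x-x; x-0; x-y≈0⇒x≈y; x≈y⇒x-y≈0; x-y+y; x*0≈0; x+0≈x; 1^n≈1; 0^n≈0; sum-nil; sum-suc; Distinct; module ≈R)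
artin R (suc i) = 1# where open Kit R using (Carrier; _≈_; _+_; _*_; -_; 0#; 1#; refl; sym; trans; +-cong; +-congˡ; +-congʳ; *-cong; *-congˡ; *-congʳ; -‿cong; +-assoc; +-comm; +-identityʳ; *-assoc; *-comm; *-identityˡ; *-identityʳ; +-commutativeMonoid; *-commutativeMonoid; -‿distribˡ-*; -‿involutive; -0#≈0#; +-cancelˡ; _^_; ^-congˡ; ^-congʳ; ^-assocʳ; ^-distrib-*; ×1-homo-*; _×ₙ_; _-_; ≡⇒≈; -‿congr; x-x; x-0; x-y≈0⇒x≈y; x≈y⇒x-y≈0; x-y+y; x*0≈0; x+0≈x; 1^n≈1; 0^n≈0; sum-nil; sum-suc; Distinct; module ≈R)

artin-eval : {R S : Ring} (φ : Hom R S) (Q : ℕ) → let open Kit S using (_≈_; _+_; _*_; -_; 0#; 1#; sym; trans; +-cong; +-congˡ; *-cong; -‿cong; +-comm; +-identityʳ; *-identityˡ; *-identityʳ; -‿distribˡ-*; _^_; ^-congʳ; _-_; sum-nil; sum-suc; module ≈R) in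
  ∀ x → linEval Q φ 1 (artin R) x ≈ x ^ Q - x
artin-eval {R} {S} φ Q x = begin
  linEval Q φ 1 (artin R) x
    ≈⟨ trans (sum-suc 1 _) (+-congˡ (trans (sum-suc 0 _) (+-congˡ (sum-nil _)))) ⟩
  ⟦ φ ⟧ (R.- R.1#) * x ^ 1 + (⟦ φ ⟧ R.1# * x ^ (Q ℕ.* 1) + 0#)
    ≈⟨ +-cong (*-cong (trans (⟦⟧-neg φ _) (-‿cong (⟦⟧-1 φ))) (*-identityʳ x))
         (trans (+-identityʳ _) (*-cong (⟦⟧-1 φ) (^-congʳ x (ℕₚ.*-identityʳ Q)))) ⟩
  (- 1#) * x + 1# * x ^ Q ≈⟨ +-cong (trans (sym (-‿distribˡ-* 1# x)) (-‿cong (*-identityˡ x))) (*-identityˡ _) ⟩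
  - x + x ^ Q ≈⟨ +-comm _ _ ⟩
  x ^ Q - x ∎
  where
  open Kit S using (_≈_; _+_; _*_; -_; 0#; 1#; sym; trans; +-cong; +-congˡ; *-cong; -‿cong; +-comm; +-identityʳ; *-identityˡ; *-identityʳ; -‿distribˡ-*; _^_; ^-congʳ; _-_; sum-nil; sum-suc; module ≈R)
  module R = Kit R using (-_; 1#; _-_)
  open ≈R

module _ {p : ℕ} (F : DField) (ch : CharP p (DField.ring F)) where
  private
    L = DField.ring F
    module L = Kit L using (1#; sym; trans; -‿cong; -‿involutive; -0#≈0#)
    fL = DField.isDFld F

  -- x^Q - x is linearized of linearized degree 1 to the base Q = p^h. Its Q roots are a copy of
  -- F_Q; all finite fields that occur are produced in this way.
  ¬¬fixed-points : ∀ h → 0 < h → ¬ ¬ (Σ (Ext F) λ E → let open Kit (DField.ring (Ext.fieldE E)) using (_≈_; 1#; sym; trans; -‿cong; *-identityʳ; -‿involutive; -0#≈0#; _^_; x-y≈0⇒x≈y; Distinct) in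
    ∃ λ ρ → Distinct (p ℕ.^ h) ρ × (∀ i → i < p ℕ.^ h → ρ i ^ (p ℕ.^ h) ≈ ρ i))
  ¬¬fixed-points h h>0 k = ¬¬roots F ch h h>0 1 (artin L)
    (λ e → IsDField.1≉0 fL (L.trans (L.sym (L.-‿involutive L.1#)) (L.trans (L.-‿cong e) L.-0#≈0#)))
    (IsDField.1≉0 fL) (p ℕ.^ h) (ℕₚ.≤-reflexive (≡.sym (ℕₚ.*-identityʳ (p ℕ.^ h))))
    λ { (E , roots ρ D z) → let open Kit (DField.ring (Ext.fieldE E)) using (_≈_; 1#; sym; trans; -‿cong; *-identityʳ; -‿involutive; -0#≈0#; _^_; x-y≈0⇒x≈y; Distinct) in
      k (E , ρ , D , λ i lt → x-y≈0⇒x≈y (trans (sym (artin-eval (Ext.emb E) (p ℕ.^ h) (ρ i))) (z i lt))) }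

fixed-bound : (E : DField) → let open Kit (DField.ring E) using (_≈_; -_; 0#; 1#; sym; trans; *-identityˡ; *-identityʳ; _^_; _-_; -‿congr; x-0; x≈y⇒x-y≈0; Distinct) in ∀ Q → 1 < Q → ∀ j ρ → Distinct j ρ →
  (∀ i → i < j → ρ i ^ Q ≈ ρ i) → j ≤ Q
fixed-bound E Q Q>1 j ρ D fix = ℕₚ.≮⇒≥ λ lt → HasDeg⇒≉0 hd (root-bound (suc Q) j ρ f (below hd) lt D (λ i i< → ev (ρ i) (fix i i<)))
  where
  open Kit (DField.ring E) using (Carrier; _≈_; -_; 0#; 1#; sym; trans; *-identityˡ; *-identityʳ; _^_; _-_; -‿congr; x-0; x≈y⇒x-y≈0; Distinct)
  open FieldPoly E using (HasDeg⇒≉0; module Ev; evalAt; root-bound)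
  open Poly (DField.ring E) using (module P; Pol; !-; HasDeg; module HasDeg; hasDeg; below; mono; mono-at; mono-off; mono-vanish; Deg<-mono; +-Deg<; neg-Deg<)
  f : Pol
  f = mono Q 1# P.- mono 1 1#
  hd : HasDeg f Q
  hd = hasDeg
    (λ e → IsDField.1≉0 (DField.isDFld E) (trans (sym (trans (!- (mono Q 1#) (mono 1 1#) Q)
      (trans (-‿congr (mono-at Q 1#) (mono-off 1 1# Q (λ e → ℕₚ.<⇒≢ Q>1 (≡.sym e)))) (x-0 1#)))) e))
    (+-Deg< (mono-vanish Q 1#) (neg-Deg< (Deg<-mono (s≤s (ℕₚ.<⇒≤ Q>1)) (mono-vanish 1 1#))))
  ev : ∀ a → a ^ Q ≈ a → evalAt a f ≈ 0#
  ev a aQ = trans (⟦⟧-- (Ev.evalHom a) (mono Q 1#) (mono 1 1#)) (x≈y⇒x-y≈0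
    (trans (Ev.eval-mono a Q 1#) (trans (*-identityˡ _) (trans aQ
      (sym (trans (Ev.eval-mono a 1 1#) (trans (*-identityˡ _) (*-identityʳ a))))))))

module Fixed {p : ℕ} (E : DField) (ch : CharP p (DField.ring E)) (h : ℕ) (h>0 : 0 < h)
             (ρ : ℕ → CommutativeRing.Carrier (DField.ring E)) where
  private
    fE = DField.isDFld E
    Q = p ℕ.^ h
  open Kit (DField.ring E) using (Carrier; _≈_; refl; sym; trans; +-cong; *-cong; *-congʳ; -‿cong; _^_; ^-congˡ; ^-distrib-*; ≡⇒≈; 1^n≈1; Distinct)
  open IsDField fE

  module _ (D : Distinct Q ρ) (fix : ∀ i → i < Q → ρ i ^ Q ≈ ρ i) where

    Q>1 : 1 < Q
    Q>1 = go h h>0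
      where
      go : ∀ h → 0 < h → 1 < p ℕ.^ h
      go (suc h) _ = ℕₚ.≤-trans (s≤s (s≤s z≤n)) (ℕₚ.≤-trans (prime>1 (CharP.isPrime ch))
        (ℕₚ.m≤m*n p (p ℕ.^ h) {{ℕ.>-nonZero (ℕₚ.m^n>0 p {{prime⇒nonZero (CharP.isPrime ch)}} h)}}))

    -- A fixed point outside the list would be a further root of x^Q - x, beyond its degree.
    fixed-is-root : ∀ x → x ^ Q ≈ x → ∃ λ i → i < Q × ρ i ≈ x
    fixed-is-root x xQ with search (λ i → ρ i ≟ x) Q
    ... | inj₁ r = r
    ... | inj₂ none = ⊥-elim (ℕₚ.<-irrefl ≡.refl (fixed-bound E Q Q>1 (suc Q) ρ′ D′ fix′))
      where
      ρ′ : ℕ → Carrier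
      ρ′ zero = x
      ρ′ (suc i) = ρ i
      D′ : Distinct (suc Q) ρ′
      D′ zero zero _ _ _ = ≡.refl
      D′ zero (suc b) _ (s≤s lt) e = ⊥-elim (none b lt (sym e))
      D′ (suc a) zero (s≤s lt) _ e = ⊥-elim (none a lt e)
      D′ (suc a) (suc b) (s≤s la) (s≤s lb) e = ≡.cong suc (D a b la lb e)
      fix′ : ∀ i → i < suc Q → ρ′ i ^ Q ≈ ρ′ i
      fix′ zero _ = xQ
      fix′ (suc i) (s≤s lt) = fix i lt

    fixedRing : Ring
    fixedRing = SubRing (DField.ring E) (λ x → x ^ Q ≈ x)
      (λ {x} {y} px py → trans (CharP.frob ch h x y) (+-cong px py))
      (λ {x} {y} px py → trans (^-distrib-* x y Q) (*-cong px py))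
      (λ {x} px → trans (⟦⟧-neg (CharP.frobHom ch h) x) (-‿cong px))
      (⟦⟧-0 (CharP.frobHom ch h)) (1^n≈1 Q)

    fixedField : FiniteField Q
    fixedField = record
      { ring = fixedRing
      ; isField = (λ e → 1≉0 (unwrap e)) , λ (x , px) nx →
          let (y , e) = inv x (λ e → nx (wrap e)) in
          (y , cancel-≈ (λ e → nx (wrap e)) (trans (*-congʳ (sym px))
             (trans (sym (^-distrib-* x y Q)) (trans (^-congˡ Q e) (trans (1^n≈1 Q) (sym e)))))) , wrap e
      ; card = (λ i → ρ (toℕ i) , fix (toℕ i) (Finₚ.toℕ<n i))
             , (λ i j e → Finₚ.toℕ-injective (D _ _ (Finₚ.toℕ<n i) (Finₚ.toℕ<n j) (unwrap e)))
             , λ (x , px) → let (i , lt , e) = fixed-is-root x px in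
                 fromℕ< lt , wrap (trans (≡⇒≈ (≡.cong ρ (Finₚ.toℕ-fromℕ< lt))) e) }

    corestrict : ∀ {R} (φ : Hom R (DField.ring E)) → (∀ x → ⟦ φ ⟧ x ^ Q ≈ ⟦ φ ⟧ x) → Hom R fixedRing
    corestrict φ fx = record
      { ⟦_⟧ = λ x → ⟦ φ ⟧ x , fx x ; ⟦⟧-cong = λ e → wrap (⟦⟧-cong φ e)
      ; ⟦⟧-+ = λ x y → wrap (⟦⟧-+ φ x y) ; ⟦⟧-* = λ x y → wrap (⟦⟧-* φ x y) ; ⟦⟧-1 = wrap (⟦⟧-1 φ) }

-- Solving homogeneous linear systems.

-- `Fin.punchIn` on natural numbers: the increasing enumeration that leaves out k. `insert` is the
-- corresponding operation on families.
skip : ℕ → ℕ → ℕ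
skip zero i = suc i
skip (suc k) zero = zero
skip (suc k) (suc i) = suc (skip k i)

skip≢ : ∀ k i → ¬ (skip k i ≡ k)
skip≢ (suc k) (suc i) e = skip≢ k i (ℕₚ.suc-injective e)

skip-inj : ∀ k i j → skip k i ≡ skip k j → i ≡ j
skip-inj zero i j e = ℕₚ.suc-injective e
skip-inj (suc k) zero zero e = ≡.refl
skip-inj (suc k) (suc i) (suc j) e = ≡.cong suc (skip-inj k i j (ℕₚ.suc-injective e))

skip-< : ∀ k i N → i < N → skip k i < suc N
skip-< zero i N lt = s≤s lt
skip-< (suc k) zero N lt = s≤s z≤n
skip-< (suc k) (suc i) (suc N) (s≤s lt) = s≤s (skip-< k i N lt)

insert : {A : Set} → ℕ → A → (ℕ → A) → ℕ → A
insert zero a c zero = a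
insert zero a c (suc i) = c i
insert (suc k) a c zero = c 0
insert (suc k) a c (suc i) = insert k a (c ∘ suc) i

insert-at : {A : Set} (k : ℕ) (a : A) (c : ℕ → A) → insert k a c k ≡ a
insert-at zero a c = ≡.refl
insert-at (suc k) a c = insert-at k a (c ∘ suc)

insert-skip : {A : Set} (k : ℕ) (a : A) (c : ℕ → A) → ∀ i → insert k a c (skip k i) ≡ c i
insert-skip zero a c i = ≡.refl
insert-skip (suc k) a c zero = ≡.refl
insert-skip (suc k) a c (suc i) = insert-skip k a (c ∘ suc) i

sum-skip : (R : Ring) → let open Kit R using (Carrier; _≈_; _+_; sym; trans; +-congˡ; sumN; sum-suc; module +S) in ∀ N k (f : ℕ → Carrier) → k ≤ N → sumN (suc N) f ≈ f k + sumN N (f ∘ skip k)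
sum-skip R N zero f le = Kit.sum-suc R N f
sum-skip R (suc N) (suc k) f (s≤s le) =
  trans (sum-suc (suc N) f) (trans (+-congˡ (sum-skip R N k (f ∘ suc) le))
    (trans (+S.x∙yz≈y∙xz _ _ _) (+-congˡ (sym (sum-suc N _)))))
  where open Kit R using (Carrier; _≈_; _+_; _*_; -_; 0#; 1#; refl; sym; trans; +-cong; +-congˡ; +-congʳ; *-congˡ; *-congʳ; -‿cong; +-comm; *-assoc; *-comm; *-identityʳ; -‿distribˡ-*; _-_; ≡⇒≈; x≈y⇒x-y≈0; distribˡ--; x*0≈0; sumN; sum-suc; sum-cong; sum-zero; sum-+; sum-*ʳ; sum-neg; module +S; module ≈R)

-- Gaussian elimination on the last column. If it is not zero, a multiple of a pivot row i₀ is
-- subtracted from every other row to clear it; the coefficient of the pivot row is determined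
-- afterwards by the other coefficients.
dependency : {k : Ring} → IsDField k → let open Kit k using (Carrier; _≈_; _+_; _*_; -_; 0#; 1#; refl; sym; trans; +-cong; +-congˡ; +-congʳ; *-congˡ; *-congʳ; -‿cong; +-comm; *-assoc; *-comm; *-identityʳ; -‿distribˡ-*; _-_; ≡⇒≈; x≈y⇒x-y≈0; distribˡ--; x*0≈0; sumN; sum-cong; sum-zero; sum-+; sum-*ʳ; sum-neg; module ≈R) in ∀ D N → D < N → (r : ℕ → ℕ → Carrier) →
  ∃ λ (c : ℕ → Carrier) → (∃ λ i → i < N × ¬ (c i ≈ 0#)) × (∀ j → j < D → sumN N (λ i → c i * r i j) ≈ 0#)
dependency {k} fld zero (suc N) _ r = (λ _ → 1#) , (0 , s≤s z≤n , IsDField.1≉0 fld) , λ j ()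
  where open Kit k using (Carrier; _≈_; _+_; _*_; -_; 0#; 1#; refl; sym; trans; +-cong; +-congˡ; +-congʳ; *-congˡ; *-congʳ; -‿cong; +-comm; *-assoc; *-comm; *-identityʳ; -‿distribˡ-*; _-_; ≡⇒≈; x≈y⇒x-y≈0; distribˡ--; x*0≈0; sumN; sum-cong; sum-zero; sum-+; sum-*ʳ; sum-neg; module ≈R)
dependency {k} fld (suc D) (suc N) (s≤s lt) r with search (λ i → ≉0? (r i D)) (suc N)
  where
  open Kit k using (Carrier; _≈_; _+_; _*_; -_; 0#; 1#; refl; sym; trans; +-cong; +-congˡ; +-congʳ; *-congˡ; *-congʳ; -‿cong; +-comm; *-assoc; *-comm; *-identityʳ; -‿distribˡ-*; _-_; ≡⇒≈; x≈y⇒x-y≈0; distribˡ--; x*0≈0; sumN; sum-cong; sum-zero; sum-+; sum-*ʳ; sum-neg; module ≈R)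
  ≉0? : ∀ x → Dec (¬ (x ≈ 0#))
  ≉0? x with IsDField.≟0 fld x
  ... | yes e = no (λ ne → ne e)
  ... | no ne = yes ne
... | inj₂ none = extend (dependency fld D (suc N) (ℕₚ.m≤n⇒m≤1+n lt) r)
  where
  open Kit k using (Carrier; _≈_; _+_; _*_; -_; 0#; 1#; refl; sym; trans; +-cong; +-congˡ; +-congʳ; *-congˡ; *-congʳ; -‿cong; +-comm; *-assoc; *-comm; *-identityʳ; -‿distribˡ-*; _-_; ≡⇒≈; x≈y⇒x-y≈0; distribˡ--; x*0≈0; sumN; sum-cong; sum-zero; sum-+; sum-*ʳ; sum-neg; module ≈R)
  zeroCol : ∀ i → i < suc N → r i D ≈ 0#
  zeroCol i i< with IsDField.≟0 fld (r i D)
  ... | yes e = e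
  ... | no ne = ⊥-elim (none i i< ne)
  extend : (∃ λ c → (∃ λ i → i < suc N × ¬ (c i ≈ 0#)) × (∀ j → j < D → sumN (suc N) (λ i → c i * r i j) ≈ 0#)) →
    ∃ λ c → (∃ λ i → i < suc N × ¬ (c i ≈ 0#)) × (∀ j → j < suc D → sumN (suc N) (λ i → c i * r i j) ≈ 0#)
  extend (c , nz , sol) = c , nz , λ j j< → col j (ℕₚ.m≤n⇒m<n∨m≡n (ℕₚ.≤-pred j<))
    where
    col : ∀ j → j < D ⊎ j ≡ D → sumN (suc N) (λ i → c i * r i j) ≈ 0#
    col j (inj₁ j<) = sol j j<
    col j (inj₂ ≡.refl) = sum-zero (suc N) {λ i → c i * r i D} (λ i i< → x*0≈0 (zeroCol i i<))
... | inj₁ (i₀ , s≤s i₀≤ , p) = extend (dependency fld D N lt r′)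
  where
  open Kit k using (Carrier; _≈_; _+_; _*_; -_; 0#; 1#; refl; sym; trans; +-cong; +-congˡ; +-congʳ; *-congˡ; *-congʳ; -‿cong; +-comm; +-identityʳ; *-assoc; *-comm; *-identityʳ; -‿distribˡ-*; _-_; ≡⇒≈; x≈y⇒x-y≈0; distribˡ--; x*0≈0; sumN; sum-cong; sum-zero; sum-+; sum-*ʳ; sum-neg; module ≈R)
  u = proj₁ (IsDField.inv fld (r i₀ D) p)
  ru = proj₂ (IsDField.inv fld (r i₀ D) p)
  s : ℕ → Carrier
  s i = r (skip i₀ i) D * u
  r′ : ℕ → ℕ → Carrier
  r′ i j = r (skip i₀ i) j - s i * r i₀ j
  r′D : ∀ i → r′ i D ≈ 0#
  r′D i = x≈y⇒x-y≈0 (sym (trans (*-assoc _ _ _) (trans (*-congˡ (trans (*-comm _ _) ru)) (*-identityʳ _))))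
  extend : (∃ λ c → (∃ λ i → i < N × ¬ (c i ≈ 0#)) × (∀ j → j < D → sumN N (λ i → c i * r′ i j) ≈ 0#)) →
    ∃ λ c → (∃ λ i → i < suc N × ¬ (c i ≈ 0#)) × (∀ j → j < suc D → sumN (suc N) (λ i → c i * r i j) ≈ 0#)
  extend (c′ , (i , i< , nz) , sol) = c ,
    (skip i₀ i , skip-< i₀ i N i< , λ e → nz (trans (≡⇒≈ (≡.sym (insert-skip i₀ a c′ i))) e)) ,
    λ j j< → trans (relation j) (solve j (ℕₚ.m≤n⇒m<n∨m≡n (ℕₚ.≤-pred j<)))
    where
    a = - sumN N (λ i → c′ i * s i)
    c = insert i₀ a c′
    solve : ∀ j → j < D ⊎ j ≡ D → sumN N (λ i → c′ i * r′ i j) ≈ 0#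
    solve j (inj₁ j<) = sol j j<
    solve j (inj₂ ≡.refl) = sum-zero N (λ i _ → x*0≈0 (r′D i))
    relation : ∀ j → sumN (suc N) (λ i → c i * r i j) ≈ sumN N (λ i → c′ i * r′ i j)
    relation j = begin
      sumN (suc N) (λ i → c i * r i j) ≈⟨ sum-skip k N i₀ (λ i → c i * r i j) i₀≤ ⟩
      c i₀ * r i₀ j + sumN N (λ i → c (skip i₀ i) * r (skip i₀ i) j)
        ≈⟨ +-cong (*-congʳ (≡⇒≈ (insert-at i₀ a c′))) (sum-cong N (λ i _ → *-congʳ (≡⇒≈ (insert-skip i₀ a c′ i)))) ⟩
      a * r i₀ j + sumN N (λ i → c′ i * r (skip i₀ i) j)
        ≈⟨ +-congʳ (trans (*-congʳ (sum-neg N _)) (sum-*ʳ N _ _)) ⟩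
      sumN N (λ i → (- (c′ i * s i)) * r i₀ j) + sumN N (λ i → c′ i * r (skip i₀ i) j) ≈⟨ sum-+ N _ _ ⟨
      sumN N (λ i → (- (c′ i * s i)) * r i₀ j + c′ i * r (skip i₀ i) j) ≈⟨ sum-cong N (λ i _ → term i) ⟩
      sumN N (λ i → c′ i * r′ i j) ∎
      where
      open ≈R
      term : ∀ i → (- (c′ i * s i)) * r i₀ j + c′ i * r (skip i₀ i) j ≈ c′ i * r′ i j
      term i = begin
        (- (c′ i * s i)) * r i₀ j + c′ i * r (skip i₀ i) j ≈⟨ +-comm _ _ ⟩
        c′ i * r (skip i₀ i) j + (- (c′ i * s i)) * r i₀ j ≈⟨ +-congˡ (-‿distribˡ-* _ _) ⟨
        c′ i * r (skip i₀ i) j - c′ i * s i * r i₀ j ≈⟨ +-congˡ (-‿cong (*-assoc _ _ _)) ⟩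
        c′ i * r (skip i₀ i) j - c′ i * (s i * r i₀ j) ≈⟨ distribˡ-- _ _ _ ⟨
        c′ i * r′ i j ∎

pair-/ : ∀ n .{{_ : ℕ.NonZero n}} i j → j < n → (i ℕ.* n ℕ.+ j) / n ≡ i
pair-/ n i j lt = ≡.trans (+-distrib-/-∣ˡ j (n∣m*n i))
  (≡.trans (≡.cong₂ ℕ._+_ (m*n/n≡m i n) (m<n⇒m/n≡0 lt)) (ℕₚ.+-identityʳ i))

pair-% : ∀ n .{{_ : ℕ.NonZero n}} i j → j < n → (i ℕ.* n ℕ.+ j) % n ≡ j
pair-% n i j lt = ≡.trans (≡.cong (_% n) (ℕₚ.+-comm (i ℕ.* n) j)) (≡.trans ([m+kn]%n≡m%n j i n) (m<n⇒m%n≡m lt))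

pair-< : ∀ m n {i j} → i < m → j < n → i ℕ.* n ℕ.+ j < m ℕ.* n
pair-< m n {i} {j} i< j< = ℕₚ.<-≤-trans (ℕₚ.+-monoʳ-< (i ℕ.* n) j<)
  (≡.subst (_≤ m ℕ.* n) (ℕₚ.+-comm n (i ℕ.* n)) (ℕₚ.*-monoˡ-≤ n i<))

pair-decode : ∀ n .{{_ : ℕ.NonZero n}} u → u ≡ (u / n) ℕ.* n ℕ.+ u % n
pair-decode n u = ≡.trans (m≡m%n+[m/n]*n u n) (ℕₚ.+-comm (u % n) _)

+-swap : ∀ a b c → a ℕ.+ (b ℕ.+ c) ≡ b ℕ.+ (a ℕ.+ c)
+-swap a b c = ≡.trans (≡.sym (ℕₚ.+-assoc a b c)) (≡.trans (≡.cong (ℕ._+ c) (ℕₚ.+-comm a b)) (ℕₚ.+-assoc b a c))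

-- Reduced monomials in z, Y and Y′

module Span {k T : Ring} (φ : Hom k T) (n1 n2′ δ : ℕ) (F : ℕ → ℕ → CommutativeRing.Carrier k)
            (z Y Y′ : CommutativeRing.Carrier T) where
  open Kit T using (Carrier; _≈_; _+_; _*_; -_; 0#; 1#; refl; sym; trans; +-cong; +-congʳ; *-cong; *-congˡ; *-congʳ; -‿cong; +-assoc; +-comm; +-identityˡ; +-identityʳ; *-assoc; *-identityˡ; *-identityʳ; distribˡ; distribʳ; zeroʳ; -‿distribˡ-*; _^_; _-_; ≡⇒≈; -‿congr; x+y≈z⇒x≈z-y; distribˡ--; distribʳ--; telescope; 0*x≈0; sumN; sum-nil; sum-suc; sum-cong; sum-zero; sum-+; sum-*ˡ; sum-*ʳ; sum-comm; sum-single; sum-nest; module +S; module *S; module ≈R)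
  private module k = Kit k using (Carrier; _≈_; _+_; _*_; -_; 0#; 1#; refl; _-_; sumN)

  n n2 : ℕ
  n = suc n1
  n2 = suc n2′

  coefF : ℕ → Carrier
  coefF j = sumN (suc δ) (λ e → ⟦ φ ⟧ (F j e) * z ^ e)

  G : ℕ → ℕ → ℕ → Carrier
  G e i j = z ^ e * (Y ^ i * Y′ ^ j)

  -- A filtration in which z has weight 1 and Y, Y′ have weight δ, spanned over k by the monomials
  -- reduced to i < n and j < n2. The coefficients of the monic relation have degree at most δ in z,
  -- so that rewriting by it never raises the weight, and multiplication by z, Y, Y′ costs 1, δ, δ.
  data Sp (w : ℕ) : Carrier → Set where
    gen  : ∀ e i j → e ℕ.+ δ ℕ.* (i ℕ.+ j) ≤ w → i < n → j < n2 → Sp w (G e i j)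
    zer  : Sp w 0#
    add  : ∀ {x y} → Sp w x → Sp w y → Sp w (x + y)
    scl  : ∀ c {x} → Sp w x → Sp w (⟦ φ ⟧ c * x)
    resp : ∀ {x y} → x ≈ y → Sp w x → Sp w y

  mono-Sp : ∀ {w w′ x} → w ≤ w′ → Sp w x → Sp w′ x
  mono-Sp le (gen e i j h i< j<) = gen e i j (ℕₚ.≤-trans h le) i< j<
  mono-Sp le zer = zer
  mono-Sp le (add s t) = add (mono-Sp le s) (mono-Sp le t)
  mono-Sp le (scl c s) = scl c (mono-Sp le s)
  mono-Sp le (resp e s) = resp e (mono-Sp le s)

  sum-Sp : ∀ {w} N {f} → (∀ i → i < N → Sp w (f i)) → Sp w (sumN N f)
  sum-Sp zero h = resp (sym (sum-nil _)) zer
  sum-Sp (suc N) h = resp (sym (sum-suc N _)) (add (h 0 (s≤s z≤n)) (sum-Sp N (λ i lt → h (suc i) (s≤s lt))))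

  neg-Sp : ∀ {w x} → Sp w x → Sp w (- x)
  neg-Sp {w} {x} s = resp (trans (*-congʳ (trans (⟦⟧-neg φ k.1#) (-‿cong (⟦⟧-1 φ))))
    (trans (sym (-‿distribˡ-* 1# x)) (-‿cong (*-identityˡ x)))) (scl (k.- k.1#) s)

  mul-Sp : ∀ a v → (∀ e i j → i < n → j < n2 → Sp (v ℕ.+ (e ℕ.+ δ ℕ.* (i ℕ.+ j))) (a * G e i j)) →
    ∀ {w x} → Sp w x → Sp (v ℕ.+ w) (a * x)
  mul-Sp a v g (gen e i j h i< j<) = mono-Sp (ℕₚ.+-monoʳ-≤ v h) (g e i j i< j<)
  mul-Sp a v g zer = resp (sym (zeroʳ a)) zer
  mul-Sp a v g (add s t) = resp (sym (distribˡ _ _ _)) (add (mul-Sp a v g s) (mul-Sp a v g t))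
  mul-Sp a v g (scl c s) = resp (*S.x∙yz≈y∙xz _ _ _) (scl c (mul-Sp a v g s))
  mul-Sp a v g (resp e s) = resp (*-congˡ e) (mul-Sp a v g s)

  mul-z : ∀ {w x} → Sp w x → Sp (1 ℕ.+ w) (z * x)
  mul-z = mul-Sp z 1 (λ e i j i< j< → resp (*-assoc _ _ _) (gen (suc e) i j ℕₚ.≤-refl i< j<))

  mul-z^ : ∀ a {w x} → Sp w x → Sp (a ℕ.+ w) (z ^ a * x)
  mul-z^ zero s = resp (sym (*-identityˡ _)) s
  mul-z^ (suc a) s = resp (sym (*-assoc _ _ _)) (mul-z (mul-z^ a s))

  mul-F : ∀ j {w x} → Sp w x → Sp (δ ℕ.+ w) (coefF j * x)
  mul-F j {w} {x} s = resp (sym (sum-*ʳ (suc δ) x (λ e → ⟦ φ ⟧ (F j e) * z ^ e)))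
    (sum-Sp (suc δ) (λ e lt → resp (sym (*-assoc _ _ _))
      (scl (F j e) (mono-Sp (ℕₚ.+-monoˡ-≤ w (ℕₚ.≤-pred lt)) (mul-z^ e s)))))

  module _ (rel₁ : Y ^ n + sumN n (λ j → coefF j * Y ^ j) ≈ 0#) where

    mul-Y : ∀ {w x} → Sp w x → Sp (δ ℕ.+ w) (Y * x)
    mul-Y = mul-Sp Y δ go
      where
      go : ∀ e i j → i < n → j < n2 → Sp (δ ℕ.+ (e ℕ.+ δ ℕ.* (i ℕ.+ j))) (Y * G e i j)
      go e i j i< j< with ℕₚ.m≤n⇒m<n∨m≡n i<
      ... | inj₁ i+1< = resp (trans (*-congˡ (*-assoc _ _ _)) (*S.x∙yz≈y∙xz _ _ _))
        (gen e (suc i) j (ℕₚ.≤-reflexive (≡.trans (≡.cong (e ℕ.+_) (ℕₚ.*-suc δ (i ℕ.+ j)))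
          (+-swap e δ (δ ℕ.* (i ℕ.+ j))))) i+1< j<)
      -- Y^n is replaced by means of the monic relation. The coefficient of Y^i′ adds at most δ to
      -- the weight, which is paid for by i′ ≤ n - 1.
      ... | inj₂ ≡.refl = resp (sym eq) (neg-Sp (sum-Sp n (λ i′ i′< →
          mono-Sp (ℕₚ.+-monoʳ-≤ δ (ℕₚ.+-monoʳ-≤ e (ℕₚ.*-monoʳ-≤ δ (ℕₚ.+-monoˡ-≤ j (ℕₚ.≤-pred i′<)))))
            (mul-F i′ (gen e i′ j ℕₚ.≤-refl i′< j<)))))
        where
        open ≈R
        eq : Y * G e i j ≈ - sumN n (λ i′ → coefF i′ * G e i′ j)
        eq = begin
          Y * (z ^ e * (Y ^ i * Y′ ^ j)) ≈⟨ *S.x∙yz≈y∙xz _ _ _ ⟩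
          z ^ e * (Y * (Y ^ i * Y′ ^ j)) ≈⟨ *-congˡ (*-assoc _ _ _) ⟨
          z ^ e * (Y ^ n * Y′ ^ j) ≈⟨ *S.x∙yz≈y∙xz _ _ _ ⟩
          Y ^ n * (z ^ e * Y′ ^ j) ≈⟨ *-congʳ (trans (x+y≈z⇒x≈z-y rel₁) (+-identityˡ _)) ⟩
          (- S) * (z ^ e * Y′ ^ j) ≈⟨ -‿distribˡ-* _ _ ⟨
          - (S * (z ^ e * Y′ ^ j)) ≈⟨ -‿cong (trans (sum-*ʳ n _ (λ j → coefF j * Y ^ j)) (sum-cong n (λ i′ _ →
            trans (*-assoc (coefF i′) (Y ^ i′) (z ^ e * Y′ ^ j)) (*-congˡ (*S.x∙yz≈y∙xz (Y ^ i′) (z ^ e) (Y′ ^ j)))))) ⟩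
          - sumN n (λ i′ → coefF i′ * G e i′ j) ∎
          where S = sumN n (λ j → coefF j * Y ^ j)

    mul-Y^ : ∀ a {w x} → Sp w x → Sp (δ ℕ.* a ℕ.+ w) (Y ^ a * x)
    mul-Y^ zero {w} s = resp (sym (*-identityˡ _)) (mono-Sp (ℕₚ.m≤n+m w (δ ℕ.* 0)) s)
    mul-Y^ (suc a) {w} s = resp (sym (*-assoc _ _ _)) (mono-Sp
      (ℕₚ.≤-reflexive (≡.trans (≡.sym (ℕₚ.+-assoc δ (δ ℕ.* a) w)) (≡.cong (ℕ._+ w) (≡.sym (ℕₚ.*-suc δ a)))))
      (mul-Y (mul-Y^ a s)))

    one-Sp : Sp 0 1#
    one-Sp = resp (trans (*-identityˡ _) (*-identityˡ _))
      (gen 0 0 0 (ℕₚ.≤-reflexive (ℕₚ.*-zeroʳ δ)) (s≤s z≤n) (s≤s z≤n))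

  -- S j is the complete homogeneous polynomial of degree j in Y and Y′.
  S : ℕ → Carrier
  S zero = 1#
  S (suc j) = Y * S j + Y′ ^ suc j

  S-quotient : ∀ j → (Y′ - Y) * S j ≈ Y′ ^ suc j - Y ^ suc j
  S-quotient zero = trans (*-identityʳ _) (sym (-‿congr (*-identityʳ _) (*-identityʳ _)))
  S-quotient (suc j) = begin
    (Y′ - Y) * (Y * S j + A) ≈⟨ distribˡ _ _ _ ⟩
    (Y′ - Y) * (Y * S j) + (Y′ - Y) * A ≈⟨ +-cong (*S.x∙yz≈y∙xz _ _ _) (distribʳ-- _ _ _) ⟩
    Y * ((Y′ - Y) * S j) + (Y′ * A - Y * A) ≈⟨ +-congʳ (trans (*-congˡ (S-quotient j)) (distribˡ-- _ _ _)) ⟩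
    (Y * A - Y * Y ^ suc j) + (Y′ * A - Y * A) ≈⟨ +-comm _ _ ⟩
    (Y′ * A - Y * A) + (Y * A - Y * Y ^ suc j) ≈⟨ telescope _ _ _ ⟩
    Y′ ^ suc (suc j) - Y ^ suc (suc j) ∎
    where
    open ≈R
    A = Y′ ^ suc j

  module _ (rel₁ : Y ^ n + sumN n (λ j → coefF j * Y ^ j) ≈ 0#) (n1≡n2 : n1 ≡ n2)
           (rel₂ : S n1 + sumN n1 (λ j → coefF (suc j) * S j) ≈ 0#) where

    S-Sp : ∀ j → j < n2 → Sp (δ ℕ.* j) (S j)
    S-Sp zero _ = mono-Sp z≤n (one-Sp rel₁)
    S-Sp (suc j) j< = add
      (mono-Sp (ℕₚ.≤-reflexive (≡.sym (ℕₚ.*-suc δ j))) (mul-Y rel₁ (S-Sp j (ℕₚ.<-trans (ℕₚ.n<1+n j) j<))))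
      (resp (trans (*-identityˡ _) (*-identityˡ _)) (gen 0 0 (suc j) ℕₚ.≤-refl (s≤s z≤n) j<))

    -- `rel₂` is the divided difference of the monic polynomial at Y and Y′. It is monic in Y′ of
    -- degree n - 1, one less than the polynomial itself, which saves a factor n / (n - 1) in the
    -- dimension.
    Y′^n2-Sp : Sp (δ ℕ.* n2) (Y′ ^ n2)
    Y′^n2-Sp = resp (sym eq) (neg-Sp (add
      (mono-Sp (ℕₚ.≤-reflexive (≡.sym (ℕₚ.*-suc δ n2′))) (mul-Y rel₁ (S-Sp n2′ ℕₚ.≤-refl)))
      (sum-Sp n2 (λ j j< → mono-Sp
        (ℕₚ.≤-trans (ℕₚ.≤-reflexive (≡.sym (ℕₚ.*-suc δ j))) (ℕₚ.*-monoʳ-≤ δ j<))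
        (mul-F (suc j) (S-Sp j j<))))))
      where
      open ≈R
      Σ′ = sumN n2 (λ j → coefF (suc j) * S j)
      rel₂′ : S n2 + Σ′ ≈ 0#
      rel₂′ = ≡.subst (λ m → S m + sumN m (λ j → coefF (suc j) * S j) ≈ 0#) n1≡n2 rel₂
      eq : Y′ ^ n2 ≈ - (Y * S n2′ + Σ′)
      eq = begin
        Y′ ^ n2 ≈⟨ x+y≈z⇒x≈z-y (trans (+S.x∙yz≈yx∙z _ _ _) rel₂′) ⟩
        0# - (Y * S n2′ + Σ′) ≈⟨ +-identityˡ _ ⟩
        - (Y * S n2′ + Σ′) ∎

    mul-Y′ : ∀ {w x} → Sp w x → Sp (δ ℕ.+ w) (Y′ * x)
    mul-Y′ = mul-Sp Y′ δ go
      where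
      go : ∀ e i j → i < n → j < n2 → Sp (δ ℕ.+ (e ℕ.+ δ ℕ.* (i ℕ.+ j))) (Y′ * G e i j)
      go e i j i< j< with ℕₚ.m≤n⇒m<n∨m≡n j<
      ... | inj₁ j+1< = resp (sym (trans (*S.x∙yz≈y∙xz _ _ _) (*-congˡ (*S.x∙yz≈y∙xz _ _ _))))
        (gen e i (suc j) (ℕₚ.≤-reflexive (≡.trans (≡.cong (λ t → e ℕ.+ δ ℕ.* t) (ℕₚ.+-suc i j))
          (≡.trans (≡.cong (e ℕ.+_) (ℕₚ.*-suc δ (i ℕ.+ j)))
          (+-swap e δ (δ ℕ.* (i ℕ.+ j)))))) i< j+1<)
      ... | inj₂ ≡.refl = resp (sym (trans (*S.x∙yz≈y∙xz _ _ _) (*-congˡ (*S.x∙yz≈y∙xz _ _ _))))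
        (mono-Sp (ℕₚ.≤-reflexive weight) (mul-z^ e (mul-Y^ rel₁ i Y′^n2-Sp)))
        where
        weight : e ℕ.+ (δ ℕ.* i ℕ.+ δ ℕ.* suc j) ≡ δ ℕ.+ (e ℕ.+ δ ℕ.* (i ℕ.+ j))
        weight = ≡.trans (≡.cong (e ℕ.+_) (≡.trans (≡.sym (ℕₚ.*-distribˡ-+ δ i (suc j))) (≡.trans (≡.cong (δ ℕ.*_) (ℕₚ.+-suc i j)) (ℕₚ.*-suc δ (i ℕ.+ j)))))
          (+-swap e δ (δ ℕ.* (i ℕ.+ j)))

    mul-Y′^ : ∀ a {w x} → Sp w x → Sp (δ ℕ.* a ℕ.+ w) (Y′ ^ a * x)
    mul-Y′^ zero {w} s = resp (sym (*-identityˡ _)) (mono-Sp (ℕₚ.m≤n+m w (δ ℕ.* 0)) s)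
    mul-Y′^ (suc a) {w} s = resp (sym (*-assoc _ _ _)) (mono-Sp
      (ℕₚ.≤-reflexive (≡.trans (≡.sym (ℕₚ.+-assoc δ (δ ℕ.* a) w)) (≡.cong (ℕ._+ w) (≡.sym (ℕₚ.*-suc δ a)))))
      (mul-Y′ (mul-Y′^ a s)))

    monomial-Sp : ∀ a b c → Sp (a ℕ.+ δ ℕ.* (b ℕ.+ c)) (G a b c)
    monomial-Sp a b c = resp (*-congˡ (*-congˡ (*-identityʳ _))) (mono-Sp
      (ℕₚ.≤-reflexive (≡.cong (a ℕ.+_) (≡.trans (≡.cong (δ ℕ.* b ℕ.+_) (ℕₚ.+-identityʳ _)) (≡.sym (ℕₚ.*-distribˡ-+ δ b c)))))
      (mul-z^ a (mul-Y^ rel₁ b (mul-Y′^ c (one-Sp rel₁)))))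

  index : ℕ → ℕ → ℕ → ℕ
  index e i j = (e ℕ.* n ℕ.+ i) ℕ.* n2 ℕ.+ j

  g : ℕ → Carrier
  g v = G (v / n2 / n) (v / n2 % n) (v % n2)

  g-index : ∀ e i j → i < n → j < n2 → g (index e i j) ≡ G e i j
  g-index e i j i< j<
    rewrite pair-/ n2 (e ℕ.* n ℕ.+ i) j j< | pair-% n2 (e ℕ.* n ℕ.+ i) j j< | pair-/ n e i i< | pair-% n e i i< = ≡.refl

  -- All reduced monomials with e ≤ w are counted, whatever the weight of their factor in Y and Y′.
  -- This coarse bound suffices for the comparison.
  dimension : ℕ → ℕ
  dimension w = (suc w ℕ.* n) ℕ.* n2

  private
    combine-+ : ∀ V (r r′ : ℕ → k.Carrier) (b : ℕ → Carrier) →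
      sumN V (λ v → ⟦ φ ⟧ (r v) * b v) + sumN V (λ v → ⟦ φ ⟧ (r′ v) * b v) ≈ sumN V (λ v → ⟦ φ ⟧ (r v k.+ r′ v) * b v)
    combine-+ V r r′ b = trans (sym (sum-+ V _ _))
      (sum-cong V (λ v _ → sym (trans (*-congʳ (⟦⟧-+ φ _ _)) (distribʳ _ _ _))))

    combine-* : ∀ V c (r : ℕ → k.Carrier) (b : ℕ → Carrier) →
      ⟦ φ ⟧ c * sumN V (λ v → ⟦ φ ⟧ (r v) * b v) ≈ sumN V (λ v → ⟦ φ ⟧ (c k.* r v) * b v)
    combine-* V c r b = trans (sum-*ˡ V _ _)
      (sum-cong V (λ v _ → sym (trans (*-congʳ (⟦⟧-* φ _ _)) (*-assoc _ _ _))))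

  coordinates : ∀ {w x} → Sp w x → ∃ λ (r : ℕ → k.Carrier) → x ≈ sumN (dimension w) (λ v → ⟦ φ ⟧ (r v) * g v)
  coordinates {w} (gen e i j h i< j<) = r , sym (trans
    (sum-single (dimension w) (λ v → ⟦ φ ⟧ (r v) * g v) v₀ v₀< (λ v _ ne → 0*x≈0 (⟦⟧≈0 φ (off v ne))))
    (trans (*-cong (trans (⟦⟧-cong φ at) (⟦⟧-1 φ)) (≡⇒≈ (g-index e i j i< j<))) (*-identityˡ _)))
    where
    v₀ = index e i j
    v₀< : v₀ < dimension w
    v₀< = pair-< (suc w ℕ.* n) n2 (pair-< (suc w) n (s≤s (ℕₚ.m+n≤o⇒m≤o e h)) i<) j<
    r : ℕ → k.Carrier
    r v with v ℕ.≟ v₀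
    ... | yes _ = k.1#
    ... | no _ = k.0#
    at : r v₀ k.≈ k.1#
    at with v₀ ℕ.≟ v₀
    ... | yes _ = k.refl
    ... | no ne = ⊥-elim (ne ≡.refl)
    off : ∀ v → ¬ (v ≡ v₀) → r v k.≈ k.0#
    off v ne with v ℕ.≟ v₀
    ... | yes e = ⊥-elim (ne e)
    ... | no _ = k.refl
  coordinates {w} zer = (λ _ → k.0#) , sym (sum-zero (dimension w) {λ v → ⟦ φ ⟧ k.0# * g v} (λ v _ → 0*x≈0 (⟦⟧-0 φ)))
  coordinates {w} (add s t) with coordinates s | coordinates t
  ... | r , e | r′ , e′ = (λ v → r v k.+ r′ v) , trans (+-cong e e′) (combine-+ (dimension w) r r′ g)
  coordinates {w} (scl c s) with coordinates s
  ... | r , e = (λ v → c k.* r v) , trans (*-congˡ e) (combine-* (dimension w) c r g)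
  coordinates (resp e s) with coordinates s
  ... | r , e′ = r , trans (sym e) e′

  nested : ∀ {w x} → Sp w x → ∃ λ (r : ℕ → ℕ → ℕ → k.Carrier) →
    x ≈ sumN (suc w) (λ e → sumN n (λ i → sumN n2 (λ j → ⟦ φ ⟧ (r e i j) * G e i j)))
  nested {w} s with coordinates s
  ... | r , eq = (λ e i j → r (index e i j)) , trans eq (trans (sum-nest (suc w ℕ.* n) n2 f)
    (trans (sum-nest (suc w) n (λ i → sumN n2 (λ j → f (i ℕ.* n2 ℕ.+ j))))
      (sum-cong (suc w) (λ e _ → sum-cong n (λ i i< → sum-cong n2 (λ j j< →
        *-congˡ {⟦ φ ⟧ (r (index e i j))} (≡⇒≈ (g-index e i j i< j<))))))))
    where
    f : ℕ → Carrier
    f v = ⟦ φ ⟧ (r v) * g v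

  private
    swap : ∀ U V (c : ℕ → k.Carrier) (row : ℕ → ℕ → k.Carrier) (x b : ℕ → Carrier) →
      (∀ u → u < U → x u ≈ sumN V (λ v → ⟦ φ ⟧ (row u v) * b v)) →
      (∀ v → v < V → k.sumN U (λ u → c u k.* row u v) k.≈ k.0#) → sumN U (λ u → ⟦ φ ⟧ (c u) * x u) ≈ 0#
    swap U V c row x b expand sol = begin
      sumN U (λ u → ⟦ φ ⟧ (c u) * x u)
        ≈⟨ sum-cong U (λ u u< → trans (*-congˡ (expand u u<)) (trans (sum-*ˡ V _ (λ v → ⟦ φ ⟧ (row u v) * b v))
             (sum-cong V (λ v _ → trans (sym (*-assoc _ _ _)) (*-congʳ (sym (⟦⟧-* φ (c u) (row u v)))))))) ⟩
      sumN U (λ u → sumN V (λ v → ⟦ φ ⟧ (c u k.* row u v) * b v)) ≈⟨ sum-comm U V _ ⟩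
      sumN V (λ v → sumN U (λ u → ⟦ φ ⟧ (c u k.* row u v) * b v))
        ≈⟨ sum-zero V (λ v v< → trans (sym (sum-*ʳ U _ (λ u → ⟦ φ ⟧ (c u k.* row u v))))
             (0*x≈0 (trans (sym (⟦⟧-sum φ U (λ u → c u k.* row u v))) (⟦⟧≈0 φ (sol v v<))))) ⟩
      0# ∎
      where open ≈R

  relation : IsDField k → ∀ w U → dimension w < U → (x : ℕ → Carrier) → (∀ u → u < U → Sp w (x u)) →
    ∃ λ (c : ℕ → k.Carrier) → (∃ λ u → u < U × ¬ (c u k.≈ k.0#)) × (sumN U (λ u → ⟦ φ ⟧ (c u) * x u) ≈ 0#)
  relation fld w U lt x h = c , nz , swap U (dimension w) c row x g expand sol
    where
    row : ℕ → ℕ → k.Carrier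
    row u with u ℕ.<? U
    ... | yes u< = proj₁ (coordinates (h u u<))
    ... | no _ = λ _ → k.0#
    expand : ∀ u → u < U → x u ≈ sumN (dimension w) (λ v → ⟦ φ ⟧ (row u v) * g v)
    expand u u< with u ℕ.<? U
    ... | yes u<′ = proj₂ (coordinates (h u u<′))
    ... | no nu = ⊥-elim (nu u<)
    solution = dependency fld (dimension w) U lt row
    c = proj₁ solution
    nz = proj₁ (proj₂ solution)
    sol = proj₂ (proj₂ solution)

-- The auxiliary function of Stepanov's method

module Sum4 (R : Ring) where
  open Kit R using (Carrier; _≈_; _+_; _*_; trans; sumN; sum-cong; sum-nest)

  sum4 : ℕ → ℕ → ℕ → ℕ → (ℕ → ℕ → ℕ → ℕ → Carrier) → Carrier
  sum4 a b c d f = sumN a (λ i → sumN b (λ j → sumN c (λ k → sumN d (λ l → f i j k l))))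

  sum4-cong : ∀ a b c d {f g} → (∀ i j k l → i < a → j < b → k < c → l < d → f i j k l ≈ g i j k l) →
    sum4 a b c d f ≈ sum4 a b c d g
  sum4-cong a b c d h = sum-cong a (λ i i< → sum-cong b (λ j j< → sum-cong c (λ k k< → sum-cong d (λ l l< → h i j k l i< j< k< l<))))

  sum4-flat : ∀ a b c d (f : ℕ → Carrier) → sumN (((a ℕ.* b) ℕ.* c) ℕ.* d) f
    ≈ sum4 a b c d (λ i j k l → f (((i ℕ.* b ℕ.+ j) ℕ.* c ℕ.+ k) ℕ.* d ℕ.+ l))
  sum4-flat a b c d f = trans (sum-nest ((a ℕ.* b) ℕ.* c) d f)
    (trans (sum-nest (a ℕ.* b) c (λ u → sumN d (λ l → f (u ℕ.* d ℕ.+ l))))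
      (sum-nest a b (λ v → sumN c (λ k → sumN d (λ l → f ((v ℕ.* c ℕ.+ k) ℕ.* d ℕ.+ l))))))

⟦⟧-sum4 : {R S : Ring} (φ : Hom R S) → ∀ a b c d f →
  CommutativeRing._≈_ S (⟦ φ ⟧ (Sum4.sum4 R a b c d f)) (Sum4.sum4 S a b c d (λ i j k l → ⟦ φ ⟧ (f i j k l)))
⟦⟧-sum4 {R} {S} φ a b c d f = trans (⟦⟧-sum φ a _) (sum-cong a (λ i _ →
  trans (⟦⟧-sum φ b _) (sum-cong b (λ j _ → trans (⟦⟧-sum φ c _) (sum-cong c (λ k _ → ⟦⟧-sum φ d _))))))
  where open Kit S using (_≈_; _+_; _*_; sym; trans; _^_; ^-congˡ; ^-distrib-*; 1^n≈1; sum-cong)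

frobκ : ∀ {p T} → CharP p T → ∀ {κ} hk → κ ≡ p ℕ.^ hk → ∀ s → Hom T T
frobκ {p} {T} ch {κ} hk κ≡ s = record
  { ⟦_⟧ = _^ (κ ℕ.^ s) ; ⟦⟧-cong = ^-congˡ (κ ℕ.^ s)
  ; ⟦⟧-+ = λ x y → ≡.subst (λ e → (x + y) ^ e ≈ x ^ e + y ^ e) (≡.sym (≡.trans (≡.cong (ℕ._^ s) κ≡) (ℕₚ.^-*-assoc p hk s))) (CharP.frob ch (hk ℕ.* s) x y)
  ; ⟦⟧-* = λ x y → ^-distrib-* x y (κ ℕ.^ s) ; ⟦⟧-1 = 1^n≈1 (κ ℕ.^ s) }
  where open Kit T using (_≈_; _+_; _*_; sym; trans; _^_; ^-congˡ; ^-distrib-*; 1^n≈1)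

*-Deg< : (R : Ring) → let open Poly R using (module P; !*; Deg<; module Deg<; deg<; van; ⊛-vanish) in ∀ {p q N M} → Deg< p N → Deg< q M → Deg< (p P.* q) (N ℕ.+ M)
*-Deg< R {p} {q} {N} {M} h g = deg< λ i le → trans (!* p q i) (⊛-vanish {N} {M} (van h) (van g) i le)
  where open Poly R using (module P; !*; Deg<; module Deg<; deg<; van; ⊛-vanish)
        open Kit R using (Carrier; _+_; _*_; trans; _^_)

module Stepanov {p hk κ : ℕ} {k : Ring} (ck : CardField κ k) (pr : Prime p) (κ≡ : κ ≡ p ℕ.^ hk)
                (n2′ δ : ℕ) (F : ℕ → ℕ → CommutativeRing.Carrier k) where
  private
    module k = Kit k using (Carrier; _≈_; 0#; sym; trans; ≡⇒≈)
    chk : CharP p k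
    chk = CardField.charP ck hk pr κ≡
    fk = CardField.fld ck

  n1 n : ℕ
  n1 = suc n2′
  n = suc n1

  coefAt : {T : Ring} → Hom k T → CommutativeRing.Carrier T → ℕ → CommutativeRing.Carrier T
  coefAt {T} φ z j = sumN (suc δ) (λ e → ⟦ φ ⟧ (F j e) * z ^ e)
    where open Kit T using (Carrier; _+_; _*_; _^_; sumN)

  fhat : {T : Ring} → Hom k T → CommutativeRing.Carrier T → CommutativeRing.Carrier T → CommutativeRing.Carrier T
  fhat {T} φ z Y = Y ^ n + sumN n (λ j → coefAt φ z j * Y ^ j)
    where open Kit T using (Carrier; _≈_; _+_; _*_; trans; *-cong; _^_; ^-congˡ; sumN; sum-cong)

  coefAt-hom : {T S : Ring} (φ : Hom k T) (φ′ : Hom k S) (ψ : Hom T S) → let open Kit S using (_≈_; _*_; trans; *-cong; _^_; ^-congˡ; sum-cong) in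
    (∀ c → ⟦ ψ ⟧ (⟦ φ ⟧ c) ≈ ⟦ φ′ ⟧ c) → ∀ {z z′} → ⟦ ψ ⟧ z ≈ z′ → ∀ j → ⟦ ψ ⟧ (coefAt φ z j) ≈ coefAt φ′ z′ j
  coefAt-hom {T} {S} φ φ′ ψ eφ {z} {z′} ez j = trans (⟦⟧-sum ψ (suc δ) (λ e → ⟦ φ ⟧ (F j e) T.* z T.^ e))
    (sum-cong (suc δ) (λ e _ → trans (⟦⟧-* ψ (⟦ φ ⟧ (F j e)) (z T.^ e))
      (*-cong (eφ (F j e)) (trans (⟦⟧-^ ψ z e) (^-congˡ e ez)))))
    where open Kit S using (_≈_; _*_; trans; +-cong; *-cong; _^_; ^-congˡ; sum-cong)
          module T = Kit T using (_*_; _^_)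

  fhat-hom : {T S : Ring} (φ : Hom k T) (φ′ : Hom k S) (ψ : Hom T S) → let open Kit S using (_≈_; _*_; trans; +-cong; *-cong; _^_; ^-congˡ; sum-cong) in
    (∀ c → ⟦ ψ ⟧ (⟦ φ ⟧ c) ≈ ⟦ φ′ ⟧ c) → ∀ {z z′ Y Y′} → ⟦ ψ ⟧ z ≈ z′ → ⟦ ψ ⟧ Y ≈ Y′ →
    ⟦ ψ ⟧ (fhat φ z Y) ≈ fhat φ′ z′ Y′
  fhat-hom {T} {S} φ φ′ ψ eφ {z} {z′} {Y} {Y′} ez eY = trans (⟦⟧-+ ψ _ _) (+-cong (pw n)
    (trans (⟦⟧-sum ψ n (λ j → coefAt φ z j T.* Y T.^ j)) (sum-cong n (λ j _ →
      trans (⟦⟧-* ψ (coefAt φ z j) (Y T.^ j)) (*-cong (coefAt-hom φ φ′ ψ eφ ez j) (pw j))))))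
    where
    open Kit S using (Carrier; _≈_; _+_; _*_; trans; +-cong; *-cong; _^_; ^-congˡ; sum-cong)
    module T = Kit T using (_*_; _^_)
    pw : ∀ j → ⟦ ψ ⟧ (Y T.^ j) ≈ Y′ ^ j
    pw j = trans (⟦⟧-^ ψ Y j) (^-congˡ j eY)

  -- The function H. With |K| = Q = B Q′ and B a power of κ, its B-th power is the sum of c z^(αB)
  -- (z^Q)^α′ Y^(βB) (Y^Q)^β′, which is a relation between z, Y and Y′ = Y^Q whenever z^Q = z.
  HH : {T : Ring} → Hom k T → (z Y : CommutativeRing.Carrier T) → (l μ Q′ : ℕ) →
    (ℕ → ℕ → ℕ → ℕ → k.Carrier) → CommutativeRing.Carrier T
  HH {T} φ z Y l μ Q′ c = sum4 l n μ n (λ α β α′ β′ →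
    ⟦ φ ⟧ (c α β α′ β′) * (z ^ (α ℕ.+ α′ ℕ.* Q′) * Y ^ (β ℕ.+ β′ ℕ.* Q′)))
    where open Kit T using (Carrier; _≈_; _+_; _*_; trans; *-cong; _^_; ^-congˡ)
          open Sum4 T

  HH-hom : {T S : Ring} (φ : Hom k T) (φ′ : Hom k S) (ψ : Hom T S) → let open Kit S using (_≈_; _+_; _*_; trans; *-cong; ^-congˡ) in
    (∀ c → ⟦ ψ ⟧ (⟦ φ ⟧ c) ≈ ⟦ φ′ ⟧ c) → ∀ {z z′ Y Y′} → ⟦ ψ ⟧ z ≈ z′ → ⟦ ψ ⟧ Y ≈ Y′ → ∀ l μ Q′ c →
    ⟦ ψ ⟧ (HH φ z Y l μ Q′ c) ≈ HH φ′ z′ Y′ l μ Q′ c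
  HH-hom {T} {S} φ φ′ ψ eφ {z} {z′} {Y} {Y′} ez eY l μ Q′ c = trans (⟦⟧-sum4 ψ l n μ n _)
    (sum4-cong l n μ n (λ α β α′ β′ _ _ _ _ → trans (⟦⟧-* ψ _ _) (*-cong (eφ _) (trans (⟦⟧-* ψ _ _)
      (*-cong (trans (⟦⟧-^ ψ z (α ℕ.+ α′ ℕ.* Q′)) (^-congˡ (α ℕ.+ α′ ℕ.* Q′) ez))
              (trans (⟦⟧-^ ψ Y (β ℕ.+ β′ ℕ.* Q′)) (^-congˡ (β ℕ.+ β′ ℕ.* Q′) eY)))))))
    where open Kit S using (Carrier; _≈_; _+_; _*_; 0#; trans; *-cong; ^-congˡ)
          open Sum4 S

  NonzeroCoeff : ℕ → ℕ → (ℕ → ℕ → ℕ → ℕ → k.Carrier) → Set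
  NonzeroCoeff l μ c = ∃ λ α → ∃ λ β → ∃ λ α′ → ∃ λ β′ →
    α < l × β < n × α′ < μ × β′ < n × ¬ (c α β α′ β′ k.≈ k.0#)

  -- The largest weight of a monomial z^(αB + α′) Y^(βB) Y′^β′ with α ≤ l′ and α′ ≤ μ′; `wH` is the
  -- same for the terms of `HH`. The first decides about the existence of a relation, the second
  -- bounds the degree of H in z after reduction.
  wG : ℕ → ℕ → ℕ → ℕ
  wG B l′ μ′ = l′ ℕ.* B ℕ.+ μ′ ℕ.+ δ ℕ.* (n1 ℕ.* B ℕ.+ n1)

  wH : ℕ → ℕ → ℕ → ℕ
  wH Q′ l′ μ′ = l′ ℕ.+ μ′ ℕ.* Q′ ℕ.+ δ ℕ.* (n1 ℕ.+ n1 ℕ.* Q′)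

  module Auxiliary {T : Ring} (φ : Hom k T) (z Y : CommutativeRing.Carrier T) (j s : ℕ) where
    open Kit T using (Carrier; _≈_; _+_; _*_; -_; 0#; 1#; refl; sym; trans; +-cong; +-congˡ; *-cong; *-congˡ; *-congʳ; +-identityʳ; *-identityʳ; distribˡ; _^_; ^-congˡ; ^-congʳ; ^-homo-*; ^-assocʳ; ^-distrib-*; _-_; ≡⇒≈; -‿congr; x-x; x≈y⇒x-y≈0; distribˡ--; -‿+; 0+x≈x; x+0≈x; sumN; sum-nil; sum-suc; sum-cong; sum-+; sum-*ˡ; sum-neg; module *S; module ≈R)
    B = κ ℕ.^ j
    Q′ = κ ℕ.^ s
    Q = κ ℕ.^ (j ℕ.+ s)

    module _ (zQ : z ^ Q ≈ z) (fz : fhat φ z Y ≈ 0#)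
             (cancelY : ∀ x → (Y ^ Q - Y) * x ≈ 0# → x ≈ 0#)
             (reduced : ∀ x → x ^ B ≈ 0# → x ≈ 0#)
             (l′ μ′ : ℕ) (dims : (suc (wG B l′ μ′) ℕ.* n) ℕ.* n1 < ((suc l′ ℕ.* n) ℕ.* suc μ′) ℕ.* n) where
      private
        Y′ = Y ^ Q
        l = suc l′
        μ = suc μ′
        w = wG B l′ μ′
        open Span φ n1 n2′ δ F z Y Y′ using (G; S; S-quotient; monomial-Sp; relation)
        open Sum4 T
        chT = charP-hom φ chk
        frobQ = frobκ chT hk κ≡ (j ℕ.+ s)
        frobB = frobκ chT hk κ≡ j

        fixk : ∀ i c → ⟦ φ ⟧ c ^ (κ ℕ.^ i) ≈ ⟦ φ ⟧ c
        fixk i c = trans (sym (⟦⟧-^ φ c (κ ℕ.^ i))) (⟦⟧-cong φ (CardField.fermat-^ ck i c))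

        fz′ : fhat φ z Y′ ≈ 0#
        fz′ = trans (sym (fhat-hom φ φ frobQ (fixk (j ℕ.+ s)) zQ refl)) (⟦⟧≈0 frobQ fz)

        -- The difference of the equations for Y′ and for Y is divisible by Y′ - Y = Y^Q - Y. Here
        -- the absence of points enters, in the form of `cancelY`.
        rel₂ : S n1 + sumN n1 (λ i → coefAt φ z (suc i) * S i) ≈ 0#
        rel₂ = cancelY _ (begin
          (Y′ - Y) * (S n1 + sumN n1 (λ i → a (suc i) * S i)) ≈⟨ distribˡ _ _ _ ⟩
          (Y′ - Y) * S n1 + (Y′ - Y) * sumN n1 (λ i → a (suc i) * S i)
            ≈⟨ +-cong (S-quotient n1) (trans (sum-*ˡ n1 (Y′ - Y) (λ i → a (suc i) * S i)) (sum-cong n1 (λ i _ →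
                 trans (*S.x∙yz≈y∙xz (Y′ - Y) (a (suc i)) (S i)) (trans (*-congˡ (S-quotient i)) (distribˡ-- _ _ _))))) ⟩
          (Y′ ^ n - Y ^ n) + sumN n1 (λ i → a (suc i) * Y′ ^ suc i - a (suc i) * Y ^ suc i)
            ≈⟨ +-congˡ (trans (trans (sym (0+x≈x (x≈y⇒x-y≈0 refl))) (sym (sum-suc n1 (λ i → a i * Y′ ^ i - a i * Y ^ i)))) (sum-sub n (λ i → a i * Y′ ^ i) (λ i → a i * Y ^ i))) ⟩
          (Y′ ^ n - Y ^ n) + (sumN n (λ i → a i * Y′ ^ i) - sumN n (λ i → a i * Y ^ i)) ≈⟨ -‿+ _ _ _ _ ⟨
          fhat φ z Y′ - fhat φ z Y ≈⟨ trans (-‿congr fz′ fz) (x-x 0#) ⟩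
          0# ∎)
          where
          open ≈R
          a = coefAt φ z
          sum-sub : ∀ N f g → sumN N (λ i → f i - g i) ≈ sumN N f - sumN N g
          sum-sub N f g = trans (sum-+ N f (λ i → - g i)) (+-congˡ (sym (sum-neg N g)))

        -- z^(αB + α′) Y^(βB) Y′^β′, where u is the mixed-radix code of (α, β, α′, β′).
        monomial : ℕ → Carrier
        monomial u = G (u / n / μ / n ℕ.* B ℕ.+ u / n % μ) ((u / n / μ % n) ℕ.* B) (u % n)

        U = ((l ℕ.* n) ℕ.* μ) ℕ.* n

        monomial-in : ∀ u → u < U → Span.Sp φ n1 n2′ δ F z Y Y′ w (monomial u)
        monomial-in u u< = Span.mono-Sp φ n1 n2′ δ F z Y Y′
          (ℕₚ.+-mono-≤ (ℕₚ.+-mono-≤ (ℕₚ.*-monoˡ-≤ B (ℕₚ.≤-pred α<)) (ℕₚ.≤-pred (m%n<n (u / n) μ)))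
            (ℕₚ.*-monoʳ-≤ δ (ℕₚ.+-mono-≤ (ℕₚ.*-monoˡ-≤ B (ℕₚ.≤-pred (m%n<n (u / n / μ) n))) (ℕₚ.≤-pred (m%n<n u n)))))
          (monomial-Sp fz ≡.refl rel₂ (u / n / μ / n ℕ.* B ℕ.+ u / n % μ) ((u / n / μ % n) ℕ.* B) (u % n))
          where
          α< : u / n / μ / n < l
          α< = m<n*o⇒m/o<n (m<n*o⇒m/o<n (m<n*o⇒m/o<n u<))

        code : ℕ → ℕ → ℕ → ℕ → ℕ
        code α β α′ β′ = ((α ℕ.* n ℕ.+ β) ℕ.* μ ℕ.+ α′) ℕ.* n ℕ.+ β′

        module Conclude (sol : ∃ λ (c : ℕ → k.Carrier) → (∃ λ u → u < U × ¬ (c u k.≈ k.0#)) ×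
                               (sumN U (λ u → ⟦ φ ⟧ (c u) * monomial u) ≈ 0#)) where
          c : ℕ → ℕ → ℕ → ℕ → k.Carrier
          c α β α′ β′ = proj₁ sol (code α β α′ β′)

          c-nonzero : NonzeroCoeff l μ c
          c-nonzero with proj₁ (proj₂ sol)
          ... | u , u< , nz = u / n / μ / n , u / n / μ % n , u / n % μ , u % n ,
            m<n*o⇒m/o<n (m<n*o⇒m/o<n (m<n*o⇒m/o<n u<)) , m%n<n (u / n / μ) n , m%n<n (u / n) μ , m%n<n u n ,
            λ e → nz (k.trans (k.≡⇒≈ (≡.cong (proj₁ sol) decode)) e)
            where
            decode : u ≡ code (u / n / μ / n) (u / n / μ % n) (u / n % μ) (u % n)
            decode = ≡.trans (pair-decode n u) (≡.cong (λ t → t ℕ.* n ℕ.+ u % n)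
              (≡.trans (pair-decode μ (u / n)) (≡.cong (λ t → t ℕ.* μ ℕ.+ u / n % μ) (pair-decode n (u / n / μ)))))

          -- The coefficients come from k and equal their own B-th powers, and z^Q = z; so the B-th
          -- power of H is the relation just found. As the ring is reduced, H itself vanishes.
          HH≈0 : HH φ z Y l μ Q′ c ≈ 0#
          HH≈0 = reduced _ (begin
            HH φ z Y l μ Q′ c ^ B ≈⟨ ⟦⟧-sum4 frobB l n μ n _ ⟩
            sum4 l n μ n (λ α β α′ β′ → (⟦ φ ⟧ (c α β α′ β′) * (z ^ (α ℕ.+ α′ ℕ.* Q′) * Y ^ (β ℕ.+ β′ ℕ.* Q′))) ^ B)
              ≈⟨ sum4-cong l n μ n (λ α β α′ β′ _ β< α′< β′< → term α β α′ β′ β< α′< β′<) ⟩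
            sum4 l n μ n (λ α β α′ β′ → ⟦ φ ⟧ (proj₁ sol (code α β α′ β′)) * monomial (code α β α′ β′))
              ≈⟨ sum4-flat l n μ n (λ u → ⟦ φ ⟧ (proj₁ sol u) * monomial u) ⟨
            sumN U (λ u → ⟦ φ ⟧ (proj₁ sol u) * monomial u) ≈⟨ proj₂ (proj₂ sol) ⟩
            0# ∎)
            where
            open ≈R
            expo : ∀ a b → (a ℕ.+ b ℕ.* Q′) ℕ.* B ≡ a ℕ.* B ℕ.+ Q ℕ.* b
            expo a b = ≡.trans (solve 4 (λ a b q B → (a :+ b :* q) :* B := a :* B :+ (B :* q) :* b) ≡.refl a b Q′ B)
              (≡.cong (λ t → a ℕ.* B ℕ.+ t ℕ.* b) (≡.sym (ℕₚ.^-distribˡ-+-* κ j s)))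
              where open +-*-Solver
            power : ∀ x a b → (x ^ (a ℕ.+ b ℕ.* Q′)) ^ B ≈ x ^ (a ℕ.* B) * (x ^ Q) ^ b
            power x a b = trans (^-assocʳ x (a ℕ.+ b ℕ.* Q′) B) (trans (^-congʳ x (expo a b))
              (trans (^-homo-* x (a ℕ.* B) (Q ℕ.* b)) (*-congˡ (sym (^-assocʳ x Q b)))))
            decoded : ∀ α β α′ β′ → β < n → α′ < μ → β′ < n → monomial (code α β α′ β′) ≡ G (α ℕ.* B ℕ.+ α′) (β ℕ.* B) β′
            decoded α β α′ β′ β< α′< β′<
              rewrite pair-/ n ((α ℕ.* n ℕ.+ β) ℕ.* μ ℕ.+ α′) β′ β′< | pair-% n ((α ℕ.* n ℕ.+ β) ℕ.* μ ℕ.+ α′) β′ β′<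
                    | pair-/ μ (α ℕ.* n ℕ.+ β) α′ α′< | pair-% μ (α ℕ.* n ℕ.+ β) α′ α′<
                    | pair-/ n α β β< | pair-% n α β β< = ≡.refl
            term : ∀ α β α′ β′ → β < n → α′ < μ → β′ < n →
              (⟦ φ ⟧ (c α β α′ β′) * (z ^ (α ℕ.+ α′ ℕ.* Q′) * Y ^ (β ℕ.+ β′ ℕ.* Q′))) ^ B ≈
              ⟦ φ ⟧ (proj₁ sol (code α β α′ β′)) * monomial (code α β α′ β′)
            term α β α′ β′ β< α′< β′< = begin
              (⟦ φ ⟧ (c α β α′ β′) * (z ^ (α ℕ.+ α′ ℕ.* Q′) * Y ^ (β ℕ.+ β′ ℕ.* Q′))) ^ B
                ≈⟨ trans (^-distrib-* _ _ B) (*-cong (fixk j _) (^-distrib-* _ _ B)) ⟩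
              C * ((z ^ (α ℕ.+ α′ ℕ.* Q′)) ^ B * (Y ^ (β ℕ.+ β′ ℕ.* Q′)) ^ B)
                ≈⟨ *-congˡ (*-cong (power z α α′) (power Y β β′)) ⟩
              C * (z ^ (α ℕ.* B) * (z ^ Q) ^ α′ * (Y ^ (β ℕ.* B) * Y′ ^ β′))
                ≈⟨ *-congˡ (*-congʳ (trans (*-congˡ (^-congˡ α′ zQ)) (sym (^-homo-* z (α ℕ.* B) α′)))) ⟩
              C * G (α ℕ.* B ℕ.+ α′) (β ℕ.* B) β′ ≈⟨ *-congˡ (≡⇒≈ (≡.sym (decoded α β α′ β′ β< α′< β′<))) ⟩
              C * monomial (code α β α′ β′) ∎
              where C = ⟦ φ ⟧ (c α β α′ β′)

      auxiliary : ∃ λ c → NonzeroCoeff l μ c × (HH φ z Y l μ Q′ c ≈ 0#)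
      auxiliary = Conclude.c sol , Conclude.c-nonzero sol , Conclude.HH≈0 sol
        where sol = relation fk w U dims monomial monomial-in

  HH-reduce : {T : Ring} (φ : Hom k T) (z Y : CommutativeRing.Carrier T) → let open Kit T using (Carrier; _≈_; _+_; _*_; 0#; 1#; trans; *-congˡ; +-identityʳ; *-identityʳ; _^_; x+0≈x; sumN; sum-nil; sum-suc; sum-cong) in fhat φ z Y ≈ 0# →
    ∀ l′ μ′ Q′ c → ∃ λ (r : ℕ → ℕ → k.Carrier) →
    HH φ z Y (suc l′) (suc μ′) Q′ c ≈ sumN (suc (wH Q′ l′ μ′)) (λ e → sumN n (λ i → ⟦ φ ⟧ (r e i) * (z ^ e * Y ^ i)))
  HH-reduce {T} φ z Y fz l′ μ′ Q′ c = (λ e i → proj₁ res e i 0) , trans (proj₂ res)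
    (sum-cong (suc w) (λ e _ → sum-cong n (λ i _ → trans (trans (sum-suc 0 (λ j → ⟦ φ ⟧ (proj₁ res e i j) * G e i j)) (x+0≈x (sum-nil _))) (*-congˡ {⟦ φ ⟧ (proj₁ res e i 0)} (*-congˡ {z ^ e} (*-identityʳ (Y ^ i)))))))
    where
    open Kit T using (Carrier; _≈_; _+_; _*_; 0#; 1#; trans; *-congˡ; +-identityʳ; *-identityʳ; _^_; x+0≈x; sumN; sum-nil; sum-suc; sum-cong; Distinct)
    -- With n2 = 1 and Y′ = 1 the reduced monomials are the z^e Y^i with i < n.
    open Span φ n1 0 δ F z Y 1# using (Sp; gen; zer; add; scl; resp; G; mono-Sp; sum-Sp; mul-z^; mul-Y^; one-Sp; nested)
    w = wH Q′ l′ μ′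
    mono-in : ∀ a b → Sp (a ℕ.+ δ ℕ.* b) (z ^ a * Y ^ b)
    mono-in a b = resp (*-congˡ (*-identityʳ _)) (mono-Sp (ℕₚ.≤-reflexive (≡.cong (a ℕ.+_) (ℕₚ.+-identityʳ _)))
      (mul-z^ a (mul-Y^ fz b (one-Sp fz))))
    inSp : Sp w (HH φ z Y (suc l′) (suc μ′) Q′ c)
    inSp = sum-Sp (suc l′) (λ α α< → sum-Sp n (λ β β< → sum-Sp (suc μ′) (λ α′ α′< → sum-Sp n (λ β′ β′< →
      scl (c α β α′ β′) (mono-Sp
        (ℕₚ.+-mono-≤ (ℕₚ.+-mono-≤ (ℕₚ.≤-pred α<) (ℕₚ.*-monoˡ-≤ Q′ (ℕₚ.≤-pred α′<)))
          (ℕₚ.*-monoʳ-≤ δ (ℕₚ.+-mono-≤ (ℕₚ.≤-pred β<) (ℕₚ.*-monoˡ-≤ Q′ (ℕₚ.≤-pred β′<)))))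
        (mono-in (α ℕ.+ α′ ℕ.* Q′) (β ℕ.+ β′ ℕ.* Q′)))))))
    res = nested inSp

  -- The point (zP , YP) on the curve only serves to certify that HH is not the zero function.
  contradiction-at : ∀ j s l′ μ′ β₀ → let B = κ ℕ.^ j; Q′ = κ ℕ.^ s; Q = κ ℕ.^ (j ℕ.+ s) in
    (suc (wG B l′ μ′) ℕ.* n) ℕ.* n1 < ((suc l′ ℕ.* n) ℕ.* suc μ′) ℕ.* n →
    suc (wH Q′ l′ μ′) ℕ.+ β₀ ≤ Q →
    {TP : Ring} (φP : Hom k TP) (zP YP : CommutativeRing.Carrier TP) →
    CommutativeRing._≈_ TP (fhat φP zP YP) (CommutativeRing.0# TP) →
    (∀ c → NonzeroCoeff (suc l′) (suc μ′) c → ¬ CommutativeRing._≈_ TP (HH φP zP YP (suc l′) (suc μ′) Q′ c) (CommutativeRing.0# TP)) →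
    {K : Ring} (cK : CardField Q K) (ψ : Hom k K) (E : Ext (record { ring = K ; isDFld = CardField.fld cK })) →
    (bad : Poly.Pol k) → ¬ CommutativeRing._≈_ (PolyRing k) bad (CommutativeRing.0# (PolyRing k)) → Poly.Deg< k bad β₀ →
    let Ω = DField.ring (Ext.fieldE E)
        ι = Ext.emb E
        open Kit Ω using (Carrier; _≈_; _+_; _*_; 0#; _^_; Distinct)
        module K = Kit K using (_≈_; 0#) in
    (∀ z → ¬ (Eval.eval ψ z bad K.≈ K.0#) → ∃ λ (y : ℕ → Carrier) → Distinct n y ×
      (∀ i → i < n → (fhat (ι ∘H ψ) (⟦ ι ⟧ z) (y i) ≈ 0#) × ¬ (y i ^ Q ≈ y i))) → ⊥
  contradiction-at j s l′ μ′ β₀ dims degs {TP} φP zP YP fP nonvanishing {K} cK ψ E bad bad≉0 badDeg rootsAt =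
    let (c₀ , nz , H₁≈0) = Auxiliary.auxiliary φ₁ z₁ Y₁ j s zQ fz₁ cancelY reduced l′ μ′ dims
        (r , reduction) = HH-reduce φ₂ z₂ Y₂ fz₂ l′ μ′ Q′ c₀
    in finish c₀ nz H₁≈0 r reduction
    where
    B = κ ℕ.^ j
    Q′ = κ ℕ.^ s
    Q = κ ℕ.^ (j ℕ.+ s)
    l = suc l′
    μ = suc μ′
    w = wH Q′ l′ μ′
    Ω = DField.ring (Ext.fieldE E)
    fΩ = DField.isDFld (Ext.fieldE E)
    fK = CardField.fld cK
    ι = Ext.emb E
    χ = ι ∘H ψ
    open Kit Ω using (Carrier; _≈_; _+_; _*_; -_; 0#; refl; sym; trans; *-cong; *-congʳ; *-assoc; _^_; ^-congˡ; _-_; x-y≈0⇒x≈y; x*0≈0; 0*x≈0; sumN; sum-cong; sum-zero; sum-*ʳ; sum-comm; Distinct; module ≈R)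
    module K = Kit K using (Carrier; _≈_; 0#; refl; sym; trans; x*0≈0; 0*x≈0)
    module TP = Kit TP using (sym; trans)

    -- All points with first coordinate in K whose second coordinate is moved by the Q-th power map.
    -- In the product over I one relation, hence one family c₀, serves for all of them.
    I : Set
    I = Σ K.Carrier λ z → Σ Carrier λ y → (fhat χ (⟦ ι ⟧ z) y ≈ 0#) × ¬ (y ^ Q ≈ y)

    zI yI : I → Carrier
    zI (z , _) = ⟦ ι ⟧ z
    yI (_ , y , _) = y

    T₁ : Ring
    T₁ = PiRing I (λ _ → Ω)
    module T₁ = Kit T₁ using (Carrier; _≈_; _*_; -_; 0#; _^_; _-_)
    φ₁ : Hom k T₁
    φ₁ = tupleHom (λ _ → χ)
    z₁ Y₁ : T₁.Carrier
    z₁ = mkPi zI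
    Y₁ = mkPi yI
    π₁ : I → Hom T₁ Ω
    π₁ i = projHom {T = λ _ → Ω} i

    zQ : z₁ T₁.^ Q T₁.≈ z₁
    zQ = Pi-ext λ i → trans (⟦⟧-^ (π₁ i) z₁ Q) (trans (^-congˡ Q (proj-mkPi {T = λ _ → Ω} zI i))
      (trans (trans (sym (⟦⟧-^ ι (proj₁ i) Q)) (⟦⟧-cong ι (CardField.fermat cK (proj₁ i)))) (sym (proj-mkPi {T = λ _ → Ω} zI i))))
    fz₁ : fhat φ₁ z₁ Y₁ T₁.≈ T₁.0#
    fz₁ = Pi-ext λ i → trans (fhat-hom φ₁ χ (π₁ i) (proj-tuple {T = λ _ → Ω} (λ _ → χ) i) (proj-mkPi {T = λ _ → Ω} zI i) (proj-mkPi {T = λ _ → Ω} yI i))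
      (trans (proj₁ (proj₂ (proj₂ i))) (sym (⟦⟧-0 (π₁ i))))
    cancelY : ∀ x → (Y₁ T₁.^ Q T₁.- Y₁) T₁.* x T₁.≈ T₁.0# → x T₁.≈ T₁.0#
    cancelY x e = Pi-ext λ i → trans (IsDField.cancel fΩ
      (λ e′ → proj₂ (proj₂ (proj₂ i)) (trans (sym (trans (⟦⟧-^ (π₁ i) Y₁ Q) (^-congˡ Q (proj-mkPi {T = λ _ → Ω} yI i))))
        (trans (x-y≈0⇒x≈y (trans (sym (⟦⟧-- (π₁ i) (Y₁ T₁.^ Q) Y₁)) e′)) (proj-mkPi {T = λ _ → Ω} yI i))))
      (trans (sym (⟦⟧-* (π₁ i) (Y₁ T₁.^ Q T₁.- Y₁) x)) (⟦⟧≈0 (π₁ i) e))) (sym (⟦⟧-0 (π₁ i)))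
    reduced : ∀ x → x T₁.^ B T₁.≈ T₁.0# → x T₁.≈ T₁.0#
    reduced x e = Pi-ext λ i → trans (IsDField.^≈0 fΩ B (trans (sym (⟦⟧-^ (π₁ i) x B)) (⟦⟧≈0 (π₁ i) e))) (sym (⟦⟧-0 (π₁ i)))

    -- H is reduced modulo the curve at the points of I and at the certifying point in the same
    -- ring, so that the reduced coefficients `r` found to vanish by means of I also describe H at
    -- the certifying point.
    T₂ : I ⊎ ⊤ → Ring
    T₂ (inj₁ _) = Ω
    T₂ (inj₂ _) = TP
    R₂ = PiRing (I ⊎ ⊤) T₂
    module R₂ = Kit R₂ using (Carrier; _≈_; _*_; 0#; trans; _^_; 0*x≈0; sumN; sum-zero)
    h₂ : ∀ i → Hom k (T₂ i)
    h₂ (inj₁ _) = χ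
    h₂ (inj₂ _) = φP
    φ₂ : Hom k R₂
    φ₂ = tupleHom h₂
    z₂′ Y₂′ : ∀ i → CommutativeRing.Carrier (T₂ i)
    z₂′ (inj₁ i) = zI i
    z₂′ (inj₂ _) = zP
    Y₂′ (inj₁ i) = yI i
    Y₂′ (inj₂ _) = YP
    z₂ Y₂ : R₂.Carrier
    z₂ = mkPi z₂′
    Y₂ = mkPi Y₂′
    πP : Hom R₂ TP
    πP = projHom {T = T₂} (inj₂ tt)
    π₂ : I → Hom R₂ Ω
    π₂ i = projHom {T = T₂} (inj₁ i)

    fz₂ : fhat φ₂ z₂ Y₂ R₂.≈ R₂.0#
    fz₂ = Pi-ext λ { (inj₁ i) → trans (fhat-hom φ₂ χ (π₂ i) (proj-tuple {T = T₂} h₂ (inj₁ i)) (proj-mkPi {T = T₂} z₂′ (inj₁ i)) (proj-mkPi {T = T₂} Y₂′ (inj₁ i)))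
                       (trans (proj₁ (proj₂ (proj₂ i))) (sym (⟦⟧-0 (π₂ i))))
                   ; (inj₂ tt) → TP.trans (fhat-hom φ₂ φP πP (proj-tuple {T = T₂} h₂ (inj₂ tt)) (proj-mkPi {T = T₂} z₂′ (inj₂ tt)) (proj-mkPi {T = T₂} Y₂′ (inj₂ tt)))
                       (TP.trans fP (TP.sym (⟦⟧-0 πP))) }

    finish : ∀ c₀ → NonzeroCoeff l μ c₀ → HH φ₁ z₁ Y₁ l μ Q′ c₀ T₁.≈ T₁.0# → ∀ (r : ℕ → ℕ → k.Carrier) →
      HH φ₂ z₂ Y₂ l μ Q′ c₀ R₂.≈ R₂.sumN (suc w) (λ e → R₂.sumN n (λ i → ⟦ φ₂ ⟧ (r e i) R₂.* (z₂ R₂.^ e R₂.* Y₂ R₂.^ i))) → ⊥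
    finish c₀ nz H₁≈0 r reduction =
      nonvanishing c₀ nz (TP.trans (TP.sym (HH-hom φ₂ φP πP (proj-tuple {T = T₂} h₂ (inj₂ tt)) (proj-mkPi {T = T₂} z₂′ (inj₂ tt)) (proj-mkPi {T = T₂} Y₂′ (inj₂ tt)) l μ Q′ c₀))
        (⟦⟧≈0 πP H₂≈0))
      where
      module Pk = Poly k using (Pol; ofCoeffs; ofCoeffs-at; ofCoeffs-Deg<; mkP; atP; !0)
      module PkR = Kit (PolyRing k) using (_≈_; _*_; 0#)
      module PK = Poly K using (atP; !0)
      module PKR = Kit (PolyRing K) using (_≈_; 0#)
      module PΩ = Poly Ω using (ofCoeffs; ofCoeffs-at; ofCoeffs-Deg<; atP; !0)
      module PΩR = Kit (PolyRing Ω) using (_≈_; 0#)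
      g : ℕ → Pk.Pol
      g i = Pk.ofCoeffs (suc w) (λ e → r e i)

      eval-g : {S : Ring} (χ : Hom k S) → ∀ x i → let module S = Kit S using (_≈_; _*_; trans; *-congʳ; _^_; sumN; sum-cong) in
        Eval.eval χ x (g i) S.≈ S.sumN (suc w) (λ e → ⟦ χ ⟧ (r e i) S.* x S.^ e)
      eval-g {S} χ x i = S.trans (Eval.eval-sum χ x (g i) (suc w) (Pk.ofCoeffs-Deg< (suc w) (λ e → r e i)))
        (S.sum-cong (suc w) (λ e e< → S.*-congʳ {x S.^ e} (⟦⟧-cong χ (Pk.ofCoeffs-at (suc w) (λ e → r e i) e e<))))
        where module S = Kit S using (_≈_; _*_; trans; *-congʳ; _^_; sumN; sum-cong)

      H-at : ∀ i → sumN n (λ a → Eval.eval χ (zI i) (g a) * yI i ^ a) ≈ 0#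
      H-at i = begin
        sumN n (λ a → Eval.eval χ (zI i) (g a) * yI i ^ a)
          ≈⟨ sum-cong n (λ a _ → trans (*-congʳ {yI i ^ a} (eval-g χ (zI i) a))
               (trans (sum-*ʳ (suc w) (yI i ^ a) (λ e → ⟦ χ ⟧ (r e a) * zI i ^ e))
                 (sum-cong (suc w) (λ e _ → *-assoc (⟦ χ ⟧ (r e a)) (zI i ^ e) (yI i ^ a))))) ⟩
        sumN n (λ a → sumN (suc w) (λ e → ⟦ χ ⟧ (r e a) * (zI i ^ e * yI i ^ a)))
          ≈⟨ sum-comm n (suc w) (λ a e → ⟦ χ ⟧ (r e a) * (zI i ^ e * yI i ^ a)) ⟩
        sumN (suc w) (λ e → sumN n (λ a → ⟦ χ ⟧ (r e a) * (zI i ^ e * yI i ^ a))) ≈⟨ project ⟨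
        ⟦ π₂ i ⟧ (R₂.sumN (suc w) (λ e → R₂.sumN n (λ a → ⟦ φ₂ ⟧ (r e a) R₂.* (z₂ R₂.^ e R₂.* Y₂ R₂.^ a))))
          ≈⟨ ⟦⟧-cong (π₂ i) (reduction) ⟨
        ⟦ π₂ i ⟧ (HH φ₂ z₂ Y₂ l μ Q′ c₀) ≈⟨ HH-hom φ₂ χ (π₂ i) (proj-tuple {T = T₂} h₂ (inj₁ i)) (proj-mkPi {T = T₂} z₂′ (inj₁ i)) (proj-mkPi {T = T₂} Y₂′ (inj₁ i)) l μ Q′ c₀ ⟩
        HH χ (zI i) (yI i) l μ Q′ c₀ ≈⟨ HH-hom φ₁ χ (π₁ i) (proj-tuple {T = λ _ → Ω} (λ _ → χ) i) (proj-mkPi {T = λ _ → Ω} zI i) (proj-mkPi {T = λ _ → Ω} yI i) l μ Q′ c₀ ⟨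
        ⟦ π₁ i ⟧ (HH φ₁ z₁ Y₁ l μ Q′ c₀) ≈⟨ ⟦⟧≈0 (π₁ i) H₁≈0 ⟩
        0# ∎
        where
        open ≈R
        project : ⟦ π₂ i ⟧ (R₂.sumN (suc w) (λ e → R₂.sumN n (λ a → ⟦ φ₂ ⟧ (r e a) R₂.* (z₂ R₂.^ e R₂.* Y₂ R₂.^ a)))) ≈
          sumN (suc w) (λ e → sumN n (λ a → ⟦ χ ⟧ (r e a) * (zI i ^ e * yI i ^ a)))
        project = trans (⟦⟧-sum (π₂ i) (suc w) (λ e → R₂.sumN n (λ a → ⟦ φ₂ ⟧ (r e a) R₂.* (z₂ R₂.^ e R₂.* Y₂ R₂.^ a))))
          (sum-cong (suc w) (λ e _ → trans (⟦⟧-sum (π₂ i) n (λ a → ⟦ φ₂ ⟧ (r e a) R₂.* (z₂ R₂.^ e R₂.* Y₂ R₂.^ a)))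
            (sum-cong n (λ a _ → trans (⟦⟧-* (π₂ i) (⟦ φ₂ ⟧ (r e a)) (z₂ R₂.^ e R₂.* Y₂ R₂.^ a))
              (*-cong (proj-tuple {T = T₂} h₂ (inj₁ i) (r e a)) (trans (⟦⟧-* (π₂ i) (z₂ R₂.^ e) (Y₂ R₂.^ a))
                (*-cong (trans (⟦⟧-^ (π₂ i) z₂ e) (^-congˡ e (proj-mkPi {T = T₂} z₂′ (inj₁ i))))
                        (trans (⟦⟧-^ (π₂ i) Y₂ a) (^-congˡ a (proj-mkPi {T = T₂} Y₂′ (inj₁ i)))))))))))

      -- Over a good z the values g_a(z) are the coefficients of a polynomial of degree less than n
      -- in Y that has the n points of the fibre as roots.
      g-vanishes : ∀ z → ¬ (Eval.eval ψ z bad K.≈ K.0#) → ∀ a → a < n → Eval.eval ψ z (g a) K.≈ K.0#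
      g-vanishes z nb a a< with rootsAt z nb
      ... | y , D , h = hom-inj fK fΩ ι (trans (eval-∘ ψ ι z (g a)) (trans (sym (PΩ.ofCoeffs-at n coef a a<))
          (trans (PΩ.atP zeroPoly a) (PΩ.!0 a))))
        where
        coef : ℕ → Carrier
        coef a = Eval.eval χ (⟦ ι ⟧ z) (g a)
        open PolyDom (IsDField.ddom fΩ) using (root-bound)
        zeroPoly : PΩ.ofCoeffs n coef PΩR.≈ PΩR.0#
        zeroPoly = root-bound n n y (PΩ.ofCoeffs n coef) (PΩ.ofCoeffs-Deg< n coef) ℕₚ.≤-refl D (λ i i< →
          trans (Eval.eval-sum (idHom Ω) (y i) (PΩ.ofCoeffs n coef) n (PΩ.ofCoeffs-Deg< n coef))
            (trans (sum-cong n (λ a a< → *-congʳ {y i ^ a} (PΩ.ofCoeffs-at n coef a a<)))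
              (H-at (z , y i , h i i<))))

      -- The product with `bad` vanishes on all of K, also at the exceptional z, and its degree is
      -- less than |K|.
      g≈0 : ∀ a → a < n → g a PkR.≈ PkR.0#
      g≈0 a a< with IsDDom.nzd (PolyDom.polyDDom (IsDField.ddom fk)) {g a} {bad} product≈0
        where
        open PolyDom (IsDField.ddom fK) using (root-bound)
        gb = g a PkR.* bad
        vanishes : ∀ z → Eval.eval ψ z gb K.≈ K.0#
        vanishes z with IsDField.≟0 fK (Eval.eval ψ z bad)
        ... | yes e = K.trans (⟦⟧-* (Eval.evalHom ψ z) (g a) bad) (K.x*0≈0 e)
        ... | no nb = K.trans (⟦⟧-* (Eval.evalHom ψ z) (g a) bad) (K.0*x≈0 (g-vanishes z nb a a<))
        mapped≈0 : mapP ψ gb PKR.≈ PKR.0#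
        mapped≈0 = root-bound (suc w ℕ.+ β₀) Q (CardField.elem cK) (mapP ψ gb)
          (mapP-Deg< ψ (*-Deg< k (Pk.ofCoeffs-Deg< (suc w) (λ e → r e a)) badDeg)) degs (CardField.elem-distinct cK)
          (λ i _ → K.trans (eval-map ψ (idHom K) (CardField.elem cK i) gb)
            (K.trans (eval-congHom (idHom K ∘H ψ) ψ (λ _ → K.refl) K.refl gb) (vanishes (CardField.elem cK i))))
        product≈0 : gb PkR.≈ PkR.0#
        product≈0 = Pk.mkP λ i → k.trans (hom-inj fk fK ψ (K.trans (K.sym (mapP-at ψ gb i))
          (K.trans (PK.atP mapped≈0 i) (PK.!0 i)))) (k.sym (Pk.!0 i))
      ... | inj₁ e = e
      ... | inj₂ e = ⊥-elim (bad≉0 e)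

      r≈0 : ∀ e a → e < suc w → a < n → r e a k.≈ k.0#
      r≈0 e a e< a< = k.trans (k.sym (Pk.ofCoeffs-at (suc w) (λ e → r e a) e e<)) (k.trans (Pk.atP (g≈0 a a<) e) (Pk.!0 e))

      H₂≈0 : HH φ₂ z₂ Y₂ l μ Q′ c₀ R₂.≈ R₂.0#
      H₂≈0 = R₂.trans (reduction) (R₂.sum-zero (suc w) (λ e e< → R₂.sum-zero n (λ a a< →
        R₂.0*x≈0 {⟦ φ₂ ⟧ (r e a)} {z₂ R₂.^ e R₂.* Y₂ R₂.^ a} (⟦⟧≈0 φ₂ (r≈0 e a e< a<)))))

-- Independent power series and the nonvanishing of H

¬¬valuation-bound : {L : Ring} → IsDField L → let open Kit L using (Carrier; _≈_; _+_; _*_; -_; 0#; 1#; refl; sym; trans; +-cong; +-congˡ; +-congʳ; *-congʳ; -‿cong; +-assoc; +-comm; +-identityˡ; *-assoc; *-comm; *-identityˡ; distribʳ; zeroˡ; -‿distribˡ-*; -‿distribʳ-*; _-_; x-x; distribˡ--; x*0≈0; 0*x≈0; 0+0≈0; 0+x≈x; x+0≈x; sumN; sum-cong; sum-zero; sum-+; sum-*ˡ; sum-neg; sum-last; module +S; module ≈R) in ∀ U (v : ℕ → ℕ → Carrier) →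
  (∀ d → (∀ i → sumN U (λ u → d u * v u i) ≈ 0#) → ∀ u → u < U → d u ≈ 0#) →
  ¬ ¬ (∃ λ V → ∀ d → (∀ i → i < V → sumN U (λ u → d u * v u i) ≈ 0#) → ∀ u → u < U → d u ≈ 0#)
¬¬valuation-bound fld zero v ind k = k (0 , λ d _ u ())
-- If the last series is no combination of the others modulo X^V′, then V′ still serves. Otherwise
-- it differs from such a combination, though not identically by independence, and the bound is
-- raised beyond the index i₀ of a nonzero coefficient of the difference.
¬¬valuation-bound {L} fld (suc U) v ind k = ¬¬valuation-bound fld U v indU λ { (V′ , bnd) →
  ¬¬-excluded-middle {A = ∃ λ (d′ : ℕ → Carrier) → ∀ i → i < V′ → v U i - sumN U (λ u → d′ u * v u i) ≈ 0#} λ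
  { (no none) → k (V′ , λ d h →
      let dU = lastZero V′ none d h in
      pick d dU (bnd d (λ i i< → trans (sym (x+0≈x (0*x≈0 dU))) (trans (sym (sum-last U (λ u → d u * v u i))) (h i i<)))))
  ; (yes (d′ , small)) → nonzeroCoeff d′ λ { (i₀ , x≉0) → k (V′ ℕ.⊔ suc i₀ , λ d h →
      let low : ∀ u → u < U → d u + d U * d′ u ≈ 0#
          low = bnd (λ u → d u + d U * d′ u) (λ i i< →
            trans (sym (x+0≈x (x*0≈0 (small i i<)))) (trans (sym (split d d′ i)) (h i (ℕₚ.<-≤-trans i< (ℕₚ.m≤m⊔n V′ (suc i₀))))))
          top : d U * (v U i₀ - sumN U (λ u → d′ u * v u i₀)) ≈ 0#
          top = trans (sym (0+x≈x (sum-zero U (λ u u< → 0*x≈0 (low u u<)))))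
            (trans (sym (split d d′ i₀)) (h i₀ (ℕₚ.m≤n⊔m V′ (suc i₀))))
          dU : d U ≈ 0#
          dU = IsDField.cancel fld x≉0 (trans (*-comm _ _) top)
      in pick d dU (λ u u< → trans (sym (x+0≈x (0*x≈0 dU))) (low u u<))) } } }
  where
  open Kit L using (Carrier; _≈_; _+_; _*_; -_; 0#; 1#; refl; sym; trans; +-cong; +-congˡ; +-congʳ; *-congʳ; -‿cong; +-assoc; +-comm; +-identityˡ; *-assoc; *-comm; *-identityˡ; distribʳ; zeroˡ; -‿distribˡ-*; -‿distribʳ-*; _-_; x-x; distribˡ--; x*0≈0; 0*x≈0; 0+0≈0; 0+x≈x; x+0≈x; sumN; sum-cong; sum-zero; sum-+; sum-*ˡ; sum-neg; sum-last; module +S; module ≈R)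
  pick : ∀ d → d U ≈ 0# → (∀ u → u < U → d u ≈ 0#) → ∀ u → u < suc U → d u ≈ 0#
  pick d dU dlow u u< with ℕₚ.m≤n⇒m<n∨m≡n (ℕₚ.≤-pred u<)
  ... | inj₁ lt = dlow u lt
  ... | inj₂ ≡.refl = dU
  pad : (ℕ → Carrier) → Carrier → ℕ → Carrier
  pad d a u with u ℕ.<? U
  ... | yes _ = d u
  ... | no _ = a
  pad-low : ∀ d a u → u < U → pad d a u ≈ d u
  pad-low d a u u< with u ℕ.<? U
  ... | yes _ = refl
  ... | no nu = ⊥-elim (nu u<)
  pad-top : ∀ d a → pad d a U ≈ a
  pad-top d a with U ℕ.<? U
  ... | yes lt = ⊥-elim (ℕₚ.<-irrefl ≡.refl lt)
  ... | no _ = refl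
  pad-sum : ∀ d a i → sumN (suc U) (λ u → pad d a u * v u i) ≈ sumN U (λ u → d u * v u i) + a * v U i
  pad-sum d a i = trans (sum-last U _) (+-cong (sum-cong U (λ u u< → *-congʳ (pad-low d a u u<))) (*-congʳ (pad-top d a)))
  indU : ∀ d → (∀ i → sumN U (λ u → d u * v u i) ≈ 0#) → ∀ u → u < U → d u ≈ 0#
  indU d h u u< = trans (sym (pad-low d 0# u u<))
    (ind (pad d 0#) (λ i → trans (pad-sum d 0# i) (0+0≈0 (h i) (zeroˡ _))) u (ℕₚ.m≤n⇒m≤1+n u<))
  split : ∀ d d′ i → sumN (suc U) (λ u → d u * v u i) ≈
    sumN U (λ u → (d u + d U * d′ u) * v u i) + d U * (v U i - sumN U (λ u → d′ u * v u i))
  split d d′ i = begin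
    sumN (suc U) (λ u → d u * v u i) ≈⟨ sum-last U _ ⟩
    A + d U * v U i ≈⟨ +-congˡ (+-identityˡ _) ⟨
    A + (0# + d U * v U i) ≈⟨ +-congˡ (+-congʳ (x-x (d U * D))) ⟨
    A + ((d U * D - d U * D) + d U * v U i) ≈⟨ +-congˡ (+S.xy∙z≈x∙zy _ _ _) ⟩
    A + (d U * D + (d U * v U i - d U * D)) ≈⟨ +-assoc _ _ _ ⟨
    (A + d U * D) + (d U * v U i - d U * D) ≈⟨ +-cong (trans (+-congˡ (sum-*ˡ U _ _)) (trans (sym (sum-+ U _ _))
      (sum-cong U (λ u _ → trans (+-congˡ (sym (*-assoc _ _ _))) (sym (distribʳ _ _ _)))))) (sym (distribˡ-- _ _ _)) ⟩
    sumN U (λ u → (d u + d U * d′ u) * v u i) + d U * (v U i - D) ∎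
    where
    open ≈R
    A = sumN U (λ u → d u * v u i)
    D = sumN U (λ u → d′ u * v u i)
  lastZero : ∀ V′ → ¬ (∃ λ (d′ : ℕ → Carrier) → ∀ i → i < V′ → v U i - sumN U (λ u → d′ u * v u i) ≈ 0#) →
    ∀ d → (∀ i → i < V′ → sumN (suc U) (λ u → d u * v u i) ≈ 0#) → d U ≈ 0#
  lastZero V′ none d h with IsDField.≟0 fld (d U)
  ... | yes e = e
  ... | no nz = ⊥-elim (none (d′ , λ i i< → IsDField.cancel fld nz
      (trans (sym (0+x≈x (sum-zero U (λ u _ → 0*x≈0 (d′-zero u))))) (trans (sym (split d d′ i)) (h i i<)))))
    where
    a = proj₁ (IsDField.inv fld (d U) nz)
    d′ : ℕ → Carrier
    d′ u = - (a * d u)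
    d′-zero : ∀ u → d u + d U * d′ u ≈ 0#
    d′-zero u = trans (+-congˡ (trans (sym (-‿distribʳ-* _ _)) (-‿cong (trans (sym (*-assoc _ _ _))
      (trans (*-congʳ (proj₂ (IsDField.inv fld (d U) nz))) (*-identityˡ _)))))) (x-x _)
  nonzeroCoeff : ∀ d′ → ¬ ¬ (∃ λ i → ¬ (v U i - sumN U (λ u → d′ u * v u i) ≈ 0#))
  nonzeroCoeff d′ none = IsDField.1≉0 fld (trans (sym (pad-top (λ u → - d′ u) 1#))
    (ind (pad (λ u → - d′ u) 1#) (λ i → trans (pad-sum (λ u → - d′ u) 1# i) (trans (+-comm _ _)
      (trans (+-cong (*-identityˡ _) (trans (sum-cong U (λ u _ → sym (-‿distribˡ-* _ _))) (sym (sum-neg U _)))) (coef i)))) U ℕₚ.≤-refl))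
    where
    coef : ∀ i → v U i - sumN U (λ u → d′ u * v u i) ≈ 0#
    coef i with IsDField.≟0 fld (v U i - sumN U (λ u → d′ u * v u i))
    ... | yes e = e
    ... | no ne = ⊥-elim (none (i , ne))

module SeriesKit {L : Ring} (fL : IsDField L) where
  open PS L
  private module L = Kit L using (_≈_; _*_; 0#; 1#; refl; sym; trans; +-congˡ; -‿cong; *-comm; *-identityˡ; -0#≈0#; ≡⇒≈; 0+0≈0; 0+x≈x; x+0≈x; sumN; sum-nil; sum-suc)

  Low : ℕ → S.Carrier → Set
  Low N f = ∀ i → i < N → coefs f i L.≈ L.0#

  Low-resp : ∀ {N f g} → f S.≈ g → Low N f → Low N g
  Low-resp e h i lt = L.trans (L.sym (at≈ e i)) (h i lt)

  Low-mono : ∀ {N M f} → N ≤ M → Low M f → Low N f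
  Low-mono le h i lt = h i (ℕₚ.<-≤-trans lt le)

  Low-+ : ∀ {N} f g → Low N f → Low N g → Low N (f S.+ g)
  Low-+ f g hf hg i lt = L.trans (S+ f g i) (L.0+0≈0 (hf i lt) (hg i lt))

  Low-neg : ∀ {N} f → Low N f → Low N (S.- f)
  Low-neg f hf i lt = L.trans (S-neg f i) (L.trans (L.-‿cong (hf i lt)) L.-0#≈0#)

  Low-* : ∀ {N M} f g → Low N f → Low M g → Low (N ℕ.+ M) (f S.* g)
  Low-* {N} {M} f g hf hg i lt = L.trans (S* f g i) (⊛-low-zero N M hf hg i lt)

  Low-*ʳ : ∀ {N} f g → Low N g → Low N (f S.* g)
  Low-*ʳ f g hg = Low-* {0} f g (λ i ()) hg

  -- A power at least doubles a positive order; the gain of one is what the convergence of the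
  -- branch needs.
  Low-^ : ∀ {N} f Q → 1 < Q → 0 < N → Low N f → Low (suc N) (f S.^ Q)
  Low-^ {N} f (suc (suc Q)) (s≤s (s≤s _)) N>0 h = Low-mono (ℕₚ.+-monoˡ-≤ N N>0)
    (Low-* {N} {N} f (f S.* f S.^ Q) h (Low-resp (S.*-comm (f S.^ Q) f) (Low-*ʳ (f S.^ Q) f h)))

  Low-sum : ∀ {N} m f → (∀ i → i < m → Low N (f i)) → Low N (S.sumN m f)
  Low-sum zero f h = Low-resp (S.sym (S.sum-nil f)) (λ i lt → S0 i)
  Low-sum (suc m) f h = Low-resp (S.sym (S.sum-suc m f))
    (Low-+ (f 0) (S.sumN m (f ∘ suc)) (h 0 (s≤s z≤n)) (Low-sum m (f ∘ suc) (λ i lt → h (suc i) (s≤s lt))))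

  Low-all : ∀ {f} → (∀ N → Low N f) → f S.≈ S.0#
  Low-all h = mk≈ λ i → L.trans (h (suc i) i ℕₚ.≤-refl) (L.sym (S0 i))

  X : S.Carrier
  X = mkS (shift 1 (const L.1#))

  X-* : ∀ f i → coefs (X S.* f) i L.≈ shift1 (coefs f) i
  X-* f i = L.trans (S* X f i) (L.trans (⊛-cong (mkS-at _) (λ _ → L.refl) i)
    (L.trans (shift1-⊛ (const L.1#) (coefs f) i) (shift1-cong (λ j → L.trans (const-⊛ L.1# (coefs f) j) (L.*-identityˡ _)) i)))

  X^-* : ∀ N f i → coefs (X S.^ N S.* f) i L.≈ shift N (coefs f) i
  X^-* zero f i = at≈ (S.*-identityˡ f) i
  X^-* (suc N) f i = L.trans (at≈ (S.*-assoc X (X S.^ N) f) i)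
    (L.trans (X-* (X S.^ N S.* f) i) (shift1-cong (X^-* N f) i))

  X^-*-at : ∀ N f i → coefs (X S.^ N S.* f) (N ℕ.+ i) L.≈ coefs f i
  X^-*-at N f i = L.trans (X^-* N f (N ℕ.+ i)) (L.≡⇒≈ (shift-at N (coefs f) i))

  X^-*-low : ∀ N f → Low N (X S.^ N S.* f)
  X^-*-low N f i lt = L.trans (X^-* N f i) (L.≡⇒≈ (shift-below N (coefs f) i lt))

  X^-cancel : ∀ N f → X S.^ N S.* f S.≈ S.0# → f S.≈ S.0#
  X^-cancel N f e = mk≈ λ i → L.trans (L.sym (X^-*-at N f i)) (L.trans (at≈ e (N ℕ.+ i)) (L.trans (S0 (N ℕ.+ i)) (L.sym (S0 i))))

  tailAfter : ℕ → S.Carrier → S.Carrier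
  tailAfter N f = mkS (λ i → coefs f (N ℕ.+ suc i))

  leading : ∀ N f → Low N f → f S.≈ X S.^ N S.* (⟦ constHom ⟧ (coefs f N) S.+ X S.* tailAfter N f)
  leading N f h = mk≈ λ i → L.sym (L.trans (X^-* N _ i) (go i))
    where
    g = tailAfter N f
    c = ⟦ constHom ⟧ (coefs f N)
    inner : ∀ j → coefs (c S.+ X S.* g) j L.≈ coefs f (N ℕ.+ j)
    inner zero = L.trans (S+ c (X S.* g) 0) (L.trans (L.x+0≈x (X-* g 0))
      (L.trans (constHom-at _ 0) (L.≡⇒≈ (≡.cong (coefs f) (≡.sym (ℕₚ.+-identityʳ N))))))
    inner (suc j) = L.trans (S+ c (X S.* g) (suc j)) (L.trans (L.0+x≈x (constHom-at _ (suc j)))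
      (L.trans (X-* g (suc j)) (mkS-at _ j)))
    go : ∀ i → shift N (coefs (c S.+ X S.* g)) i L.≈ coefs f i
    go i with i ℕ.<? N
    ... | yes lt = L.trans (L.≡⇒≈ (shift-below N _ i lt)) (L.sym (h i lt))
    ... | no nlt = ≡.subst (λ j → shift N (coefs (c S.+ X S.* g)) j L.≈ coefs f j) (ℕₚ.m+[n∸m]≡n (ℕₚ.≮⇒≥ nlt))
      (L.trans (L.≡⇒≈ (shift-at N _ (i ℕ.∸ N))) (inner (i ℕ.∸ N)))

  const-*-at : ∀ c f i → coefs (⟦ constHom ⟧ c S.* f) i L.≈ c L.* coefs f i
  const-*-at c f i = L.trans (S* (⟦ constHom ⟧ c) f i) (L.trans (⊛-cong (constHom-at c) (λ _ → L.refl) i) (const-⊛ c (coefs f) i))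

  sum-at : ∀ n f i → coefs (S.sumN n f) i L.≈ L.sumN n (λ j → coefs (f j) i)
  sum-at zero f i = L.trans (at≈ (S.sum-nil f) i) (L.trans (S0 i) (L.sym (L.sum-nil _)))
  sum-at (suc n) f i = L.trans (at≈ (S.sum-suc n f) i) (L.trans (S+ (f 0) (S.sumN n (f ∘ suc)) i)
    (L.trans (L.+-congˡ (sum-at n (f ∘ suc) i)) (L.sym (L.sum-suc n _))))

  -- Equality of series is not decidable, so f ≠ 0 does not exhibit a nonzero coefficient. Instead,
  -- a first nonzero coefficient of g would force the coefficients of f to vanish one after the
  -- other.
  seriesCancel : ∀ f g → f S.* g S.≈ S.0# → ¬ (f S.≈ S.0#) → g S.≈ S.0#
  seriesCancel f g e f≉0 = Low-all go
    where
    open IsDField fL using (≟0; cancel)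
    go : ∀ N → Low N g
    go (suc N) i lt with ℕₚ.m≤n⇒m<n∨m≡n (ℕₚ.≤-pred lt)
    ... | inj₁ i<N = go N i i<N
    ... | inj₂ ≡.refl with ≟0 (coefs g i)
    ...   | yes g0 = g0
    ...   | no gi = ⊥-elim (f≉0 (Low-all lowf))
      where
      lowf : ∀ M → Low M f
      lowf (suc M) a lt with ℕₚ.m≤n⇒m<n∨m≡n (ℕₚ.≤-pred lt)
      ... | inj₁ a<M = lowf M a a<M
      ... | inj₂ ≡.refl = cancel gi (L.trans (L.*-comm _ _) (L.trans (L.sym (⊛-low a i (lowf a) (go i)))
        (L.trans (L.sym (S* f g (a ℕ.+ i))) (L.trans (at≈ e (a ℕ.+ i)) (S0 _)))))

module NonVanishing {p hk κ : ℕ} {k : Ring} (ck : CardField κ k) (pr : Prime p) (κ≡ : κ ≡ p ℕ.^ hk)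
                    (n2′ δ : ℕ) (F : ℕ → ℕ → CommutativeRing.Carrier k)
                    {L : Ring} (fL : IsDField L) (emb : Hom k L)
                    (z Y : CommutativeRing.Carrier (PSRing L)) where
  open Stepanov {hk = hk} ck pr κ≡ n2′ δ F using (n; HH; NonzeroCoeff)
  open PS L using (coefs; S+; S0; at≈; mk≈; constHom)
  open SeriesKit fL using (Low; X; X^-*-low; X^-cancel; tailAfter; leading; const-*-at; sum-at)
  open Kit (PSRing L) using (Carrier; _≈_; _+_; _*_; 0#; refl; sym; trans; +-cong; +-congˡ; *-cong; *-congˡ; *-congʳ; *-comm; distribˡ; _^_; ^-homo-*; ^-assocʳ; ^-distrib-*; ≡⇒≈; x+0≈x; sumN; sum-cong; sum-+; sum-*ˡ; sum-nest; module *S; module ≈R)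
  private
    module L = Kit L using (Carrier; _≈_; _*_; 0#; sym; trans; *-congˡ; _^_; ≡⇒≈; x+0≈x; sumN; sum-cong; sum-nest)
    module k = Kit k using (Carrier)

  φP : Hom k (PSRing L)
  φP = constHom ∘H emb

  mn : ℕ → ℕ → Carrier
  mn a b = z ^ a * Y ^ b

  sum2 : ℕ → ℕ → (ℕ → ℕ → Carrier) → Carrier
  sum2 A B f = sumN A (λ a → sumN B (λ b → f a b))

  sum2-cong : ∀ A B {f g} → (∀ a b → a < A → b < B → f a b ≈ g a b) → sum2 A B f ≈ sum2 A B g
  sum2-cong A B h = sum-cong A (λ a a< → sum-cong B (λ b b< → h a b a< b<))

  sum2-+ : ∀ A B f g → sum2 A B f + sum2 A B g ≈ sum2 A B (λ a b → f a b + g a b)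
  sum2-+ A B f g = sym (trans (sum-cong A (λ a _ → sum-+ B (f a) (g a))) (sum-+ A _ _))

  sum2-*ˡ : ∀ A B x f → x * sum2 A B f ≈ sum2 A B (λ a b → x * f a b)
  sum2-*ˡ A B x f = trans (sum-*ˡ A x _) (sum-cong A (λ a _ → sum-*ˡ B x (f a)))

  sum2-hom : (ψ : Hom (PSRing L) (PSRing L)) → ∀ A B f → ⟦ ψ ⟧ (sum2 A B f) ≈ sum2 A B (λ a b → ⟦ ψ ⟧ (f a b))
  sum2-hom ψ A B f = trans (⟦⟧-sum ψ A _) (sum-cong A (λ a _ → ⟦⟧-sum ψ B (f a)))

  module _ (indep : ∀ A (d : ℕ → ℕ → L.Carrier) → sum2 A n (λ a b → ⟦ constHom ⟧ (d a b) * mn a b) ≈ 0# →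
                    ∀ a b → a < A → b < n → d a b L.≈ L.0#) where
    private
      v : ℕ → ℕ → L.Carrier
      v u i = coefs (mn (u / n) (u % n)) i

      sum-v : ∀ l (d : ℕ → L.Carrier) i → coefs (sum2 l n (λ a b → ⟦ constHom ⟧ (d (a ℕ.* n ℕ.+ b)) * mn a b)) i
        L.≈ L.sumN (l ℕ.* n) (λ u → d u L.* v u i)
      sum-v l d i = L.trans (sum-at l _ i) (L.trans (L.sum-cong l (λ a _ → L.trans (sum-at n _ i)
          (L.sum-cong n (λ b b< → L.trans (const-*-at _ (mn a b) i) (L.*-congˡ (L.≡⇒≈ (≡.sym (decode a b b<))))))))
        (L.sym (L.sum-nest l n (λ u → d u L.* v u i))))
        where
        decode : ∀ a b → b < n → v (a ℕ.* n ℕ.+ b) i ≡ coefs (mn a b) i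
        decode a b b< rewrite pair-/ n a b b< | pair-% n a b b< = ≡.refl

      ind-v : ∀ l d → (∀ i → L.sumN (l ℕ.* n) (λ u → d u L.* v u i) L.≈ L.0#) → ∀ u → u < l ℕ.* n → d u L.≈ L.0#
      ind-v l d h u u< = L.trans (L.≡⇒≈ (≡.cong d (pair-decode n u)))
        (indep l (λ a b → d (a ℕ.* n ℕ.+ b)) (mk≈ λ i → L.trans (sum-v l d i) (L.trans (h i) (L.sym (S0 i))))
          (u / n) (u % n) (m<n*o⇒m/o<n u<) (m%n<n u n))

    -- H is the sum of the z^α Y^β e^Q′, where e = `e α β` is a combination of the z^α′ Y^β′ over k
    -- and not all of these are zero. If v₀ is their least order, then division by X^(v₀ Q′) leaves,
    -- modulo X^Q′, a combination of the z^α Y^β whose constant coefficients are the Q′-th powers of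
    -- the lowest terms. For Q′ ≥ V these vanish if H does, against the choice of v₀.
    ¬¬nonvanishing : ∀ l μ → ¬ ¬ (∃ λ V → ∀ s → V ≤ κ ℕ.^ s → ∀ c → NonzeroCoeff l μ c →
      ¬ (HH φP z Y l μ (κ ℕ.^ s) c ≈ 0#))
    ¬¬nonvanishing l μ k′ = ¬¬valuation-bound fL (l ℕ.* n) v (ind-v l) λ { (V , bnd) → k′ (V , contra V bnd) }
      where
      contra : ∀ V → (∀ d → (∀ i → i < V → L.sumN (l ℕ.* n) (λ u → d u L.* v u i) L.≈ L.0#) → ∀ u → u < l ℕ.* n → d u L.≈ L.0#) →
        ∀ s → V ≤ κ ℕ.^ s → ∀ c → NonzeroCoeff l μ c → ¬ (HH φP z Y l μ (κ ℕ.^ s) c ≈ 0#)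
      contra V bnd s V≤ c (α₀ , β₀ , α₁ , β₁ , α₀< , β₀< , α₁< , β₁< , nz) H≈0 =
        someCoeff λ some → ¬¬-least some λ { (v₀ , (α , β , α< , β< , ne) , least) → finish v₀ least α β α< β< ne }
        where
        Q′ = κ ℕ.^ s
        frobQ = frobκ (charP-hom φP (CardField.charP ck hk pr κ≡)) hk κ≡ s
        e : ℕ → ℕ → Carrier
        e α β = sum2 μ n (λ α′ β′ → φP ⟦⟧$ c α β α′ β′ * mn α′ β′)
          where
          _⟦⟧$_ : Hom k (PSRing L) → k.Carrier → Carrier
          ψ ⟦⟧$ x = ⟦ ψ ⟧ x
          infixl 8 _⟦⟧$_
        P : ℕ → Set
        P i = ∃ λ α → ∃ λ β → α < l × β < n × ¬ (coefs (e α β) i L.≈ L.0#)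
        someCoeff : ¬ ¬ (∃ P)
        someCoeff none = nz (hom-inj (CardField.fld ck) fL emb (indep μ (λ α′ β′ → ⟦ emb ⟧ (c α₀ β₀ α′ β′))
          (mk≈ λ i → L.trans (coef i) (L.sym (S0 i))) α₁ β₁ α₁< β₁<))
          where
          coef : ∀ i → coefs (e α₀ β₀) i L.≈ L.0#
          coef i with IsDField.≟0 fL (coefs (e α₀ β₀) i)
          ... | yes p = p
          ... | no np = ⊥-elim (none (i , α₀ , β₀ , α₀< , β₀< , np))
        finish : ∀ v₀ → (∀ m → m < v₀ → ¬ P m) → ∀ α β → α < l → β < n → ¬ (coefs (e α β) v₀ L.≈ L.0#) → ⊥
        finish v₀ least α β α< β< ne = ne (IsDField.^≈0 fL Q′ (L.trans (L.≡⇒≈ (≡.sym (decode α β β<)))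
          (bnd d small (α ℕ.* n ℕ.+ β) (pair-< l n α< β<))))
          where
          open ≈R
          ε : ℕ → ℕ → L.Carrier
          ε α β = coefs (e α β) v₀
          g : ℕ → ℕ → Carrier
          g α β = tailAfter v₀ (e α β)
          low : ∀ α β → α < l → β < n → Low v₀ (e α β)
          low α β α< β< i i< with IsDField.≟0 fL (coefs (e α β) i)
          ... | yes p = p
          ... | no np = ⊥-elim (least i i< (α , β , α< , β< , np))
          d : ℕ → L.Carrier
          d u = ε (u / n) (u % n) L.^ Q′
          decode : ∀ α β → β < n → d (α ℕ.* n ℕ.+ β) ≡ ε α β L.^ Q′
          decode α β β< rewrite pair-/ n α β β< | pair-% n α β β< = ≡.refl
          Θ = sum2 l n (λ α β → ⟦ constHom ⟧ (d (α ℕ.* n ℕ.+ β)) * mn α β)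
          Γ = sum2 l n (λ α β → mn α β * g α β ^ Q′)
          M = v₀ ℕ.* Q′
          fixc : ∀ x → ⟦ φP ⟧ x ^ Q′ ≈ ⟦ φP ⟧ x
          fixc x = trans (sym (⟦⟧-^ φP x Q′)) (⟦⟧-cong φP (CardField.fermat-^ ck s x))
          power : ∀ x a b → x ^ (a ℕ.+ b ℕ.* Q′) ≈ x ^ a * (x ^ b) ^ Q′
          power x a b = trans (^-homo-* x a (b ℕ.* Q′)) (*-congˡ (sym (^-assocʳ x b Q′)))
          regroup : HH φP z Y l μ Q′ c ≈ sum2 l n (λ α β → mn α β * e α β ^ Q′)
          regroup = sum2-cong l n (λ α β _ _ → begin
            sum2 μ n (λ α′ β′ → ⟦ φP ⟧ (c α β α′ β′) * (z ^ (α ℕ.+ α′ ℕ.* Q′) * Y ^ (β ℕ.+ β′ ℕ.* Q′)))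
              ≈⟨ sum2-cong μ n (λ α′ β′ _ _ → trans (*-cong (sym (fixc _)) (trans (*-cong (power z α α′) (power Y β β′)) (*S.interchange _ _ _ _)))
                   (trans (*S.x∙yz≈y∙xz _ _ _) (*-congˡ (sym (trans (^-distrib-* _ _ Q′) (*-congˡ (^-distrib-* _ _ Q′))))))) ⟩
            sum2 μ n (λ α′ β′ → mn α β * (⟦ φP ⟧ (c α β α′ β′) * mn α′ β′) ^ Q′) ≈⟨ sum2-*ˡ μ n _ _ ⟨
            mn α β * sum2 μ n (λ α′ β′ → (⟦ φP ⟧ (c α β α′ β′) * mn α′ β′) ^ Q′) ≈⟨ *-congˡ (sum2-hom frobQ μ n _) ⟨
            mn α β * e α β ^ Q′ ∎)
          lead : ∀ α β → α < l → β < n → mn α β * e α β ^ Q′ ≈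
            X ^ M * (⟦ constHom ⟧ (d (α ℕ.* n ℕ.+ β)) * mn α β + X ^ Q′ * (mn α β * g α β ^ Q′))
          lead α β α< β< = begin
            mn α β * e α β ^ Q′ ≈⟨ *-congˡ (⟦⟧-cong frobQ (leading v₀ (e α β) (low α β α< β<))) ⟩
            mn α β * (X ^ v₀ * (C + X * g α β)) ^ Q′
              ≈⟨ *-congˡ (trans (⟦⟧-* frobQ _ _) (*-cong (^-assocʳ X v₀ Q′) (trans (⟦⟧-+ frobQ _ _) (+-congˡ (⟦⟧-* frobQ _ _))))) ⟩
            mn α β * (X ^ M * (C ^ Q′ + X ^ Q′ * g α β ^ Q′)) ≈⟨ *S.x∙yz≈y∙xz _ _ _ ⟩
            X ^ M * (mn α β * (C ^ Q′ + X ^ Q′ * g α β ^ Q′)) ≈⟨ *-congˡ (trans (distribˡ _ _ _) (+-cong (trans (*-comm _ _) (*-congʳ Cd)) (*S.x∙yz≈y∙xz _ _ _))) ⟩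
            X ^ M * (⟦ constHom ⟧ (d (α ℕ.* n ℕ.+ β)) * mn α β + X ^ Q′ * (mn α β * g α β ^ Q′)) ∎
            where
            C = ⟦ constHom ⟧ (ε α β)
            Cd : C ^ Q′ ≈ ⟦ constHom ⟧ (d (α ℕ.* n ℕ.+ β))
            Cd = trans (sym (⟦⟧-^ constHom (ε α β) Q′)) (⟦⟧-cong constHom (L.≡⇒≈ (≡.sym (decode α β β<))))
          factored : X ^ M * (Θ + X ^ Q′ * Γ) ≈ 0#
          factored = begin
            X ^ M * (Θ + X ^ Q′ * Γ) ≈⟨ *-congˡ (trans (+-congˡ (sum2-*ˡ l n _ _)) (sum2-+ l n _ _)) ⟩
            X ^ M * sum2 l n (λ α β → ⟦ constHom ⟧ (d (α ℕ.* n ℕ.+ β)) * mn α β + X ^ Q′ * (mn α β * g α β ^ Q′)) ≈⟨ sum2-*ˡ l n _ _ ⟩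
            sum2 l n (λ α β → X ^ M * (⟦ constHom ⟧ (d (α ℕ.* n ℕ.+ β)) * mn α β + X ^ Q′ * (mn α β * g α β ^ Q′)))
              ≈⟨ sum2-cong l n (λ α β α< β< → sym (lead α β α< β<)) ⟩
            sum2 l n (λ α β → mn α β * e α β ^ Q′) ≈⟨ regroup ⟨
            HH φP z Y l μ Q′ c ≈⟨ H≈0 ⟩
            0# ∎
          small : ∀ i → i < V → L.sumN (l ℕ.* n) (λ u → d u L.* v u i) L.≈ L.0#
          small i i<V = L.trans (L.sym (sum-v l d i)) (L.trans (L.sym (L.x+0≈x (X^-*-low Q′ Γ i (ℕₚ.<-≤-trans i<V V≤))))
            (L.trans (L.sym (S+ Θ (X ^ Q′ * Γ) i)) (L.trans (at≈ (X^-cancel M _ factored) i) (S0 i))))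

-- Factors of a polynomial in x^q

module Support (F : DField) {p : ℕ} (ch : CharP p (DField.ring F)) where
  open DField F renaming (ring to L; isDFld to fld)
  open Kit L using (Carrier; _≈_; _+_; _*_; -_; 0#; 1#; refl; sym; trans; +-cong; +-congˡ; +-congʳ; *-congˡ; *-congʳ; -‿cong; +-comm; +-identityˡ; *-assoc; *-comm; *-identityˡ; distribʳ; -‿distribʳ-*; _^_; _×ₙ_; _-_; x+y≈z⇒x≈z-y; distribˡ--; x*0≈0; 0*x≈0; 0+x≈x; x+0≈x; ×ₙ-zero; module *S; module ≈R)
  open Poly L using (module P; Pol; cf; mkPol; bound; vanish; cf-mkPol; mkP; atP; !+; !*; !0; _!_; Deg<; module Deg<; van; below; Deg<-resp; Deg<-mono; Deg<-1; C; tail; _⊛_; ⊛-cong)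
  open Theta L
  open FieldPoly F using (deg?; module PD; factor-Deg<)

  Supp : ℕ → Pol → Set
  Supp m f = ∀ i → ¬ (m ∣ i) → f ! i ≈ 0#

  private
    drop : ℕ → C → C
    drop j f i = f (j ℕ.+ i)

    ⊛-jump : ∀ j f g m → (∀ i → i < j → f i ≈ 0#) → (f ⊛ g) (j ℕ.+ m) ≈ (drop j f ⊛ g) m
    ⊛-jump zero f g m h = refl
    ⊛-jump (suc j) f g m h = trans (0+x≈x (0*x≈0 (h 0 (s≤s z≤n)))) (⊛-jump j (tail f) g m (λ i lt → h (suc i) (s≤s lt)))

    p′ = ℕ.pred p
    p≡ : p ≡ suc p′
    p≡ = ≡.sym (ℕₚ.suc-pred p {{ℕ.>-nonZero (prime>0 (CharP.isPrime ch))}})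

    compress : C → C
    compress f n = f (n ℕ.* p)

    small∤ : ∀ i → 0 < i → i < p → ¬ (p ∣ i)
    small∤ (suc i) _ lt d = ℕₚ.<⇒≱ lt (∣⇒≤ d)

    drop-supp : ∀ f → (∀ i → ¬ (p ∣ i) → f i ≈ 0#) → ∀ i → ¬ (p ∣ i) → drop p f i ≈ 0#
    drop-supp f h i nd = h (p ℕ.+ i) (λ d → nd (∣m+n∣m⇒∣n d (divides 1 (≡.sym (ℕₚ.*-identityˡ p)))))

    compress-⊛ : ∀ n f g → (∀ i → ¬ (p ∣ i) → f i ≈ 0#) → (f ⊛ g) (n ℕ.* p) ≈ (compress f ⊛ compress g) n
    compress-⊛ zero f g h = refl
    compress-⊛ (suc n) f g h = trans step (+-congˡ (compress-⊛ n (drop p f) g (drop-supp f h)))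
      where
      go : ∀ p₁ → p ≡ suc p₁ → (f ⊛ g) (suc p₁ ℕ.+ n ℕ.* p) ≈ f 0 * g (suc p₁ ℕ.+ n ℕ.* p) + (drop (suc p₁) f ⊛ g) (n ℕ.* p)
      go p₁ e = +-congˡ (⊛-jump p₁ (tail f) g (n ℕ.* p) (λ i lt → h (suc i) (small∤ (suc i) (s≤s z≤n) (≡.subst (suc i <_) (≡.sym e) (s≤s lt)))))
      step : (f ⊛ g) (p ℕ.+ n ℕ.* p) ≈ f 0 * g (p ℕ.+ n ℕ.* p) + (drop p f ⊛ g) (n ℕ.* p)
      step = ≡.subst (λ m → (f ⊛ g) (m ℕ.+ n ℕ.* p) ≈ f 0 * g (m ℕ.+ n ℕ.* p) + (drop m f ⊛ g) (n ℕ.* p)) (≡.sym p≡) (go p′ p≡)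

  -- Takes g(x^p) to g(x).
  compressP : Pol → Pol
  compressP f = mkPol (compress (cf f)) (bound f)
    (λ i le → vanish f (i ℕ.* p) (ℕₚ.≤-trans le (ℕₚ.m≤m*n i p {{ℕ.>-nonZero (prime>0 (CharP.isPrime ch))}})))

  compressP-at : ∀ f i → compressP f ! i ≈ f ! (i ℕ.* p)
  compressP-at f i = cf-mkPol i

  -- It is enough that one factor is a polynomial in x^p: the unwanted products contain a vanishing
  -- coefficient of it. So a Bézout identity for two such polynomials survives compression although
  -- its cofactors are arbitrary.
  compressP-* : ∀ f g → Supp p f → compressP (f P.* g) P.≈ compressP f P.* compressP g
  compressP-* f g h = mkP λ i → trans (compressP-at (f P.* g) i) (trans (!* f g (i ℕ.* p))
    (trans (compress-⊛ i (cf f) (cf g) h) (sym (trans (!* (compressP f) (compressP g) i)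
      (⊛-cong (compressP-at f) (compressP-at g) i)))))

  -- Since θ(G₁ G₂) = 0, coprimality gives G₂ ∣ θ G₂, and the quotient u is constant by degrees. It
  -- is zero because θ G₂ has no constant term while G₂ has one. So θ kills both factors, which are
  -- therefore polynomials in x^p; replacing x^p by x reduces h by one.
  coprime-supp : ∀ h G₁ G₂ α β → α P.* G₁ P.+ β P.* G₂ P.≈ P.1# → Supp (p ℕ.^ h) (G₁ P.* G₂) →
    ¬ (G₂ ! 0 ≈ 0#) → Supp (p ℕ.^ h) G₂
  coprime-supp zero G₁ G₂ α β bez sup nz i nd = ⊥-elim (nd (1∣ i))
  coprime-supp (suc h) G₁ G₂ α β bez sup nz = result
    where
    open P.≈R
    pSupp : Supp p (G₁ P.* G₂)
    pSupp i nd = sup i (λ d → nd (∣-trans (m∣m*n (p ℕ.^ h)) d))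
    θ-prod : θP G₁ P.* G₂ P.+ G₁ P.* θP G₂ P.≈ P.0#
    θ-prod = P.trans (P.sym (θP-* G₁ G₂)) (mkP λ i → trans (θP-at (G₁ P.* G₂) i) (trans (zeroθ i) (sym (!0 i))))
      where
      zeroθ : ∀ i → i ×ₙ ((G₁ P.* G₂) ! i) ≈ 0#
      zeroθ i with p ∣? i
      ... | yes d = CharP.∣×x≈0 ch d _
      ... | no nd = ×ₙ-zero i (pSupp i nd)
    u = β P.* θP G₂ P.- α P.* θP G₁
    θG₂≈ : θP G₂ P.≈ G₂ P.* u
    θG₂≈ = begin
      θP G₂ ≈⟨ P.*-identityˡ _ ⟨
      P.1# P.* θP G₂ ≈⟨ P.*-congʳ bez ⟨
      (α P.* G₁ P.+ β P.* G₂) P.* θP G₂ ≈⟨ P.distribʳ _ _ _ ⟩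
      α P.* G₁ P.* θP G₂ P.+ β P.* G₂ P.* θP G₂
        ≈⟨ P.+-cong (P.trans (P.*-assoc _ _ _) (P.*-congˡ (P.trans (P.x+y≈z⇒x≈z-y (P.trans (P.+-comm _ _) θ-prod)) (P.+-identityˡ _)))) (P.*S.xy∙z≈y∙xz _ _ _) ⟩
      α P.* (P.- (θP G₁ P.* G₂)) P.+ G₂ P.* (β P.* θP G₂)
        ≈⟨ P.+-congʳ (P.trans (P.sym (P.-‿distribʳ-* _ _)) (P.-‿cong (P.*S.x∙yz≈z∙xy _ _ _))) ⟩
      P.- (G₂ P.* (α P.* θP G₁)) P.+ G₂ P.* (β P.* θP G₂) ≈⟨ P.+-comm _ _ ⟩
      G₂ P.* (β P.* θP G₂) P.- G₂ P.* (α P.* θP G₁) ≈⟨ P.distribˡ-- _ _ _ ⟨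
      G₂ P.* u ∎
    u≈0 : u P.≈ P.0#
    u≈0 with deg? G₂
    ... | inj₁ z = ⊥-elim (nz (trans (atP z 0) (!0 0)))
    ... | inj₂ (d , hd) = mkP λ { zero → trans u0 (sym (!0 0)) ; (suc i) → trans (van uDeg (suc i) (s≤s z≤n)) (sym (!0 (suc i))) }
      where
      uDeg : Deg< u 1
      uDeg = factor-Deg< hd (Deg<-mono (ℕₚ.≤-reflexive (ℕₚ.+-comm 1 d)) (Deg<-resp θG₂≈ (θP-Deg< (below hd))))
      u0 : u ! 0 ≈ 0#
      u0 = IsDField.cancel fld nz (trans (sym (!* G₂ u 0)) (trans (sym (atP θG₂≈ 0)) (θP-at G₂ 0)))
    θG₂≈0 : θP G₂ P.≈ P.0#
    θG₂≈0 = P.trans θG₂≈ (P.x*0≈0 u≈0)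
    θG₁≈0 : θP G₁ P.≈ P.0#
    θG₁≈0 = PD.cancel (λ e → nz (trans (atP e 0) (!0 0)))
      (P.trans (P.*-comm _ _) (P.trans (P.sym (P.x+0≈x (P.x*0≈0 θG₂≈0))) θ-prod))
    θ⇒supp : ∀ f → θP f P.≈ P.0# → Supp p f
    θ⇒supp f e i nd = charP-unit fld ch i nd (trans (sym (θP-at f i)) (trans (atP e i) (!0 i)))
    s₁ = θ⇒supp G₁ θG₁≈0
    s₂ = θ⇒supp G₂ θG₂≈0
    M₁ = compressP G₁
    M₂ = compressP G₂
    bez′ : compressP α P.* M₁ P.+ compressP β P.* M₂ P.≈ P.1#
    bez′ = begin
      compressP α P.* M₁ P.+ compressP β P.* M₂ ≈⟨ P.+-cong (P.*-comm _ _) (P.*-comm _ _) ⟩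
      M₁ P.* compressP α P.+ M₂ P.* compressP β ≈⟨ P.+-cong (compressP-* G₁ α s₁) (compressP-* G₂ β s₂) ⟨
      compressP (G₁ P.* α) P.+ compressP (G₂ P.* β)
        ≈⟨ mkP (λ i → trans (!+ _ _ i) (trans (+-cong (compressP-at (G₁ P.* α) i) (compressP-at (G₂ P.* β) i))
             (trans (sym (!+ (G₁ P.* α) (G₂ P.* β) (i ℕ.* p)))
               (trans (atP (P.trans (P.+-cong (P.*-comm _ _) (P.*-comm _ _)) bez) (i ℕ.* p)) (one i))))) ⟩
      P.1# ∎
      where
      one : ∀ i → P.1# ! (i ℕ.* p) ≈ P.1# ! i
      one zero = refl
      one (suc i) = trans (van Deg<-1 _ (ℕₚ.≤-trans (prime>0 (CharP.isPrime ch)) (ℕₚ.m≤m+n p (i ℕ.* p)))) (sym (van Deg<-1 (suc i) (s≤s z≤n)))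
    sup′ : Supp (p ℕ.^ h) (M₁ P.* M₂)
    sup′ i nd = trans (sym (atP (compressP-* G₁ G₂ s₁) i)) (trans (compressP-at (G₁ P.* G₂) i) (sup (i ℕ.* p) (λ d → nd (cancelp i d))))
      where
      cancelp : ∀ i → p ℕ.* p ℕ.^ h ∣ i ℕ.* p → p ℕ.^ h ∣ i
      cancelp i d = *-cancelˡ-∣ p {{ℕ.>-nonZero (prime>0 (CharP.isPrime ch))}} (≡.subst (p ℕ.* p ℕ.^ h ∣_) (ℕₚ.*-comm i p) d)
    ih : Supp (p ℕ.^ h) M₂
    ih = coprime-supp h M₁ M₂ (compressP α) (compressP β) bez′ sup′ (λ e → nz (trans (sym (compressP-at G₂ 0)) e))
    result : Supp (p ℕ.* p ℕ.^ h) G₂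
    result i nd with p ∣? i
    ... | no np = s₂ i np
    ... | yes (divides c ≡.refl) = trans (sym (compressP-at G₂ c))
      (ih c (λ d → nd (≡.subst (p ℕ.* p ℕ.^ h ∣_) (ℕₚ.*-comm p c) (*-monoʳ-∣ p d))))


-- Will be used with D = z d/dz on L[z], which gives z ∂/∂z on L[z][x].
module CoeffDerivation (R : Ring) (D : CommutativeRing.Carrier R → CommutativeRing.Carrier R) where
  open Kit R using (Carrier; _≈_; _+_; _*_; -_; 0#; refl; sym; trans; +-cong; +-identityˡ; +-identityʳ; +-cancelˡ; _-_; module +S)
  open Poly R using (module P; Pol; cf; mkPol; bound; vanish; cf-mkPol; mkP; atP; !+; !*; _!_; tail; _⊛_; ⊛-cong)

  module _ (D-cong : ∀ {x y} → x ≈ y → D x ≈ D y) (D-+ : ∀ x y → D (x + y) ≈ D x + D y)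
           (D-* : ∀ x y → D (x * y) ≈ D x * y + x * D y) where
    private
      D-0 : D 0# ≈ 0#
      D-0 = +-cancelˡ (D 0#) _ _ (trans (sym (D-+ 0# 0#)) (trans (D-cong (+-identityˡ 0#)) (sym (+-identityʳ _))))

      leibniz : ∀ n f g → D ((f ⊛ g) n) ≈ ((D ∘ f) ⊛ g) n + (f ⊛ (D ∘ g)) n
      leibniz zero f g = D-* _ _
      leibniz (suc n) f g = trans (D-+ _ _) (trans (+-cong (D-* _ _) (leibniz n (tail f) g)) (+S.interchange _ _ _ _))

    DP : Pol → Pol
    DP p = mkPol (D ∘ cf p) (bound p) (λ i le → trans (D-cong (vanish p i le)) D-0)

    DP-at : ∀ p i → DP p ! i ≈ D (p ! i)
    DP-at p i = cf-mkPol i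

    DP-* : ∀ p q → DP (p P.* q) P.≈ DP p P.* q P.+ p P.* DP q
    DP-* p q = mkP λ i → trans (DP-at (p P.* q) i) (trans (D-cong (!* p q i)) (trans (leibniz i (cf p) (cf q))
      (sym (trans (!+ (DP p P.* q) (p P.* DP q) i) (+-cong
        (trans (!* (DP p) q i) (⊛-cong (DP-at p) (λ _ → refl) i))
        (trans (!* p (DP q) i) (⊛-cong (λ _ → refl) (DP-at q) i)))))))

    DP-cong : ∀ {p q} → p P.≈ q → DP p P.≈ DP q
    DP-cong {p} {q} e = mkP λ i → trans (DP-at p i) (trans (D-cong (atP e i)) (sym (DP-at q i)))

-- The weighted Gauss norm on L[z][x]: the largest N j - M i over monomials x^i z^j.

module GaussNorm (F : DField) (N M : ℕ) (N>0 : 0 < N) where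
  open DField F renaming (ring to L; isDFld to fld)
  private
    R₁ = PolyRing L
    module L = Kit L using (Carrier; _≈_; _*_; 0#; refl; sym; trans; +-cong; *-cong; x*0≈0; 0*x≈0)
    module A = Poly L using (Pol; cf; mkPol; bound; vanish; cf-mkPol; mkP; atP; !+; !*; !0; _!_; ⊛-antidiagonal)
    dom₁ = PolyDom.polyDDom (IsDField.ddom fld)
  open Poly R₁ using (module P; Pol; cf; mkPol; bound; vanish; cf-mkPol; mkP; atP; !+; !*; !0; _!_; ⊛-antidiagonal)
  open PolyDom dom₁ hiding (polyDDom)

  co : Pol → ℕ → ℕ → L.Carrier
  co f i j = f ! i A.! j

  -- N j - M i ≤ w on the support, written without subtraction because N j - M i can be negative.
  Nrm≤ : Pol → ℕ → Set
  Nrm≤ f w = ∀ i j → w ℕ.+ M ℕ.* i < N ℕ.* j → co f i j L.≈ L.0#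

  sel : ℕ → ℕ → (ℕ → L.Carrier) → ℕ → L.Carrier
  sel w i f j with N ℕ.* j ℕ.≟ w ℕ.+ M ℕ.* i
  ... | yes _ = f j
  ... | no _ = L.0#

  sel-yes : ∀ w i f j → N ℕ.* j ≡ w ℕ.+ M ℕ.* i → sel w i f j L.≈ f j
  sel-yes w i f j e with N ℕ.* j ℕ.≟ w ℕ.+ M ℕ.* i
  ... | yes _ = L.refl
  ... | no ne = ⊥-elim (ne e)

  sel-no : ∀ w i f j → ¬ (N ℕ.* j ≡ w ℕ.+ M ℕ.* i) → sel w i f j L.≈ L.0#
  sel-no w i f j ne with N ℕ.* j ℕ.≟ w ℕ.+ M ℕ.* i
  ... | yes e = ⊥-elim (ne e)
  ... | no _ = L.refl

  sel-zero : ∀ w i f j → f j L.≈ L.0# → sel w i f j L.≈ L.0#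
  sel-zero w i f j z with N ℕ.* j ℕ.≟ w ℕ.+ M ℕ.* i
  ... | yes _ = z
  ... | no _ = L.refl

  topRow : ℕ → ℕ → A.Pol → A.Pol
  topRow w i p = A.mkPol (sel w i (A.cf p)) (A.bound p) (λ j le → sel-zero w i (A.cf p) j (A.vanish p j le))

  -- The initial form in weight w: the terms on the line N j = w + M i.
  top : ℕ → Pol → Pol
  top w f = mkPol (λ i → topRow w i (f ! i)) (bound f) (λ i le → A.mkP λ j →
    L.trans (A.cf-mkPol j) (L.trans (sel-zero w i (A.cf (f ! i)) j (L.trans (A.atP (vanish f i le) j) (A.!0 j))) (L.sym (A.!0 j))))

  top-yes : ∀ w f i j → N ℕ.* j ≡ w ℕ.+ M ℕ.* i → co (top w f) i j L.≈ co f i j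
  top-yes w f i j e = L.trans (A.atP (cf-mkPol i) j) (L.trans (A.cf-mkPol j) (sel-yes w i (A.cf (f ! i)) j e))

  top-no : ∀ w f i j → ¬ (N ℕ.* j ≡ w ℕ.+ M ℕ.* i) → co (top w f) i j L.≈ L.0#
  top-no w f i j ne = L.trans (A.atP (cf-mkPol i) j) (L.trans (A.cf-mkPol j) (sel-no w i (A.cf (f ! i)) j ne))

  coefficient-* : ∀ f g f′ g′ I J →
    (∀ i i′ j j′ → i ℕ.+ i′ ≡ I → j ℕ.+ j′ ≡ J → co f i j L.* co g i′ j′ L.≈ co f′ i j L.* co g′ i′ j′) →
    co (f P.* g) I J L.≈ co (f′ P.* g′) I J
  coefficient-* f g f′ g′ I J h = L.trans (A.atP (!* f g I) J) (L.trans
    (⊛-antidiagonal (λ x y → x A.! J L.≈ y A.! J)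
      (λ {x} {y} {u} {v} p q → L.trans (A.!+ x u J) (L.trans (L.+-cong p q) (L.sym (A.!+ y v J)))) I
      (λ i i′ ei → L.trans (A.!* (f ! i) (g ! i′) J) (L.trans
        (A.⊛-antidiagonal L._≈_ L.+-cong J (λ j j′ ej → h i i′ j j′ ei ej)) (L.sym (A.!* (f′ ! i) (g′ ! i′) J)))))
    (L.sym (A.atP (!* f′ g′ I) J)))

  private
    weights : ∀ w₁ w₂ {i i′ j j′ I J} → i ℕ.+ i′ ≡ I → j ℕ.+ j′ ≡ J → N ℕ.* J ≡ (w₁ ℕ.+ w₂) ℕ.+ M ℕ.* I →
      N ℕ.* j ℕ.+ N ℕ.* j′ ≡ (w₁ ℕ.+ M ℕ.* i) ℕ.+ (w₂ ℕ.+ M ℕ.* i′)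
    weights w₁ w₂ {i} {i′} {j} {j′} ≡.refl ≡.refl e = ≡.trans (≡.sym (ℕₚ.*-distribˡ-+ N j j′)) (≡.trans e
      (solve 5 (λ w₁ w₂ M i i′ → w₁ :+ w₂ :+ M :* (i :+ i′) := (w₁ :+ M :* i) :+ (w₂ :+ M :* i′)) ≡.refl w₁ w₂ M i i′))
      where open +-*-Solver

  -- In a product of weight w₁ + w₂, if one term lies below its line, the other lies above its own
  -- and vanishes. Hence only initial terms contribute.
  top-product : ∀ f g w₁ w₂ → Nrm≤ f w₁ → Nrm≤ g w₂ → ∀ I J → N ℕ.* J ≡ (w₁ ℕ.+ w₂) ℕ.+ M ℕ.* I →
    co (top w₁ f P.* top w₂ g) I J L.≈ co (f P.* g) I J
  top-product f g w₁ w₂ hf hg I J e = coefficient-* (top w₁ f) (top w₂ g) f g I J term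
    where
    term : ∀ i i′ j j′ → i ℕ.+ i′ ≡ I → j ℕ.+ j′ ≡ J →
      co (top w₁ f) i j L.* co (top w₂ g) i′ j′ L.≈ co f i j L.* co g i′ j′
    term i i′ j j′ ei ej with ℕₚ.<-cmp (N ℕ.* j) (w₁ ℕ.+ M ℕ.* i)
    ... | tri≈ _ eq _ = L.*-cong (top-yes w₁ f i j eq) (top-yes w₂ g i′ j′
        (ℕₚ.+-cancelˡ-≡ (w₁ ℕ.+ M ℕ.* i) _ _ (≡.trans (≡.cong (ℕ._+ N ℕ.* j′) (≡.sym eq)) (weights w₁ w₂ ei ej e))))
    ... | tri> _ ne gt = L.trans (L.0*x≈0 (top-no w₁ f i j ne)) (L.sym (L.0*x≈0 (hf i j gt)))
    ... | tri< lt ne _ = L.trans (L.0*x≈0 (top-no w₁ f i j ne)) (L.sym (L.x*0≈0 (hg i′ j′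
        (ℕₚ.≰⇒> (λ le → ℕₚ.<⇒≢ (ℕₚ.+-mono-<-≤ lt le) (weights w₁ w₂ ei ej e))))))

  top-product-off : ∀ f g w₁ w₂ I J → ¬ (N ℕ.* J ≡ (w₁ ℕ.+ w₂) ℕ.+ M ℕ.* I) → co (top w₁ f P.* top w₂ g) I J L.≈ L.0#
  top-product-off f g w₁ w₂ I J ne = L.trans (coefficient-* (top w₁ f) (top w₂ g) P.0# P.0# I J term)
      (L.trans (A.atP (atP (P.zeroˡ P.0#) I) J) (L.trans (A.atP (!0 I) J) (A.!0 J)))
    where
    zz : ∀ i j → co P.0# i j L.≈ L.0#
    zz i j = L.trans (A.atP (!0 i) j) (A.!0 j)
    term : ∀ i i′ j j′ → i ℕ.+ i′ ≡ I → j ℕ.+ j′ ≡ J →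
      co (top w₁ f) i j L.* co (top w₂ g) i′ j′ L.≈ co P.0# i j L.* co P.0# i′ j′
    term i i′ j j′ ei ej with N ℕ.* j ℕ.≟ w₁ ℕ.+ M ℕ.* i | N ℕ.* j′ ℕ.≟ w₂ ℕ.+ M ℕ.* i′
    ... | no n₁ | _ = L.trans (L.0*x≈0 (top-no w₁ f i j n₁)) (L.sym (L.0*x≈0 (zz i j)))
    ... | yes _ | no n₂ = L.trans (L.x*0≈0 (top-no w₂ g i′ j′ n₂)) (L.sym (L.0*x≈0 (zz i j)))
    ... | yes e₁ | yes e₂ = ⊥-elim (ne (back ei ej e₁ e₂))
      where
      back : i ℕ.+ i′ ≡ I → j ℕ.+ j′ ≡ J → N ℕ.* j ≡ w₁ ℕ.+ M ℕ.* i → N ℕ.* j′ ≡ w₂ ℕ.+ M ℕ.* i′ → N ℕ.* J ≡ (w₁ ℕ.+ w₂) ℕ.+ M ℕ.* I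
      back ≡.refl ≡.refl e₁ e₂ = ≡.trans (ℕₚ.*-distribˡ-+ N j j′) (≡.trans (≡.cong₂ ℕ._+_ e₁ e₂)
        (solve 5 (λ w₁ w₂ M i i′ → (w₁ :+ M :* i) :+ (w₂ :+ M :* i′) := w₁ :+ w₂ :+ M :* (i :+ i′)) ≡.refl w₁ w₂ M i i′))
        where open +-*-Solver

  Attains : Pol → ℕ → Set
  Attains f w = Nrm≤ f w × ¬ (top w f P.≈ P.0#)

  some-norm : ∀ f → ∃ λ w → Nrm≤ f w
  some-norm f = N ℕ.* D , λ i j lt → zero-above i j (ℕₚ.*-cancelˡ-< N D j (ℕₚ.≤-<-trans (ℕₚ.m≤m+n (N ℕ.* D) (M ℕ.* i)) lt))
    where
    maxBound : ℕ → ℕ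
    maxBound zero = 0
    maxBound (suc k) = maxBound k ℕ.⊔ A.bound (f ! k)
    maxBound-≥ : ∀ k i → i < k → A.bound (f ! i) ≤ maxBound k
    maxBound-≥ (suc k) i i< with ℕₚ.m≤n⇒m<n∨m≡n (ℕₚ.≤-pred i<)
    ... | inj₁ lt = ℕₚ.≤-trans (maxBound-≥ k i lt) (ℕₚ.m≤m⊔n _ _)
    ... | inj₂ ≡.refl = ℕₚ.m≤n⊔m (maxBound k) _
    D = maxBound (bound f)
    zero-above : ∀ i j → D < j → co f i j L.≈ L.0#
    zero-above i j lt with i ℕ.<? bound f
    ... | yes i< = A.vanish (f ! i) j (ℕₚ.≤-trans (maxBound-≥ (bound f) i i<) (ℕₚ.<⇒≤ lt))
    ... | no ni = L.trans (A.atP (vanish f i (ℕₚ.≮⇒≥ ni)) j) (A.!0 j)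

  ¬¬attains : ∀ f j₀ → ¬ (co f 0 j₀ L.≈ L.0#) → ¬ ¬ (∃ λ w → N ℕ.* j₀ ≤ w × Attains f w)
  ¬¬attains f j₀ nz k = ¬¬-least (some-norm f) λ { (w , hw , least) → k (w , lower w hw , hw , nonzero w hw least) }
    where
    lower : ∀ w → Nrm≤ f w → N ℕ.* j₀ ≤ w
    lower w hw = ℕₚ.≮⇒≥ λ lt → nz (hw 0 j₀ (≡.subst (_< N ℕ.* j₀) (≡.sym (≡.trans (≡.cong (w ℕ.+_) (ℕₚ.*-zeroʳ M)) (ℕₚ.+-identityʳ w))) lt))
    nonzero : ∀ w → Nrm≤ f w → (∀ m → m < w → ¬ Nrm≤ f m) → ¬ (top w f P.≈ P.0#)
    nonzero zero hw _ e = nz (L.trans (L.sym (top-yes 0 f 0 j₀ eq)) (L.trans (A.atP (atP e 0) j₀) (L.trans (A.atP (!0 0) j₀) (A.!0 j₀))))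
      where
      eq : N ℕ.* j₀ ≡ 0 ℕ.+ M ℕ.* 0
      eq = ≡.trans (ℕₚ.n≤0⇒n≡0 (lower 0 hw)) (≡.sym (ℕₚ.*-zeroʳ M))
    nonzero (suc w) hw least e = least w ℕₚ.≤-refl smaller
      where
      smaller : Nrm≤ f w
      smaller i j lt with ℕₚ.m≤n⇒m<n∨m≡n lt
      ... | inj₁ lt′ = hw i j lt′
      ... | inj₂ eq = L.trans (L.sym (top-yes (suc w) f i j (≡.sym eq)))
        (L.trans (A.atP (atP e i) j) (L.trans (A.atP (!0 i) j) (A.!0 j)))

  -- The product of two nonzero initial forms is nonzero, L[z][x] being a domain; it would be a part
  -- of b of weight greater than w.
  norm-* : ∀ f g b w₁ w₂ w → f P.* g P.≈ b → Attains f w₁ → Attains g w₂ → Nrm≤ b w → w₁ ℕ.+ w₂ ≤ w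
  norm-* f g b w₁ w₂ w e (hf , nf) (hg , ng) hb with w₁ ℕ.+ w₂ ℕ.≤? w
  ... | yes le = le
  ... | no nle = ⊥-elim (PD.nzd-¬ nf ng (mkP λ I → A.mkP λ J → L.trans (zeroTop I J)
        (L.sym (L.trans (A.atP (!0 I) J) (A.!0 J)))))
    where
    zeroTop : ∀ I J → co (top w₁ f P.* top w₂ g) I J L.≈ L.0#
    zeroTop I J with N ℕ.* J ℕ.≟ (w₁ ℕ.+ w₂) ℕ.+ M ℕ.* I
    ... | no ne = top-product-off f g w₁ w₂ I J ne
    ... | yes eq = L.trans (top-product f g w₁ w₂ hf hg I J eq) (L.trans (A.atP (atP e I) J)
      (hb I J (≡.subst (w ℕ.+ M ℕ.* I <_) (≡.sym eq) (ℕₚ.+-monoˡ-< (M ℕ.* I) (ℕₚ.≰⇒> nle)))))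

  -- The terms z^j₁ and z^j₂ bound the norms of the factors from below. These bounds already add up
  -- to the norm of the product, so both are attained.
  ¬¬factor-norms : ∀ f g b w j₁ j₂ → f P.* g P.≈ b → Nrm≤ b w → N ℕ.* j₁ ℕ.+ N ℕ.* j₂ ≡ w →
    ¬ (co f 0 j₁ L.≈ L.0#) → ¬ (co g 0 j₂ L.≈ L.0#) → ¬ ¬ (Nrm≤ f (N ℕ.* j₁) × Nrm≤ g (N ℕ.* j₂))
  ¬¬factor-norms f g b w j₁ j₂ e hb sum nf ng k = ¬¬attains f j₁ nf λ { (w₁ , l₁ , a₁) → ¬¬attains g j₂ ng λ { (w₂ , l₂ , a₂) →
    let le = norm-* f g b w₁ w₂ w e a₁ a₂ hb
        e₁ : w₁ ≡ N ℕ.* j₁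
        e₁ = ℕₚ.≤-antisym (ℕₚ.+-cancelʳ-≤ (N ℕ.* j₂) w₁ (N ℕ.* j₁)
               (ℕₚ.≤-trans (ℕₚ.+-monoʳ-≤ w₁ l₂) (ℕₚ.≤-trans le (ℕₚ.≤-reflexive (≡.sym sum))))) l₁
        e₂ : w₂ ≡ N ℕ.* j₂
        e₂ = ℕₚ.≤-antisym (ℕₚ.+-cancelˡ-≤ (N ℕ.* j₁) w₂ (N ℕ.* j₂)
               (ℕₚ.≤-trans (ℕₚ.+-monoˡ-≤ w₂ l₁) (ℕₚ.≤-trans le (ℕₚ.≤-reflexive (≡.sym sum))))) l₂
    in k (≡.subst (Nrm≤ f) e₁ (proj₁ a₁) , ≡.subst (Nrm≤ g) e₂ (proj₁ a₂)) } }

-- The product of the two Bézout identities, sorted by multiples of x y and of g.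
coprime-mul : (R : Ring) → let open Kit R using (_≈_; _+_; _*_; 1#; refl; trans; *-cong; *-identityˡ; commutativeSemiring) in ∀ α₁ β₁ α₂ β₂ x y g → α₁ * x + β₁ * g ≈ 1# → α₂ * y + β₂ * g ≈ 1# →
  (α₁ * α₂) * (x * y) + (β₁ * (α₂ * y + β₂ * g) + (α₁ * x) * β₂) * g ≈ 1#
coprime-mul R α₁ β₁ α₂ β₂ x y g e₁ e₂ = trans
  (solve 7 (λ α₁ β₁ α₂ β₂ x y g → (α₁ :* α₂) :* (x :* y) :+ (β₁ :* (α₂ :* y :+ β₂ :* g) :+ (α₁ :* x) :* β₂) :* g
    := (α₁ :* x :+ β₁ :* g) :* (α₂ :* y :+ β₂ :* g)) refl α₁ β₁ α₂ β₂ x y g)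
  (trans (*-cong e₁ e₂) (*-identityˡ 1#))
  where
  open Kit R using (Carrier; _≈_; _+_; _*_; 1#; refl; trans; *-cong; *-identityˡ; commutativeSemiring)
  open Algebra.Solver.Ring.NaturalCoefficients.Default commutativeSemiring using (solve; _:+_; _:*_; _:=_)

-- The curve and its possible factorizations

module Curve (Fld : DField) {p : ℕ} (ch : CharP p (DField.ring Fld)) (h : ℕ) (h>0 : 0 < h)
             (a : ℕ → CommutativeRing.Carrier (DField.ring Fld)) (r t : ℕ) where
  open DField Fld renaming (ring to L; isDFld to fld)
  open Kit L using (Carrier; _≈_; _+_; _*_; -_; 0#; 1#; refl; sym; trans; +-cong; +-congˡ; *-cong; *-congˡ; -‿cong; +-comm; +-identityˡ; +-identityʳ; *-assoc; *-comm; *-identityˡ; *-identityʳ; distribˡ; -‿distribˡ-*; -‿distribʳ-*; -‿involutive; -0#≈0#; -‿+-comm; _^_; ^-congˡ; ^-assocʳ; ×-congʳ; ×-comm-*; _×ₙ_; ×-distrib-+; _-_; ≡⇒≈; -‿congr; x-x; x-0; x-y≈0⇒x≈y; x≈y⇒x-y≈0; distribˡ--; x*0≈0; 0*x≈0; 0+0≈0; 0+x≈x; 1^n≈1; 0^n≈0; ×ₙ-zero; sumN; sum-zero; sum-single; Distinct; module *S; module ≈R)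

  q : ℕ
  q = p ℕ.^ h

  p∣q : p ∣ q
  p∣q = go h h>0
    where
    go : ∀ h → 0 < h → p ∣ p ℕ.^ h
    go (suc h) _ = m∣m*n (p ℕ.^ h)

  p>0 : 0 < p
  p>0 = prime>0 (CharP.isPrime ch)

  q>1 : 1 < q
  q>1 = ℕₚ.<-≤-trans (prime>1 (CharP.isPrime ch)) (∣⇒≤ {{ℕ.>-nonZero (ℕₚ.m^n>0 p {{ℕ.>-nonZero p>0}} h)}} p∣q)

  q^>0 : ∀ i → 0 < q ℕ.^ i
  q^>0 i = ℕₚ.≤-trans (s≤s z≤n) (n<q^n q>1 i)

  q^-mono : ∀ {i j} → i ≤ j → q ℕ.^ i ≤ q ℕ.^ j
  q^-mono le = ℕₚ.^-monoʳ-≤ q {{ℕ.>-nonZero (ℕₚ.<-trans (s≤s z≤n) q>1)}} le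

  q^-mono-< : ∀ {i j} → i < j → q ℕ.^ i < q ℕ.^ j
  q^-mono-< lt = ℕₚ.^-monoʳ-< q q>1 lt

  q^-inj : ∀ i j → q ℕ.^ i ≡ q ℕ.^ j → i ≡ j
  q^-inj = LinPol.q^-inj L ch h q>1 p∣q a r

  ex : ℕ → ℕ
  ex i = ℕ.pred (q ℕ.^ i)

  suc-ex : ∀ i → suc (ex i) ≡ q ℕ.^ i
  suc-ex i = ℕₚ.suc-pred (q ℕ.^ i) {{ℕ.>-nonZero (q^>0 i)}}

  ex-inj : ∀ i j → ex i ≡ ex j → i ≡ j
  ex-inj i j e = q^-inj i j (≡.trans (≡.sym (suc-ex i)) (≡.trans (≡.cong suc e) (suc-ex j)))

  R₁ : Ring
  R₁ = PolyRing L
  module A = Poly L using (_!_; !*; !+; !-; !0; !1; !neg; +-Deg<; Deg<; Deg<-mono; Deg<-resp; HasDeg; Pol; atP; below; bound; cf; cf-mkPol; con; con-*; con-at; const-vanish; deg<; deg<bound; hasDeg; lead≉0; mkP; mkPol; mkPol-Deg<; mono; mono-*; mono-*-shift; mono-at; mono-off; mono-vanish; neg-Deg<; ofCoeffs; ofCoeffs-Deg<; ofCoeffs-at; tail; van; vanish)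
  module FA = FieldPoly Fld using (Irreducible; module Irreducible; HasDeg-*; HasDeg-resp; HasDeg-unique; HasDeg⇒≉0; deg?; factor-Deg<; factor-root; lin; lin-HasDeg; polyDDom; root-bound; ¬¬irreducible-factor)
  dom₁ : IsDDom R₁
  dom₁ = FA.polyDDom
  module B = Poly R₁ using (_!_; !*; !0; Deg<; Deg<-mono; HasDeg; Pol; atP; below; bound; con; con-*; con-at; const-vanish; deg<; deg<bound; hasDeg; lead≉0; mkP; mono; mono-at; mono-off; ofCoeffs; ofCoeffs-Deg<; ofCoeffs-at; sumP-!; van; ⊛-top)
  module DB = PolyDom dom₁ using (HasDeg-*; HasDeg-<; HasDeg-resp; HasDeg-unique; HasDeg⇒≉0; deg?; deg?-bounded; pdiv; polyDDom)
  module TA = Theta L using (θP; θP-*; θP-at; θP-cong)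
  module AP = Kit R₁ using (_*_; *-assoc; *-comm; *-congʳ; *-congˡ; module *S; _+_; +-comm; +-cong; +-congˡ; -_; _-_; -‿cong; -‿distribˡ-*; 0#; 0*x≈0; 0+x≈x; 1#; _^_; distribˡ; distribˡ--; sum-single; sum-zero; sym; trans; x*0≈0; x-y≈0⇒x≈y; _≈_; module ≈R; ≡⇒≈)
  module BP = Kit (PolyRing R₁) using (_*_; *-assoc; *-comm; *-congʳ; *-congˡ; *-identityˡ; module *S; _+_; +-comm; 0#; 0*x≈0; 1#; sumN; sym; trans; x*0≈0; x+0≈x; x+y≈z⇒x≈z-y; _≈_; module ≈R)

  W : ℕ → A.Pol
  W i = A.mono (q ℕ.^ t) 1# AP.- A.mono (q ℕ.^ i) 1#

  coefβ : ℕ → A.Pol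
  coefβ i = A.con (a i) AP.* W i

  coefβ-at : ∀ i j → coefβ i A.! j ≈ a i * (A.mono (q ℕ.^ t) 1# A.! j - A.mono (q ℕ.^ i) 1# A.! j)
  coefβ-at i j = trans (A.con-* (a i) (W i) j) (*-congˡ (A.!- _ _ j))

  -- b(x, z) with x as the outer and z as the inner variable, that is, a polynomial in x over L[z].
  b : B.Pol
  b = BP.sumN (suc r) (λ i → B.mono (ex i) (coefβ i))

  b-at : ∀ i → i ≤ r → b B.! ex i AP.≈ coefβ i
  b-at i le = AP.trans (B.sumP-! (suc r) (λ j → B.mono (ex j) (coefβ j)) (ex i))
    (AP.trans (AP.sum-single (suc r) (λ j → B.mono (ex j) (coefβ j) B.! ex i) i (s≤s le)
      (λ j _ ne → B.mono-off (ex j) (coefβ j) (ex i) (λ e → ne (≡.sym (ex-inj i j e)))))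
    (B.mono-at (ex i) (coefβ i)))

  b-off : ∀ j → (∀ i → i ≤ r → ¬ (j ≡ ex i)) → b B.! j AP.≈ AP.0#
  b-off j ne = AP.trans (B.sumP-! (suc r) (λ i → B.mono (ex i) (coefβ i)) j)
    (AP.sum-zero (suc r) (λ i i< → B.mono-off (ex i) (coefβ i) j (ne i (ℕₚ.≤-pred i<))))

  b-cases : ∀ j → (∃ λ i → i ≤ r × j ≡ ex i) ⊎ (b B.! j AP.≈ AP.0#)
  b-cases j with search (λ i → j ℕ.≟ ex i) (suc r)
  ... | inj₁ (i , i< , e) = inj₁ (i , ℕₚ.≤-pred i< , e)
  ... | inj₂ none = inj₂ (b-off j (λ i le → none i (s≤s le)))

  evH : Carrier → Hom R₁ L
  evH c = Eval.evalHom (idHom L) c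

  evH-mono : ∀ c k x → ⟦ evH c ⟧ (A.mono k x) ≈ x * c ^ k
  evH-mono c k x = Eval.eval-mono (idHom L) c k x

  evH-coefβ : ∀ c i → ⟦ evH c ⟧ (coefβ i) ≈ a i * (c ^ (q ℕ.^ t) - c ^ (q ℕ.^ i))
  evH-coefβ c i = trans (⟦⟧-* (evH c) _ _) (*-cong (Eval.eval-con (idHom L) c (a i))
    (trans (⟦⟧-- (evH c) _ _) (-‿congr (trans (evH-mono c (q ℕ.^ t) 1#) (*-identityˡ _)) (trans (evH-mono c (q ℕ.^ i) 1#) (*-identityˡ _)))))

  -- Specialization to z = c.
  mz : Carrier → Hom (PolyRing R₁) (PolyRing L)
  mz c = mapHom (evH c)

  mz-at : ∀ c f i → ⟦ mz c ⟧ f A.! i ≈ ⟦ evH c ⟧ (f B.! i)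
  mz-at c f i = mapP-at (evH c) f i

  open CoeffDerivation R₁ TA.θP

  θ-+ : ∀ x y → TA.θP (x AP.+ y) AP.≈ TA.θP x AP.+ TA.θP y
  θ-+ x y = A.mkP λ i → trans (TA.θP-at (x AP.+ y) i) (trans (×-congʳ i (A.!+ x y i)) (trans (×-distrib-+ _ _ i)
    (sym (trans (A.!+ (TA.θP x) (TA.θP y) i) (+-cong (TA.θP-at x i) (TA.θP-at y i))))))

  Θ : B.Pol → B.Pol
  Θ = DP TA.θP-cong θ-+ TA.θP-*

  Θ-at : ∀ f i → Θ f B.! i AP.≈ TA.θP (f B.! i)
  Θ-at = DP-at TA.θP-cong θ-+ TA.θP-*

  θ-power : ∀ i j → 0 < i → j ×ₙ (A.mono (q ℕ.^ i) 1# A.! j) ≈ 0#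
  θ-power (suc i) j _ with j ℕ.≟ q ℕ.^ suc i
  ... | yes ≡.refl = CharP.∣×x≈0 ch (∣-trans p∣q (m∣m*n (q ℕ.^ i))) _
  ... | no ne = ×ₙ-zero j (A.mono-off (q ℕ.^ suc i) 1# j ne)

  ×ₙ-sub : ∀ j x y → j ×ₙ (x - y) ≈ j ×ₙ x - j ×ₙ y
  ×ₙ-sub j x y = trans (×-distrib-+ x (- y) j) (+-congˡ (×ₙ-neg j))
    where
    ×ₙ-neg : ∀ j → j ×ₙ (- y) ≈ - (j ×ₙ y)
    ×ₙ-neg zero = sym -0#≈0#
    ×ₙ-neg (suc j) = trans (+-congˡ (×ₙ-neg j)) (-‿+-comm _ _)

  -- `cop` says that F_{q^t} and F_{q^r} meet in F_q. Hence the leading coefficient a_r (z^(q^t) -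
  -- z^(q^r)) of b does not vanish at the elements of F_{q^t} outside F_q.
  module _ (t>1 : 1 < t) (r>0 : 0 < r) (r≢t : ¬ (r ≡ t)) (a0 : ¬ (a 0 ≈ 0#)) (ar : ¬ (a r ≈ 0#))
           (cop : ∀ x → x ^ (q ℕ.^ t) ≈ x → x ^ (q ℕ.^ r) ≈ x → x ^ q ≈ x) where

    t>0 : 0 < t
    t>0 = ℕₚ.<-trans (s≤s z≤n) t>1

    θ-coefβ : ∀ i → 0 < i → TA.θP (coefβ i) AP.≈ AP.0#
    θ-coefβ i i>0 = A.mkP λ j → trans (TA.θP-at (coefβ i) j) (trans (×-congʳ j (coefβ-at i j))
      (trans (sym (×-comm-* j _ _)) (trans (x*0≈0 (trans (×ₙ-sub j _ _) (trans (-‿congr (θ-power t j t>0) (θ-power i j i>0)) (x-x 0#)))) (sym (A.!0 j)))))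

    θ-coefβ0 : TA.θP (coefβ 0) AP.≈ A.mono 1 (- a 0)
    θ-coefβ0 = A.mkP λ j → trans (TA.θP-at (coefβ 0) j) (trans (×-congʳ j (coefβ-at 0 j)) (trans (sym (×-comm-* j _ _))
      (trans (*-congˡ (trans (×ₙ-sub j _ _) (0+x≈x (θ-power t j t>0)))) (last j))))
      where
      last : ∀ j → a 0 * - (j ×ₙ (A.mono 1 1# A.! j)) ≈ A.mono 1 (- a 0) A.! j
      last j with j ℕ.≟ 1
      ... | yes ≡.refl = trans (*-congˡ (-‿cong (trans (+-identityʳ _) (A.mono-at 1 1#)))) (trans (sym (-‿distribʳ-* _ _))
              (trans (-‿cong (*-identityʳ _)) (sym (A.mono-at 1 (- a 0)))))
      ... | no ne = trans (x*0≈0 (trans (-‿cong (×ₙ-zero j (A.mono-off 1 1# j ne))) -0#≈0#)) (sym (A.mono-off 1 (- a 0) j ne))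

    -- θ kills z^(q^i) for i > 0 and t > 0, so only the last term of a₀ (z^(q^t) - z) survives.
    Θ-b : Θ b BP.≈ B.con (A.mono 1 (- a 0))
    Θ-b = B.mkP λ j → AP.trans (Θ-at b j) (go j (b-cases j))
      where
      go : ∀ j → (∃ λ i → i ≤ r × j ≡ ex i) ⊎ (b B.! j AP.≈ AP.0#) → TA.θP (b B.! j) AP.≈ B.con (A.mono 1 (- a 0)) B.! j
      go .0 (inj₁ (zero , _ , ≡.refl)) = AP.trans (TA.θP-cong (b-at 0 z≤n)) (AP.trans θ-coefβ0 (AP.sym (B.con-at _ 0)))
      go j (inj₁ (suc i , le , ≡.refl)) = AP.trans (TA.θP-cong (b-at (suc i) le)) (AP.trans (θ-coefβ (suc i) (s≤s z≤n))
        (AP.sym (AP.trans (B.con-at _ (ex (suc i))) (B.const-vanish _ (ex (suc i)) (ℕₚ.≤-pred (≡.subst (1 <_) (≡.sym (suc-ex (suc i))) (ℕₚ.<-≤-trans q>1 (ℕₚ.≤-trans (ℕₚ.≤-reflexive (≡.sym (ℕₚ.*-identityʳ q))) (ℕₚ.*-monoʳ-≤ q (q^>0 i))))))))))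
      go zero (inj₂ z) = AP.trans (TA.θP-cong (b-at 0 z≤n)) (AP.trans θ-coefβ0 (AP.sym (B.con-at _ 0)))
      go (suc j) (inj₂ z) = AP.trans (TA.θP-cong z) (AP.trans (A.mkP λ i → trans (TA.θP-at AP.0# i) (trans (×ₙ-zero i (A.!0 i)) (sym (A.!0 i)))) (AP.sym (B.con-at _ (suc j))))

    coefβ-r : coefβ r A.! (q ℕ.^ r) ≈ - a r
    coefβ-r = trans (coefβ-at r (q ℕ.^ r)) (trans (*-congˡ (trans (-‿congr (A.mono-off (q ℕ.^ t) 1# (q ℕ.^ r) (λ e → r≢t (q^-inj r t e))) (A.mono-at (q ℕ.^ r) 1#)) (+-identityˡ _)))
      (trans (sym (-‿distribʳ-* _ _)) (-‿cong (*-identityʳ _))))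

    -ar≉0 : ¬ (- a r ≈ 0#)
    -ar≉0 e = ar (trans (sym (-‿involutive _)) (trans (-‿cong e) -0#≈0#))

    b-HasDeg : B.HasDeg b (ex r)
    b-HasDeg = B.hasDeg (λ z → -ar≉0 (trans (sym coefβ-r) (trans (A.atP (AP.trans (AP.sym (b-at r ℕₚ.≤-refl)) z) (q ℕ.^ r)) (A.!0 _))))
      (B.deg< λ j lt → b-off j (λ i le e → ℕₚ.<⇒≱ lt (≡.subst (_≤ ex r) (≡.sym e) (ℕₚ.pred-mono-≤ (q^-mono le)))))

    -- The term with i = 0 drops out, and the other exponents q^i - 1 are all -1 modulo q.
    mz-b-fixed : ∀ c → c ^ (q ℕ.^ t) ≈ c → ∀ j → ¬ (q ∣ suc j) → ⟦ mz c ⟧ b A.! j ≈ 0#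
    mz-b-fixed c cf j nd = trans (mz-at c b j) (go (b-cases j))
      where
      go : (∃ λ i → i ≤ r × j ≡ ex i) ⊎ (b B.! j AP.≈ AP.0#) → ⟦ evH c ⟧ (b B.! j) ≈ 0#
      go (inj₂ z) = ⟦⟧≈0 (evH c) z
      go (inj₁ (zero , _ , ≡.refl)) = trans (⟦⟧-cong (evH c) (b-at 0 z≤n)) (trans (evH-coefβ c 0) (x*0≈0 (x≈y⇒x-y≈0 (trans cf (sym (*-identityʳ c))))))
      go (inj₁ (suc i , _ , e)) = ⊥-elim (nd (≡.subst (q ∣_) (≡.sym (≡.trans (≡.cong suc e) (suc-ex (suc i)))) (m∣m*n (q ℕ.^ i))))

    leads : ∀ f₁ f₂ e₁ e₂ → f₁ BP.* f₂ BP.≈ b → B.HasDeg f₁ e₁ → B.HasDeg f₂ e₂ →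
      (e₁ ℕ.+ e₂ ≡ ex r) × (f₁ B.! e₁ AP.* f₂ B.! e₂ AP.≈ coefβ r)
    leads f₁ f₂ e₁ e₂ e h₁ h₂ = sum , AP.trans (AP.sym (AP.trans (B.!* f₁ f₂ (e₁ ℕ.+ e₂)) (B.⊛-top e₁ e₂ (B.van (B.below h₁)) (B.van (B.below h₂)))))
      (AP.trans (B.atP e (e₁ ℕ.+ e₂)) (AP.trans (AP.≡⇒≈ (≡.cong (b B.!_) sum)) (b-at r ℕₚ.≤-refl)))
      where sum = DB.HasDeg-unique (DB.HasDeg-* h₁ h₂) (DB.HasDeg-resp (BP.sym e) b-HasDeg)

    leibniz-at : ∀ f₁ f₂ → f₁ BP.* f₂ BP.≈ b → ∀ c →
      ⟦ mz c ⟧ (Θ f₁) AP.* ⟦ mz c ⟧ f₂ AP.+ ⟦ mz c ⟧ f₁ AP.* ⟦ mz c ⟧ (Θ f₂) AP.≈ A.con (- a 0 * c)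
    leibniz-at f₁ f₂ e c = begin
      ⟦ mz c ⟧ (Θ f₁) AP.* ⟦ mz c ⟧ f₂ AP.+ ⟦ mz c ⟧ f₁ AP.* ⟦ mz c ⟧ (Θ f₂) ≈⟨ AP.+-cong (⟦⟧-* (mz c) _ _) (⟦⟧-* (mz c) _ _) ⟨
      ⟦ mz c ⟧ (Θ f₁ BP.* f₂) AP.+ ⟦ mz c ⟧ (f₁ BP.* Θ f₂) ≈⟨ ⟦⟧-+ (mz c) _ _ ⟨
      ⟦ mz c ⟧ (Θ f₁ BP.* f₂ BP.+ f₁ BP.* Θ f₂) ≈⟨ ⟦⟧-cong (mz c) (BP.trans (BP.sym Θ-b) (BP.trans (DP-cong TA.θP-cong θ-+ TA.θP-* (BP.sym e)) (DP-* TA.θP-cong θ-+ TA.θP-* f₁ f₂))) ⟨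
      ⟦ mz c ⟧ (B.con (A.mono 1 (- a 0))) ≈⟨ A.mkP (λ { zero → trans (mz-at c _ 0) (trans (⟦⟧-cong (evH c) (B.con-at _ 0)) (trans (evH-mono c 1 (- a 0)) (trans (*-congˡ (*-identityʳ c)) (sym (A.con-at _ 0)))))
                                                      ; (suc i) → trans (mz-at c _ (suc i)) (trans (⟦⟧≈0 (evH c) (B.con-at _ (suc i))) (sym (A.con-at _ (suc i)))) }) ⟩
      A.con (- a 0 * c) ∎
      where open AP.≈R

    fixed≉0 : ∀ c → ¬ (c ^ q ≈ c) → ¬ (c ≈ 0#)
    fixed≉0 c nq c0 = nq (trans (0^n≈0 q (ℕₚ.<-trans (s≤s z≤n) q>1) c0) (sym c0))

    -a0c≉0 : ∀ c → ¬ (c ≈ 0#) → ¬ (- a 0 * c ≈ 0#)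
    -a0c≉0 c nc e = IsDField.nzd-¬ fld (λ z → a0 (trans (sym (-‿involutive _)) (trans (-‿cong z) -0#≈0#))) nc e

    -- The curve is smooth, so its components do not meet.
    other-nonzero : ∀ f₁ f₂ → f₁ BP.* f₂ BP.≈ b → ∀ c → ¬ (c ≈ 0#) → ⟦ evH c ⟧ (f₁ B.! 0) ≈ 0# → ¬ (⟦ evH c ⟧ (f₂ B.! 0) ≈ 0#)
    other-nonzero f₁ f₂ e c nc z₁ z₂ = -a0c≉0 c nc (trans (sym (A.con-at _ 0)) (trans (sym (A.atP (leibniz-at f₁ f₂ e c) 0))
      (trans (A.!+ _ _ 0) (0+0≈0 (trans (A.!* _ _ 0) (x*0≈0 (trans (mz-at c f₂ 0) z₂))) (trans (A.!* _ _ 0) (0*x≈0 (trans (mz-at c f₁ 0) z₁)))))))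

    -- At z = c the polynomial f₂ is coprime to x, because f₂(0, c) ≠ 0, and to f₁, by the Leibniz
    -- rule for θ b = -a₀ z. So it is coprime to x f₁, and x f₁ f₂ = x b is a polynomial in x^q; by
    -- `coprime-supp` so is f₂(x, c). Its degree is still e₂ because the leading coefficient of b
    -- does not vanish at c.
    q-divides : ∀ f₁ f₂ e₁ e₂ → f₁ BP.* f₂ BP.≈ b → B.HasDeg f₁ e₁ → B.HasDeg f₂ e₂ →
      ∀ c → c ^ (q ℕ.^ t) ≈ c → ¬ (c ^ q ≈ c) → ¬ (⟦ evH c ⟧ (f₂ B.! 0) ≈ 0#) → q ∣ e₂
    q-divides f₁ f₂ e₁ e₂ e h₁ h₂ c cf nq nz with q ∣? e₂
    ... | yes d = d
    ... | no nd = ⊥-elim (lead≉0 (trans (sym (mz-at c f₂ e₂)) (supp e₂ nd)))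
      where
      module Su = Support Fld ch using (Supp; coprime-supp)
      g₁ = ⟦ mz c ⟧ f₁
      g₂ = ⟦ mz c ⟧ f₂
      γ₁ = ⟦ mz c ⟧ (Θ f₁)
      γ₂ = ⟦ mz c ⟧ (Θ f₂)
      X = A.mono 1 1#
      lead≉0 : ¬ (⟦ evH c ⟧ (f₂ B.! e₂) ≈ 0#)
      lead≉0 z = IsDField.nzd-¬ fld ar (λ d → nq (cop c cf (sym (trans (sym cf) (x-y≈0⇒x≈y d)))))
        (trans (sym (evH-coefβ c r)) (trans (⟦⟧-cong (evH c) (AP.sym (proj₂ (leads f₁ f₂ e₁ e₂ e h₁ h₂)))) (trans (⟦⟧-* (evH c) _ _) (x*0≈0 z))))
      g₂0≉0 : ¬ (g₂ A.! 0 ≈ 0#)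
      g₂0≉0 z = nz (trans (sym (mz-at c f₂ 0)) z)
      si = IsDField.inv fld (g₂ A.! 0) g₂0≉0
      mi = IsDField.inv fld (- a 0 * c) (-a0c≉0 c (fixed≉0 c nq))
      S = A.con (proj₁ si)
      Mm = A.con (proj₁ mi)
      tl : A.Pol
      tl = A.mkPol (A.tail (A.cf g₂)) (A.bound g₂) (λ i le → A.vanish g₂ (suc i) (ℕₚ.m≤n⇒m≤1+n le))
      head-tail : g₂ AP.- X AP.* tl AP.≈ A.con (g₂ A.! 0)
      head-tail = A.mkP λ { zero → trans (A.!- g₂ (X AP.* tl) 0) (trans (-‿congr refl (A.mono-*-shift 1 1# tl 0)) (trans (x-0 _) (sym (A.con-at _ 0))))
                          ; (suc i) → trans (A.!- g₂ (X AP.* tl) (suc i)) (trans (x≈y⇒x-y≈0 (sym (trans (A.mono-* 1 1# tl i) (trans (*-identityˡ _) (A.cf-mkPol i))))) (sym (A.con-at _ (suc i)))) }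
      con-inv : ∀ x y → x * y ≈ 1# → A.con y AP.* A.con x AP.≈ AP.1#
      con-inv x y e = AP.trans (AP.sym (⟦⟧-* (conHom L) y x)) (AP.trans (⟦⟧-cong (conHom L) (trans (*-comm y x) e)) (⟦⟧-1 (conHom L)))
      bez₁ : AP.- (S AP.* tl) AP.* X AP.+ S AP.* g₂ AP.≈ AP.1#
      bez₁ = begin
        AP.- (S AP.* tl) AP.* X AP.+ S AP.* g₂ ≈⟨ AP.+-comm _ _ ⟩
        S AP.* g₂ AP.+ AP.- (S AP.* tl) AP.* X ≈⟨ AP.+-congˡ (AP.trans (AP.sym (AP.-‿distribˡ-* _ _)) (AP.-‿cong (AP.*S.xy∙z≈x∙zy _ _ _))) ⟩
        S AP.* g₂ AP.- S AP.* (X AP.* tl) ≈⟨ AP.distribˡ-- _ _ _ ⟨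
        S AP.* (g₂ AP.- X AP.* tl) ≈⟨ AP.*-congˡ head-tail ⟩
        S AP.* A.con (g₂ A.! 0) ≈⟨ con-inv _ _ (proj₂ si) ⟩
        AP.1# ∎
        where open AP.≈R
      bez₂ : (Mm AP.* γ₂) AP.* g₁ AP.+ (Mm AP.* γ₁) AP.* g₂ AP.≈ AP.1#
      bez₂ = begin
        (Mm AP.* γ₂) AP.* g₁ AP.+ (Mm AP.* γ₁) AP.* g₂ ≈⟨ AP.+-comm _ _ ⟩
        (Mm AP.* γ₁) AP.* g₂ AP.+ (Mm AP.* γ₂) AP.* g₁ ≈⟨ AP.+-cong (AP.*-assoc _ _ _) (AP.*S.xy∙z≈x∙zy _ _ _) ⟩
        Mm AP.* (γ₁ AP.* g₂) AP.+ Mm AP.* (g₁ AP.* γ₂) ≈⟨ AP.distribˡ _ _ _ ⟨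
        Mm AP.* (γ₁ AP.* g₂ AP.+ g₁ AP.* γ₂) ≈⟨ AP.*-congˡ (leibniz-at f₁ f₂ e c) ⟩
        Mm AP.* A.con (- a 0 * c) ≈⟨ con-inv _ _ (proj₂ mi) ⟩
        AP.1# ∎
        where open AP.≈R
      product : (X AP.* g₁) AP.* g₂ AP.≈ X AP.* ⟦ mz c ⟧ b
      product = AP.trans (AP.*-assoc _ _ _) (AP.*-congˡ (AP.trans (AP.sym (⟦⟧-* (mz c) f₁ f₂)) (⟦⟧-cong (mz c) e)))
      psupp : Su.Supp q ((X AP.* g₁) AP.* g₂)
      psupp zero nd = trans (A.atP product 0) (A.mono-*-shift 1 1# (⟦ mz c ⟧ b) 0)
      psupp (suc i) nd = trans (A.atP product (suc i)) (trans (A.mono-* 1 1# (⟦ mz c ⟧ b) i) (trans (*-identityˡ _) (mz-b-fixed c cf i nd)))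
      supp : Su.Supp q g₂
      supp = Su.coprime-supp h (X AP.* g₁) g₂ _ _
        (coprime-mul (PolyRing L) (AP.- (S AP.* tl)) S (Mm AP.* γ₂) (Mm AP.* γ₁) X g₁ g₂ bez₁ bez₂) psupp g₂0≉0

    coefβ0-HasDeg : A.HasDeg (coefβ 0) (q ℕ.^ t)
    coefβ0-HasDeg = A.hasDeg (λ z → a0 (trans (sym (trans (coefβ-at 0 (q ℕ.^ t)) (trans (*-congˡ (trans (-‿congr (A.mono-at (q ℕ.^ t) 1#) (A.mono-off 1 1# (q ℕ.^ t) (ℕₚ.>⇒≢ 1<q^t))) (x-0 _))) (*-identityʳ _)))) z))
      (A.deg< λ j lt → trans (coefβ-at 0 j) (x*0≈0 (trans (-‿congr (A.van (A.mono-vanish (q ℕ.^ t) 1#) j lt)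
        (A.van (A.mono-vanish 1 1#) j (ℕₚ.<-trans 1<q^t lt))) (x-x 0#))))
      where
      1<q^t : 1 < q ℕ.^ t
      1<q^t = ℕₚ.<-trans t>1 (n<q^n q>1 t)

    constants : ∀ f₁ f₂ → f₁ BP.* f₂ BP.≈ b → ∃ λ j₁ → ∃ λ j₂ → A.HasDeg (f₁ B.! 0) j₁ × A.HasDeg (f₂ B.! 0) j₂ × j₁ ℕ.+ j₂ ≡ q ℕ.^ t
    constants f₁ f₂ e with FA.deg? (f₁ B.! 0) | FA.deg? (f₂ B.! 0)
    ... | inj₁ z | _ = ⊥-elim (FA.HasDeg⇒≉0 coefβ0-HasDeg (AP.trans (AP.sym (AP.trans (AP.sym (B.!* f₁ f₂ 0)) (AP.trans (B.atP e 0) (b-at 0 z≤n)))) (AP.0*x≈0 z)))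
    ... | inj₂ _ | inj₁ z = ⊥-elim (FA.HasDeg⇒≉0 coefβ0-HasDeg (AP.trans (AP.sym (AP.trans (AP.sym (B.!* f₁ f₂ 0)) (AP.trans (B.atP e 0) (b-at 0 z≤n)))) (AP.x*0≈0 z)))
    ... | inj₂ (j₁ , h₁) | inj₂ (j₂ , h₂) = j₁ , j₂ , h₁ , h₂ ,
      FA.HasDeg-unique (FA.HasDeg-* h₁ h₂) (FA.HasDeg-resp (AP.sym (AP.trans (AP.sym (B.!* f₁ f₂ 0)) (AP.trans (B.atP e 0) (b-at 0 z≤n)))) coefβ0-HasDeg)

    -- r > t: all branches over z = ∞ have slope (q^r - q^t)/(q^r - 1).
    module _ (t<r : t < r)
             (arith : ∀ e → q ∣ e → e ≤ ex r → ex r ∣ (q ℕ.^ r ℕ.∸ q ℕ.^ t) ℕ.* e → e ≡ 0) where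

      ¬¬trivial-> : ∀ f₁ f₂ e₁ e₂ → f₁ BP.* f₂ BP.≈ b → B.HasDeg f₁ e₁ → B.HasDeg f₂ e₂ →
        ∀ z₀ → z₀ ^ (q ℕ.^ t) ≈ z₀ → ¬ (z₀ ^ q ≈ z₀) → ⟦ evH z₀ ⟧ (f₁ B.! 0) ≈ 0# → ¬ ¬ (e₂ ≡ 0)
      ¬¬trivial-> f₁ f₂ e₁ e₂ e h₁ h₂ z₀ zf nq z₁ k with constants f₁ f₂ e
      ... | j₁ , j₂ , c₁ , c₂ , jsum = GN.¬¬factor-norms f₁ f₂ b (N ℕ.* q ℕ.^ t) j₁ j₂ e b-norm
          (≡.trans (≡.sym (ℕₚ.*-distribˡ-+ N j₁ j₂)) (≡.cong (N ℕ.*_) jsum)) (A.lead≉0 c₁) (A.lead≉0 c₂) λ { (n₁ , n₂) →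
          k (arith e₂ (q-divides f₁ f₂ e₁ e₂ e h₁ h₂ z₀ zf nq (other-nonzero f₁ f₂ e z₀ (fixed≉0 z₀ nq) z₁))
              (≡.subst (e₂ ≤_) (proj₁ lds) (ℕₚ.m≤n+m e₂ e₁)) (divisibility n₁ n₂)) }
        where
        -- At z = ∞ the Newton polygon of b is a single edge from z^(q^t) to x^(q^r - 1) z^(q^r), of
        -- slope M / N.
        N = ex r
        M = q ℕ.^ r ℕ.∸ q ℕ.^ t
        N>0 : 0 < N
        N>0 = ℕₚ.≤-pred (≡.subst (1 <_) (≡.sym (suc-ex r)) (ℕₚ.≤-trans (s≤s r>0) (n<q^n q>1 r)))
        module GN = GaussNorm Fld N M N>0 using (Nrm≤; ¬¬factor-norms)
        lds = leads f₁ f₂ e₁ e₂ e h₁ h₂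
        M+ : q ℕ.^ t ℕ.+ M ≡ q ℕ.^ r
        M+ = ℕₚ.m+[n∸m]≡n (q^-mono (ℕₚ.<⇒≤ t<r))
        slope : ∀ i → i ≤ r → N ℕ.* q ℕ.^ i ≤ N ℕ.* q ℕ.^ t ℕ.+ M ℕ.* ex i
        slope i le with ℕₚ.≤-total i t
        ... | inj₁ i≤t = ℕₚ.≤-trans (ℕₚ.*-monoʳ-≤ N (q^-mono i≤t)) (ℕₚ.m≤m+n _ _)
        ... | inj₂ t≤i = slope-arith (ex i) (ex t) N (q ℕ.^ i) (q ℕ.^ t) (q ℕ.^ r) M (suc-ex i) (suc-ex t) (suc-ex r) M+
            (ℕₚ.pred-mono-≤ (q^-mono le))
          where
          -- (Q-1)(I-T) <= (Q-T)(I-1) because the difference is (Q-I)(T-1).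
          slope-arith : ∀ ei et N I T Q M → suc ei ≡ I → suc et ≡ T → suc N ≡ Q → T ℕ.+ M ≡ Q → ei ≤ N →
            N ℕ.* I ≤ N ℕ.* T ℕ.+ M ℕ.* ei
          slope-arith ei et N .(suc ei) .(suc et) .(suc N) M ≡.refl ≡.refl ≡.refl eM ei≤N = ℕₚ.+-cancelʳ-≤ (et ℕ.* ei) _ _ (begin
            N ℕ.* suc ei ℕ.+ et ℕ.* ei ≡⟨ solve 3 (λ N e t → N :* (con 1 :+ e) :+ t :* e := N :+ N :* e :+ t :* e) ≡.refl N ei et ⟩
            N ℕ.+ N ℕ.* ei ℕ.+ et ℕ.* ei ≤⟨ ℕₚ.+-monoʳ-≤ (N ℕ.+ N ℕ.* ei) (ℕₚ.*-monoʳ-≤ et ei≤N) ⟩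
            N ℕ.+ N ℕ.* ei ℕ.+ et ℕ.* N ≡⟨ ≡.cong (λ x → N ℕ.+ x ℕ.* ei ℕ.+ et ℕ.* N) (≡.sym (ℕₚ.suc-injective eM)) ⟩
            N ℕ.+ (et ℕ.+ M) ℕ.* ei ℕ.+ et ℕ.* N ≡⟨ solve 4 (λ N t M e → N :+ (t :+ M) :* e :+ t :* N := N :* (con 1 :+ t) :+ M :* e :+ t :* e) ≡.refl N et M ei ⟩
            N ℕ.* suc et ℕ.+ M ℕ.* ei ℕ.+ et ℕ.* ei ∎)
            where open ℕₚ.≤-Reasoning
                  open +-*-Solver
        b-norm : GN.Nrm≤ b (N ℕ.* q ℕ.^ t)
        b-norm j k lt with b-cases j
        ... | inj₂ z = trans (A.atP z k) (A.!0 k)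
        ... | inj₁ (i , le , ≡.refl) = trans (A.atP (b-at i le) k) (trans (coefβ-at i k) (x*0≈0 (trans (-‿congr
            (A.mono-off (q ℕ.^ t) 1# k (λ { ≡.refl → ℕₚ.<⇒≱ lt (ℕₚ.m≤m+n _ _) }))
            (A.mono-off (q ℕ.^ i) 1# k (λ { ≡.refl → ℕₚ.<⇒≱ lt (slope i le) }))) (x-x 0#))))
        deg-lead : ∀ f e → B.HasDeg f e → ∃ λ D → A.HasDeg (f B.! e) D
        deg-lead f e hf with FA.deg? (f B.! e)
        ... | inj₁ z = ⊥-elim (B.lead≉0 hf z)
        ... | inj₂ d = d
        coefβr-HasDeg : A.HasDeg (coefβ r) (q ℕ.^ r)
        coefβr-HasDeg = A.hasDeg (λ z → -ar≉0 (trans (sym coefβ-r) z)) (A.deg< λ j lt → trans (coefβ-at r j) (x*0≈0 (trans (-‿congr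
          (A.van (A.mono-vanish (q ℕ.^ t) 1#) j (ℕₚ.<-trans (q^-mono-< t<r) lt)) (A.van (A.mono-vanish (q ℕ.^ r) 1#) j lt)) (x-x 0#))))
        -- The norms give N D ≤ N j + M e for the leading terms x^e z^D of both factors. The sums of
        -- the two sides agree, as b is the product, so N D₂ = N j₂ + M e₂.
        divisibility : GN.Nrm≤ f₁ (N ℕ.* j₁) → GN.Nrm≤ f₂ (N ℕ.* j₂) → N ∣ M ℕ.* e₂
        divisibility n₁ n₂ = ∣m+n∣m⇒∣n (≡.subst (N ∣_) equality (m∣m*n D₂)) (m∣m*n j₂)
          where
          D₁ = proj₁ (deg-lead f₁ e₁ h₁)
          D₂ = proj₁ (deg-lead f₂ e₂ h₂)
          H₁ = proj₂ (deg-lead f₁ e₁ h₁)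
          H₂ = proj₂ (deg-lead f₂ e₂ h₂)
          Dsum : D₁ ℕ.+ D₂ ≡ q ℕ.^ r
          Dsum = FA.HasDeg-unique (FA.HasDeg-* H₁ H₂) (FA.HasDeg-resp (AP.sym (proj₂ lds)) coefβr-HasDeg)
          le₁ : N ℕ.* D₁ ≤ N ℕ.* j₁ ℕ.+ M ℕ.* e₁
          le₁ = ℕₚ.≮⇒≥ (λ lt → A.lead≉0 H₁ (n₁ e₁ D₁ lt))
          le₂ : N ℕ.* D₂ ≤ N ℕ.* j₂ ℕ.+ M ℕ.* e₂
          le₂ = ℕₚ.≮⇒≥ (λ lt → A.lead≉0 H₂ (n₂ e₂ D₂ lt))
          total : N ℕ.* D₁ ℕ.+ N ℕ.* D₂ ≡ (N ℕ.* j₁ ℕ.+ M ℕ.* e₁) ℕ.+ (N ℕ.* j₂ ℕ.+ M ℕ.* e₂)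
          total = ≡.trans (≡.sym (ℕₚ.*-distribˡ-+ N D₁ D₂)) (≡.trans (≡.cong (N ℕ.*_) (≡.trans Dsum (≡.sym M+)))
            (≡.trans (≡.cong (λ x → N ℕ.* (x ℕ.+ M)) (≡.sym jsum)) (≡.trans (solve 4 (λ N j₁ j₂ M → N :* (j₁ :+ j₂ :+ M) := N :* j₁ :+ N :* j₂ :+ M :* N) ≡.refl N j₁ j₂ M)
              (≡.trans (≡.cong (λ x → N ℕ.* j₁ ℕ.+ N ℕ.* j₂ ℕ.+ M ℕ.* x) (≡.sym (proj₁ lds)))
                (solve 6 (λ N j₁ j₂ M e₁ e₂ → N :* j₁ :+ N :* j₂ :+ M :* (e₁ :+ e₂) := (N :* j₁ :+ M :* e₁) :+ (N :* j₂ :+ M :* e₂)) ≡.refl N j₁ j₂ M e₁ e₂)))))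
            where open +-*-Solver
          equality : N ℕ.* D₂ ≡ N ℕ.* j₂ ℕ.+ M ℕ.* e₂
          equality = ℕₚ.≤-antisym le₂ (ℕₚ.+-cancelˡ-≤ (N ℕ.* j₁ ℕ.+ M ℕ.* e₁) _ _
            (ℕₚ.≤-trans (ℕₚ.≤-reflexive (≡.sym total)) (ℕₚ.+-monoˡ-≤ (N ℕ.* D₂) le₁)))

    -- r < t: a component through (0 , z₀) passes through all points (0 , z₁), so the other one has small degree in z.
    module _ (r<t : r < t)
             (ρ : ℕ → Carrier) (ρ-distinct : Distinct (q ℕ.^ t) ρ) (ρ-fixed : ∀ i → i < q ℕ.^ t → ρ i ^ (q ℕ.^ t) ≈ ρ i)
             (σ : ℕ → Carrier) (σ-distinct : Distinct q σ) (σ-fixed : ∀ i → i < q → σ i ^ q ≈ σ i) where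

      ¬¬trivial-< : ∀ f₁ f₂ e₁ e₂ → f₁ BP.* f₂ BP.≈ b → B.HasDeg f₁ e₁ → B.HasDeg f₂ e₂ →
        ∀ z₀ → z₀ ^ (q ℕ.^ t) ≈ z₀ → ¬ (z₀ ^ q ≈ z₀) → ⟦ evH z₀ ⟧ (f₁ B.! 0) ≈ 0# →
        (∀ c → ¬ (⟦ mz c ⟧ f₁ AP.≈ AP.0#)) → ¬ ¬ (e₂ ≡ 0)
      ¬¬trivial-< f₁ f₂ e₁ e₂ e h₁ h₂ z₀ zf nq z₁ prim k with constants f₁ f₂ e
      ... | j₁ , j₂ , c₁ , c₂ , jsum = GN.¬¬factor-norms f₁ f₂ b (1 ℕ.* q ℕ.^ t) j₁ j₂ e b-norm
          (≡.trans (≡.sym (ℕₚ.*-distribˡ-+ 1 j₁ j₂)) (≡.cong (1 ℕ.*_) jsum)) (A.lead≉0 c₁) (A.lead≉0 c₂) λ { (_ , n₂) → k (degree-zero n₂) }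
        where
        -- With the weights 1 and 0 the norm is the degree in z.
        module GN = GaussNorm Fld 1 0 (s≤s z≤n) using (Nrm≤; ¬¬factor-norms)
        q>0 : 0 < q
        q>0 = ℕₚ.<-trans (s≤s z≤n) q>1
        V : A.Pol
        V = A.mono q 1# AP.- A.mono 1 1#
        V-HasDeg : A.HasDeg V q
        V-HasDeg = A.hasDeg
          (λ z → IsDField.1≉0 fld (trans (sym (trans (A.!- _ _ q) (trans (-‿congr (A.mono-at q 1#) (A.mono-off 1 1# q (ℕₚ.>⇒≢ q>1))) (x-0 1#)))) z))
          (A.+-Deg< (A.mono-vanish q 1#) (A.neg-Deg< (A.Deg<-mono (s≤s q>0) (A.mono-vanish 1 1#))))
        evH-V : ∀ c → ⟦ evH c ⟧ V ≈ c ^ q - c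
        evH-V c = trans (⟦⟧-- (evH c) _ _) (-‿congr (trans (evH-mono c q 1#) (*-identityˡ _)) (trans (evH-mono c 1 1#) (trans (*-identityˡ _) (*-identityʳ c))))
        fixed-^ : ∀ i c → c ^ q ≈ c → c ^ (q ℕ.^ i) ≈ c
        fixed-^ zero c cf = *-identityʳ c
        fixed-^ (suc i) c cf = trans (sym (^-assocʳ c q (q ℕ.^ i))) (trans (^-congˡ (q ℕ.^ i) cf) (fixed-^ i c cf))
        lds = leads f₁ f₂ e₁ e₂ e h₁ h₂
        q∣e₂ : q ∣ e₂
        q∣e₂ = q-divides f₁ f₂ e₁ e₂ e h₁ h₂ z₀ zf nq (other-nonzero f₁ f₂ e z₀ (fixed≉0 z₀ nq) z₁)
        -- q divides e₂, and e₁ + e₂ + 1 = q^r.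
        q∤e₁ : ¬ (q ∣ e₁)
        q∤e₁ d = ℕₚ.<⇒≱ q>1 (∣⇒≤ (∣m+n∣m⇒∣n (≡.subst (q ∣_) eq (q∣q^r r r>0)) (∣m∣n⇒∣m+n d q∣e₂)))
          where
          q∣q^r : ∀ r → 0 < r → q ∣ q ℕ.^ r
          q∣q^r (suc r) _ = m∣m*n (q ℕ.^ r)
          eq : q ℕ.^ r ≡ e₁ ℕ.+ e₂ ℕ.+ 1
          eq = ≡.trans (≡.sym (suc-ex r)) (≡.trans (≡.cong suc (≡.sym (proj₁ lds))) (ℕₚ.+-comm 1 (e₁ ℕ.+ e₂)))
        -- Were f₁ nonzero at such a point (0, c) with c outside F_q, `q-divides` with the factors
        -- exchanged would give q ∣ e₁.
        f₁-vanishes : ∀ i → i < q ℕ.^ t → ⟦ evH (ρ i) ⟧ (f₁ B.! 0 AP.* V) ≈ 0#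
        f₁-vanishes i i< with IsDField._≟_ fld (ρ i ^ q) (ρ i)
        ... | yes e′ = trans (⟦⟧-* (evH (ρ i)) _ _) (x*0≈0 (trans (evH-V (ρ i)) (x≈y⇒x-y≈0 e′)))
        ... | no ne with IsDField.≟0 fld (⟦ evH (ρ i) ⟧ (f₁ B.! 0))
        ...   | yes z = trans (⟦⟧-* (evH (ρ i)) _ _) (0*x≈0 z)
        ...   | no nz = ⊥-elim (q∤e₁ (q-divides f₂ f₁ e₂ e₁ (BP.trans (BP.*-comm f₂ f₁) e) h₂ h₁ (ρ i) (ρ-fixed i i<) ne nz))
        -- f₁(0, z) (z^q - z) has degree j₁ + q and vanishes on the q^t = j₁ + j₂ elements of
        -- F_{q^t}.
        j₂≤q : j₂ ≤ q
        j₂≤q = ℕₚ.+-cancelˡ-≤ j₁ j₂ q (≡.subst (_≤ j₁ ℕ.+ q) (≡.sym jsum) (ℕₚ.≮⇒≥ λ lt →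
          FA.HasDeg⇒≉0 hV (FA.root-bound (suc (j₁ ℕ.+ q)) (q ℕ.^ t) ρ (f₁ B.! 0 AP.* V) (A.below hV) lt ρ-distinct f₁-vanishes)))
          where hV = FA.HasDeg-* c₁ V-HasDeg
        b-norm : GN.Nrm≤ b (1 ℕ.* q ℕ.^ t)
        b-norm j k lt with b-cases j
        ... | inj₂ z = trans (A.atP z k) (A.!0 k)
        ... | inj₁ (i , le , ≡.refl) = trans (A.atP (b-at i le) k) (trans (coefβ-at i k) (x*0≈0 (trans (-‿congr
            (A.mono-off (q ℕ.^ t) 1# k (λ { ≡.refl → ℕₚ.<-irrefl ≡.refl lt′ }))
            (A.mono-off (q ℕ.^ i) 1# k (λ { ≡.refl → ℕₚ.<⇒≱ lt′ (q^-mono (ℕₚ.≤-trans le (ℕₚ.<⇒≤ r<t))) }))) (x-x 0#))))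
          where
          lt′ : q ℕ.^ t < k
          lt′ = ≡.subst₂ _<_ (≡.trans (ℕₚ.+-identityʳ _) (ℕₚ.*-identityˡ _)) (ℕₚ.*-identityˡ k) lt
        -- For c in F_q the whole of b(x, c) is zero, whereas f₁(x, c) is not, by `prim`.
        mz-f₂ : ∀ c → c ^ q ≈ c → ∀ i → ⟦ evH c ⟧ (f₂ B.! i) ≈ 0#
        mz-f₂ c cf i = trans (sym (mz-at c f₂ i)) (trans (A.atP (IsDDom.cancel dom₁ (prim c)
          (AP.trans (AP.sym (⟦⟧-* (mz c) f₁ f₂)) (AP.trans (⟦⟧-cong (mz c) e) mz-b))) i) (A.!0 i))
          where
          mz-b : ⟦ mz c ⟧ b AP.≈ AP.0#
          mz-b = A.mkP λ j → trans (mz-at c b j) (trans (go j (b-cases j)) (sym (A.!0 j)))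
            where
            go : ∀ j → (∃ λ i → i ≤ r × j ≡ ex i) ⊎ (b B.! j AP.≈ AP.0#) → ⟦ evH c ⟧ (b B.! j) ≈ 0#
            go j (inj₂ z) = ⟦⟧≈0 (evH c) z
            go j (inj₁ (i , le , ≡.refl)) = trans (⟦⟧-cong (evH c) (b-at i le)) (trans (evH-coefβ c i)
              (x*0≈0 (x≈y⇒x-y≈0 (trans (fixed-^ t c cf) (sym (fixed-^ i c cf))))))
        module _ (n₂ : GN.Nrm≤ f₂ (1 ℕ.* j₂)) where
          g : ℕ → Carrier
          g i = f₂ B.! i A.! q
          -- The coefficient has degree at most q in z and vanishes at the q elements of F_q.
          f₂-form : ∀ i → f₂ B.! i AP.≈ A.con (g i) AP.* V
          f₂-form i = AP.x-y≈0⇒x≈y (FA.root-bound q q σ d d-deg ℕₚ.≤-refl σ-distinct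
            (λ s s< → trans (⟦⟧-- (evH (σ s)) _ _) (trans (-‿congr (mz-f₂ (σ s) (σ-fixed s s<) i)
              (trans (⟦⟧-* (evH (σ s)) _ _) (x*0≈0 (trans (evH-V (σ s)) (x≈y⇒x-y≈0 (σ-fixed s s<)))))) (x-x 0#))))
            where
            d = f₂ B.! i AP.- A.con (g i) AP.* V
            d-deg : A.Deg< d q
            d-deg = A.deg< λ j le → trans (A.!- _ _ j) (trans (-‿congr refl (A.con-* (g i) V j)) (at j (ℕₚ.m≤n⇒m<n∨m≡n le)))
              where
              at : ∀ j → q < j ⊎ q ≡ j → f₂ B.! i A.! j - g i * V A.! j ≈ 0#
              at j (inj₁ lt) = trans (-‿congr (n₂ i j (≡.subst₂ _<_ (≡.sym (≡.trans (ℕₚ.+-identityʳ _) (ℕₚ.*-identityˡ j₂))) (≡.sym (ℕₚ.*-identityˡ j)) (ℕₚ.≤-<-trans j₂≤q lt)))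
                (x*0≈0 (A.van (A.below V-HasDeg) j lt))) (x-x 0#)
              at j (inj₂ ≡.refl) = x≈y⇒x-y≈0 (sym (trans (*-congˡ (trans (A.!- _ _ q) (trans (-‿congr (A.mono-at q 1#) (A.mono-off 1 1# q (ℕₚ.>⇒≢ q>1))) (x-0 1#)))) (*-identityʳ _)))
          γ₂ = ⟦ mz 1# ⟧ (Θ f₂)
          θV-1 : ⟦ evH 1# ⟧ (TA.θP V) ≈ - 1#
          θV-1 = trans (⟦⟧-cong (evH 1#) θV) (trans (⟦⟧-neg (evH 1#) _) (-‿cong (trans (evH-mono 1# 1 1#) (trans (*-identityˡ _) (1^n≈1 1)))))
            where
            θV : TA.θP V AP.≈ AP.- A.mono 1 1#
            θV = A.mkP λ j → trans (TA.θP-at V j) (trans (×-congʳ j (A.!- _ _ j)) (trans (×ₙ-sub j _ _)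
              (trans (0+x≈x (trans (×-congʳ j (≡⇒≈ (≡.cong (λ m → A.mono m 1# A.! j) (≡.sym (ℕₚ.*-identityʳ q))))) (θ-power 1 j (s≤s z≤n))))
                (trans (-‿cong (one j)) (sym (A.!neg _ j))))))
              where
              one : ∀ j → j ×ₙ (A.mono 1 1# A.! j) ≈ A.mono 1 1# A.! j
              one j with j ℕ.≟ 1
              ... | yes ≡.refl = +-identityʳ _
              ... | no ne = trans (×ₙ-zero j (A.mono-off 1 1# j ne)) (sym (A.mono-off 1 1# j ne))
          γ₂-at : ∀ i → γ₂ A.! i ≈ - g i
          γ₂-at i = begin
            γ₂ A.! i ≈⟨ trans (mz-at 1# (Θ f₂) i) (⟦⟧-cong (evH 1#) (AP.trans (Θ-at f₂ i) (AP.trans (TA.θP-cong (f₂-form i)) (TA.θP-* (A.con (g i)) V)))) ⟩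
            ⟦ evH 1# ⟧ (TA.θP (A.con (g i)) AP.* V AP.+ A.con (g i) AP.* TA.θP V) ≈⟨ trans (⟦⟧-+ (evH 1#) _ _) (+-cong (⟦⟧-* (evH 1#) _ _) (⟦⟧-* (evH 1#) _ _)) ⟩
            ⟦ evH 1# ⟧ (TA.θP (A.con (g i))) * ⟦ evH 1# ⟧ V + ⟦ evH 1# ⟧ (A.con (g i)) * ⟦ evH 1# ⟧ (TA.θP V)
              ≈⟨ +-cong (x*0≈0 (trans (evH-V 1#) (x≈y⇒x-y≈0 (1^n≈1 q)))) (*-cong (Eval.eval-con (idHom L) 1# (g i)) θV-1) ⟩
            0# + g i * - 1# ≈⟨ trans (+-identityˡ _) (trans (sym (-‿distribʳ-* _ _)) (-‿cong (*-identityʳ _))) ⟩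
            - g i ∎
            where open ≈R
          -- f₂ vanishes at z = 1, so of the Leibniz rule only f₁ θf₂ remains there. As θ(z^q - z) =
          -- -z, the second factor is -Σ g_i x^i; it divides a nonzero constant, which forces the
          -- degree e₂ of f₂ in x to be 0.
          unit : ⟦ mz 1# ⟧ f₁ AP.* γ₂ AP.≈ A.con (- a 0 * 1#)
          unit = AP.trans (AP.sym (AP.0+x≈x (AP.x*0≈0 (A.mkP λ i → trans (mz-at 1# f₂ i) (trans (mz-f₂ 1# (1^n≈1 q) i) (sym (A.!0 i))))))) (leibniz-at f₁ f₂ e 1#)
          degree-zero : e₂ ≡ 0
          degree-zero with e₂ ℕ.≟ 0
          ... | yes z = z
          ... | no nz = ⊥-elim (γ₂e≉0 (A.van γ₂-deg e₂ (ℕₚ.n≢0⇒n>0 nz)))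
            where
            unit≉0 : ¬ (- a 0 * 1# ≈ 0#)
            unit≉0 = -a0c≉0 1# (IsDField.1≉0 fld)
            γ₂e≉0 : ¬ (γ₂ A.! e₂ ≈ 0#)
            γ₂e≉0 z = B.lead≉0 h₂ (AP.trans (f₂-form e₂) (AP.0*x≈0 (AP.trans (⟦⟧-cong (conHom L) ge≈0) (⟦⟧-0 (conHom L)))))
              where
              ge≈0 : g e₂ ≈ 0#
              ge≈0 = trans (sym (-‿involutive _)) (trans (-‿cong (trans (sym (γ₂-at e₂)) z)) -0#≈0#)
            con-HasDeg : A.HasDeg (A.con (- a 0 * 1#)) 0
            con-HasDeg = A.hasDeg (λ z → unit≉0 (trans (sym (A.con-at _ 0)) z)) (A.mkPol-Deg< _ 1 (A.const-vanish _))
            γ₂-deg : A.Deg< γ₂ 1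
            γ₂-deg = Sum.[ (λ z → ⊥-elim (prim 1# z)) , (λ (d , hd) →
              FA.factor-Deg< hd (A.Deg<-mono (ℕₚ.m≤n+m 1 d) (A.Deg<-resp (AP.sym unit) (A.below con-HasDeg)))) ]′ (FA.deg? (⟦ mz 1# ⟧ f₁))

-- Gauss' lemma and the formal branch

divide-out : {R : Ring} → IsDDom R → let open Poly R using (module P; mkPol; bound; vanish; cf-mkPol; mkP; _!_; con; con-*); open Kit R using (_≈_; _*_; 0#; sym; trans; *-congˡ) in ∀ π → ¬ (π ≈ 0#) → ∀ f →
  (∀ i → ∃ λ u → f ! i ≈ π * u) → ∃ λ f′ → f P.≈ con π P.* f′
divide-out {R} dom π nπ f d = mkPol (λ i → proj₁ (d i)) (bound f)
    (λ i le → IsDDom.cancel dom nπ (trans (sym (proj₂ (d i))) (vanish f i le))) ,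
  mkP λ i → trans (proj₂ (d i)) (sym (trans (con-* π _ i) (*-congˡ (cf-mkPol i))))
  where
  open Poly R using (module P; mkPol; bound; vanish; cf-mkPol; mkP; atP; !0; _!_; con; con-*)
  open Kit R using (_≈_; _*_; 0#; sym; trans; *-congˡ)

-- Gauss' lemma for one irreducible polynomial.
prime-content : (F : DField) → let module A = Kit (PolyRing (DField.ring F)) using (_≈_; _*_); open Poly (PolyRing (DField.ring F)) using (module P; mkP; atP; !0; _!_; con) in
  ∀ π → FieldPoly.Irreducible F π → ∀ f g → (∀ i → ∃ λ u → (f P.* g) ! i A.≈ π A.* u) →
  (∃ λ f′ → f P.≈ con π P.* f′) ⊎ (∃ λ g′ → g P.≈ con π P.* g′)
prime-content F π irr f g h = go (IsDDom.nzd (PolyDom.polyDDom (IsDField.ddom (DField.isDFld E-field))) product≈0)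
  where
  module FA = FieldPoly F using (HasDeg⇒≉0; polyDDom; Irreducible; module Irreducible; module Adjoin)
  open FA.Adjoin π irr
  module E = Kit E using (sym; trans)
  module PE = Poly E using (module P; mkP; atP; !0)
  open Poly (PolyRing (DField.ring F)) using (module P; mkP; atP; !0; _!_; con; shift1)
  dom₁ = FA.polyDDom
  red : Hom (PolyRing (PolyRing (DField.ring F))) (PolyRing E)
  red = mapHom quot
  product≈0 : ⟦ red ⟧ f PE.P.* ⟦ red ⟧ g PE.P.≈ PE.P.0#
  product≈0 = PE.P.trans (PE.P.sym (⟦⟧-* red f g)) (PE.mkP λ i → E.trans (mapP-at quot (f P.* g) i)
    (E.trans (∣⇒E≈0 _ (proj₁ (h i)) (proj₂ (h i))) (E.sym (PE.!0 i))))
  divided : ∀ f → ⟦ red ⟧ f PE.P.≈ PE.P.0# → ∃ λ f′ → f P.≈ con π P.* f′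
  divided f z = divide-out dom₁ π (FA.HasDeg⇒≉0 (FA.Irreducible.πdeg irr)) f
    (λ i → E≈0⇒∣ (f ! i) (E.trans (E.sym (mapP-at quot f i)) (E.trans (PE.atP z i) (PE.!0 i))))
  go : (⟦ red ⟧ f PE.P.≈ PE.P.0#) ⊎ (⟦ red ⟧ g PE.P.≈ PE.P.0#) →
    (∃ λ f′ → f P.≈ con π P.* f′) ⊎ (∃ λ g′ → g P.≈ con π P.* g′)
  go (inj₁ z) = inj₁ (divided f z)
  go (inj₂ z) = inj₂ (divided g z)

module Branch (Fld : DField) {p : ℕ} (ch : CharP p (DField.ring Fld)) (h : ℕ) (h>0 : 0 < h)
              (a : ℕ → CommutativeRing.Carrier (DField.ring Fld)) (r t : ℕ)
              (t>1 : 1 < t) (r>0 : 0 < r) (r≢t : ¬ (r ≡ t)) where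
  open DField Fld renaming (ring to L; isDFld to fld)
  open Curve Fld ch h h>0 a r t
    using (q; q>1; ex; suc-ex; R₁; module A; module FA; dom₁; module B; module DB; module AP; module BP; coefβ; b; b-at; evH; evH-coefβ; mz; mz-at; b-HasDeg; leads; constants)
  open PS L using (coefs; mkS; mkS-at; mk≈; at≈; S+; S*; S-neg; S0; S1; constHom; constHom-at; shift1)
  open SeriesKit fld using (Low; Low-resp; Low-mono; Low-+; Low-neg; Low-*ʳ; Low-^; Low-sum; Low-all; X; X-*; X^-*-low; seriesCancel)
  private module L = Kit L using (Carrier; _≈_; _+_; 0#; 1#; sym; trans; +-cong; +-congˡ; +-identityˡ; +-identityʳ; *-comm; _^_; ≡⇒≈; x-y≈0⇒x≈y; x≈y⇒x-y≈0; x*0≈0)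
  open Kit (PSRing L) using (Carrier; _≈_; _+_; _*_; -_; 0#; 1#; refl; sym; trans; +-cong; +-congˡ; +-congʳ; *-cong; *-congˡ; *-congʳ; -‿cong; +-assoc; +-comm; +-identityˡ; +-identityʳ; *-assoc; *-comm; *-identityˡ; *-identityʳ; distribˡ; _^_; ^-congˡ; _-_; ≡⇒≈; -‿congr; x-x; x-y≈0⇒x≈y; x≈y⇒x-y≈0; x+y≈z⇒x≈z-y; x-y+y; -‿+; x-y≈-[y-x]; telescope; x*0≈0; 0*x≈0; x+0≈x; sumN; sum-suc; sum-cong; sum-zero; sum-+; module +S; module *S; module ≈R)

  module _ (a0 : ¬ (a 0 L.≈ L.0#)) (ar : ¬ (a r L.≈ L.0#))
           (cop : ∀ x → x L.^ (q ℕ.^ t) L.≈ x → x L.^ (q ℕ.^ r) L.≈ x → x L.^ q L.≈ x)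
           (z₀ : L.Carrier) (z₀-fixed : z₀ L.^ (q ℕ.^ t) L.≈ z₀) (z₀-new : ¬ (z₀ L.^ q L.≈ z₀)) where

    private
      chS : CharP p (PSRing L)
      chS = charP-hom constHom ch

      φ^ : ℕ → Hom (PSRing L) (PSRing L)
      φ^ i = frobκ chS {q} h ≡.refl i

      C₀ = ⟦ constHom ⟧ (proj₁ (IsDField.inv fld (a 0) a0))

      term : ℕ → Carrier → Carrier
      term i f = ⟦ constHom ⟧ (a (suc i)) * (X ^ ex (suc i) * (f ^ (q ℕ.^ t) - f ^ (q ℕ.^ suc i)))

      -- A point on the curve is a fixed point of the additive map T.
      T : Carrier → Carrier
      T f = f ^ (q ℕ.^ t) + C₀ * sumN r (λ i → term i f)

      term-cong : ∀ i {f g} → f ≈ g → term i f ≈ term i g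
      term-cong i e = *-congˡ (*-congˡ (-‿congr (^-congˡ (q ℕ.^ t) e) (^-congˡ (q ℕ.^ suc i) e)))

      T-cong : ∀ {f g} → f ≈ g → T f ≈ T g
      T-cong e = +-cong (^-congˡ (q ℕ.^ t) e) (*-congˡ (sum-cong r (λ i _ → term-cong i e)))

      term-+ : ∀ i f g → term i (f + g) ≈ term i f + term i g
      term-+ i f g = trans (*-congˡ (trans (*-congˡ (trans (-‿congr (⟦⟧-+ (φ^ t) f g) (⟦⟧-+ (φ^ (suc i)) f g)) (-‿+ _ _ _ _))) (distribˡ _ _ _))) (distribˡ _ _ _)

      T-+ : ∀ f g → T (f + g) ≈ T f + T g
      T-+ f g = trans (+-cong (⟦⟧-+ (φ^ t) f g) (trans (*-congˡ (trans (sum-cong r (λ i _ → term-+ i f g)) (sum-+ r _ _))) (distribˡ _ _ _))) (+S.interchange _ _ _ _)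

      T-- : ∀ f g → T f - T g ≈ T (f - g)
      T-- f g = sym (x+y≈z⇒x≈z-y (trans (sym (T-+ (f - g) g)) (T-cong (x-y+y f g))))

      1<q^suc : ∀ i → 1 < q ℕ.^ suc i
      1<q^suc i = ℕₚ.≤-trans (s≤s (s≤s z≤n)) (n<q^n q>1 (suc i))

      Low-− : ∀ {N} f g → Low N f → Low N g → Low N (f - g)
      Low-− f g hf hg = Low-+ f (- g) hf (Low-neg g hg)

      -- All powers of f in T have exponents divisible by q, so T raises the order. Being additive,
      -- it is a contraction, and its iterates converge.
      T-Low : ∀ N f → 0 < N → Low N f → Low (suc N) (T f)
      T-Low N f N>0 hf = Low-+ _ _ ht (Low-*ʳ C₀ _ (Low-sum r _ (λ i _ → Low-*ʳ _ _ (Low-*ʳ _ _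
        (Low-− _ _ ht (Low-^ f (q ℕ.^ suc i) (1<q^suc i) N>0 hf))))))
        where
        ht : Low (suc N) (f ^ (q ℕ.^ t))
        ht = Low-^ f (q ℕ.^ t) (ℕₚ.<-trans t>1 (n<q^n q>1 t)) N>0 hf

      zs : ℕ → Carrier
      zs zero = ⟦ constHom ⟧ z₀
      zs (suc s) = T (zs s)

      ex>0 : ∀ i → 0 < ex (suc i)
      ex>0 i = ℕₚ.≤-pred (≡.subst (1 <_) (≡.sym (suc-ex (suc i))) (1<q^suc i))

      zs-Low : ∀ s → Low (suc s) (zs (suc s) - zs s)
      zs-Low zero = Low-resp {f = (zs 0 ^ (q ℕ.^ t) - zs 0) + C₀ * sumN r (λ i → term i (zs 0))}
        (sym (trans (+-congʳ (+-comm _ _)) (trans (+-assoc _ _ _) (+-comm _ _))))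
        (Low-+ _ _ (Low-resp (sym (trans (+-congʳ (trans (sym (⟦⟧-^ constHom z₀ (q ℕ.^ t))) (⟦⟧-cong constHom z₀-fixed))) (x-x _))) (λ i _ → S0 i))
          (Low-*ʳ C₀ _ (Low-sum r _ (λ i _ → Low-*ʳ _ _ (Low-mono (ex>0 i) (X^-*-low (ex (suc i)) _))))))
      zs-Low (suc s) = Low-resp (sym (T-- (zs (suc s)) (zs s))) (T-Low (suc s) _ (s≤s z≤n) (zs-Low s))

      zs-stable : ∀ i d → coefs (zs (i ℕ.+ d)) i L.≈ coefs (zs i) i
      zs-stable i zero = L.≡⇒≈ (≡.cong (λ m → coefs (zs m) i) (ℕₚ.+-identityʳ i))
      zs-stable i (suc d) = L.trans (L.≡⇒≈ (≡.cong (λ m → coefs (zs m) i) (ℕₚ.+-suc i d)))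
        (L.trans (L.x-y≈0⇒x≈y (L.trans (L.sym (L.trans (S+ _ _ i) (L.+-congˡ (S-neg _ i)))) (zs-Low (i ℕ.+ d) i (s≤s (ℕₚ.m≤m+n i d))))) (zs-stable i d))

    -- The limit of the iterates, read off along the diagonal: the coefficient of X^i is constant
    -- from the i-th iterate on.
    zP : Carrier
    zP = mkS (λ i → coefs (zs i) i)

    private
      zP-Low : ∀ s → Low (suc s) (zP - zs s)
      zP-Low s i lt = L.trans (S+ _ _ i) (L.trans (L.+-cong (mkS-at _ i) (S-neg _ i)) (L.x≈y⇒x-y≈0
        (L.sym (≡.subst (λ m → coefs (zs m) i L.≈ coefs (zs i) i) (ℕₚ.m+[n∸m]≡n (ℕₚ.≤-pred lt)) (zs-stable i (s ℕ.∸ i))))))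

      T-fixed : T zP ≈ zP
      T-fixed = x-y≈0⇒x≈y (Low-all λ N → Low-resp (telescope (T zP) (zs (suc N)) zP)
        (Low-+ _ _ (Low-mono (ℕₚ.≤-trans (ℕₚ.n≤1+n N) (ℕₚ.n≤1+n _)) (Low-resp (sym (T-- zP (zs N))) (T-Low (suc N) _ (s≤s z≤n) (zP-Low N))))
          (Low-mono (ℕₚ.≤-trans (ℕₚ.n≤1+n N) (ℕₚ.n≤1+n _)) (Low-resp (sym (x-y≈-[y-x] _ _)) (Low-neg _ (zP-Low (suc N)))))))

    evR : Hom R₁ (PSRing L)
    evR = Eval.evalHom constHom zP

    -- Restriction to the branch x = X, z = `zP`.
    evP : Hom (PolyRing R₁) (PSRing L)
    evP = Eval.evalHom evR X

    private
      evR-coefβ : ∀ i → ⟦ evR ⟧ (coefβ i) ≈ ⟦ constHom ⟧ (a i) * (zP ^ (q ℕ.^ t) - zP ^ (q ℕ.^ i))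
      evR-coefβ i = trans (⟦⟧-* evR _ _) (*-cong (Eval.eval-con constHom zP (a i)) (trans (⟦⟧-- evR _ _)
        (-‿congr (mon (q ℕ.^ t)) (mon (q ℕ.^ i)))))
        where
        mon : ∀ m → ⟦ evR ⟧ (A.mono m L.1#) ≈ zP ^ m
        mon m = trans (Eval.eval-mono constHom zP m L.1#) (trans (*-congʳ (⟦⟧-1 constHom)) (*-identityˡ _))

    evP-b : ⟦ evP ⟧ b ≈ 0#
    evP-b = begin
      ⟦ evP ⟧ b ≈⟨ ⟦⟧-sum evP (suc r) _ ⟩
      sumN (suc r) (λ i → ⟦ evP ⟧ (B.mono (ex i) (coefβ i))) ≈⟨ sum-cong (suc r) (λ i _ → trans (Eval.eval-mono evR X (ex i) (coefβ i)) (*-congʳ (evR-coefβ i))) ⟩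
      sumN (suc r) summand ≈⟨ sum-suc r summand ⟩
      c₀ * (zt - zP ^ 1) * X ^ 0 + sumN r (λ i → summand (suc i)) ≈⟨ +-cong (trans (*-identityʳ _) (*-congˡ (+-congˡ (-‿cong (*-identityʳ _)))))
         (sum-cong r (λ i _ → trans (*-assoc _ _ _) (*-congˡ (*-comm _ _)))) ⟩
      c₀ * (zt - zP) + Σr ≈⟨ +-congˡ (trans (sym (*-identityˡ _)) (trans (*-congʳ (sym c₀C₀)) (*-assoc _ _ _))) ⟩
      c₀ * (zt - zP) + c₀ * (C₀ * Σr) ≈⟨ distribˡ _ _ _ ⟨
      c₀ * ((zt - zP) + C₀ * Σr) ≈⟨ x*0≈0 (trans (+S.xy∙z≈xz∙y _ _ _) (x≈y⇒x-y≈0 T-fixed)) ⟩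
      0# ∎
      where
      open ≈R
      c₀ = ⟦ constHom ⟧ (a 0)
      zt = zP ^ (q ℕ.^ t)
      summand : ℕ → Carrier
      summand i = ⟦ constHom ⟧ (a i) * (zP ^ (q ℕ.^ t) - zP ^ (q ℕ.^ i)) * X ^ ex i
      Σr = sumN r (λ i → term i zP)
      c₀C₀ : c₀ * C₀ ≈ 1#
      c₀C₀ = trans (sym (⟦⟧-* constHom _ _)) (trans (⟦⟧-cong constHom (proj₂ (IsDField.inv fld (a 0) a0))) (⟦⟧-1 constHom))

    private
      coef0 : Hom (PSRing L) L
      coef0 = record { ⟦_⟧ = λ f → coefs f 0 ; ⟦⟧-cong = λ e → at≈ e 0 ; ⟦⟧-+ = λ f g → S+ f g 0 ; ⟦⟧-* = λ f g → S* f g 0 ; ⟦⟧-1 = S1 0 }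

      eval-at-0 : {R S : Ring} (φ : Hom R S) → let module S = Kit S using (_≈_; 0#; trans; *-identityʳ; x*0≈0; 0*x≈0; x+0≈x; sum-suc; sum-zero) in ∀ x → x S.≈ S.0# → ∀ f → Eval.eval φ x f S.≈ ⟦ φ ⟧ (Poly._!_ R f 0)
      eval-at-0 {R} {S} φ x x0 f = S.trans (Eval.eval-sum φ x f (suc (Poly.bound R f)) (Poly.Deg<-mono R (ℕₚ.n≤1+n _) (Poly.deg<bound R f)))
        (S.trans (S.sum-suc _ _) (S.trans (S.x+0≈x (S.sum-zero (Poly.bound R f) (λ i _ → S.x*0≈0 (S.0*x≈0 x0)))) (S.*-identityʳ _)))
        where module S = Kit S using (_≈_; 0#; trans; *-identityʳ; x*0≈0; 0*x≈0; x+0≈x; sum-suc; sum-zero)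

    coef0-evR : ∀ g → coefs (⟦ evR ⟧ g) 0 L.≈ ⟦ evH z₀ ⟧ g
    coef0-evR g = L.trans (eval-∘ constHom coef0 zP g) (eval-congHom (coef0 ∘H constHom) (idHom L) (λ x → constHom-at x 0)
      (L.trans (mkS-at _ 0) (constHom-at z₀ 0)) g)

    coef0-evP : ∀ f → coefs (⟦ evP ⟧ f) 0 L.≈ ⟦ evH z₀ ⟧ (f B.! 0)
    coef0-evP f = L.trans (eval-∘ evR coef0 X f) (L.trans (eval-at-0 (coef0 ∘H evR) (coefs X 0) (mkS-at _ 0) f) (coef0-evR (f B.! 0)))

    private
      eval-const : {R : Ring} (φ : Hom R L) → ∀ f j → coefs (Eval.eval (constHom ∘H φ) X f) j L.≈ ⟦ φ ⟧ (Poly._!_ R f j)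
      eval-const {R} φ f j = go (Poly.bound R f) (Poly.cf R f) (Poly.vanish R f) j
        where
        go : ∀ N f → Poly.Vanish R N f → ∀ j → coefs (Eval.ev (constHom ∘H φ) X N f) j L.≈ ⟦ φ ⟧ (f j)
        go zero f v j = L.trans (S0 j) (L.sym (⟦⟧≈0 φ (v j z≤n)))
        go (suc N) f v j = L.trans (S+ _ _ j) (L.trans (L.+-cong (constHom-at _ j) (X-* _ j)) (step j))
          where
          step : ∀ j → PS.const L (⟦ φ ⟧ (f 0)) j L.+ shift1 (coefs (Eval.ev (constHom ∘H φ) X N (f ∘ suc))) j L.≈ ⟦ φ ⟧ (f j)
          step zero = L.+-identityʳ _
          step (suc j) = L.trans (L.+-identityˡ _) (go N (f ∘ suc) (λ i le → v (suc i) (s≤s le)) j)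

    -- If z were constant on the branch, b(x, z₀) would be the zero polynomial; its leading
    -- coefficient is nonzero by `cop`.
    evR-lin : ¬ (⟦ evR ⟧ (FA.lin z₀) ≈ 0#)
    evR-lin e = IsDField.nzd-¬ fld ar (λ d → z₀-new (cop z₀ z₀-fixed (L.sym (L.trans (L.sym z₀-fixed) (L.x-y≈0⇒x≈y d)))))
      (L.trans (L.sym (evH-coefβ z₀ r)) (L.trans (⟦⟧-cong (evH z₀) (AP.sym (b-at r ℕₚ.≤-refl)))
        (L.trans (L.sym (eval-const (evH z₀) b (ex r))) (L.trans (at≈ (trans (sym constant) evP-b) (ex r)) (S0 _)))))
      where
      zP≈ : zP ≈ ⟦ constHom ⟧ z₀
      zP≈ = x-y≈0⇒x≈y (trans (sym (trans (⟦⟧-- evR _ _) (-‿congr (trans (Eval.eval-mono constHom zP 1 L.1#)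
        (trans (*-congʳ (⟦⟧-1 constHom)) (trans (*-identityˡ _) (*-identityʳ _)))) (Eval.eval-con constHom zP z₀)))) e)
      constant : ⟦ evP ⟧ b ≈ Eval.eval (constHom ∘H evH z₀) X b
      constant = eval-congHom evR (constHom ∘H evH z₀) (λ g → trans (eval-congHom constHom (constHom ∘H idHom L) (λ _ → refl) zP≈ g)
        (sym (eval-∘ (idHom L) constHom z₀ g))) refl b

    -- A polynomial in z that vanishes on the branch vanishes at z₀. The factor z - z₀ is not zero
    -- on the branch and can be cancelled, until the degree is exhausted.
    evR-injective : ∀ N g → A.Deg< g N → ⟦ evR ⟧ g ≈ 0# → g AP.≈ AP.0#
    evR-injective zero g dg e = A.mkP λ i → L.trans (A.van dg i z≤n) (L.sym (A.!0 i))
    evR-injective (suc N) g dg e with FA.factor-root g z₀ (L.trans (L.sym (coef0-evR g)) (L.trans (at≈ e 0) (S0 0)))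
    ... | g′ , fac = AP.trans fac (AP.x*0≈0 (evR-injective N g′
      (FA.factor-Deg< (FA.lin-HasDeg z₀) (A.Deg<-resp fac dg))
      (seriesCancel _ _ (trans (sym (⟦⟧-* evR (FA.lin z₀) g′)) (trans (⟦⟧-cong evR (AP.sym fac)) e)) evR-lin)))

    evR-≉0 : ∀ g → ¬ (g AP.≈ AP.0#) → ¬ (⟦ evR ⟧ g ≈ 0#)
    evR-≉0 g ng e = ng (evR-injective (A.bound g) g (A.deg<bound g) e)

    evP-con : ∀ c → ⟦ evP ⟧ (B.con c) ≈ ⟦ evR ⟧ c
    evP-con c = Eval.eval-con evR X c

    evP-cancel : ∀ c f → ¬ (c AP.≈ AP.0#) → ⟦ evP ⟧ (B.con c BP.* f) ≈ 0# → ⟦ evP ⟧ f ≈ 0#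
    evP-cancel c f nc e = seriesCancel _ _ (trans (sym (⟦⟧-* evP (B.con c) f)) e) (λ z → evR-≉0 c nc (trans (sym (evP-con c)) z))

    private
      module B2 = IsDDom DB.polyDDom
      con≉0 : ∀ c → ¬ (c AP.≈ AP.0#) → ¬ (B.con c BP.≈ BP.0#)
      con≉0 c nc e = nc (AP.trans (AP.sym (B.con-at c 0)) (AP.trans (B.atP e 0) (B.!0 0)))

    -- Factorizations of b through P; cofactors in z alone are removed by Gauss' lemma.
    Factors : B.Pol → B.Pol → Set
    Factors f₁ f₂ = (f₁ BP.* f₂ BP.≈ b) × (⟦ evP ⟧ f₁ ≈ 0#) × B.Deg< f₁ (ex r)

    -- Descent on the degree of c: an irreducible factor of c divides Ψ or G and is cancelled. A
    -- constant c is a unit and goes into the cofactor.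
    ¬¬gauss : ∀ c Ψ G → ¬ (c AP.≈ AP.0#) → B.con c BP.* b BP.≈ Ψ BP.* G → ⟦ evP ⟧ Ψ ≈ 0# → B.Deg< Ψ (ex r) →
      ¬ ¬ (∃ λ f₁ → ∃ λ f₂ → Factors f₁ f₂)
    ¬¬gauss c Ψ G nc e Ψ0 dΨ k with FA.deg? c
    ... | inj₁ z = nc z
    ... | inj₂ (d , hd) = ¬¬-least {P = Q} (d , c , Ψ , G , hd , e , Ψ0 , dΨ) λ { (d , (c , Ψ , G , hd , e , Ψ0 , dΨ) , least) → go d c Ψ G hd e Ψ0 dΨ least }
      where
      Q : ℕ → Set
      Q d = ∃ λ c → ∃ λ Ψ → ∃ λ G → A.HasDeg c d × (B.con c BP.* b BP.≈ Ψ BP.* G) × (⟦ evP ⟧ Ψ ≈ 0#) × B.Deg< Ψ (ex r)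
      go : ∀ d c Ψ G → A.HasDeg c d → B.con c BP.* b BP.≈ Ψ BP.* G → ⟦ evP ⟧ Ψ ≈ 0# → B.Deg< Ψ (ex r) → (∀ m → m < d → ¬ Q m) → ⊥
      go zero c Ψ G hd e Ψ0 dΨ least = k (Ψ , B.con w BP.* G , eq , Ψ0 , dΨ)
        where
        wi = IsDField.inv fld (c A.! 0) (A.lead≉0 hd)
        w = A.con (proj₁ wi)
        wc : w AP.* c AP.≈ AP.1#
        wc = A.mkP λ { zero → L.trans (A.con-* _ c 0) (L.trans (L.*-comm _ _) (L.trans (proj₂ wi) (L.sym (A.!1 0))))
                     ; (suc i) → L.trans (A.con-* _ c (suc i)) (L.trans (L.x*0≈0 (A.van (A.below hd) (suc i) (s≤s z≤n))) (L.sym (A.!1 (suc i)))) }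
        eq : Ψ BP.* (B.con w BP.* G) BP.≈ b
        eq = begin
          Ψ BP.* (B.con w BP.* G) ≈⟨ BP.*S.x∙yz≈y∙xz _ _ _ ⟩
          B.con w BP.* (Ψ BP.* G) ≈⟨ BP.*-congˡ e ⟨
          B.con w BP.* (B.con c BP.* b) ≈⟨ BP.*-assoc _ _ _ ⟨
          (B.con w BP.* B.con c) BP.* b ≈⟨ BP.*-congʳ (BP.trans (BP.sym (⟦⟧-* (conHom R₁) w c)) (BP.trans (⟦⟧-cong (conHom R₁) wc) (⟦⟧-1 (conHom R₁)))) ⟩
          BP.1# BP.* b ≈⟨ BP.*-identityˡ b ⟩
          b ∎
          where open BP.≈R
      go (suc d) c Ψ G hd e Ψ0 dΨ least = FA.¬¬irreducible-factor c (suc d) hd (s≤s z≤n) λ (π , irr , c′ , ce) → reduce π irr c′ ce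
        where
        reduce : (π : A.Pol) → FA.Irreducible π → (c′ : A.Pol) → c AP.≈ π AP.* c′ → ⊥
        reduce π irr c′ ce = cases (prime-content Fld π irr Ψ G (λ i → c′ AP.* b B.! i ,
            AP.trans (B.atP (BP.sym e) i) (AP.trans (B.con-* c b i) (AP.trans (AP.*-congʳ ce) (AP.*-assoc _ _ _)))))
          where
          open FA.Irreducible irr using (πdeg; deg>0)
          π≉0 : ¬ (π AP.≈ AP.0#)
          π≉0 = FA.HasDeg⇒≉0 πdeg
          descend : ∀ Ψ₁ G₁ → B.con π BP.* (Ψ₁ BP.* G₁) BP.≈ Ψ BP.* G → ⟦ evP ⟧ Ψ₁ ≈ 0# → B.Deg< Ψ₁ (ex r) → ⊥
          descend Ψ₁ G₁ eq z₁ d₁ with FA.deg? c′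
          ... | inj₁ z = FA.HasDeg⇒≉0 hd (AP.trans ce (AP.x*0≈0 z))
          ... | inj₂ (d′ , hd′) = least d′ d′< (c′ , Ψ₁ , G₁ , hd′ , B2.cancel-≈ (con≉0 π π≉0) eq′ , z₁ , d₁)
            where
            d′< : d′ < suc d
            d′< = ≡.subst (d′ <_) (FA.HasDeg-unique (FA.HasDeg-* πdeg hd′) (FA.HasDeg-resp ce hd)) (ℕₚ.m<n+m d′ deg>0)
            eq′ : B.con π BP.* (B.con c′ BP.* b) BP.≈ B.con π BP.* (Ψ₁ BP.* G₁)
            eq′ = BP.trans (BP.sym (BP.*-assoc _ _ _)) (BP.trans (BP.*-congʳ (BP.trans (BP.sym (⟦⟧-* (conHom R₁) π c′)) (⟦⟧-cong (conHom R₁) (AP.sym ce))))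
              (BP.trans e (BP.sym eq)))
          cases : (∃ λ f′ → Ψ BP.≈ B.con π BP.* f′) ⊎ (∃ λ g′ → G BP.≈ B.con π BP.* g′) → ⊥
          cases (inj₁ (Ψ′ , fac)) = descend Ψ′ G (BP.trans (BP.sym (BP.*-assoc _ _ _)) (BP.*-congʳ (BP.sym fac)))
              (evP-cancel π Ψ′ π≉0 (trans (⟦⟧-cong evP (BP.sym fac)) Ψ0))
              (B.deg< λ i le → IsDDom.cancel dom₁ π≉0 (AP.trans (AP.sym (B.con-* π Ψ′ i)) (AP.trans (AP.sym (B.atP fac i)) (B.van dΨ i le))))
          cases (inj₂ (G′ , fac)) = descend Ψ G′ (BP.trans (BP.*S.x∙yz≈y∙xz _ _ _) (BP.*-congˡ (BP.sym fac))) Ψ0 dΨ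

    b-deg : B.HasDeg b (ex r)
    b-deg = b-HasDeg t>1 r>0 r≢t a0 ar cop

    nonzero-factors : ∀ f₁ f₂ → f₁ BP.* f₂ BP.≈ b → ¬ (f₁ BP.≈ BP.0#) × ¬ (f₂ BP.≈ BP.0#)
    nonzero-factors f₁ f₂ e = (λ z → DB.HasDeg⇒≉0 b-deg (BP.trans (BP.sym e) (BP.0*x≈0 z))) , λ z → DB.HasDeg⇒≉0 b-deg (BP.trans (BP.sym e) (BP.x*0≈0 z))

    module _ (no-factor : ∀ f₁ f₂ e₁ e₂ → f₁ BP.* f₂ BP.≈ b → B.HasDeg f₁ e₁ → B.HasDeg f₂ e₂ →
               ⟦ evH z₀ ⟧ (f₁ B.! 0) L.≈ L.0# → (∀ c → ¬ (⟦ mz c ⟧ f₁ AP.≈ AP.0#)) → ¬ ¬ (e₂ ≡ 0)) where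

      -- f₁ is chosen with f₁(0, z) of least degree. Then no z - c divides f₁, since it could be
      -- moved to the other factor; this is the primitivity that `no-factor` asks for.
      no-factors : ∀ f₁ f₂ → ¬ Factors f₁ f₂
      no-factors f₁ f₂ F = ¬¬-least {P = Q} (proj₁ (const-deg f₁ f₂ F) , f₁ , f₂ , F , proj₂ (const-deg f₁ f₂ F)) λ
        { (j , (g₁ , g₂ , F@(e , z , d) , hj) , least) → finish g₁ g₂ F j hj least }
        where
        Q : ℕ → Set
        Q j = ∃ λ f₁ → ∃ λ f₂ → Factors f₁ f₂ × A.HasDeg (f₁ B.! 0) j
        const-deg : ∀ f₁ f₂ → Factors f₁ f₂ → ∃ λ j → A.HasDeg (f₁ B.! 0) j
        const-deg f₁ f₂ (e , _) = let (j , _ , hj , _) = constants t>1 r>0 r≢t a0 ar cop f₁ f₂ e in j , hj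
        finish : ∀ g₁ g₂ → Factors g₁ g₂ → ∀ j → A.HasDeg (g₁ B.! 0) j → (∀ m → m < j → ¬ Q m) → ⊥
        finish g₁ g₂ (e , z , d) j hj least with DB.deg? g₁ | DB.deg? g₂
        ... | inj₁ z₁ | _ = proj₁ (nonzero-factors g₁ g₂ e) z₁
        ... | inj₂ _ | inj₁ z₂ = proj₂ (nonzero-factors g₁ g₂ e) z₂
        ... | inj₂ (e₁ , h₁) | inj₂ (e₂ , h₂) = no-factor g₁ g₂ e₁ e₂ e h₁ h₂
              (L.trans (L.sym (coef0-evP g₁)) (L.trans (at≈ z 0) (S0 0))) content-free
              (λ e₂≡0 → ℕₚ.<⇒≢ (DB.HasDeg-< h₁ d) (≡.trans (≡.sym (ℕₚ.+-identityʳ e₁)) (≡.trans (≡.cong (e₁ ℕ.+_) (≡.sym e₂≡0))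
                (proj₁ (leads t>1 r>0 r≢t a0 ar cop g₁ g₂ e₁ e₂ e h₁ h₂)))))
          where
          content-free : ∀ c → ¬ (⟦ mz c ⟧ g₁ AP.≈ AP.0#)
          content-free c zc = go j hj (FA.deg? (g₁′ B.! 0))
            where
            π = FA.lin c
            π≉0 = FA.HasDeg⇒≉0 (FA.lin-HasDeg c)
            dv = divide-out dom₁ π π≉0 g₁ (λ i → FA.factor-root (g₁ B.! i) c (L.trans (L.sym (mz-at c g₁ i)) (L.trans (A.atP zc i) (A.!0 i))))
            g₁′ = proj₁ dv
            fac = proj₂ dv
            F′ : Factors g₁′ (B.con π BP.* g₂)
            F′ = BP.trans (BP.*S.x∙yz≈yx∙z _ _ _) (BP.trans (BP.*-congʳ (BP.sym fac)) e) ,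
                 evP-cancel π g₁′ π≉0 (trans (⟦⟧-cong evP (BP.sym fac)) z) ,
                 B.deg< λ i le → IsDDom.cancel dom₁ π≉0 (AP.trans (AP.sym (B.con-* π g₁′ i)) (AP.trans (AP.sym (B.atP fac i)) (B.van d i le)))
            go : ∀ j → A.HasDeg (g₁ B.! 0) j → (g₁′ B.! 0 AP.≈ AP.0#) ⊎ (∃ λ j′ → A.HasDeg (g₁′ B.! 0) j′) → ⊥
            go j₀ hj₀ (inj₁ z₀′) = FA.HasDeg⇒≉0 hj (AP.trans (B.atP fac 0) (AP.trans (B.con-* π g₁′ 0) (AP.x*0≈0 z₀′)))
            go j₀ hj₀ (inj₂ (j′ , hj′)) = least j′ (≡.subst (j′ <_) (FA.HasDeg-unique (FA.HasDeg-* (FA.lin-HasDeg c) hj′)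
              (FA.HasDeg-resp (AP.trans (B.atP fac 0) (B.con-* π g₁′ 0)) hj)) ℕₚ.≤-refl) (g₁′ , B.con π BP.* g₂ , F′ , hj′)

      -- Let Ψ be of least degree in x among the nonzero polynomials vanishing on the branch. The
      -- pseudo-remainder of b by Ψ vanishes there too, hence is zero, and Ψ divides a multiple c b
      -- with c in L[z].
      injective : ∀ Φ → B.Deg< Φ (ex r) → ⟦ evP ⟧ Φ ≈ 0# → Φ BP.≈ BP.0#
      injective Φ dΦ z with DB.deg?-bounded (ex r) Φ dΦ
      ... | inj₁ z′ = z′
      ... | inj₂ (e , e< , he) = ⊥-elim (¬¬-least {P = Q} (e , Φ , he , e< , z) λ { (e , (Ψ , hΨ , e< , zΨ) , least) → finish e Ψ hΨ e< zΨ least })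
        where
        Q : ℕ → Set
        Q e = ∃ λ Ψ → B.HasDeg Ψ e × e < ex r × (⟦ evP ⟧ Ψ ≈ 0#)
        finish : ∀ e Ψ → B.HasDeg Ψ e → e < ex r → ⟦ evP ⟧ Ψ ≈ 0# → (∀ m → m < e → ¬ Q m) → ⊥
        finish e Ψ hΨ e< zΨ least with DB.pdiv Ψ e hΨ (B.bound b) b (B.deg<bound b)
        ... | s , G , ρ , eq , hρ with DB.deg?-bounded e ρ hρ
        ...   | inj₂ (e′ , e′< , he′) = least e′ e′< (ρ , he′ , ℕₚ.<-trans e′< e< , zρ)
          where
          zρ : ⟦ evP ⟧ ρ ≈ 0#
          zρ = trans (⟦⟧-cong evP (BP.x+y≈z⇒x≈z-y (BP.trans (BP.+-comm _ _) (BP.sym eq)))) (trans (⟦⟧-- evP _ _)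
            (trans (-‿congr (trans (⟦⟧-* evP _ _) (x*0≈0 evP-b)) (trans (⟦⟧-* evP _ _) (0*x≈0 zΨ))) (x-x 0#)))
        ...   | inj₁ zρ = ¬¬gauss ((Ψ B.! e) AP.^ s) Ψ G (IsDDom.^-≉0 dom₁ s (B.lead≉0 hΨ)) (BP.trans eq (BP.x+0≈x zρ)) zΨ
              (B.Deg<-mono e< (B.below hΨ)) λ { (f₁ , f₂ , F) → no-factors f₁ f₂ F }

-- The parameters of the auxiliary polynomial: B = κ^j, degree bounds l and μ with μ + δ n1 + 1 = B.
parameters : ∀ κ n1 δ → 1 < κ → ∃ λ j → ∃ λ l′ → ∃ λ μ′ →
  let n = suc n1; B = κ ℕ.^ j in
  ((suc (l′ ℕ.* B ℕ.+ μ′ ℕ.+ δ ℕ.* (n1 ℕ.* B ℕ.+ n1)) ℕ.* n) ℕ.* n1 < ((suc l′ ℕ.* n) ℕ.* suc μ′) ℕ.* n) ×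
  (∀ s β₀ → suc l′ ℕ.+ δ ℕ.* n1 ℕ.+ β₀ ≤ κ ℕ.^ s →
    suc (l′ ℕ.+ μ′ ℕ.* κ ℕ.^ s ℕ.+ δ ℕ.* (n1 ℕ.+ n1 ℕ.* κ ℕ.^ s)) ℕ.+ β₀ ≤ κ ℕ.^ (j ℕ.+ s))
parameters κ n1 δ κ>1 = j , l′ , μ′ , dims , degs
  where
  open +-*-Solver
  open ℕₚ.≤-Reasoning
  n = suc n1
  e = δ ℕ.* n1
  A = n ℕ.* suc e
  -- With W + 1 = (l + e) B and μ = B - e - 1, the dimension inequality follows from e B n1 + l A <
  -- l B. Here l > 2 e n1 makes the first summand, and B = κ^j > j = 2 A the second, less than half
  -- of l B.
  j = 2 ℕ.* A
  B = κ ℕ.^ j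
  l′ = 2 ℕ.* n ℕ.* e
  l = suc l′
  μ′ = B ℕ.∸ (2 ℕ.+ e)
  s′ = B ℕ.∸ suc j
  B≡ : B ≡ 2 ℕ.* A ℕ.+ 1 ℕ.+ s′
  B≡ = ≡.trans (≡.sym (ℕₚ.m+[n∸m]≡n (n<q^n κ>1 j))) (≡.cong (ℕ._+ s′) (ℕₚ.+-comm 1 j))
  e+2≤B : 2 ℕ.+ e ≤ B
  e+2≤B = begin
    2 ℕ.+ e ≡⟨ solve 1 (λ e → con 2 :+ e := con 1 :+ (con 1 :+ e)) ≡.refl e ⟩
    1 ℕ.+ suc e ≤⟨ ℕₚ.+-monoʳ-≤ 1 (ℕₚ.≤-trans (ℕₚ.m≤m+n (suc e) (n1 ℕ.* suc e)) (ℕₚ.m≤m+n A (A ℕ.+ 0))) ⟩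
    1 ℕ.+ j ≤⟨ n<q^n κ>1 j ⟩
    B ∎
  μ+ : suc μ′ ℕ.+ suc e ≡ B
  μ+ = ≡.trans (solve 2 (λ m e → (con 1 :+ m) :+ (con 1 :+ e) := (con 2 :+ e) :+ m) ≡.refl μ′ e) (ℕₚ.m+[n∸m]≡n e+2≤B)
  w+ : suc (l′ ℕ.* B ℕ.+ μ′ ℕ.+ δ ℕ.* (n1 ℕ.* B ℕ.+ n1)) ℕ.+ 1 ≡ l ℕ.* B ℕ.+ e ℕ.* B
  w+ = ≡.trans (solve 5 (λ l m δ n B → (con 1 :+ (l :* B :+ m :+ δ :* (n :* B :+ n))) :+ con 1 :=
      ((con 1 :+ m) :+ (con 1 :+ δ :* n)) :+ l :* B :+ δ :* n :* B) ≡.refl l′ μ′ δ n1 B)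
    (≡.cong (λ x → x ℕ.+ l′ ℕ.* B ℕ.+ e ℕ.* B) μ+)
  key : e ℕ.* B ℕ.* n1 ℕ.+ l ℕ.* A < l ℕ.* B
  key = ≡.subst₂ (λ x y → x < y) (≡.cong (λ b → e ℕ.* b ℕ.* n1 ℕ.+ l ℕ.* A) (≡.sym B≡)) (≡.trans (≡.sym ident) (≡.cong (l ℕ.*_) (≡.sym B≡)))
    (s≤s (ℕₚ.m≤m+n _ _))
    where
    ident : l ℕ.* (2 ℕ.* A ℕ.+ 1 ℕ.+ s′) ≡ suc (e ℕ.* (2 ℕ.* A ℕ.+ 1 ℕ.+ s′) ℕ.* n1 ℕ.+ l ℕ.* A ℕ.+
      (2 ℕ.* e ℕ.* A ℕ.+ (n1 ℕ.+ 2) ℕ.* e ℕ.* (1 ℕ.+ s′) ℕ.+ A ℕ.+ s′))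
    ident = solve 4 (λ n1 e s A → (con 1 :+ con 2 :* (con 1 :+ n1) :* e) :* (con 2 :* A :+ con 1 :+ s) :=
      con 1 :+ (e :* (con 2 :* A :+ con 1 :+ s) :* n1 :+ (con 1 :+ con 2 :* (con 1 :+ n1) :* e) :* A :+
        (con 2 :* e :* A :+ (n1 :+ con 2) :* e :* (con 1 :+ s) :+ A :+ s))) ≡.refl n1 e s′ A
  dims : (suc (l′ ℕ.* B ℕ.+ μ′ ℕ.+ δ ℕ.* (n1 ℕ.* B ℕ.+ n1)) ℕ.* n) ℕ.* n1 < ((l ℕ.* n) ℕ.* suc μ′) ℕ.* n
  dims = begin-strict
    (W ℕ.* n) ℕ.* n1 ≡⟨ solve 3 (λ W n m → (W :* n) :* m := n :* (W :* m)) ≡.refl W n n1 ⟩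
    n ℕ.* (W ℕ.* n1) <⟨ ℕₚ.*-monoʳ-< n inner ⟩
    n ℕ.* (l ℕ.* (n ℕ.* suc μ′)) ≡⟨ solve 3 (λ n l m → n :* (l :* (n :* m)) := ((l :* n) :* m) :* n) ≡.refl n l (suc μ′) ⟩
    ((l ℕ.* n) ℕ.* suc μ′) ℕ.* n ∎
    where
    W = suc (l′ ℕ.* B ℕ.+ μ′ ℕ.+ δ ℕ.* (n1 ℕ.* B ℕ.+ n1))
    inner : W ℕ.* n1 < l ℕ.* (n ℕ.* suc μ′)
    inner = ℕₚ.+-cancelʳ-< (l ℕ.* A) _ _ (begin-strict
      W ℕ.* n1 ℕ.+ l ℕ.* A ≤⟨ ℕₚ.+-monoˡ-≤ (l ℕ.* A) (ℕₚ.*-monoˡ-≤ n1 (ℕₚ.≤-trans (ℕₚ.m≤m+n W 1) (ℕₚ.≤-reflexive w+))) ⟩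
      (l ℕ.* B ℕ.+ e ℕ.* B) ℕ.* n1 ℕ.+ l ℕ.* A ≡⟨ solve 5 (λ l B e n1 A → (l :* B :+ e :* B) :* n1 :+ l :* A := l :* B :* n1 :+ (e :* B :* n1 :+ l :* A)) ≡.refl l B e n1 A ⟩
      l ℕ.* B ℕ.* n1 ℕ.+ (e ℕ.* B ℕ.* n1 ℕ.+ l ℕ.* A) <⟨ ℕₚ.+-monoʳ-< (l ℕ.* B ℕ.* n1) key ⟩
      l ℕ.* B ℕ.* n1 ℕ.+ l ℕ.* B ≡⟨ solve 3 (λ l B n1 → l :* B :* n1 :+ l :* B := l :* ((con 1 :+ n1) :* B)) ≡.refl l B n1 ⟩
      l ℕ.* (n ℕ.* B) ≡⟨ ≡.cong (λ x → l ℕ.* (n ℕ.* x)) μ+ ⟨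
      l ℕ.* (n ℕ.* (suc μ′ ℕ.+ suc e)) ≡⟨ solve 4 (λ l n m e → l :* (n :* (m :+ e)) := l :* (n :* m) :+ l :* (n :* e)) ≡.refl l n (suc μ′) (suc e) ⟩
      l ℕ.* (n ℕ.* suc μ′) ℕ.+ l ℕ.* A ∎)
  -- μ′ + e = B - 2 leaves 2 κ^s for the terms that do not grow with s.
  degs : ∀ s β₀ → suc l′ ℕ.+ δ ℕ.* n1 ℕ.+ β₀ ≤ κ ℕ.^ s →
    suc (l′ ℕ.+ μ′ ℕ.* κ ℕ.^ s ℕ.+ δ ℕ.* (n1 ℕ.+ n1 ℕ.* κ ℕ.^ s)) ℕ.+ β₀ ≤ κ ℕ.^ (j ℕ.+ s)
  degs s β₀ le = begin
    suc (l′ ℕ.+ μ′ ℕ.* Q ℕ.+ δ ℕ.* (n1 ℕ.+ n1 ℕ.* Q)) ℕ.+ β₀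
      ≡⟨ solve 6 (λ l m Q δ n β → con 1 :+ (l :+ m :* Q :+ δ :* (n :+ n :* Q)) :+ β := (con 1 :+ l :+ δ :* n :+ β) :+ (m :+ δ :* n) :* Q) ≡.refl l′ μ′ Q δ n1 β₀ ⟩
    (suc l′ ℕ.+ e ℕ.+ β₀) ℕ.+ (μ′ ℕ.+ e) ℕ.* Q ≤⟨ ℕₚ.+-monoˡ-≤ _ (ℕₚ.≤-trans le (ℕₚ.m≤m+n Q (Q ℕ.+ 0))) ⟩
    2 ℕ.* Q ℕ.+ (μ′ ℕ.+ e) ℕ.* Q ≡⟨ solve 3 (λ Q m e → con 2 :* Q :+ (m :+ e) :* Q := ((con 1 :+ m) :+ (con 1 :+ e)) :* Q) ≡.refl Q μ′ e ⟩
    (suc μ′ ℕ.+ suc e) ℕ.* Q ≡⟨ ≡.cong (ℕ._* Q) μ+ ⟩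
    B ℕ.* Q ≡⟨ ℕₚ.^-distribˡ-+-* κ j s ⟨
    κ ℕ.^ (j ℕ.+ s) ∎
    where Q = κ ℕ.^ s

-- The monic form and points over all large fields

maximum : (ℕ → ℕ) → ℕ → ℕ
maximum f zero = 0
maximum f (suc k) = maximum f k ℕ.⊔ f k

maximum-≥ : ∀ f k i → i < k → f i ≤ maximum f k
maximum-≥ f (suc k) i i< with ℕₚ.m≤n⇒m<n∨m≡n (ℕₚ.≤-pred i<)
... | inj₁ lt = ℕₚ.≤-trans (maximum-≥ f k i lt) (ℕₚ.m≤m⊔n _ _)
... | inj₂ ≡.refl = ℕₚ.m≤n⊔m (maximum f k) _

-- For g of degree n = suc n1 in x with leading coefficient Λ ∈ k[z], the polynomial Λ^n1 g(x) is monic in Λ x.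
module Monic {k : Ring} (n1 : ℕ) (g : Poly.Pol (PolyRing k)) (gdeg : Poly.Deg< (PolyRing k) g (suc (suc n1))) where
  private
    module A = Poly k using (module P; Pol; bound; _!_; deg<bound; Deg<-mono)
    module B = Poly (PolyRing k) using (_!_)
    Λ : A.Pol
    Λ = g B.! suc n1
    coeffPoly : ℕ → A.Pol
    coeffPoly j = g B.! j A.P.* Λ A.P.^ (n1 ℕ.∸ j)

  δ : ℕ
  δ = maximum (λ j → A.bound (coeffPoly j)) (suc n1)

  F : ℕ → ℕ → CommutativeRing.Carrier k
  F j e = coeffPoly j A.! e

  at : {T : Ring} → Hom k T → CommutativeRing.Carrier T → CommutativeRing.Carrier T → CommutativeRing.Carrier T
  at φ z x = Eval.eval (Eval.evalHom φ z) x g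

  lead : {T : Ring} → Hom k T → CommutativeRing.Carrier T → CommutativeRing.Carrier T
  lead φ z = Eval.eval φ z Λ

  monic : {T : Ring} (φ : Hom k T) → let open Kit T using (_≈_; _+_; _*_; sym; trans; +-cong; +-congˡ; *-cong; *-congˡ; *-congʳ; +-comm; *-assoc; *-comm; distribˡ; _^_; ^-congʳ; ^-homo-*; ^-distrib-*; sumN; sum-cong; sum-*ˡ; sum-last; module *S; module ≈R) in ∀ z x →
    (lead φ z * x) ^ suc n1 + sumN (suc n1) (λ j → sumN (suc δ) (λ e → ⟦ φ ⟧ (F j e) * z ^ e) * (lead φ z * x) ^ j)
      ≈ lead φ z ^ n1 * at φ z x
  monic {T} φ z x = begin
    (λz * x) ^ suc n1 + sumN (suc n1) (λ j → sumN (suc δ) (λ e → ⟦ φ ⟧ (F j e) * z ^ e) * (λz * x) ^ j)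
      ≈⟨ +-cong (trans (^-distrib-* λz x (suc n1)) (trans (*-congʳ (*-comm _ _)) (*-assoc _ _ _))) (sum-cong (suc n1) (λ j j< → term j (ℕₚ.≤-pred j<))) ⟩
    λz ^ n1 * (ev Λ * x ^ suc n1) + sumN (suc n1) (λ j → λz ^ n1 * (ev (g B.! j) * x ^ j)) ≈⟨ +-congˡ (sum-*ˡ (suc n1) _ _) ⟨
    λz ^ n1 * (ev Λ * x ^ suc n1) + λz ^ n1 * sumN (suc n1) (λ j → ev (g B.! j) * x ^ j) ≈⟨ distribˡ _ _ _ ⟨
    λz ^ n1 * (ev Λ * x ^ suc n1 + sumN (suc n1) (λ j → ev (g B.! j) * x ^ j)) ≈⟨ *-congˡ (trans (+-comm _ _) (sym (sum-last (suc n1) (λ j → ev (g B.! j) * x ^ j)))) ⟩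
    λz ^ n1 * sumN (suc (suc n1)) (λ j → ev (g B.! j) * x ^ j) ≈⟨ *-congˡ (Eval.eval-sum (Eval.evalHom φ z) x g (suc (suc n1)) gdeg) ⟨
    λz ^ n1 * at φ z x ∎
    where
    open Kit T using (_≈_; _+_; _*_; sym; trans; +-cong; +-congˡ; *-cong; *-congˡ; *-congʳ; +-comm; *-assoc; *-comm; distribˡ; _^_; ^-congʳ; ^-homo-*; ^-distrib-*; sumN; sum-cong; sum-*ˡ; sum-last; module *S; module ≈R)
    open ≈R
    ev = Eval.eval φ z
    λz = lead φ z
    term : ∀ j → j ≤ n1 → sumN (suc δ) (λ e → ⟦ φ ⟧ (F j e) * z ^ e) * (λz * x) ^ j ≈ λz ^ n1 * (ev (g B.! j) * x ^ j)
    term j le = begin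
      sumN (suc δ) (λ e → ⟦ φ ⟧ (F j e) * z ^ e) * (λz * x) ^ j
        ≈⟨ *-cong (sym (Eval.eval-sum φ z (coeffPoly j) (suc δ) (A.Deg<-mono (ℕₚ.≤-trans (maximum-≥ _ (suc n1) j (s≤s le)) (ℕₚ.n≤1+n δ)) (A.deg<bound (coeffPoly j))))) (^-distrib-* λz x j) ⟩
      ev (coeffPoly j) * (λz ^ j * x ^ j) ≈⟨ *-congʳ (trans (⟦⟧-* (Eval.evalHom φ z) _ _) (*-congˡ (⟦⟧-^ (Eval.evalHom φ z) Λ (n1 ℕ.∸ j)))) ⟩
      ev (g B.! j) * λz ^ (n1 ℕ.∸ j) * (λz ^ j * x ^ j) ≈⟨ trans (*S.xy∙z≈y∙xz _ _ _) (*-congˡ (*S.x∙yz≈y∙xz _ _ _)) ⟩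
      λz ^ (n1 ℕ.∸ j) * (λz ^ j * (ev (g B.! j) * x ^ j)) ≈⟨ *-assoc _ _ _ ⟨
      λz ^ (n1 ℕ.∸ j) * λz ^ j * (ev (g B.! j) * x ^ j) ≈⟨ *-congʳ (trans (sym (^-homo-* λz (n1 ℕ.∸ j) j)) (^-congʳ λz (ℕₚ.m∸n+n≡m le))) ⟩
      λz ^ n1 * (ev (g B.! j) * x ^ j) ∎

module CurveEval (Fld : DField) {p : ℕ} (ch : CharP p (DField.ring Fld)) (h : ℕ) (h>0 : 0 < h)
                 (a : ℕ → CommutativeRing.Carrier (DField.ring Fld)) (r t : ℕ) where
  open Curve Fld ch h h>0 a r t using (q; ex; coefβ; b; module A; module B)

  module _ {T : Ring} (φ : Hom (DField.ring Fld) T) (z : CommutativeRing.Carrier T) where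
    open Kit T using (Carrier; _≈_; _*_; -_; 1#; refl; sym; trans; *-cong; *-congʳ; *-identityˡ; _^_; _-_; -‿congr; x-y≈0⇒x≈y; x≈y⇒x-y≈0; sumN; sum-cong)

    eval-coefβ : ∀ i → Eval.eval φ z (coefβ i) ≈ ⟦ φ ⟧ (a i) * (z ^ (q ℕ.^ t) - z ^ (q ℕ.^ i))
    eval-coefβ i = trans (⟦⟧-* E _ _) (*-cong (Eval.eval-con φ z (a i)) (trans (⟦⟧-- E _ _) (-‿congr (mon (q ℕ.^ t)) (mon (q ℕ.^ i)))))
      where
      E = Eval.evalHom φ z
      mon : ∀ m → ⟦ E ⟧ (A.mono m (CommutativeRing.1# (DField.ring Fld))) ≈ z ^ m
      mon m = trans (Eval.eval-mono φ z m _) (trans (*-congʳ (⟦⟧-1 φ)) (*-identityˡ _))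

    eval-b : ∀ x → Eval.eval (Eval.evalHom φ z) x b ≈ sumN (suc r) (λ i → ⟦ φ ⟧ (a i) * (z ^ (q ℕ.^ t) - z ^ (q ℕ.^ i)) * x ^ ex i)
    eval-b x = trans (⟦⟧-sum (Eval.evalHom (Eval.evalHom φ z) x) (suc r) (λ i → B.mono (ex i) (coefβ i)))
      (sum-cong (suc r) (λ i _ → trans (Eval.eval-mono (Eval.evalHom φ z) x (ex i) (coefβ i)) (*-congʳ (eval-coefβ i))))

-- The elements of K are already Q fixed points of the Q-th power map, as many as there can be.
fixed-descends : ∀ {p Q K} → CharP p K → ∀ hQ → 0 < hQ → Q ≡ p ℕ.^ hQ → (cK : CardField Q K)
  (E : Ext (record { ring = K ; isDFld = CardField.fld cK })) → let open Kit (DField.ring (Ext.fieldE E)) using (_≈_; refl; sym; trans; _^_; x-y≈0⇒x≈y; x≈y⇒x-y≈0) in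
  ∀ x → x ^ Q ≈ x → ∃ λ y → ⟦ Ext.emb E ⟧ y ≈ x
fixed-descends {p} {K = K} chK hQ hQ>0 ≡.refl cK E x xQ =
  let (i , _ , e) = Fixed.fixed-is-root (Ext.fieldE E) (charP-hom ι chK) hQ hQ>0 (λ i → ⟦ ι ⟧ (CardField.elem cK i))
        (λ i j i< j< e → CardField.elem-distinct cK i j i< j< (K.x-y≈0⇒x≈y
          (hom-inj (CardField.fld cK) (DField.isDFld (Ext.fieldE E)) ι (trans (⟦⟧-- ι _ _) (x≈y⇒x-y≈0 e)))))
        (λ i _ → trans (sym (⟦⟧-^ ι (CardField.elem cK i) (p ℕ.^ hQ))) (⟦⟧-cong ι (CardField.fermat cK _))) x xQ
  in CardField.elem cK i , e
  where
  ι = Ext.emb E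
  open Kit (DField.ring (Ext.fieldE E)) using (_≈_; refl; sym; trans; _^_; x-y≈0⇒x≈y; x≈y⇒x-y≈0)
  module K = Kit K using (x-y≈0⇒x≈y)

CommonFixed : Ring → ℕ → ℕ → ℕ → Set
CommonFixed R q r t = ∀ x → x ^ (q ℕ.^ t) ≈ x → x ^ (q ℕ.^ r) ≈ x → x ^ q ≈ x
  where open Kit R using (Carrier; _≈_; _*_; -_; _^_; _-_; sumN)

-- x b(x, z), which for fixed z is a linearized polynomial in x.
bilinear : {k T : Ring} → ℕ → ℕ → ℕ → (ℕ → CommutativeRing.Carrier k) → Hom k T →
  CommutativeRing.Carrier T → CommutativeRing.Carrier T → CommutativeRing.Carrier T
bilinear {k} {T} q r t a φ x z = sumN (suc r) (λ i → ⟦ φ ⟧ (a i) * (z ^ (q ℕ.^ t) - z ^ (q ℕ.^ i)) * x ^ (q ℕ.^ i))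
  where open Kit T using (Carrier; _≈_; _*_; -_; *-congˡ; _^_; ^-congˡ; _-_; sumN; sum-cong)

bilinear-congˡ : {k T : Ring} → let open Kit T using (Carrier; _≈_; *-congˡ; _^_; ^-congˡ; sum-cong) in ∀ q r t (a : ℕ → CommutativeRing.Carrier k) (φ : Hom k T) {x y z} →
  x ≈ y → bilinear q r t a φ x z ≈ bilinear q r t a φ y z
bilinear-congˡ {T = T} q r t a φ e = sum-cong (suc r) (λ i _ → *-congˡ (^-congˡ (q ℕ.^ i) e))
  where open Kit T using (Carrier; _≈_; 0#; *-congˡ; _^_; ^-congˡ; sum-cong)

NoPoint : {k K : Ring} → ℕ → ℕ → ℕ → (ℕ → CommutativeRing.Carrier k) → Hom k K → Set
NoPoint {K = K} q r t a ψ = ∀ x z → ¬ (x ≈ 0#) → ¬ (z ^ q ≈ z) → ¬ (bilinear q r t a ψ x z ≈ 0#)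
  where open Kit K using (Carrier; _≈_; _*_; 0#; _^_)

module Existence {p h n₀ : ℕ} (pr : Prime p) (h>0 : 0 < h) {k : Ring} (ck : CardField ((p ℕ.^ h) ℕ.^ n₀) k)
                 (q>2 : 2 < p ℕ.^ h) (n₀>0 : 0 < n₀) (a : ℕ → CommutativeRing.Carrier k) (r t : ℕ)
                 (t>1 : 1 < t) (r>0 : 0 < r) (r≢t : ¬ (r ≡ t)) where
  private
    q = p ℕ.^ h
    κ = q ℕ.^ n₀
    hk = h ℕ.* n₀
    κ≡ : κ ≡ p ℕ.^ hk
    κ≡ = ℕₚ.^-*-assoc p h n₀
    chk : CharP p k
    chk = CardField.charP ck hk pr κ≡
    kF : DField
    kF = record { ring = k ; isDFld = CardField.fld ck }
    module k = Kit k using (_≈_; 0#; sym; trans)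
    module Ck = Curve kF chk h h>0 a r t using (module A; module B; module AP; module FA; b; b-HasDeg; b-at; coefβ; coefβ-r; coefβ0-HasDeg; -ar≉0; dom₁; q^>0; ex; suc-ex)
    module CE = CurveEval kF chk h h>0 a r t
    open Ck using (ex; suc-ex)

    -- n = q^r - 1 ≥ 2 makes the degree n - 1 of the divided difference in Y′ positive.
    2≤ex : 2 ≤ ex r
    2≤ex = ℕₚ.≤-pred (≡.subst (3 ≤_) (≡.sym (suc-ex r)) (ℕₚ.≤-trans q>2 (go r r>0)))
      where
      go : ∀ r → 0 < r → q ≤ q ℕ.^ r
      go (suc r) _ = ℕₚ.m≤m*n q (q ℕ.^ r) {{ℕ.>-nonZero (Ck.q^>0 r)}}

    n2′ = ex r ℕ.∸ 2
    n1 = suc n2′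
    n = suc n1
    ex≡ : ex r ≡ n
    ex≡ = ≡.sym (ℕₚ.m+[n∸m]≡n 2≤ex)

    κ>1 : 1 < κ
    κ>1 = ℕₚ.≤-trans (s≤s n₀>0) (n<q^n (ℕₚ.<-trans (s≤s (s≤s z≤n)) q>2) n₀)

  module _ (a0 : ¬ (a 0 k.≈ k.0#)) (ar : ¬ (a r k.≈ k.0#))
           (cop : (E : DField) → CommonFixed (DField.ring E) q r t)
           (order : (t < r × (∀ e → q ∣ e → e ≤ ex r → ex r ∣ (q ℕ.^ r ℕ.∸ q ℕ.^ t) ℕ.* e → e ≡ 0)) ⊎ r < t) where
    private
      gdeg : Ck.B.Deg< Ck.b (suc n)
      gdeg = ≡.subst (λ m → Ck.B.Deg< Ck.b (suc m)) ex≡ (Ck.B.below (Ck.b-HasDeg t>1 r>0 r≢t a0 ar (cop kF)))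

      module M = Monic n1 Ck.b gdeg
      module St = Stepanov {hk = hk} ck pr κ≡ n2′ M.δ M.F using (HH; NonzeroCoeff; contradiction-at; fhat; fhat-hom)

      lead≈ : {T : Ring} (φ : Hom k T) → let open Kit T using (_≈_; _*_; -_; sym; trans; _^_; _-_; ≡⇒≈) in ∀ z → M.lead φ z ≈ ⟦ φ ⟧ (a r) * (z ^ (q ℕ.^ t) - z ^ (q ℕ.^ r))
      lead≈ {T} φ z = Kit.trans T (⟦⟧-cong (Eval.evalHom φ z) (Ck.AP.trans (Ck.AP.≡⇒≈ (≡.cong (Ck.b Ck.B.!_) (≡.sym ex≡))) (Ck.b-at r ℕₚ.≤-refl)))
        (CE.eval-coefβ φ z r)

      at-bilinear : {T : Ring} (φ : Hom k T) → let open Kit T using (_≈_; _*_; trans; *-congˡ; *-congʳ; *-assoc; *-comm; ^-congʳ; sum-cong; sum-*ʳ) in ∀ x z → M.at φ z x * x ≈ bilinear q r t a φ x z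
      at-bilinear {T} φ x z = trans (*-congʳ (CE.eval-b φ z x)) (trans (sum-*ʳ (suc r) x _) (sum-cong (suc r) (λ i _ →
        trans (*-assoc _ _ _) (*-congˡ (trans (*-comm _ _) (^-congʳ x (suc-ex i)))))))
        where open Kit T using (Carrier; _≈_; _*_; 0#; trans; *-congˡ; *-congʳ; *-assoc; *-comm; ^-congʳ; sum-cong; sum-*ʳ)

    -- ρ and σ enumerate F_{q^t} and F_q inside L.
    module AtBranch (L : DField) (emb : Hom k (DField.ring L))
      (ρ : ℕ → CommutativeRing.Carrier (DField.ring L)) (σ : ℕ → CommutativeRing.Carrier (DField.ring L)) where
      private
        module L = Kit (DField.ring L) using (Carrier; _≈_; 0#; sym; trans; _^_; Distinct)
        fL = DField.isDFld L
        chL = charP-hom emb chk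
        aL : ℕ → L.Carrier
        aL i = ⟦ emb ⟧ (a i)
        inj : ∀ {x} → ⟦ emb ⟧ x L.≈ L.0# → x k.≈ k.0#
        inj = hom-inj (CardField.fld ck) fL emb
        a0L : ¬ (aL 0 L.≈ L.0#)
        a0L e = a0 (inj e)
        arL : ¬ (aL r L.≈ L.0#)
        arL e = ar (inj e)
        module CL = Curve L chL h h>0 aL r t
          using (module A; module B; module AP; module BP; b; coefβ; coefβ-r; -ar≉0; dom₁; evH; mz; q^-mono-<; ¬¬trivial-<; ¬¬trivial->)
        module CEL = CurveEval L chL h h>0 aL r t
        module Br = Branch L chL h h>0 aL r t t>1 r>0 r≢t using (zP; evR; evP; evP-b; injective)
        open PS (DField.ring L) using (constHom)
        open SeriesKit fL using (X)

      module _ (ρ-distinct : L.Distinct (q ℕ.^ t) ρ) (ρ-fixed : ∀ i → i < q ℕ.^ t → ρ i L.^ (q ℕ.^ t) L.≈ ρ i)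
               (σ-distinct : L.Distinct q σ) (σ-fixed : ∀ i → i < q → σ i L.^ q L.≈ σ i) where
        private
          q>1 : 1 < q
          q>1 = ℕₚ.<-trans (s≤s (s≤s z≤n)) q>2

          -- As t > 1, the q^t elements listed by ρ cannot all be roots of z^q - z.
          newPoint : ∃ λ z₀ → (z₀ L.^ (q ℕ.^ t) L.≈ z₀) × ¬ (z₀ L.^ q L.≈ z₀)
          newPoint with search (λ i → ≉? (ρ i)) (q ℕ.^ t)
            where
            ≉? : ∀ x → Dec (¬ (x L.^ q L.≈ x))
            ≉? x with IsDField._≟_ fL (x L.^ q) x
            ... | yes e = no (λ ne → ne e)
            ... | no ne = yes ne
          ... | inj₁ (i , i< , ne) = ρ i , ρ-fixed i i< , ne
          ... | inj₂ none = ⊥-elim (ℕₚ.<⇒≱ (≡.subst (_< q ℕ.^ t) (ℕₚ.*-identityʳ q) (CL.q^-mono-< t>1))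
              (fixed-bound L q q>1 (q ℕ.^ t) ρ ρ-distinct (λ i i< → stable i (none i i<))))
            where
            stable : ∀ i → ¬ ¬ (ρ i L.^ q L.≈ ρ i) → ρ i L.^ q L.≈ ρ i
            stable i nn with IsDField._≟_ fL (ρ i L.^ q) (ρ i)
            ... | yes e = e
            ... | no ne = ⊥-elim (nn ne)

          z₀ = proj₁ newPoint
          z₀-fixed = proj₁ (proj₂ newPoint)
          z₀-new = proj₂ (proj₂ newPoint)

          no-factor : ∀ f₁ f₂ e₁ e₂ → f₁ CL.BP.* f₂ CL.BP.≈ CL.b → CL.B.HasDeg f₁ e₁ → CL.B.HasDeg f₂ e₂ →
            ⟦ CL.evH z₀ ⟧ (f₁ CL.B.! 0) L.≈ L.0# → (∀ c → ¬ (⟦ CL.mz c ⟧ f₁ CL.AP.≈ CL.AP.0#)) → ¬ ¬ (e₂ ≡ 0)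
          no-factor f₁ f₂ e₁ e₂ e h₁ h₂ z c = Sum.[
            (λ (t<r , arith) → CL.¬¬trivial-> t>1 r>0 r≢t a0L arL (cop L) t<r arith f₁ f₂ e₁ e₂ e h₁ h₂ z₀ z₀-fixed z₀-new z) ,
            (λ r<t → CL.¬¬trivial-< t>1 r>0 r≢t a0L arL (cop L) r<t ρ ρ-distinct ρ-fixed σ σ-distinct σ-fixed f₁ f₂ e₁ e₂ e h₁ h₂ z₀ z₀-fixed z₀-new z c) ]
            order

        open Kit (PSRing (DField.ring L)) using (Carrier; _≈_; _*_; 0#; sym; trans; *-congˡ; *-congʳ; *-assoc; *-comm; *-identityʳ; _^_; ^-congˡ; ^-distrib-*; x*0≈0; sumN; sum-cong; sum-*ʳ; sum-comm; Distinct; module ≈R)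

        zP : Carrier
        zP = Br.zP a0L arL (cop L) z₀ z₀-fixed z₀-new

        φP : Hom k (PSRing (DField.ring L))
        φP = constHom ∘H emb

        YP : Carrier
        YP = M.lead φP zP * X

        private
          evR = Br.evR a0L arL (cop L) z₀ z₀-fixed z₀-new
          evP = Br.evP a0L arL (cop L) z₀ z₀-fixed z₀-new
          lcL = CL.coefβ r

          evR-lc : ⟦ evR ⟧ lcL ≈ M.lead φP zP
          evR-lc = trans (CEL.eval-coefβ constHom zP r) (sym (lead≈ φP zP))

        on-curve : St.fhat φP zP YP ≈ 0#
        on-curve = trans (M.monic φP zP X) (x*0≈0 (trans (CE.eval-b φP zP X)
          (trans (sym (CEL.eval-b constHom zP X)) (Br.evP-b a0L arL (cop L) z₀ z₀-fixed z₀-new))))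

        private
          module NV = NonVanishing {hk = hk} ck pr κ≡ n2′ M.δ M.F fL emb zP YP using (mn; sum2; ¬¬nonvanishing)

        -- Y^b = Λ^b x^b with Λ in L[z], so a relation is a polynomial of degree less than q^r - 1
        -- in x that vanishes on the branch. It is zero by `injective`, and the powers of Λ cancel.
        independent : ∀ A (d : ℕ → ℕ → L.Carrier) → NV.sum2 A n (λ a b → ⟦ constHom ⟧ (d a b) * NV.mn a b) ≈ 0# →
          ∀ a b → a < A → b < n → d a b L.≈ L.0#
        independent A d e a b a< b< = L.trans (L.sym (CL.A.ofCoeffs-at A (λ a → d a b) a a<)) (L.trans (CL.A.atP D≈0 a) (CL.A.!0 a))
          where
          D : ℕ → CL.A.Pol
          D b = CL.A.ofCoeffs A (λ a → d a b)
          row : ℕ → CL.A.Pol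
          row b = D b CL.AP.* lcL CL.AP.^ b
          Φ : CL.B.Pol
          Φ = CL.B.ofCoeffs n row
          evP-Φ : ⟦ evP ⟧ Φ ≈ NV.sum2 A n (λ a b → ⟦ constHom ⟧ (d a b) * NV.mn a b)
          evP-Φ = begin
            ⟦ evP ⟧ Φ ≈⟨ Eval.eval-sum evR X Φ n (CL.B.ofCoeffs-Deg< n row) ⟩
            sumN n (λ b → ⟦ evR ⟧ (Φ CL.B.! b) * X ^ b) ≈⟨ sum-cong n (λ b b< → column b b<) ⟩
            sumN n (λ b → sumN A (λ a → ⟦ constHom ⟧ (d a b) * NV.mn a b)) ≈⟨ sum-comm n A _ ⟩
            NV.sum2 A n (λ a b → ⟦ constHom ⟧ (d a b) * NV.mn a b) ∎
            where
            open ≈R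
            column : ∀ b → b < n → ⟦ evR ⟧ (Φ CL.B.! b) * X ^ b ≈ sumN A (λ a → ⟦ constHom ⟧ (d a b) * NV.mn a b)
            column b b< = begin
              ⟦ evR ⟧ (Φ CL.B.! b) * X ^ b ≈⟨ *-congʳ (trans (⟦⟧-cong evR (CL.B.ofCoeffs-at n row b b<)) (trans (⟦⟧-* evR _ _) (*-congˡ (trans (⟦⟧-^ evR lcL b) (^-congˡ b evR-lc))))) ⟩
              ⟦ evR ⟧ (D b) * M.lead φP zP ^ b * X ^ b ≈⟨ trans (*-assoc _ _ _) (*-congˡ (sym (^-distrib-* _ _ b))) ⟩
              ⟦ evR ⟧ (D b) * YP ^ b ≈⟨ *-congʳ (Eval.eval-sum constHom zP (D b) A (CL.A.ofCoeffs-Deg< A (λ a → d a b))) ⟩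
              sumN A (λ a → ⟦ constHom ⟧ (D b CL.A.! a) * zP ^ a) * YP ^ b ≈⟨ sum-*ʳ A _ _ ⟩
              sumN A (λ a → ⟦ constHom ⟧ (D b CL.A.! a) * zP ^ a * YP ^ b)
                ≈⟨ sum-cong A (λ a a< → trans (*-assoc _ _ _) (*-congʳ (⟦⟧-cong constHom (CL.A.ofCoeffs-at A (λ a → d a b) a a<)))) ⟩
              sumN A (λ a → ⟦ constHom ⟧ (d a b) * NV.mn a b) ∎
          Φ≈0 : Φ CL.BP.≈ CL.BP.0#
          Φ≈0 = Br.injective a0L arL (cop L) z₀ z₀-fixed z₀-new no-factor Φ
            (CL.B.Deg<-mono (ℕₚ.≤-reflexive (≡.sym ex≡)) (CL.B.ofCoeffs-Deg< n row)) (trans evP-Φ e)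
          lc≉0 : ¬ (lcL CL.AP.≈ CL.AP.0#)
          lc≉0 z = CL.-ar≉0 t>1 r>0 r≢t a0L arL (cop L) (L.trans (L.sym (CL.coefβ-r t>1 r>0 r≢t a0L arL (cop L))) (L.trans (CL.A.atP z (q ℕ.^ r)) (CL.A.!0 _)))
          D≈0 : D b CL.AP.≈ CL.AP.0#
          D≈0 = IsDDom.cancel CL.dom₁ (IsDDom.^-≉0 CL.dom₁ b lc≉0) (CL.AP.trans (CL.AP.*-comm _ _)
            (CL.AP.trans (CL.AP.sym (CL.B.ofCoeffs-at n row b b<)) (CL.AP.trans (CL.B.atP Φ≈0 b) (CL.B.!0 b))))

        ¬¬nonvanishing : ∀ l μ → ¬ ¬ (∃ λ V → ∀ s → V ≤ κ ℕ.^ s → ∀ c → St.NonzeroCoeff l μ c →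
          ¬ (St.HH φP zP YP l μ (κ ℕ.^ s) c ≈ 0#))
        ¬¬nonvanishing = NV.¬¬nonvanishing independent

    module Fibres {Q : ℕ} {hQ : ℕ} (Q≡ : Q ≡ p ℕ.^ hQ) (hQ>0 : 0 < hQ) {K : Ring} (cK : CardField Q K) (ψ : Hom k K) where
      private
        module K = Kit K using (Carrier; _≈_; _*_; -_; 0#; 1#; refl; sym; trans; *-cong; *-identityʳ; _^_; ^-congˡ; ^-assocʳ; _-_; ≡⇒≈; x≈y⇒x-y≈0; x*0≈0; 0*x≈0)
        fK = CardField.fld cK
        KF : DField
        KF = record { ring = K ; isDFld = fK }
        chK = charP-hom ψ chk

      -- Away from the zeros of bad, the fibre over z consists of q^r - 1 distinct points.
      bad : Ck.A.Pol
      bad = Ck.coefβ 0 Ck.AP.* Ck.coefβ r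

      bad≉0 : ¬ (bad Ck.AP.≈ Ck.AP.0#)
      bad≉0 = IsDDom.nzd-¬ Ck.dom₁ (Ck.FA.HasDeg⇒≉0 (Ck.coefβ0-HasDeg t>1 r>0 r≢t a0 ar (cop kF)))
        (λ z → Ck.-ar≉0 t>1 r>0 r≢t a0 ar (cop kF) (k.trans (k.sym (Ck.coefβ-r t>1 r>0 r≢t a0 ar (cop kF))) (k.trans (Ck.A.atP z (q ℕ.^ r)) (Ck.A.!0 _))))

      coeffs : K.Carrier → ℕ → K.Carrier
      coeffs z i = ⟦ ψ ⟧ (a i) K.* (z K.^ (q ℕ.^ t) K.- z K.^ (q ℕ.^ i))

      good : ∀ z → ¬ (Eval.eval ψ z bad K.≈ K.0#) → ¬ (coeffs z 0 K.≈ K.0#) × ¬ (coeffs z r K.≈ K.0#)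
      good z nb = (λ e → nb (K.trans prod (K.0*x≈0 e))) , (λ e → nb (K.trans prod (K.x*0≈0 e)))
        where
        prod : Eval.eval ψ z bad K.≈ coeffs z 0 K.* coeffs z r
        prod = K.trans (⟦⟧-* (Eval.evalHom ψ z) _ _) (K.*-cong (CE.eval-coefβ ψ z 0) (CE.eval-coefβ ψ z r))

      -- Bad points get a dummy polynomial so that all fibres can be split at once.
      coeffs′ : K.Carrier → ℕ → K.Carrier
      coeffs′ z with IsDField.≟0 fK (Eval.eval ψ z bad)
      ... | yes _ = λ _ → K.1#
      ... | no _ = coeffs z

      coeffs′-≉0 : ∀ z → ¬ (coeffs′ z 0 K.≈ K.0#) × ¬ (coeffs′ z r K.≈ K.0#)
      coeffs′-≉0 z with IsDField.≟0 fK (Eval.eval ψ z bad)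
      ... | yes _ = IsDField.1≉0 fK , IsDField.1≉0 fK
      ... | no nb = good z nb

      coeffs′-good : ∀ z → ¬ (Eval.eval ψ z bad K.≈ K.0#) → ∀ i → coeffs′ z i ≡ coeffs z i
      coeffs′-good z nb i with IsDField.≟0 fK (Eval.eval ψ z bad)
      ... | yes e = ⊥-elim (nb e)
      ... | no _ = ≡.refl

      ¬¬split : ¬ ¬ (Σ (Ext KF) λ E → ∀ i → i < Q → Roots KF q r (coeffs′ (CardField.elem cK i)) (q ℕ.^ r) E)
      ¬¬split = ¬¬roots-family KF chK h h>0 r Q (λ i → coeffs′ (CardField.elem cK i))
        (λ i _ → proj₁ (coeffs′-≉0 _)) (λ i _ → proj₂ (coeffs′-≉0 _))

      module _ (E : Ext KF) (allRoots : ∀ i → i < Q → Roots KF q r (coeffs′ (CardField.elem cK i)) (q ℕ.^ r) E)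
               (noPoint : NoPoint q r t a ψ) where
        private
          Ω = DField.ring (Ext.fieldE E)
          fΩ = DField.isDFld (Ext.fieldE E)
          ι = Ext.emb E
          χ = ι ∘H ψ
          injι : ∀ {x} → Kit._≈_ Ω (⟦ ι ⟧ x) (Kit.0# Ω) → x K.≈ K.0#
          injι = hom-inj fK fΩ ι
        open Kit Ω using (Carrier; _≈_; _+_; _*_; 0#; refl; sym; trans; *-cong; *-congˡ; *-congʳ; +-comm; *-comm; *-identityʳ; _^_; ^-congˡ; ^-assocʳ; ^-distrib-*; ≡⇒≈; -‿congr; x-y≈0⇒x≈y; x≈y⇒x-y≈0; x*0≈0; sum-cong; Distinct)

        private
          fromK : ∀ x → x ^ Q ≈ x → ∃ λ y → ⟦ ι ⟧ y ≈ x
          fromK = fixed-descends chK hQ hQ>0 Q≡ cK E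

          bilinear-hom : ∀ x z → ⟦ ι ⟧ (bilinear q r t a ψ x z) ≈ bilinear q r t a χ (⟦ ι ⟧ x) (⟦ ι ⟧ z)
          bilinear-hom x z = trans (⟦⟧-sum ι (suc r) _) (sum-cong (suc r) (λ i _ → trans (⟦⟧-* ι _ _) (*-cong
            (trans (⟦⟧-* ι _ _) (*-congˡ (trans (⟦⟧-- ι _ _) (-‿congr (⟦⟧-^ ι z (q ℕ.^ t)) (⟦⟧-^ ι z (q ℕ.^ i)))))) (⟦⟧-^ ι x (q ℕ.^ i)))))

        module _ (z : K.Carrier) (nb : ¬ (Eval.eval ψ z bad K.≈ K.0#)) where
          private
            zi = CardField.elem-surj cK z
            i₀ = proj₁ zi
            z′ = CardField.elem cK i₀
            z′≈z : z′ K.≈ z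
            z′≈z = proj₂ (proj₂ zi)
            nb′ : ¬ (Eval.eval ψ z′ bad K.≈ K.0#)
            nb′ e = nb (K.trans (eval-congHom ψ ψ (λ _ → K.refl) (K.sym z′≈z) bad) e)
            Rt = allRoots i₀ (proj₁ (proj₂ zi))
            open Roots Rt renaming (ρ to ρΩ; distinct to DΩ; isRoot to rootΩ)
            ζ = ⟦ ι ⟧ z′
            Λ = M.lead χ ζ
            Λ≉0 : ¬ (Λ ≈ 0#)
            Λ≉0 e = proj₂ (good z′ nb′) (injι (trans (sym leadK) e))
              where
              leadK : Λ ≈ ⟦ ι ⟧ (coeffs z′ r)
              leadK = trans (lead≈ χ ζ) (sym (trans (⟦⟧-* ι _ _) (*-congˡ (trans (⟦⟧-- ι _ _) (-‿congr (⟦⟧-^ ι z′ (q ℕ.^ t)) (⟦⟧-^ ι z′ (q ℕ.^ r)))))))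
            onLine : ∀ i → i < q ℕ.^ r → bilinear q r t a χ (ρΩ i) ζ ≈ 0#
            onLine i i< = trans (sum-cong (suc r) (λ j _ → *-congʳ (sym (trans (⟦⟧-cong ι (K.≡⇒≈ (coeffs′-good z′ nb′ j)))
              (trans (⟦⟧-* ι _ _) (*-congˡ (trans (⟦⟧-- ι _ _) (-‿congr (⟦⟧-^ ι z′ (q ℕ.^ t)) (⟦⟧-^ ι z′ (q ℕ.^ j)))))))))) (rootΩ i i<)
            -- The q^r = n + 1 roots are those of x b(x, z), and x = 0 has to be left out to obtain
            -- n points of the fibre. If 0 is not in the list, leaving out the first root does as
            -- well.
            zeroIndex : ∃ λ i → i < suc n × (∀ j → j < n → ¬ (ρΩ (skip i j) ≈ 0#))
            zeroIndex with search (λ i → IsDField.≟0 fΩ (ρΩ i)) (suc n)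
            ... | inj₂ none = 0 , s≤s z≤n , λ j j< → none (suc j) (s≤s j<)
            ... | inj₁ (i , i< , e) = i , i< , λ j j< e′ → skip≢ i j (DΩ (skip i j) i (bnd (skip-< i j n j<)) (bnd i<) (trans e′ (sym e)))
              where
              bnd : ∀ {m} → m < suc n → m < q ℕ.^ r
              bnd {m} = ≡.subst (m <_) (≡.trans (≡.cong suc (≡.sym ex≡)) (suc-ex r))
            sk = proj₁ zeroIndex
            x : ℕ → Carrier
            x j = ρΩ (skip sk j)
            x≉0 : ∀ j → j < n → ¬ (x j ≈ 0#)
            x≉0 = proj₂ (proj₂ zeroIndex)
            skip-bound : ∀ j → j < n → skip sk j < q ℕ.^ r
            skip-bound j j< = ≡.subst (skip sk j <_) (≡.trans (≡.cong suc (≡.sym ex≡)) (suc-ex r)) (skip-< sk j n j<)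
            z-new : ¬ (z′ K.^ q K.≈ z′)
            z-new e = proj₁ (good z′ nb′) (K.x*0≈0 (K.x≈y⇒x-y≈0 (K.trans (pw t) (K.sym (K.*-identityʳ z′)))))
              where
              pw : ∀ i → z′ K.^ (q ℕ.^ i) K.≈ z′
              pw zero = K.*-identityʳ z′
              pw (suc i) = K.trans (K.sym (K.^-assocʳ z′ q (q ℕ.^ i))) (K.trans (K.^-congˡ (q ℕ.^ i) e) (pw i))

          fibre : ∃ λ (y : ℕ → Carrier) → Distinct n y × (∀ i → i < n → (St.fhat χ (⟦ ι ⟧ z) (y i) ≈ 0#) × ¬ (y i ^ Q ≈ y i))
          fibre = (λ j → Λ * x j) ,
            (λ i j i< j< e → skip-inj sk i j (DΩ _ _ (skip-bound i i<) (skip-bound j j<) (IsDField.cancel-≈ fΩ Λ≉0 e))) ,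
            λ j j< → onCurve j j< , notFixed j j<
            where
            at≈0 : ∀ j → j < n → M.at χ ζ (x j) ≈ 0#
            at≈0 j j< = IsDField.cancel fΩ (x≉0 j j<) (trans (*-comm _ _) (trans (at-bilinear χ (x j) ζ) (onLine (skip sk j) (skip-bound j j<))))
            onCurve : ∀ j → j < n → St.fhat χ (⟦ ι ⟧ z) (Λ * x j) ≈ 0#
            onCurve j j< = trans (sym (St.fhat-hom χ χ (idHom Ω) (λ _ → refl) (⟦⟧-cong ι z′≈z) refl))
              (trans (M.monic χ ζ (x j)) (x*0≈0 (at≈0 j j<)))
            -- Λ takes a nonzero value in K at z′, so if Λ x were fixed, x would be fixed as well
            -- and come from K. Then (x, z′) would be a point over K.
            notFixed : ∀ j → j < n → ¬ ((Λ * x j) ^ Q ≈ Λ * x j)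
            notFixed j j< e = let (y , ye) = fromK (x j) xQ in
              noPoint y z′ (λ y0 → x≉0 j j< (trans (sym ye) (⟦⟧≈0 ι y0))) z-new
                (injι (trans (bilinear-hom y z′) (trans (bilinear-congˡ q r t a χ ye) (onLine (skip sk j) (skip-bound j j<)))))
              where
              ΛQ : Λ ^ Q ≈ Λ
              ΛQ = trans (^-congˡ Q lk) (trans (sym (⟦⟧-^ ι _ Q)) (trans (⟦⟧-cong ι (CardField.fermat cK _)) (sym lk)))
                where
                lk : Λ ≈ ⟦ ι ⟧ (M.lead ψ z′)
                lk = sym (eval-∘ ψ ι z′ _)
              xQ : x j ^ Q ≈ x j
              xQ = IsDField.cancel-≈ fΩ Λ≉0 (trans (*-congʳ (sym ΛQ)) (trans (sym (^-distrib-* Λ (x j) Q)) e))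

    ¬¬point : ¬ ¬ (∃ λ m₀ → ∀ m → m₀ ≤ m → {K : Ring} (cK : CardField (κ ℕ.^ m) K) (ψ : Hom k K) → ¬ NoPoint q r t a ψ)
    ¬¬point contra = ¬¬fixed-points kF chk (h ℕ.* t) ht>0 λ { (E₁ , ρ , ρD , ρfix) →
      ¬¬fixed-points (Ext.fieldE E₁) (charP-hom (Ext.emb E₁) chk) h h>0 λ { (E₂ , σ , σD , σfix) →
      let emb₂ = Ext.emb E₂
          module L₁ = Kit (DField.ring (Ext.fieldE E₁)) using (x-y≈0⇒x≈y)
          module L₂ = Kit (DField.ring (Ext.fieldE E₂)) using (_≈_; sym; trans; _^_; x≈y⇒x-y≈0; Distinct)
          inj₂ = hom-inj (DField.isDFld (Ext.fieldE E₁)) (DField.isDFld (Ext.fieldE E₂)) emb₂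
      in atBranch (Ext.fieldE E₂) (emb₂ ∘H Ext.emb E₁) (λ i → ⟦ emb₂ ⟧ (ρ i)) σ
        (≡.subst (λ N → L₂.Distinct N (λ i → ⟦ emb₂ ⟧ (ρ i))) q^t≡ (λ i j i< j< e →
          ρD i j i< j< (L₁.x-y≈0⇒x≈y (inj₂ (L₂.trans (⟦⟧-- emb₂ _ _) (L₂.x≈y⇒x-y≈0 e))))))
        (≡.subst (λ N → ∀ i → i < N → ⟦ emb₂ ⟧ (ρ i) L₂.^ N L₂.≈ ⟦ emb₂ ⟧ (ρ i)) q^t≡
          (λ i i< → L₂.trans (L₂.sym (⟦⟧-^ emb₂ (ρ i) (p ℕ.^ (h ℕ.* t)))) (⟦⟧-cong emb₂ (ρfix i i<))))
        σD σfix } }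
      where
      q^t≡ : p ℕ.^ (h ℕ.* t) ≡ q ℕ.^ t
      q^t≡ = ≡.sym (ℕₚ.^-*-assoc p h t)
      ht>0 : 0 < h ℕ.* t
      ht>0 = ℕₚ.*-mono-≤ h>0 (ℕₚ.<⇒≤ t>1)
      params = parameters κ n1 M.δ κ>1
      j = proj₁ params
      l′ = proj₁ (proj₂ params)
      μ′ = proj₁ (proj₂ (proj₂ params))
      dims = proj₁ (proj₂ (proj₂ (proj₂ params)))
      degs = proj₂ (proj₂ (proj₂ (proj₂ params)))
      bd : Ck.A.Pol
      bd = Ck.coefβ 0 Ck.AP.* Ck.coefβ r
      β₀ = Ck.A.bound bd
      -- The threshold that `degs` imposes on κ^s. As κ^s > s, it is enough to take s ≥ s₁ + V to
      -- satisfy it together with V ≤ κ^s.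
      s₁ = suc l′ ℕ.+ M.δ ℕ.* n1 ℕ.+ β₀
      module _ (L : DField) (emb : Hom k (DField.ring L)) (ρ σ : ℕ → CommutativeRing.Carrier (DField.ring L)) where
        open Kit (DField.ring L) using (Carrier; _≈_; _+_; _*_; 0#; refl; sym; trans; +-comm; _^_; x-y≈0⇒x≈y; x≈y⇒x-y≈0; Distinct)
        atBranch : Distinct (q ℕ.^ t) ρ → (∀ i → i < q ℕ.^ t → ρ i ^ (q ℕ.^ t) ≈ ρ i) →
          Distinct q σ → (∀ i → i < q → σ i ^ q ≈ σ i) → ⊥
        atBranch ρD ρfix σD σfix = Br.¬¬nonvanishing ρD ρfix σD σfix (suc l′) (suc μ′) λ (V , nonvan) →
          contra (j ℕ.+ (s₁ ℕ.+ V) , λ m m≥ cK ψ → conclude V nonvan (m ℕ.∸ j) (s-bound V m m≥) m (≡.sym (ℕₚ.m+[n∸m]≡n (ℕₚ.≤-trans (ℕₚ.m≤m+n j _) m≥))) cK ψ)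
          where
          module Br = AtBranch L emb ρ σ
          s-bound : ∀ V m → j ℕ.+ (s₁ ℕ.+ V) ≤ m → s₁ ℕ.+ V ≤ m ℕ.∸ j
          s-bound V m le = ℕₚ.m+n≤o⇒m≤o∸n (s₁ ℕ.+ V) (≡.subst (_≤ m) (ℕₚ.+-comm j _) le)
          conclude : ∀ V → (∀ s → V ≤ κ ℕ.^ s → ∀ c → St.NonzeroCoeff (suc l′) (suc μ′) c →
              ¬ Kit._≈_ (PSRing (DField.ring L)) (St.HH (Br.φP ρD ρfix σD σfix) (Br.zP ρD ρfix σD σfix) (Br.YP ρD ρfix σD σfix) (suc l′) (suc μ′) (κ ℕ.^ s) c) (Kit.0# (PSRing (DField.ring L)))) →
            ∀ s → s₁ ℕ.+ V ≤ s → ∀ m → m ≡ j ℕ.+ s → {K : Ring} (cK : CardField (κ ℕ.^ m) K) (ψ : Hom k K) → ¬ NoPoint q r t a ψ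
          conclude V nonvan s s≥ m ≡.refl cK ψ noPoint = Fb.¬¬split λ (E , allRoots) →
            St.contradiction-at j s l′ μ′ β₀ dims (degs s β₀ (ℕₚ.≤-trans (ℕₚ.m≤m+n s₁ V) s≤))
              {TP = PSRing (DField.ring L)} (Br.φP ρD ρfix σD σfix) (Br.zP ρD ρfix σD σfix) (Br.YP ρD ρfix σD σfix) (Br.on-curve ρD ρfix σD σfix)
              (nonvan s (ℕₚ.≤-trans (ℕₚ.m≤n+m V s₁) s≤)) cK ψ E Fb.bad Fb.bad≉0 (Ck.A.deg<bound bd) (Fb.fibre E allRoots noPoint)
            where
            s≤ : s₁ ℕ.+ V ≤ κ ℕ.^ s
            s≤ = ℕₚ.≤-trans s≥ (ℕₚ.<⇒≤ (n<q^n κ>1 s))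
            m>0 : 0 < j ℕ.+ s
            m>0 = ℕₚ.≤-trans (s≤s z≤n) (ℕₚ.≤-trans s≥ (ℕₚ.m≤n+m s j))
            module Fb = Fibres {hQ = hk ℕ.* (j ℕ.+ s)} (≡.trans (≡.cong (ℕ._^ (j ℕ.+ s)) κ≡) (ℕₚ.^-*-assoc p hk (j ℕ.+ s)))
              (ℕₚ.*-mono-≤ (ℕₚ.*-mono-≤ h>0 n₀>0) m>0) cK ψ

-- Arithmetic of q^r - 1

fixed-iterate : (R : Ring) → let open Kit R using (_≈_; sym; trans; *-identityʳ; _^_; ^-congˡ; ^-assocʳ) in ∀ {x} M → x ^ M ≈ x → ∀ j → x ^ (M ℕ.^ j) ≈ x
fixed-iterate R {x} M e zero = *-identityʳ x where open Kit R using (_≈_; _+_; _*_; -_; refl; sym; trans; +-comm; *-assoc; *-comm; *-identityˡ; *-identityʳ; _^_; ^-congˡ; ^-congʳ; ^-assocʳ; _-_)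
fixed-iterate R {x} M e (suc j) = trans (sym (^-assocʳ x M (M ℕ.^ j))) (trans (^-congˡ (M ℕ.^ j) e) (fixed-iterate R M e j))
  where open Kit R using (_≈_; _*_; refl; sym; trans; *-comm; *-identityʳ; _^_; ^-congˡ; ^-congʳ; ^-assocʳ)

-- By Bézout there are consecutive multiples of r and t. x is fixed by the corresponding powers of x
-- ↦ x^q, hence by x ↦ x^q itself.
coprime-fixed : ∀ R q {r t} → Coprime r t → CommonFixed R q r t
coprime-fixed R q {r} {t} c x et er = go (coprime-Bézout c)
  where
  open Kit R using (_≈_; _*_; refl; sym; trans; *-comm; _^_; ^-congˡ; ^-congʳ; ^-assocʳ)
  multiple : ∀ {s} j → x ^ (q ℕ.^ s) ≈ x → x ^ (q ℕ.^ (j ℕ.* s)) ≈ x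
  multiple {s} j e = trans (^-congʳ x (≡.trans (≡.cong (q ℕ.^_) (ℕₚ.*-comm j s)) (≡.sym (ℕₚ.^-*-assoc q s j)))) (fixed-iterate R (q ℕ.^ s) e j)
  descend : ∀ a b → suc b ≡ a → x ^ (q ℕ.^ a) ≈ x → x ^ (q ℕ.^ b) ≈ x → x ^ q ≈ x
  descend _ b ≡.refl ea eb = trans (^-congˡ q (sym eb)) (trans (^-assocʳ x (q ℕ.^ b) q) (trans (^-congʳ x (ℕₚ.*-comm (q ℕ.^ b) q)) ea))
  go : Bézout.Identity 1 r t → x ^ q ≈ x
  go (Bézout.+- i j e) = descend (i ℕ.* r) (j ℕ.* t) e (multiple i er) (multiple j et)
  go (Bézout.-+ i j e) = descend (j ℕ.* t) (i ℕ.* r) e (multiple j et) (multiple i er)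

module Repunit (g : ℕ) where
  private q = suc g

  -- (q^n - 1) / (q - 1) without division. In this form coprime indices give coprime values, whereas
  -- q^a - 1 and q^b - 1 always share q - 1.
  repunit : ℕ → ℕ
  repunit zero = 0
  repunit (suc n) = suc (q ℕ.* repunit n)

  repunit-^ : ∀ n → suc (g ℕ.* repunit n) ≡ q ℕ.^ n
  repunit-^ zero = ≡.cong suc (ℕₚ.*-zeroʳ g)
  repunit-^ (suc n) = ≡.trans (solve 2 (λ g R → con 1 :+ g :* (con 1 :+ (con 1 :+ g) :* R) := (con 1 :+ g) :* (con 1 :+ g :* R)) ≡.refl g (repunit n))
    (≡.cong (q ℕ.*_) (repunit-^ n))
    where open +-*-Solver

  repunit-+ : ∀ a b → repunit (a ℕ.+ b) ≡ repunit a ℕ.+ q ℕ.^ a ℕ.* repunit b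
  repunit-+ zero b = ≡.sym (ℕₚ.*-identityˡ (repunit b))
  repunit-+ (suc a) b = ≡.cong suc (≡.trans (≡.cong (q ℕ.*_) (repunit-+ a b))
    (solve 4 (λ q A Q B → q :* (A :+ Q :* B) := q :* A :+ q :* Q :* B) ≡.refl q (repunit a) (q ℕ.^ a) (repunit b)))
    where open +-*-Solver

  ^≤repunit : ∀ n → q ℕ.^ n ≤ repunit (suc n)
  ^≤repunit zero = s≤s z≤n
  ^≤repunit (suc n) = ℕₚ.≤-trans (ℕₚ.*-monoʳ-≤ q (^≤repunit n)) (ℕₚ.n≤1+n _)

  ∣repunit-* : ∀ {d a} → d ∣ repunit a → ∀ j → d ∣ repunit (j ℕ.* a)
  ∣repunit-* {d} da zero = d ∣0
  ∣repunit-* {d} {a} da (suc j) = ≡.subst (d ∣_) (≡.sym (repunit-+ a (j ℕ.* a))) (∣m∣n⇒∣m+n da (∣n⇒∣m*n (q ℕ.^ a) (∣repunit-* da j)))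

  -- A common divisor divides the repunits at consecutive multiples of a and b, one of which is 1
  -- plus q times the other.
  repunit-coprime : ∀ {a b} → Coprime a b → Coprime (repunit a) (repunit b)
  repunit-coprime {a} {b} c {d} (da , db) = go (coprime-Bézout c)
    where
    consecutive : ∀ x y → suc y ≡ x → d ∣ repunit x → d ∣ repunit y → d ≡ 1
    consecutive _ y ≡.refl dx dy = ∣1⇒≡1 (∣m+n∣m⇒∣n (≡.subst (d ∣_) (ℕₚ.+-comm 1 _) dx) (∣n⇒∣m*n q dy))
    go : Bézout.Identity 1 a b → d ≡ 1
    go (Bézout.+- i j e) = consecutive (i ℕ.* a) (j ℕ.* b) e (∣repunit-* da i) (∣repunit-* db j)
    go (Bézout.-+ i j e) = consecutive (j ℕ.* b) (i ℕ.* a) e (∣repunit-* db j) (∣repunit-* da i)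

  repunit-coprime-q : ∀ n → Coprime (repunit (suc n)) q
  repunit-coprime-q n {d} (dr , dq) = ∣1⇒≡1 (∣m+n∣m⇒∣n (≡.subst (d ∣_) (ℕₚ.+-comm 1 _) dr) (∣m⇒∣m*n (repunit n) dq))

  -- q^r - 1 divides (q^r - q^t) e only if repunit r divides e, and e / q is smaller than repunit r.
  divisible⇒zero : .{{ℕ.NonZero g}} → ∀ {r t} → Prime r → 0 < t → t < r → ∀ N e → suc N ≡ q ℕ.^ r → q ∣ e → e ≤ N →
    N ∣ (q ℕ.^ r ℕ.∸ q ℕ.^ t) ℕ.* e → e ≡ 0
  divisible⇒zero {suc r} {t} pr t>0 t<r N e N≡ (divides e′ ≡.refl) e≤N N∣ = ≡.cong (ℕ._* q) (small e′ e′< R∣e′)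
    where
    s = suc r ℕ.∸ t
    s>0 : 0 < s
    s>0 = ℕₚ.m<n⇒0<n∸m t<r
    s<r : s < suc r
    s<r = ℕₚ.∸-monoʳ-< {suc r} {t} {0} t>0 (ℕₚ.<⇒≤ t<r)
    R = repunit (suc r)
    N≡gR : N ≡ g ℕ.* R
    N≡gR = ℕₚ.suc-injective (≡.trans N≡ (≡.sym (repunit-^ (suc r))))
    difference : q ℕ.^ suc r ℕ.∸ q ℕ.^ t ≡ q ℕ.^ t ℕ.* (g ℕ.* repunit s)
    difference = ≡.trans (≡.cong (ℕ._∸ q ℕ.^ t) (≡.trans (≡.cong (q ℕ.^_) (≡.sym (ℕₚ.m+[n∸m]≡n (ℕₚ.<⇒≤ t<r)))) (≡.trans (ℕₚ.^-distribˡ-+-* q t s)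
      (≡.trans (≡.cong (q ℕ.^ t ℕ.*_) (≡.sym (repunit-^ s))) (ℕₚ.*-suc (q ℕ.^ t) (g ℕ.* repunit s))))))
      (ℕₚ.m+n∸m≡n (q ℕ.^ t) _)
    R∣ : R ∣ q ℕ.^ t ℕ.* (repunit s ℕ.* (q ℕ.* e′))
    R∣ = *-cancelˡ-∣ g (≡.subst₂ _∣_ N≡gR (≡.trans (≡.cong (ℕ._* (e′ ℕ.* q)) difference)
      (solve 5 (λ Q g S e q → Q :* (g :* S) :* (e :* q) := g :* (Q :* (S :* (q :* e)))) ≡.refl (q ℕ.^ t) g (repunit s) e′ q)) N∣)
      where open +-*-Solver
    strip : ∀ t {x} → R ∣ q ℕ.^ t ℕ.* x → R ∣ x
    strip zero d = ≡.subst (R ∣_) (ℕₚ.*-identityˡ _) d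
    strip (suc t) {x} d = strip t (coprime-divisor {n = q} (repunit-coprime-q r) (≡.subst (R ∣_) (ℕₚ.*-assoc q (q ℕ.^ t) x) d))
    R∣e′ : R ∣ e′
    R∣e′ = coprime-divisor (repunit-coprime-q r) (coprime-divisor (repunit-coprime (prime⇒coprime pr {{ℕ.>-nonZero s>0}} s<r)) (strip t R∣))
    e′< : e′ < R
    e′< = ℕₚ.<-≤-trans (ℕₚ.*-cancelʳ-< q e′ (q ℕ.^ r) (≡.subst (e′ ℕ.* q <_) (≡.trans N≡ (ℕₚ.*-comm q (q ℕ.^ r))) (s≤s e≤N))) (^≤repunit r)
    small : ∀ x → x < R → R ∣ x → x ≡ 0
    small zero _ _ = ≡.refl
    small (suc x) lt d = ⊥-elim (ℕₚ.<⇒≱ lt (∣⇒≤ d))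

-- The trace form and the adjoint

module Trace {p : ℕ} {K : Ring} (ch : CharP p K) (h N′ : ℕ) (h>0 : 0 < h) (cK : CardField ((p ℕ.^ h) ℕ.^ suc N′) K) where
  open Kit K using (Carrier; _≈_; _+_; _*_; 0#; 1#; sym; trans; +-congˡ; +-congʳ; *-congˡ; +-comm; *-assoc; *-identityˡ; *-identityʳ; +-cancelˡ; _^_; ^-congˡ; ^-congʳ; ^-assocʳ; ^-distrib-*; 1^n≈1; sumN; sum-suc; sum-cong; sum-*ˡ; sum-*ʳ; sum-last; sum-comm; sum-reverse; Distinct; module ≈R)
  private
    q = p ℕ.^ h
    N = suc N′
    fK = CardField.fld cK

  frobq : ℕ → Hom K K
  frobq l = record { ⟦_⟧ = _^ (q ℕ.^ l) ; ⟦⟧-cong = ^-congˡ (q ℕ.^ l)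
    ; ⟦⟧-+ = λ x y → ≡.subst (λ M → (x + y) ^ M ≈ x ^ M + y ^ M) (≡.sym (ℕₚ.^-*-assoc p h l)) (CharP.frob ch (h ℕ.* l) x y)
    ; ⟦⟧-* = λ x y → ^-distrib-* x y (q ℕ.^ l) ; ⟦⟧-1 = 1^n≈1 (q ℕ.^ l) }

  ^q^-+ : ∀ x i j → (x ^ (q ℕ.^ i)) ^ (q ℕ.^ j) ≈ x ^ (q ℕ.^ (i ℕ.+ j))
  ^q^-+ x i j = trans (^-assocʳ x (q ℕ.^ i) (q ℕ.^ j)) (^-congʳ x (≡.sym (ℕₚ.^-distribˡ-+-* q i j)))

  Tr : Carrier → Carrier
  Tr v = sumN N (λ l → v ^ (q ℕ.^ l))

  Tr-cong : ∀ {v w} → v ≈ w → Tr v ≈ Tr w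
  Tr-cong e = sum-cong N (λ l _ → ^-congˡ (q ℕ.^ l) e)

  -- Frobenius shifts the summands cyclically, since v^(q^N) = v.
  Tr-frob : ∀ v → Tr (v ^ q) ≈ Tr v
  Tr-frob v = begin
    sumN N (λ l → (v ^ q) ^ (q ℕ.^ l)) ≈⟨ sum-cong N (λ l _ → ^-assocʳ v q (q ℕ.^ l)) ⟩
    sumN N (λ l → v ^ (q ℕ.^ suc l)) ≈⟨ +-cancelˡ v _ _ shift ⟩
    sumN N (λ l → v ^ (q ℕ.^ l)) ∎
    where
    open ≈R
    shift : v + sumN N (λ l → v ^ (q ℕ.^ suc l)) ≈ v + sumN N (λ l → v ^ (q ℕ.^ l))
    shift = begin
      v + sumN N (λ l → v ^ (q ℕ.^ suc l)) ≈⟨ +-congʳ (*-identityʳ v) ⟨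
      v ^ 1 + sumN N (λ l → v ^ (q ℕ.^ suc l)) ≈⟨ sum-suc N (λ l → v ^ (q ℕ.^ l)) ⟨
      sumN (suc N) (λ l → v ^ (q ℕ.^ l)) ≈⟨ sum-last N (λ l → v ^ (q ℕ.^ l)) ⟩
      sumN N (λ l → v ^ (q ℕ.^ l)) + v ^ (q ℕ.^ N) ≈⟨ +-congˡ (CardField.fermat cK v) ⟩
      sumN N (λ l → v ^ (q ℕ.^ l)) + v ≈⟨ +-comm _ _ ⟩
      v + sumN N (λ l → v ^ (q ℕ.^ l)) ∎

  Tr-frob^ : ∀ j v → Tr (v ^ (q ℕ.^ j)) ≈ Tr v
  Tr-frob^ zero v = Tr-cong (*-identityʳ v)
  Tr-frob^ (suc j) v = trans (Tr-cong (sym (^-assocʳ v q (q ℕ.^ j)))) (trans (Tr-frob^ j (v ^ q)) (Tr-frob v))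

  Tr-sum : ∀ n f → Tr (sumN n f) ≈ sumN n (λ i → Tr (f i))
  Tr-sum n f = trans (sum-cong N (λ l _ → ⟦⟧-sum (frobq l) n f)) (sum-comm N n (λ l i → f i ^ (q ℕ.^ l)))

  -- The summand with i = r - j is raised to the power q^j. This does not change its trace and turns
  -- x^(q^i) into the common factor x^(q^r).
  Tr-adjoint : ∀ r (c : ℕ → Carrier) u x → Tr (u * sumN (suc r) (λ i → c i * x ^ (q ℕ.^ i))) ≈
    Tr (sumN (suc r) (λ j → (u * c (r ℕ.∸ j)) ^ (q ℕ.^ j)) * x ^ (q ℕ.^ r))
  Tr-adjoint r c u x = begin
    Tr (u * sumN (suc r) (λ i → c i * x ^ (q ℕ.^ i))) ≈⟨ Tr-cong (trans (sum-*ˡ (suc r) u _) (sum-reverse r _)) ⟩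
    Tr (sumN (suc r) (λ j → u * (c (r ℕ.∸ j) * x ^ (q ℕ.^ (r ℕ.∸ j))))) ≈⟨ Tr-sum (suc r) (λ j → u * (c (r ℕ.∸ j) * x ^ (q ℕ.^ (r ℕ.∸ j)))) ⟩
    sumN (suc r) (λ j → Tr (u * (c (r ℕ.∸ j) * x ^ (q ℕ.^ (r ℕ.∸ j))))) ≈⟨ sum-cong (suc r) (λ j j< → term j (ℕₚ.≤-pred j<)) ⟩
    sumN (suc r) (λ j → Tr ((u * c (r ℕ.∸ j)) ^ (q ℕ.^ j) * x ^ (q ℕ.^ r))) ≈⟨ Tr-sum (suc r) (λ j → (u * c (r ℕ.∸ j)) ^ (q ℕ.^ j) * x ^ (q ℕ.^ r)) ⟨
    Tr (sumN (suc r) (λ j → (u * c (r ℕ.∸ j)) ^ (q ℕ.^ j) * x ^ (q ℕ.^ r))) ≈⟨ Tr-cong (sum-*ʳ (suc r) _ _) ⟨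
    Tr (sumN (suc r) (λ j → (u * c (r ℕ.∸ j)) ^ (q ℕ.^ j)) * x ^ (q ℕ.^ r)) ∎
    where
    open ≈R
    term : ∀ j → j ≤ r → Tr (u * (c (r ℕ.∸ j) * x ^ (q ℕ.^ (r ℕ.∸ j)))) ≈ Tr ((u * c (r ℕ.∸ j)) ^ (q ℕ.^ j) * x ^ (q ℕ.^ r))
    term j le = trans (Tr-cong (sym (*-assoc _ _ _))) (trans (sym (Tr-frob^ j _)) (Tr-cong (trans (^-distrib-* _ _ (q ℕ.^ j))
      (*-congˡ (trans (^q^-+ x (r ℕ.∸ j) j) (^-congʳ x (≡.cong (q ℕ.^_) (ℕₚ.m∸n+n≡m le))))))))

  -- The trace is a polynomial of degree q^(N-1) < |K|.
  Tr-nonzero : ∀ ρ → Distinct (q ℕ.^ N) ρ → ¬ (∀ i → i < q ℕ.^ N → Tr (ρ i) ≈ 0#)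
  Tr-nonzero ρ D z = HasDeg⇒≉0 (T.poly-HasDeg 1≉0) (root-bound (suc (q ℕ.^ N′)) (q ℕ.^ N) ρ T.poly (Poly.below (T.poly-HasDeg 1≉0))
    (ℕₚ.^-monoʳ-< q q>1 (ℕₚ.n<1+n N′)) D (λ i i< → trans (T.eval-poly (idHom K) (ρ i))
      (trans (sum-cong N (λ l _ → *-identityˡ _)) (z i i<))))
    where
    KF : DField
    KF = record { ring = K ; isDFld = fK }
    open FieldPoly KF using (root-bound; HasDeg⇒≉0)
    open IsDField fK using (1≉0)
    q>1 : 1 < q
    q>1 = ℕₚ.≤-trans (prime>1 (CharP.isPrime ch)) (grow h h>0)
      where
      grow : ∀ h → 0 < h → p ≤ p ℕ.^ h
      grow (suc h) _ = ℕₚ.m≤m*n p (p ℕ.^ h) {{ℕ.>-nonZero (ℕₚ.m^n>0 p {{ℕ.>-nonZero (prime>0 (CharP.isPrime ch))}} h)}}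
    p∣q : p ∣ q
    p∣q = go h h>0
      where
      go : ∀ h → 0 < h → p ∣ p ℕ.^ h
      go (suc h) _ = m∣m*n (p ℕ.^ h)
    
    module T = LinPol K ch h q>1 p∣q (λ _ → 1#) N′

-- The adjoint of x ↦ Σ a_i x^(q^i) with respect to the trace form, up to a power of Frobenius.
adjoint : (k : Ring) → ℕ → ℕ → (ℕ → CommutativeRing.Carrier k) → ℕ → CommutativeRing.Carrier k
adjoint k q r a j = a (r ℕ.∸ j) ^ (q ℕ.^ j)
  where open Kit k using (Carrier; _^_)

module Adjoint {p : ℕ} {k K : Ring} (ch : CharP p K) (h N′ : ℕ) (h>0 : 0 < h) (cK : CardField ((p ℕ.^ h) ℕ.^ suc N′) K)
               (ψ : Hom k K) (a : ℕ → CommutativeRing.Carrier k) (r′ : ℕ) where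
  open Kit K using (Carrier; _≈_; _+_; _*_; -_; 0#; sym; trans; *-cong; *-congˡ; *-congʳ; -‿cong; +-comm; *-comm; *-identityʳ; distribˡ; -‿distribˡ-*; -‿distribʳ-*; -0#≈0#; _^_; ^-congˡ; ^-congʳ; _-_; -‿congr; x-y≈0⇒x≈y; x≈y⇒x-y≈0; x+y≈z⇒x≈z-y; x-y+y; x-y≈-[y-x]; 0*x≈0; sumN; sum-cong; sum-zero; sum-+; sum-neg; module ≈R)
  open Trace ch h N′ h>0 cK
  private
    q = p ℕ.^ h
    N = suc N′
    r = suc r′

  -- For fixed z outside F_q the map H(x) = x b(x, z) is additive and, without points, injective on
  -- K. A point (u, w) of the adjoint curve would make all u H(x) have trace 0, and these are |K|
  -- different elements.
  noPoint : NoPoint q r 1 a ψ → NoPoint q r r′ (adjoint k q r a) ψ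
  noPoint none u w u≉0 w-new e = Tr-nonzero (λ i → u * H (elem i))
    (λ i j i< j< e → elem-distinct i j i< j< (x-y≈0⇒x≈y (H-kernel (trans (H-- _ _) (x≈y⇒x-y≈0 (cancel-≈ u≉0 e))))))
    (λ i i< → trans (Tr-adjoint r c u (elem i)) (trans (Tr-cong (0*x≈0 g≈0)) Tr-0))
    where
    open CardField cK using (elem; elem-distinct; fermat; fld)
    open IsDField fld using (≟0; cancel-≈)
    -- The q-th root of w. The adjoint involves z only through z^q, because z^(q^r) = w^(q^(r - 1));
    -- this is where the new t = r - 1 comes from.
    z = w ^ (q ℕ.^ N′)
    zq : z ^ (q ℕ.^ 1) ≈ w
    zq = trans (^q^-+ w N′ 1) (trans (^-congʳ w (≡.cong (q ℕ.^_) (ℕₚ.+-comm N′ 1))) (fermat w))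
    z-new : ¬ (z ^ q ≈ z)
    z-new e = w-new (trans (^-congˡ q (sym zq′)) (trans (^-congˡ q e) zq′))
      where
      zq′ : z ^ q ≈ w
      zq′ = trans (^-congʳ z (≡.sym (ℕₚ.*-identityʳ q))) zq
    c : ℕ → Carrier
    c i = ⟦ ψ ⟧ (a i) * (z ^ (q ℕ.^ 1) - z ^ (q ℕ.^ i))
    H : Carrier → Carrier
    H x = sumN (suc r) (λ i → c i * x ^ (q ℕ.^ i))
    H-+ : ∀ x y → H (x + y) ≈ H x + H y
    H-+ x y = trans (sum-cong (suc r) (λ i _ → trans (*-congˡ (⟦⟧-+ (frobq i) x y)) (distribˡ _ _ _))) (sum-+ (suc r) _ _)
    H-- : ∀ x y → H (x - y) ≈ H x - H y
    H-- x y = x+y≈z⇒x≈z-y (trans (sym (H-+ (x - y) y)) (sum-cong (suc r) (λ i _ → *-congˡ (^-congˡ (q ℕ.^ i) (x-y+y x y)))))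
    H-kernel : ∀ {x} → H x ≈ 0# → x ≈ 0#
    H-kernel {x} e with ≟0 x
    ... | yes x≈0 = x≈0
    ... | no x≉0 = ⊥-elim (none x z x≉0 z-new e)
    g≈0 : sumN (suc r) (λ j → (u * c (r ℕ.∸ j)) ^ (q ℕ.^ j)) ≈ 0#
    g≈0 = begin
      sumN (suc r) (λ j → (u * c (r ℕ.∸ j)) ^ (q ℕ.^ j)) ≈⟨ sum-cong (suc r) (λ j j< → term j (ℕₚ.≤-pred j<)) ⟩
      sumN (suc r) (λ j → - (⟦ ψ ⟧ (adjoint k q r a j) * (w ^ (q ℕ.^ r′) - w ^ (q ℕ.^ j)) * u ^ (q ℕ.^ j))) ≈⟨ sum-neg (suc r) _ ⟨
      - bilinear q r r′ (adjoint k q r a) ψ u w ≈⟨ trans (-‿cong e) -0#≈0# ⟩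
      0# ∎
      where
      open ≈R
      term : ∀ j → j ≤ r → (u * c (r ℕ.∸ j)) ^ (q ℕ.^ j) ≈ - (⟦ ψ ⟧ (adjoint k q r a j) * (w ^ (q ℕ.^ r′) - w ^ (q ℕ.^ j)) * u ^ (q ℕ.^ j))
      term j le = begin
        (u * c (r ℕ.∸ j)) ^ (q ℕ.^ j) ≈⟨ trans (⟦⟧-* (frobq j) u (c (r ℕ.∸ j))) (*-comm _ _) ⟩
        c (r ℕ.∸ j) ^ (q ℕ.^ j) * u ^ (q ℕ.^ j) ≈⟨ *-congʳ (⟦⟧-* (frobq j) _ _) ⟩
        ⟦ ψ ⟧ (a (r ℕ.∸ j)) ^ (q ℕ.^ j) * (z ^ (q ℕ.^ 1) - z ^ (q ℕ.^ (r ℕ.∸ j))) ^ (q ℕ.^ j) * u ^ (q ℕ.^ j)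
          ≈⟨ *-congʳ (*-cong (sym (⟦⟧-^ ψ (a (r ℕ.∸ j)) (q ℕ.^ j))) (trans (⟦⟧-- (frobq j) _ _) (-‿congr (^-congˡ (q ℕ.^ j) zq) shifted))) ⟩
        ⟦ ψ ⟧ (adjoint k q r a j) * (w ^ (q ℕ.^ j) - w ^ (q ℕ.^ r′)) * u ^ (q ℕ.^ j) ≈⟨ *-congʳ (*-congˡ (x-y≈-[y-x] _ _)) ⟩
        ⟦ ψ ⟧ (adjoint k q r a j) * (- (w ^ (q ℕ.^ r′) - w ^ (q ℕ.^ j))) * u ^ (q ℕ.^ j)
          ≈⟨ trans (*-congʳ (sym (-‿distribʳ-* _ _))) (sym (-‿distribˡ-* _ _)) ⟩
        - (⟦ ψ ⟧ (adjoint k q r a j) * (w ^ (q ℕ.^ r′) - w ^ (q ℕ.^ j)) * u ^ (q ℕ.^ j)) ∎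
        where
        shifted : (z ^ (q ℕ.^ (r ℕ.∸ j))) ^ (q ℕ.^ j) ≈ w ^ (q ℕ.^ r′)
        shifted = trans (^q^-+ z (r ℕ.∸ j) j) (trans (^-congʳ z (≡.cong (q ℕ.^_) (ℕₚ.m∸n+n≡m le)))
          (trans (sym (^q^-+ z 1 r′)) (^-congˡ (q ℕ.^ r′) zq)))
    Tr-0 : Tr 0# ≈ 0#
    Tr-0 = sum-zero N (λ l _ → ⟦⟧-0 (frobq l))

-- Points in all cases and auxiliary finite fields

module _ {p h n : ℕ} (pr : Prime p) (h>0 : 0 < h) (q>2 : 2 < p ℕ.^ h) (n>0 : 0 < n)
         {k : Ring} (ck : CardField ((p ℕ.^ h) ℕ.^ n) k) where
  private
    q = p ℕ.^ h
    module k = Kit k using (Carrier; _≈_; 0#; sym; trans; *-identityʳ; ^-congʳ; ≡⇒≈)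
    κ≡ : q ℕ.^ n ≡ p ℕ.^ (h ℕ.* n)
    κ≡ = ℕₚ.^-*-assoc p h n
    chk : CharP p k
    chk = CardField.charP ck (h ℕ.* n) pr κ≡
    kF : DField
    kF = record { ring = k ; isDFld = CardField.fld ck }
    g = ℕ.pred q
    q≡ : suc g ≡ q
    q≡ = ℕₚ.suc-pred q {{ℕ.>-nonZero (ℕₚ.<-trans (s≤s z≤n) q>2)}}

    arithmetic : ∀ {r t} → Prime r → 0 < t → t < r → ∀ N e → suc N ≡ q ℕ.^ r → q ∣ e → e ≤ N →
      N ∣ (q ℕ.^ r ℕ.∸ q ℕ.^ t) ℕ.* e → e ≡ 0
    arithmetic {r} {t} pr′ t>0 t<r N e = ≡.subst (λ q → suc N ≡ q ℕ.^ r → q ∣ e → e ≤ N → N ∣ (q ℕ.^ r ℕ.∸ q ℕ.^ t) ℕ.* e → e ≡ 0) q≡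
      (Repunit.divisible⇒zero g {{ℕ.>-nonZero (ℕₚ.≤-pred (≡.subst (1 <_) (≡.sym q≡) (ℕₚ.<-trans (s≤s (s≤s z≤n)) q>2)))}} pr′ t>0 t<r N e)

  HasPoints : ℕ → ℕ → (ℕ → k.Carrier) → Set₁
  HasPoints r t a = ∃ λ m₀ → ∀ m → m₀ ≤ m → {K : Ring} (cK : CardField ((q ℕ.^ n) ℕ.^ m) K) (ψ : Hom k K) → ¬ NoPoint q r t a ψ

  module _ (a : ℕ → k.Carrier) where
    module _ {r t : ℕ} (a0 : ¬ (a 0 k.≈ k.0#)) (ar : ¬ (a r k.≈ k.0#)) where
      ¬¬points-< : 0 < r → r < t → Prime t → ¬ ¬ HasPoints r t a
      ¬¬points-< r>0 r<t prt = Existence.¬¬point pr h>0 ck q>2 n>0 a r t (prime>1 prt) r>0 (ℕₚ.<⇒≢ r<t) a0 ar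
        (λ E → coprime-fixed (DField.ring E) q (coprime-sym (prime⇒coprime prt {{ℕ.>-nonZero r>0}} r<t))) (inj₂ r<t)

      ¬¬points-> : 1 < t → t < r → Prime r → ¬ ¬ HasPoints r t a
      ¬¬points-> t>1 t<r prr = Existence.¬¬point pr h>0 ck q>2 n>0 a r t t>1 (ℕₚ.<-trans t>0 t<r) (λ e → ℕₚ.<⇒≢ t<r (≡.sym e)) a0 ar
        (λ E → coprime-fixed (DField.ring E) q (prime⇒coprime prr {{ℕ.>-nonZero t>0}} t<r))
        (inj₁ (t<r , λ e → arithmetic prr t>0 t<r _ e (Curve.suc-ex kF chk h h>0 a r t r)))
        where
        t>0 : 0 < t
        t>0 = ℕₚ.<⇒≤ t>1

  ¬¬points-1 : ∀ a r′ → ¬ (a 0 k.≈ k.0#) → ¬ (a (suc r′) k.≈ k.0#) → 1 < r′ → Prime (suc r′) → ¬ ¬ HasPoints (suc r′) 1 a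
  ¬¬points-1 a r′ a0 ar r′>1 prr contra = ¬¬points-> (adjoint k q r a)
    (λ e → ar (k.trans (k.sym (k.*-identityʳ _)) e))
    (λ e → a0 (k.trans (k.≡⇒≈ (≡.cong a (≡.sym (ℕₚ.n∸n≡0 r′)))) (IsDField.^≈0 (CardField.fld ck) (q ℕ.^ r) e)))
    -- `suc m₀` keeps m positive, as the trace needs |K| = q^(N′ + 1).
    r′>1 ℕₚ.≤-refl prr λ (m₀ , points) → contra (suc m₀ , λ { (suc m) (s≤s m≥) cK ψ none →
      points (suc m) (ℕₚ.m≤n⇒m≤1+n m≥) cK ψ (transfer m cK ψ none) })
    where
    r = suc r′
    transfer : ∀ m {K} (cK : CardField ((q ℕ.^ n) ℕ.^ suc m) K) (ψ : Hom k K) → NoPoint q r 1 a ψ → NoPoint q r r′ (adjoint k q r a) ψ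
    transfer m {K} cK ψ = Adjoint.noPoint (charP-hom ψ chk) h (ℕ.pred (n ℕ.* suc m)) h>0
      (≡.subst (λ N → CardField N K) (≡.trans (ℕₚ.^-*-assoc q n (suc m)) (≡.cong (q ℕ.^_) (≡.sym (ℕₚ.suc-pred (n ℕ.* suc m) {{ℕ.>-nonZero (ℕₚ.*-mono-≤ n>0 (s≤s z≤n))}})))) cK) ψ a r′

  ¬¬points : ∀ a r t → ¬ (a 0 k.≈ k.0#) → ¬ (a r k.≈ k.0#) → a t k.≈ k.0# → 0 < r → 0 < t → Prime (r ⊔ t) → IsOdd (r ⊔ t) →
    ¬ ¬ HasPoints r t a
  ¬¬points a r t a0 ar at r>0 t>0 prd odd with ℕₚ.<-cmp r t
  ... | tri< r<t _ _ = ¬¬points-< a a0 ar r>0 r<t (≡.subst Prime (ℕₚ.m≤n⇒m⊔n≡n (ℕₚ.<⇒≤ r<t)) prd)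
  -- Normalization gives a_t = 0, whereas a_r is the leading coefficient.
  ... | tri≈ _ ≡.refl _ = ⊥-elim (ar at)
  ... | tri> _ _ t<r = greater t t>0 t<r (≡.subst Prime r⊔t≡r prd)
    where
    r⊔t≡r = ℕₚ.m≥n⇒m⊔n≡m (ℕₚ.<⇒≤ t<r)
    at-one : ∀ r → ¬ (a r k.≈ k.0#) → 1 < r → Prime r → IsOdd r → ¬ ¬ HasPoints r 1 a
    at-one (suc zero) ar (s≤s ()) prr odd
    -- The case r = 2, t = 1, in which passing to the adjoint would not increase t, is ruled out by
    -- oddness.
    at-one (suc (suc zero)) ar _ prr ()
    at-one (suc (suc (suc r))) ar _ prr odd = ¬¬points-1 a (suc (suc r)) a0 ar (s≤s (s≤s z≤n)) prr
    greater : ∀ t → 0 < t → t < r → Prime r → ¬ ¬ HasPoints r t a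
    greater (suc (suc t)) _ t<r prr = ¬¬points-> a a0 ar (s≤s (s≤s z≤n)) t<r prr
    greater (suc zero) _ t<r prr = at-one r ar t<r prr (≡.subst IsOdd r⊔t≡r odd)

  -- Scatteredness speaks of all fields with q^(nm) elements that contain F, so one such field has
  -- to be exhibited.
  ¬¬extension : ∀ m → 0 < m → ¬ ¬ (Σ (FiniteField (q ℕ.^ (n ℕ.* m))) λ K → Hom k (FiniteField.ring K))
  ¬¬extension m m>0 contra = ¬¬fixed-points kF chk (h ℕ.* n ℕ.* m) e>0 λ { (ext E emb , ρ , D , fix) →
    contra (≡.subst (λ N → Σ (FiniteField N) λ K → Hom k (FiniteField.ring K)) size
      ( Fixed.fixedField E (charP-hom emb chk) (h ℕ.* n ℕ.* m) e>0 ρ D fix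
      , Fixed.corestrict E (charP-hom emb chk) (h ℕ.* n ℕ.* m) e>0 ρ D fix emb (fixed E emb) )) }
    where
    e>0 : 0 < h ℕ.* n ℕ.* m
    e>0 = ℕₚ.*-mono-≤ (ℕₚ.*-mono-≤ h>0 n>0) m>0
    size : p ℕ.^ (h ℕ.* n ℕ.* m) ≡ q ℕ.^ (n ℕ.* m)
    size = ≡.trans (≡.cong (p ℕ.^_) (ℕₚ.*-assoc h n m)) (≡.sym (ℕₚ.^-*-assoc p h (n ℕ.* m)))
    size′ : (q ℕ.^ n) ℕ.^ m ≡ p ℕ.^ (h ℕ.* n ℕ.* m)
    size′ = ≡.trans (ℕₚ.^-*-assoc q n m) (≡.sym size)
    fixed : (E : DField) (emb : Hom k (DField.ring E)) → let open Kit (DField.ring E) using (_≈_; _*_; sym; trans; *-assoc; _^_; ^-congʳ) in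
      ∀ x → ⟦ emb ⟧ x ^ (p ℕ.^ (h ℕ.* n ℕ.* m)) ≈ ⟦ emb ⟧ x
    fixed E emb x = trans (sym (⟦⟧-^ emb x (p ℕ.^ (h ℕ.* n ℕ.* m)))) (⟦⟧-cong emb (k.trans (k.^-congʳ x (≡.sym size′)) (CardField.fermat-^ ck m x)))
      where open Kit (DField.ring E) using (Carrier; _≈_; _*_; 0#; sym; trans; *-assoc; _^_; ^-congˡ; ^-congʳ; x-y≈0⇒x≈y; x≈y⇒x-y≈0; Distinct)

  -- A copy of F_q exists in some extension of K. Its elements are also fixed by the |K|-th power
  -- map, hence lie in K.
  ¬¬subfield : ∀ {m} → 0 < m → {K : Ring} (cK : CardField (q ℕ.^ (n ℕ.* m)) K) (ψ : Hom k K) → let open Kit K using (Carrier; _≈_; _*_; 0#; sym; trans; _^_; ^-congˡ; x-y≈0⇒x≈y; x≈y⇒x-y≈0; Distinct) in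
    ¬ ¬ (∃ λ σ → Distinct q σ × (∀ i → i < q → σ i ^ q ≈ σ i))
  ¬¬subfield {m} m>0 {K} cK ψ contra = ¬¬fixed-points KF chK h h>0 λ { (E , ρ , D , fix) →
    let open Kit (DField.ring (Ext.fieldE E)) using (Carrier; _≈_; _*_; 0#; sym; trans; _^_; ^-congˡ; x-y≈0⇒x≈y; x≈y⇒x-y≈0; Distinct)
        ι = Ext.emb E
        down = λ i i< → fixed-descends chK (h ℕ.* (n ℕ.* m)) (ℕₚ.*-mono-≤ h>0 (ℕₚ.*-mono-≤ n>0 m>0)) (ℕₚ.^-*-assoc p h (n ℕ.* m)) cK E (ρ i)
          (fixed-iterate (DField.ring (Ext.fieldE E)) q (fix i i<) (n ℕ.* m))
    in choose E ρ D fix down }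
    where
    module K = Kit K using (Carrier; 0#; x-y≈0⇒x≈y)
    chK = charP-hom ψ chk
    fK = CardField.fld cK
    KF : DField
    KF = record { ring = K ; isDFld = fK }
    choose : (E : Ext KF) → let open Kit (DField.ring (Ext.fieldE E)) using (Carrier; _≈_; _*_; 0#; sym; trans; _^_; ^-congˡ; x-y≈0⇒x≈y; x≈y⇒x-y≈0; Distinct) in ∀ ρ → Distinct q ρ → (∀ i → i < q → ρ i ^ q ≈ ρ i) →
      (∀ i → i < q → ∃ λ y → ⟦ Ext.emb E ⟧ y ≈ ρ i) → ⊥
    choose E ρ D fix down = contra (σ , (λ i j i< j< e → D i j i< j< (trans (sym (σ-ρ i i<)) (trans (⟦⟧-cong ι e) (σ-ρ j j<)))) ,
      λ i i< → K.x-y≈0⇒x≈y (hom-inj fK (DField.isDFld (Ext.fieldE E)) ι (trans (⟦⟧-- ι _ _) (x≈y⇒x-y≈0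
        (trans (⟦⟧-^ ι (σ i) q) (trans (^-congˡ q (σ-ρ i i<)) (trans (fix i i<) (sym (σ-ρ i i<)))))))))
      where
      open Kit (DField.ring (Ext.fieldE E)) using (Carrier; _≈_; _*_; 0#; sym; trans; _^_; ^-congˡ; x-y≈0⇒x≈y; x≈y⇒x-y≈0; Distinct)
      ι = Ext.emb E
      σ : ℕ → K.Carrier
      σ i with i ℕ.<? q
      ... | yes i< = proj₁ (down i i<)
      ... | no _ = K.0#
      σ-ρ : ∀ i → i < q → ⟦ ι ⟧ (σ i) ≈ ρ i
      σ-ρ i i< with i ℕ.<? q
      ... | yes i<′ = proj₂ (down i i<′)
      ... | no ≮ = ⊥-elim (≮ i<)

-- From points on the curve to the theorem

module _ (K : Ring) where
  open Kit K using (Carrier; _≈_; refl; sym; trans; +-cong; *-congˡ; _^_; sumN; sum-nil; sum-suc)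

  pow≈^ : ∀ x n → pow K x n ≈ x ^ n
  pow≈^ x zero = refl
  pow≈^ x (suc n) = *-congˡ (pow≈^ x n)

  sumFin≈sumN : ∀ n (f : Fin n → Carrier) (g : ℕ → Carrier) → (∀ i → f i ≈ g (toℕ i)) → sumFin K n f ≈ sumN n g
  sumFin≈sumN zero f g e = sym (sum-nil g)
  sumFin≈sumN (suc n) f g e = trans (+-cong (e Fin.zero) (sumFin≈sumN n (f ∘ Fin.suc) (g ∘ suc) (e ∘ Fin.suc))) (sym (sum-suc n g))

coeffAt-toℕ : {F : Ring} (ℓ : LinPoly F) (i : Fin (suc (LinPoly.r ℓ))) → coeffAt ℓ (toℕ i) ≡ LinPoly.coeff ℓ i
coeffAt-toℕ ℓ i with toℕ i ℕ.<? suc (LinPoly.r ℓ)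
... | yes lt = ≡.cong (LinPoly.coeff ℓ) (Finₚ.fromℕ<-toℕ i lt)
... | no ≮ = ⊥-elim (≮ (Finₚ.toℕ<n i))

evalIn≈linEval : {F K : Ring} (q : ℕ) (ψ : Hom F K) (ℓ : LinPoly F) → let open Kit K using (_≈_; sym; *-cong; _^_; ≡⇒≈) in
  ∀ x → evalIn {F} {K} q ⟦ ψ ⟧ ℓ x ≈ linEval q ψ (LinPoly.r ℓ) (coeffAt ℓ) x
evalIn≈linEval {F} {K} q ψ ℓ x = sumFin≈sumN K (suc (LinPoly.r ℓ)) _ _
  (λ i → *-cong (⟦⟧-cong ψ (Kit.≡⇒≈ F (≡.sym (coeffAt-toℕ ℓ i)))) (pow≈^ K x (q ℕ.^ toℕ i)))
  where open Kit K using (_≈_; sym; *-cong; _^_; ≡⇒≈)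

isEmbedding : {F K : Ring} (ψ : Hom F K) → IsEmbedding {F} {K} ⟦ ψ ⟧
isEmbedding ψ = record
  { isSemiringHomomorphism = record
    { isNearSemiringHomomorphism = record
      { +-isMonoidHomomorphism = record
        { isMagmaHomomorphism = record { isRelHomomorphism = record { cong = ⟦⟧-cong ψ } ; homo = ⟦⟧-+ ψ }
        ; ε-homo = ⟦⟧-0 ψ }
      ; *-homo = ⟦⟧-* ψ }
    ; 1#-homo = ⟦⟧-1 ψ }
  ; -‿homo = ⟦⟧-neg ψ }

-- A point (x , z) yields the q + 1 roots z x and c x, c ∈ F_q, of ℓ - s₀ x^(q^t) with s₀ = ℓ(x) / x^(q^t).
scattered⇒noPoint : {F K : Ring} (fK : IsDField K) (q t : ℕ) (ψ : Hom F K) (ℓ : LinPoly F) → let open Kit K using (Carrier; _≈_; _+_; _*_; -_; 0#; refl; sym; trans; +-cong; *-congˡ; *-congʳ; *-assoc; *-comm; *-identityʳ; _^_; ^-congˡ; ^-distrib-*; _-_; -‿congr; x-y≈0⇒x≈y; x≈y⇒x-y≈0; distribˡ--; distribʳ--; sumN; sum-cong; sum-+; sum-*ˡ; sum-neg; Distinct; module *S; module ≈R) in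
  (σ : ℕ → Carrier) → Distinct q σ → (∀ i → i < q → σ i ^ q ≈ σ i) →
  ScatteredIn {F} {K} q t ⟦ ψ ⟧ ℓ → NoPoint q (LinPoly.r ℓ) t (coeffAt ℓ) ψ
scattered⇒noPoint {F} {K} fK q t ψ ℓ σ D fix scat x z x≉0 z-new point = scat s₀ (root , distinct , isRoot)
  where
  open Kit K using (Carrier; _≈_; _+_; _*_; -_; 0#; refl; sym; trans; +-cong; *-congˡ; *-congʳ; *-assoc; *-comm; *-identityʳ; _^_; ^-congˡ; ^-distrib-*; _-_; -‿congr; x-y≈0⇒x≈y; x≈y⇒x-y≈0; distribˡ--; distribʳ--; sumN; sum-cong; sum-+; sum-*ˡ; sum-neg; Distinct; module *S; module ≈R)
  open IsDField fK
  r = LinPoly.r ℓ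
  a = coeffAt ℓ
  L : Carrier → Carrier
  L = linEval q ψ r a
  X = x ^ (q ℕ.^ t)
  X⁻¹ = inv X (^-≉0 (q ℕ.^ t) x≉0)
  s₀ = L x * proj₁ X⁻¹
  root : Fin (suc q) → Carrier
  root Fin.zero = z * x
  root (Fin.suc i) = σ (toℕ i) * x
  cancelx : ∀ {c d} → c * x ≈ d * x → c ≈ d
  cancelx e = cancel-≈ x≉0 (trans (*-comm _ _) (trans e (*-comm _ _)))
  foreign : ∀ i → ¬ (z * x ≈ σ (toℕ {q} i) * x)
  foreign i e = z-new (trans (^-congˡ q (cancelx e)) (trans (fix (toℕ i) (Finₚ.toℕ<n i)) (sym (cancelx e))))
  distinct : ∀ i j → root i ≈ root j → i ≡ j
  distinct Fin.zero Fin.zero e = ≡.refl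
  distinct Fin.zero (Fin.suc j) e = ⊥-elim (foreign j e)
  distinct (Fin.suc i) Fin.zero e = ⊥-elim (foreign i (sym e))
  distinct (Fin.suc i) (Fin.suc j) e = ≡.cong Fin.suc (Finₚ.toℕ-injective (D _ _ (Finₚ.toℕ<n i) (Finₚ.toℕ<n j) (cancelx e)))
  -- For c in F_q this is linearity of ℓ over F_q, as c^(q^t) = c. For c = z it is the equation of
  -- the curve, because x b(x, z) = z^(q^t) ℓ(x) - ℓ(z x).
  homogeneous : ∀ i → ∃ λ c → (root i ≈ c * x) × (L (c * x) ≈ c ^ (q ℕ.^ t) * L x)
  homogeneous Fin.zero = z , refl , sym (x-y≈0⇒x≈y (trans (sym expand) point))
    where
    expand : bilinear q r t a ψ x z ≈ z ^ (q ℕ.^ t) * L x - L (z * x)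
    expand = begin
      bilinear q r t a ψ x z ≈⟨ sum-cong (suc r) (λ i _ → term i) ⟩
      sumN (suc r) (λ i → z ^ (q ℕ.^ t) * (⟦ ψ ⟧ (a i) * x ^ (q ℕ.^ i)) + - (⟦ ψ ⟧ (a i) * (z * x) ^ (q ℕ.^ i))) ≈⟨ sum-+ (suc r) _ _ ⟩
      sumN (suc r) (λ i → z ^ (q ℕ.^ t) * (⟦ ψ ⟧ (a i) * x ^ (q ℕ.^ i))) + sumN (suc r) (λ i → - (⟦ ψ ⟧ (a i) * (z * x) ^ (q ℕ.^ i)))
        ≈⟨ +-cong (sum-*ˡ (suc r) _ _) (sum-neg (suc r) _) ⟨
      z ^ (q ℕ.^ t) * L x - L (z * x) ∎
      where
      open ≈R
      term : ∀ i → ⟦ ψ ⟧ (a i) * (z ^ (q ℕ.^ t) - z ^ (q ℕ.^ i)) * x ^ (q ℕ.^ i) ≈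
        z ^ (q ℕ.^ t) * (⟦ ψ ⟧ (a i) * x ^ (q ℕ.^ i)) - ⟦ ψ ⟧ (a i) * (z * x) ^ (q ℕ.^ i)
      term i = trans (trans (*-congʳ (distribˡ-- _ _ _)) (distribʳ-- _ _ _)) (-‿congr
        (trans (*-congʳ (*-comm _ _)) (*-assoc _ _ _)) (trans (*-assoc _ _ _) (*-congˡ (sym (^-distrib-* z x (q ℕ.^ i))))))
  homogeneous (Fin.suc i) = c , refl , trans (sum-cong (suc r) (λ j _ → term j)) (trans (sym (sum-*ˡ (suc r) c _)) (*-congʳ (sym (fixed t))))
    where
    c = σ (toℕ i)
    fixed : ∀ j → c ^ (q ℕ.^ j) ≈ c
    fixed = fixed-iterate K q (fix (toℕ i) (Finₚ.toℕ<n i))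
    term : ∀ j → ⟦ ψ ⟧ (a j) * (c * x) ^ (q ℕ.^ j) ≈ c * (⟦ ψ ⟧ (a j) * x ^ (q ℕ.^ j))
    term j = trans (*-congˡ (trans (^-distrib-* c x (q ℕ.^ j)) (*-congʳ (fixed j)))) (*S.x∙yz≈y∙xz _ _ _)
  isRoot : ∀ i → (evalIn {F} {K} q ⟦ ψ ⟧ ℓ (root i) + - (s₀ * pow K (root i) (q ℕ.^ t))) ≈ 0#
  isRoot i with homogeneous i
  ... | c , e , hom = x≈y⇒x-y≈0 (begin
    evalIn {F} {K} q ⟦ ψ ⟧ ℓ (root i) ≈⟨ evalIn≈linEval q ψ ℓ (root i) ⟩
    L (root i) ≈⟨ sum-cong (suc r) (λ j _ → *-congˡ (^-congˡ (q ℕ.^ j) e)) ⟩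
    L (c * x) ≈⟨ hom ⟩
    c ^ (q ℕ.^ t) * L x ≈⟨ *-congˡ (trans (sym (*-identityʳ _)) (*-congˡ (sym (trans (*-comm _ _) (proj₂ X⁻¹))))) ⟩
    c ^ (q ℕ.^ t) * (L x * (proj₁ X⁻¹ * X)) ≈⟨ *-congˡ (*-assoc _ _ _) ⟨
    c ^ (q ℕ.^ t) * (s₀ * X) ≈⟨ *S.x∙yz≈y∙xz _ _ _ ⟩
    s₀ * (c ^ (q ℕ.^ t) * X) ≈⟨ *-congˡ (trans (^-congˡ (q ℕ.^ t) e) (^-distrib-* c x (q ℕ.^ t))) ⟨
    s₀ * root i ^ (q ℕ.^ t) ≈⟨ *-congˡ (pow≈^ K (root i) (q ℕ.^ t)) ⟨
    s₀ * pow K (root i) (q ℕ.^ t) ∎)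
    where open ≈R

odd-primePower>2 : ∀ {p} k → Prime p → IsOdd (p ℕ.^ suc k) → 2 < p ℕ.^ suc k
odd-primePower>2 {p} k pr odd = ℕₚ.≤∧≢⇒< (ℕₚ.≤-trans (prime>1 pr)
  (ℕₚ.m≤m*n p (p ℕ.^ k) {{ℕ.>-nonZero (ℕₚ.m^n>0 p {{ℕ.>-nonZero (prime>0 pr)}} k)}})) (λ e → even (≡.subst IsOdd (≡.sym e) odd))
  where
  even : ¬ IsOdd 2
  even ()

-- From some m₀ on the curve has points over every field with q^(nm) elements that contains F, while
-- exceptionality supplies an m ≥ m₀ for which there is none.
positive-degree⇒¬exceptional : ∀ {p k n t} → Prime p → IsOdd (p ℕ.^ suc k) → 1 ≤ n → 1 ≤ t →
  (F : FiniteField ((p ℕ.^ suc k) ℕ.^ n)) (ℓ : LinPoly (FiniteField.ring F)) → 0 < LinPoly.r ℓ →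
  HasLinDegree ℓ (LinPoly.r ℓ) → TNormalized t ℓ → Prime (LinPoly.r ℓ ⊔ t) → IsOdd (LinPoly.r ℓ ⊔ t) →
  ¬ ExceptionalScattered (p ℕ.^ suc k) n t ℓ
positive-degree⇒¬exceptional {p} {k} {n} {t} pr odd n>0 t>0 F ℓ r>0 (_ , ar) (_ , at , a0) prd oddd exceptional =
  ¬¬points {h = suc k} {n} pr h>0 q>2 n>0 cF (coeffAt ℓ) r t (a0 t>0) ar at r>0 t>0 prd oddd λ (m₀ , points) →
  let (m , m≥ , m>0 , scattered) = exceptional m₀ in
  ¬¬extension {h = suc k} {n} pr h>0 q>2 n>0 cF m m>0 λ (K , ψ) →
  ¬¬subfield {h = suc k} {n} pr h>0 q>2 n>0 cF m>0 (cardField K) ψ λ (σ , D , fix) →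
  points m m≥ (≡.subst (λ N → CardField N (FiniteField.ring K)) (≡.sym (ℕₚ.^-*-assoc q n m)) (cardField K)) ψ
    (scattered⇒noPoint (CardField.fld (cardField K)) q t ψ ℓ σ D fix (scattered K ⟦ ψ ⟧ (isEmbedding ψ)))
  where
  q = p ℕ.^ suc k
  r = LinPoly.r ℓ
  h>0 : 0 < suc k
  h>0 = s≤s z≤n
  q>2 = odd-primePower>2 k pr odd
  cF = cardField F

open import Data.Nat using (_^_)

theorem1p2 : (q n t r : ℕ) → IsPrimePower q → IsOdd q → 1 ≤ n → 1 ≤ t →
    (F : FiniteField (q ^ n)) → (ℓ : LinPoly (FiniteField.ring F)) →
    HasLinDegree ℓ r → TNormalized t ℓ → ExceptionalScattered q n t ℓ →
    Prime (r ⊔ t) → IsOdd (r ⊔ t) →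
    (r ≡ 0) × CommutativeRing._≈_ (FiniteField.ring F) (coeffAt ℓ 0) (CommutativeRing.1# (FiniteField.ring F))
theorem1p2 _ n t _ (p , k , pr , ≡.refl) odd n>0 t>0 F ℓ hd@(≡.refl , _) norm exceptional prd oddd with LinPoly.r ℓ ℕ.≟ 0
... | yes r≡0 = r≡0 , ≡.subst (λ i → CommutativeRing._≈_ (FiniteField.ring F) (coeffAt ℓ i) (CommutativeRing.1# (FiniteField.ring F))) r≡0 (proj₁ norm)
... | no r≢0 = ⊥-elim (positive-degree⇒¬exceptional {p} {k} pr odd n>0 t>0 F ℓ (ℕₚ.n≢0⇒n>0 r≢0) hd norm prd oddd exceptional)
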